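{- Let $d\ge 3$. There exists $\gamma>0$ with the following property: for every positive integer $n$ such that $n+d$ is even, there exists a $\gamma$-dense set of $n$ points in general position in $\mathbb{R}^d$ with $n^{d-1}e^{\Omega(\sqrt{\log n})}$ halving hyperplanes. Explicitly: for every integer $d\ge 3$ there exist $\gamma>0$, $c>0$ and $n_0$ (depending only on $d$) such that for every positive integer $n$ with $n+d$ even there is a $\gamma$-dense set $P_n\subset\mathbb{R}^d$ of $n$ points in general position such that, whenever $n\ge n_0$, the set $P_n$ has at least $n^{d-1}e^{c\sqrt{\log n}}$ halving hyperplanes.
   Context: A set of points in $\mathbb{R}^d$ is in general position if no $d+1$ of its points are on a hyperplane. For a set $P$ of $n$ points in $\mathbb{R}^d$ in general position, a hyperplane determined by $d$ points of $P$ is a halving hyperplane of $P$ if it has exactly $(n-d)/2$ points of $P$ on each of its two (open) sides. For $\gamma>0$, a set $P$ of $n$ points in $\mathbb{R}^d$ is $\gamma$-dense if the ratio of the largest and smallest distances determined by (pairs of distinct points of) $P$ is at most $\gamma\sqrt[d]{n}$ (a one-point set is regarded as $\gamma$-dense for every $\gamma$). -}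

module Defs where

open import Data.Nat as ℕ using (ℕ; zero; suc; _!)
import Data.Nat.Properties as ℕₚ
open import Data.Nat.Properties using (_!≢0)
open import Data.Integer using (+_)
open import Data.Rational as ℚ
  using (ℚ; 0ℚ; 1ℚ; ½; ∣_∣; 1/_; Positive; NonZero)
import Data.Rational.Properties as ℚₚ
open import Data.Rational.Solver using (module +-*-Solver)
open import Data.Fin using (Fin)
open import Data.Fin.Subset using (Subset; _∈_) renaming (∣_∣ to card)
open import Data.Product using (Σ; ∃-syntax; _×_; _,_)
open import Data.Sum using (_⊎_)
open import Data.Vec.Functional using (Vector; foldr)
open import Function using (_⇔_; Injective)
open import Relation.Nullary using (¬_)
open import Relation.Binary.PropositionalEquality

-- Real numbers are Cauchy sequences of rationals, with equality as a
-- separate relation.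

Cauchy : (ℕ → ℚ) → Set
Cauchy x = ∀ ε → 0ℚ ℚ.< ε →
  ∃[ N ] (∀ m n → N ℕ.≤ m → N ℕ.≤ n → ∣ x m ℚ.- x n ∣ ℚ.< ε)

record ℝ : Set where
  constructor mkℝ
  field
    seq    : ℕ → ℚ
    cauchy : Cauchy seq

open ℝ public

infix 4 _≈_ _<ℝ_ _≤ℝ_ _#_

_≈_ : ℝ → ℝ → Set
x ≈ y = ∀ ε → 0ℚ ℚ.< ε →
  ∃[ N ] (∀ n → N ℕ.≤ n → ∣ seq x n ℚ.- seq y n ∣ ℚ.< ε)

_<ℝ_ : ℝ → ℝ → Set
x <ℝ y = ∃[ ε ] (0ℚ ℚ.< ε ×
  ∃[ N ] (∀ n → N ℕ.≤ n → seq x n ℚ.+ ε ℚ.< seq y n))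

_≤ℝ_ : ℝ → ℝ → Set
x ≤ℝ y = ¬ (y <ℝ x)

_#_ : ℝ → ℝ → Set
x # y = x <ℝ y ⊎ y <ℝ x

private
  half-pos : ∀ {ε} → 0ℚ ℚ.< ε → 0ℚ ℚ.< ½ ℚ.* ε
  half-pos {ε} 0<ε = subst (ℚ._< ½ ℚ.* ε) (ℚₚ.*-zeroʳ ½) (ℚₚ.*-monoʳ-<-pos ½ 0<ε)

  halves : ∀ ε → ½ ℚ.* ε ℚ.+ ½ ℚ.* ε ≡ ε
  halves ε = trans (sym (ℚₚ.*-distribʳ-+ ε ½ ½)) (ℚₚ.*-identityˡ ε)

  constant-cauchy : ∀ q → Cauchy (λ _ → q)
  constant-cauchy q ε 0<ε =
    0 , λ _ _ _ _ → subst (λ r → ∣ r ∣ ℚ.< ε) (sym (ℚₚ.+-inverseʳ q)) 0<ε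

  +-cauchy : ∀ x y → Cauchy x → Cauchy y → Cauchy (λ n → x n ℚ.+ y n)
  +-cauchy x y cx cy ε 0<ε with cx _ (half-pos 0<ε) | cy _ (half-pos 0<ε)
  ... | M , close-x | N , close-y = M ℕ.⊔ N , λ m n m≥ n≥ → begin-strict
      ∣ (x m ℚ.+ y m) ℚ.- (x n ℚ.+ y n) ∣
        ≡⟨ cong ∣_∣ (regroup (x m) (y m) (x n) (y n)) ⟩
      ∣ (x m ℚ.- x n) ℚ.+ (y m ℚ.- y n) ∣
        ≤⟨ ℚₚ.∣p+q∣≤∣p∣+∣q∣ (x m ℚ.- x n) (y m ℚ.- y n) ⟩
      ∣ x m ℚ.- x n ∣ ℚ.+ ∣ y m ℚ.- y n ∣
        <⟨ ℚₚ.+-mono-<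
             (close-x m n (ℕₚ.m⊔n≤o⇒m≤o M N m≥) (ℕₚ.m⊔n≤o⇒m≤o M N n≥))
             (close-y m n (ℕₚ.m⊔n≤o⇒n≤o M N m≥) (ℕₚ.m⊔n≤o⇒n≤o M N n≥)) ⟩
      ½ ℚ.* ε ℚ.+ ½ ℚ.* ε
        ≡⟨ halves ε ⟩
      ε ∎
    where
    open ℚₚ.≤-Reasoning
    open +-*-Solver
    regroup : ∀ a b c d → (a ℚ.+ b) ℚ.- (c ℚ.+ d) ≡ (a ℚ.- c) ℚ.+ (b ℚ.- d)
    regroup = solve 4 (λ a b c d → (a :+ b) :- (c :+ d) := (a :- c) :+ (b :- d)) refl

  neg-cauchy : ∀ x → Cauchy x → Cauchy (λ n → ℚ.- x n)
  neg-cauchy x cx ε 0<ε with cx ε 0<ε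
  ... | N , close = N , λ m n m≥ n≥ →
      subst (ℚ._< ε) (trans (sym (ℚₚ.∣-p∣≡∣p∣ (x m ℚ.- x n)))
                            (cong ∣_∣ (ℚₚ.neg-distrib-+ (x m) (ℚ.- x n))))
            (close m n m≥ n≥)

  bounded : ∀ x → Cauchy x →
    ∃[ B ] (Positive B × ∃[ N ] (∀ n → N ℕ.≤ n → ∣ x n ∣ ℚ.≤ B))
  bounded x cx with cx 1ℚ (ℚₚ.positive⁻¹ 1ℚ)
  ... | N , close = 1ℚ ℚ.+ ∣ x N ∣ , ℚ.positive B-pos , N , λ n n≥ → begin
      ∣ x n ∣                        ≡⟨ cong ∣_∣ (split (x n) (x N)) ⟩
      ∣ (x n ℚ.- x N) ℚ.+ x N ∣       ≤⟨ ℚₚ.∣p+q∣≤∣p∣+∣q∣ (x n ℚ.- x N) (x N) ⟩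
      ∣ x n ℚ.- x N ∣ ℚ.+ ∣ x N ∣     ≤⟨ ℚₚ.+-monoˡ-≤ ∣ x N ∣
                                          (ℚₚ.<⇒≤ (close n N n≥ ℕₚ.≤-refl)) ⟩
      1ℚ ℚ.+ ∣ x N ∣                 ∎
    where
    open ℚₚ.≤-Reasoning
    open +-*-Solver
    split : ∀ a b → a ≡ (a ℚ.- b) ℚ.+ b
    split = solve 2 (λ a b → a := (a :- b) :+ b) refl
    B-pos : 0ℚ ℚ.< 1ℚ ℚ.+ ∣ x N ∣
    B-pos = ℚₚ.+-mono-<-≤ (ℚₚ.positive⁻¹ 1ℚ) (ℚₚ.0≤∣p∣ (x N))

  scaled : ∀ z B → Positive B → Cauchy z → ∀ ε → 0ℚ ℚ.< ε →
    ∃[ N ] (∀ m n → N ℕ.≤ m → N ℕ.≤ n → B ℚ.* ∣ z m ℚ.- z n ∣ ℚ.< ε)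
  scaled z B B-pos cz ε 0<ε with cz (B⁻¹ ℚ.* ε) 0<δ
    where
    instance
      pos : Positive B
      pos = B-pos
      nz : NonZero B
      nz = ℚₚ.pos⇒nonZero B
    B⁻¹ : ℚ
    B⁻¹ = 1/ B
    0<δ : 0ℚ ℚ.< B⁻¹ ℚ.* ε
    0<δ = subst (ℚ._< B⁻¹ ℚ.* ε) (ℚₚ.*-zeroʳ B⁻¹)
            (ℚₚ.*-monoʳ-<-pos B⁻¹ {{ℚₚ.1/pos⇒pos B}} 0<ε)
  ... | N , close = N , λ m n m≥ n≥ →
      subst (B ℚ.* ∣ z m ℚ.- z n ∣ ℚ.<_) cancel
        (ℚₚ.*-monoʳ-<-pos B {{B-pos}} (close m n m≥ n≥))
    where
    instance
      nz : NonZero B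
      nz = ℚₚ.pos⇒nonZero B {{B-pos}}
    cancel : B ℚ.* ((1/ B) ℚ.* ε) ≡ ε
    cancel = trans (sym (ℚₚ.*-assoc B (1/ B) ε))
               (trans (cong (ℚ._* ε) (ℚₚ.*-inverseʳ B)) (ℚₚ.*-identityˡ ε))

  product-close : ∀ a b c d {A B ε} → ∣ a ∣ ℚ.≤ A → ∣ d ∣ ℚ.≤ B →
    A ℚ.* ∣ b ℚ.- d ∣ ℚ.< ½ ℚ.* ε → B ℚ.* ∣ a ℚ.- c ∣ ℚ.< ½ ℚ.* ε →
    ∣ a ℚ.* b ℚ.- c ℚ.* d ∣ ℚ.< ε
  product-close a b c d {A} {B} {ε} a≤A d≤B close₁ close₂ = begin-strict
      ∣ a ℚ.* b ℚ.- c ℚ.* d ∣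
        ≡⟨ cong ∣_∣ (regroup a b c d) ⟩
      ∣ a ℚ.* (b ℚ.- d) ℚ.+ d ℚ.* (a ℚ.- c) ∣
        ≤⟨ ℚₚ.∣p+q∣≤∣p∣+∣q∣ (a ℚ.* (b ℚ.- d)) (d ℚ.* (a ℚ.- c)) ⟩
      ∣ a ℚ.* (b ℚ.- d) ∣ ℚ.+ ∣ d ℚ.* (a ℚ.- c) ∣
        ≡⟨ cong₂ ℚ._+_ (ℚₚ.∣p*q∣≡∣p∣*∣q∣ a (b ℚ.- d))
                       (ℚₚ.∣p*q∣≡∣p∣*∣q∣ d (a ℚ.- c)) ⟩
      ∣ a ∣ ℚ.* ∣ b ℚ.- d ∣ ℚ.+ ∣ d ∣ ℚ.* ∣ a ℚ.- c ∣
        ≤⟨ ℚₚ.+-mono-≤ (scale (b ℚ.- d) a≤A) (scale (a ℚ.- c) d≤B) ⟩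
      A ℚ.* ∣ b ℚ.- d ∣ ℚ.+ B ℚ.* ∣ a ℚ.- c ∣
        <⟨ ℚₚ.+-mono-< close₁ close₂ ⟩
      ½ ℚ.* ε ℚ.+ ½ ℚ.* ε
        ≡⟨ halves ε ⟩
      ε ∎
    where
    open ℚₚ.≤-Reasoning
    open +-*-Solver
    regroup : ∀ a b c d →
      a ℚ.* b ℚ.- c ℚ.* d ≡ a ℚ.* (b ℚ.- d) ℚ.+ d ℚ.* (a ℚ.- c)
    regroup = solve 4 (λ a b c d →
      a :* b :- c :* d := a :* (b :- d) :+ d :* (a :- c)) refl
    scale : ∀ {p C} q → p ℚ.≤ C → p ℚ.* ∣ q ∣ ℚ.≤ C ℚ.* ∣ q ∣
    scale q = ℚₚ.*-monoʳ-≤-nonNeg ∣ q ∣ {{ℚ.nonNegative (ℚₚ.0≤∣p∣ q)}}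

  *-cauchy : ∀ x y → Cauchy x → Cauchy y → Cauchy (λ n → x n ℚ.* y n)
  *-cauchy x y cx cy ε 0<ε =
    let A , A-pos , K , x≤A = bounded x cx
        B , B-pos , L , y≤B = bounded y cy
        M , close-y = scaled y A A-pos cy (½ ℚ.* ε) (half-pos 0<ε)
        N , close-x = scaled x B B-pos cx (½ ℚ.* ε) (half-pos 0<ε)
        left : ∀ {o} → (K ℕ.⊔ L) ℕ.⊔ (M ℕ.⊔ N) ℕ.≤ o → K ℕ.⊔ L ℕ.≤ o
        left = ℕₚ.m⊔n≤o⇒m≤o (K ℕ.⊔ L) (M ℕ.⊔ N)
        right : ∀ {o} → (K ℕ.⊔ L) ℕ.⊔ (M ℕ.⊔ N) ℕ.≤ o → M ℕ.⊔ N ℕ.≤ o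
        right = ℕₚ.m⊔n≤o⇒n≤o (K ℕ.⊔ L) (M ℕ.⊔ N)
    in (K ℕ.⊔ L) ℕ.⊔ (M ℕ.⊔ N) , λ m n m≥ n≥ →
      product-close (x m) (y m) (x n) (y n)
        (x≤A m (ℕₚ.m⊔n≤o⇒m≤o K L (left m≥)))
        (y≤B n (ℕₚ.m⊔n≤o⇒n≤o K L (left n≥)))
        (close-y m n (ℕₚ.m⊔n≤o⇒m≤o M N (right m≥)) (ℕₚ.m⊔n≤o⇒m≤o M N (right n≥)))
        (close-x m n (ℕₚ.m⊔n≤o⇒n≤o M N (right m≥)) (ℕₚ.m⊔n≤o⇒n≤o M N (right n≥)))

infixl 6 _+ℝ_ _-ℝ_
infixl 7 _*ℝ_
infixr 8 _^ℝ_

fromℚ : ℚ → ℝ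
fromℚ q = mkℝ (λ _ → q) (constant-cauchy q)

fromℕ : ℕ → ℝ
fromℕ n = fromℚ (+ n ℚ./ 1)

0ℝ 1ℝ : ℝ
0ℝ = fromℚ 0ℚ
1ℝ = fromℚ 1ℚ

_+ℝ_ _-ℝ_ _*ℝ_ : ℝ → ℝ → ℝ
x +ℝ y = mkℝ (λ n → seq x n ℚ.+ seq y n) (+-cauchy (seq x) (seq y) (cauchy x) (cauchy y))
x -ℝ y = mkℝ (λ n → seq x n ℚ.- seq y n)
  (+-cauchy (seq x) (λ n → ℚ.- seq y n) (cauchy x) (neg-cauchy (seq y) (cauchy y)))
x *ℝ y = mkℝ (λ n → seq x n ℚ.* seq y n) (*-cauchy (seq x) (seq y) (cauchy x) (cauchy y))

_^ℝ_ : ℝ → ℕ → ℝ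
x ^ℝ zero  = 1ℝ
x ^ℝ suc n = x *ℝ x ^ℝ n

∑ : ∀ {n} → Vector ℝ n → ℝ
∑ = foldr _+ℝ_ 0ℝ

-- Roots, exponentials and logarithms are given by their graphs:
-- the last argument is the value.

Root : ℕ → ℝ → ℝ → Set
Root k x r = 0ℝ ≤ℝ r × r ^ℝ k ≈ x

Sqrt : ℝ → ℝ → Set
Sqrt = Root 2

_⟶_ : (ℕ → ℝ) → ℝ → Set
s ⟶ l = ∀ ε → 0ℚ ℚ.< ε → ∃[ N ] (∀ n → N ℕ.≤ n →
  s n -ℝ l <ℝ fromℚ ε × l -ℝ s n <ℝ fromℚ ε)

expSum : ℝ → ℕ → ℝ
expSum x zero    = 0ℝ
expSum x (suc m) = expSum x m +ℝ x ^ℝ m *ℝ fromℚ (ℚ._/_ (+ 1) (m !) {{m !≢0}})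

Exp : ℝ → ℝ → Set
Exp x y = expSum x ⟶ y

Log : ℝ → ℝ → Set
Log x y = Exp y x

Point : ℕ → Set
Point d = Vector ℝ d

_≋_ : ∀ {d} → Point d → Point d → Set
p ≋ q = ∀ i → p i ≈ q i

⟨_,_⟩ : ∀ {d} → Point d → Point d → ℝ
⟨ p , q ⟩ = ∑ λ i → p i *ℝ q i

Distance : ∀ {d} → Point d → Point d → ℝ → Set
Distance p q = Sqrt (∑ λ i → (p i -ℝ q i) ^ℝ 2)

record PointSet (d n : ℕ) : Set where
  field
    point    : Fin n → Point d
    distinct : ∀ i j → i ≢ j → ¬ (point i ≋ point j)

open PointSet public

module _ {d n : ℕ} (P : PointSet d n) where

  IsDistance : ℝ → Set
  IsDistance δ = ∃[ i ] ∃[ j ] (i ≢ j × Distance (point P i) (point P j) δ)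

  IsLargestDistance : ℝ → Set
  IsLargestDistance D = IsDistance D × (∀ δ → IsDistance δ → δ ≤ℝ D)

  IsSmallestDistance : ℝ → Set
  IsSmallestDistance D = IsDistance D × (∀ δ → IsDistance δ → D ≤ℝ δ)

  -- The bound D / δ ≤ γ n^(1/d) is multiplied out; δ is nonzero because
  -- the points are distinct.
  IsDense : ℝ → Set
  IsDense γ = n ≡ 1 ⊎ (∃[ D ] ∃[ δ ] ∃[ r ]
    (IsLargestDistance D × IsSmallestDistance δ × Root d (fromℕ n) r ×
     D ≤ℝ γ *ℝ r *ℝ δ))

record Hyperplane (d : ℕ) : Set where
  field
    normal   : Point d
    offset   : ℝ
    nonzero  : ∃[ i ] (normal i # 0ℝ)

open Hyperplane public

module _ {d : ℕ} (H : Hyperplane d) where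

  On Above Below : Point d → Set
  On    p = ⟨ normal H , p ⟩ ≈ offset H
  Above p = offset H <ℝ ⟨ normal H , p ⟩
  Below p = ⟨ normal H , p ⟩ <ℝ offset H

_≐_ : ∀ {d} → Hyperplane d → Hyperplane d → Set
H ≐ H′ = ∀ p → On H p ⇔ On H′ p

Card : ∀ {n} → (Fin n → Set) → ℕ → Set
Card {n} Q k = Σ (Subset n) λ S → (∀ i → i ∈ S ⇔ Q i) × card S ≡ k

module _ {d n : ℕ} (P : PointSet d n) where

  InGeneralPosition : Set
  InGeneralPosition = (s : Fin (suc d) → Fin n) → Injective _≡_ _≡_ s →
    ¬ (∃[ H ] (∀ k → On H (point P (s k))))

  -- Uniqueness matters only when n ≡ d: general position is then vacuous
  -- and the d points need not span a hyperplane.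
  IsDetermined : Hyperplane d → Set
  IsDetermined H = Σ (Fin d → Fin n) λ s → Injective _≡_ _≡_ s ×
    (∀ k → On H (point P (s k))) ×
    (∀ H′ → (∀ k → On H′ (point P (s k))) → H′ ≐ H)

  IsHalving : Hyperplane d → Set
  IsHalving H = IsDetermined H × (∃[ k ] (2 ℕ.* k ℕ.+ d ≡ n ×
    Card (λ i → Above H (point P i)) k ×
    Card (λ i → Below H (point P i)) k))

  HasAtLeastHalving : ℝ → Set
  HasAtLeastHalving x = ∃[ m ] (x ≤ℝ fromℕ m ×
    Σ (Fin m → Hyperplane d) λ H →
      (∀ i → IsHalving (H i)) × (∀ i j → i ≢ j → ¬ (H i ≐ H j)))

-- In the plane, replacing every point by a short, almost collinear cluster and
-- every halving edge by a bipartite family of edges between two clusters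
-- multiplies the edge/point ratio by 3/2 while the coordinates only grow by a
-- factor exponential in the number of steps; n points thus carry
-- n e^{Ω(√log n)} halving edges and still fit into a box of side e^{O(log n)}.
-- In dimension d, antipodally symmetric points are placed near a coarse lattice:
-- a row of points on a line through the origin carries a copy of the planar set
-- (via a perturbation of second order), and the remaining points come in κ = d − 2
-- classes. A planar halving edge of a row together with one point from each class
-- spans a hyperplane through the origin up to a perturbation, and the infinitely
-- small tilts of the antipodes are chosen such that exactly half of the points lie
-- on each side. Everything is done for a formal small parameter: a polynomial
-- inequality valid for all small positive rationals is realised by one of them.

{-# OPTIONS --safe #-}
module Submission where

-- A refinement must keep the line of every edge away from all other points by an amount that
-- survives the next refinement. So each level carries integer inequalities: determinants dominate
-- horizontal distances, and near its bold end an edge is not crossed by the lines of edges at other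
-- bold points. A new bold point sits at a quarter of this safe distance; the safety parameter grows
-- by a factor 16 per step and the coordinates of level r by 2^O(r), hence to 2^O(r²). Thus r of
-- order sqrt(log n) fits, and the gain (3/2)^r is e^Ω(sqrt(log n)). In dimension d three orders of
-- a small η are kept apart. Points off the limit hyperplane are decided at order 1 and cancel with
-- their antipodes; antipodes of points on it are decided at order η by their tilts; the chosen row
-- is decided at order η², where the planar determinant appears. Order on the reals is not
-- decidable, so all points are rational. A hyperplane through d points is carried together with a
-- dual basis. This certificate gives uniqueness even among real hyperplanes, and one elimination
-- step repairs it when a point moves, so general position can be reached last.

-- Finite index types, integer sums over them, and signs

module FiniteTypes where

  open import Data.Nat as ℕ using (ℕ; zero; suc; s≤s; z≤n)
  import Data.Nat.Properties as ℕₚ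
  open import Data.Integer as ℤ using (ℤ; +_; +[1+_]; +0; -[1+_]; 0ℤ; 1ℤ; -1ℤ; ∣_∣)
  import Data.Integer.Properties as ℤₚ
  import Data.Integer.Tactic.RingSolver as ℤR
  import Data.Nat.Tactic.RingSolver as ℕR
  open import Data.Fin as Fin using (Fin; zero; suc; _↑ˡ_; _↑ʳ_)
  import Data.Fin.Properties as Finₚ
  open import Data.Product using (_×_; _,_; proj₁; proj₂)
  import Data.Product.Properties as ×ₚ
  open import Data.Sum using (_⊎_; inj₁; inj₂)
  import Data.Sum.Properties as ⊎ₚ
  open import Function using (_∘_)
  open import Relation.Nullary using (contradiction)
  open import Relation.Binary.PropositionalEquality
  open import Relation.Binary using (DecidableEquality)

  -- Codes for the index sets that refinement produces. Sums split along the code, so that a cluster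
  -- contributes one summand, while `encode` provides a numbering by an initial segment of ℕ where
  -- one is needed.
  data Ty : Set where
    fin     : ℕ → Ty
    _⊕_ _⊗_ : Ty → Ty → Ty

  infixr 5 _⊕_
  infixr 6 _⊗_

  El : Ty → Set
  El (fin n) = Fin n
  El (c ⊕ d) = El c ⊎ El d
  El (c ⊗ d) = El c × El d

  size : Ty → ℕ
  size (fin n) = n
  size (c ⊕ d) = size c ℕ.+ size d
  size (c ⊗ d) = size c ℕ.* size d

  _≟ᵀ_ : ∀ {c} → DecidableEquality (El c)
  _≟ᵀ_ {fin n} = Finₚ._≟_
  _≟ᵀ_ {c ⊕ d} = ⊎ₚ.≡-dec _≟ᵀ_ _≟ᵀ_
  _≟ᵀ_ {c ⊗ d} = ×ₚ.≡-dec _≟ᵀ_ _≟ᵀ_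

  ∑F : ∀ {n} → (Fin n → ℤ) → ℤ
  ∑F {zero}  f = 0ℤ
  ∑F {suc n} f = f zero ℤ.+ ∑F (f ∘ suc)

  ∑ᵀ : ∀ c → (El c → ℤ) → ℤ
  ∑ᵀ (fin n) f = ∑F f
  ∑ᵀ (c ⊕ d) f = ∑ᵀ c (f ∘ inj₁) ℤ.+ ∑ᵀ d (f ∘ inj₂)
  ∑ᵀ (c ⊗ d) f = ∑ᵀ c λ x → ∑ᵀ d λ y → f (x , y)

  ∑F-cong : ∀ {n} {f g : Fin n → ℤ} → f ≗ g → ∑F f ≡ ∑F g
  ∑F-cong {zero}  e = refl
  ∑F-cong {suc n} e = cong₂ ℤ._+_ (e zero) (∑F-cong (e ∘ suc))

  ∑ᵀ-cong : ∀ c {f g : El c → ℤ} → f ≗ g → ∑ᵀ c f ≡ ∑ᵀ c g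
  ∑ᵀ-cong (fin n) e = ∑F-cong e
  ∑ᵀ-cong (c ⊕ d) e = cong₂ ℤ._+_ (∑ᵀ-cong c (e ∘ inj₁)) (∑ᵀ-cong d (e ∘ inj₂))
  ∑ᵀ-cong (c ⊗ d) e = ∑ᵀ-cong c λ x → ∑ᵀ-cong d λ y → e (x , y)

  interchange : ∀ a b c d → (a ℤ.+ b) ℤ.+ (c ℤ.+ d) ≡ (a ℤ.+ c) ℤ.+ (b ℤ.+ d)
  interchange = ℤR.solve-∀

  ∑F-+ : ∀ {n} (f g : Fin n → ℤ) → ∑F (λ i → f i ℤ.+ g i) ≡ ∑F f ℤ.+ ∑F g
  ∑F-+ {zero}  f g = refl
  ∑F-+ {suc n} f g = trans (cong (λ t → (f zero ℤ.+ g zero) ℤ.+ t) (∑F-+ (f ∘ suc) (g ∘ suc)))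
    (interchange (f zero) (g zero) (∑F (f ∘ suc)) (∑F (g ∘ suc)))

  ∑ᵀ-+ : ∀ c (f g : El c → ℤ) → ∑ᵀ c (λ i → f i ℤ.+ g i) ≡ ∑ᵀ c f ℤ.+ ∑ᵀ c g
  ∑ᵀ-+ (fin n) f g = ∑F-+ f g
  ∑ᵀ-+ (c ⊕ d) f g = trans (cong₂ ℤ._+_ (∑ᵀ-+ c (f ∘ inj₁) (g ∘ inj₁)) (∑ᵀ-+ d (f ∘ inj₂) (g ∘ inj₂)))
    (interchange (∑ᵀ c (f ∘ inj₁)) (∑ᵀ c (g ∘ inj₁)) (∑ᵀ d (f ∘ inj₂)) (∑ᵀ d (g ∘ inj₂)))
  ∑ᵀ-+ (c ⊗ d) f g = trans (∑ᵀ-cong c λ x → ∑ᵀ-+ d (λ y → f (x , y)) (λ y → g (x , y)))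
    (∑ᵀ-+ c (λ x → ∑ᵀ d λ y → f (x , y)) (λ x → ∑ᵀ d λ y → g (x , y)))

  ∑F-* : ∀ {n} k (f : Fin n → ℤ) → ∑F (λ i → k ℤ.* f i) ≡ k ℤ.* ∑F f
  ∑F-* {zero}  k f = sym (ℤₚ.*-zeroʳ k)
  ∑F-* {suc n} k f = trans (cong (λ t → k ℤ.* f zero ℤ.+ t) (∑F-* k (f ∘ suc)))
    (sym (ℤₚ.*-distribˡ-+ k (f zero) (∑F (f ∘ suc))))

  ∑ᵀ-* : ∀ c k (f : El c → ℤ) → ∑ᵀ c (λ i → k ℤ.* f i) ≡ k ℤ.* ∑ᵀ c f
  ∑ᵀ-* (fin n) k f = ∑F-* k f
  ∑ᵀ-* (c ⊕ d) k f = trans (cong₂ ℤ._+_ (∑ᵀ-* c k (f ∘ inj₁)) (∑ᵀ-* d k (f ∘ inj₂)))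
    (sym (ℤₚ.*-distribˡ-+ k (∑ᵀ c (f ∘ inj₁)) (∑ᵀ d (f ∘ inj₂))))
  ∑ᵀ-* (c ⊗ d) k f = trans (∑ᵀ-cong c λ x → ∑ᵀ-* d k (λ y → f (x , y)))
    (∑ᵀ-* c k (λ x → ∑ᵀ d λ y → f (x , y)))

  ∑F-const : ∀ n k → ∑F {n} (λ _ → k) ≡ + n ℤ.* k
  ∑F-const zero    k = sym (ℤₚ.*-zeroˡ k)
  ∑F-const (suc n) k = trans (cong (λ t → k ℤ.+ t) (∑F-const n k)) (sym (ℤₚ.suc-* (+ n) k))

  ∑ᵀ-const : ∀ c k → ∑ᵀ c (λ _ → k) ≡ + size c ℤ.* k
  ∑ᵀ-const (fin n) k = ∑F-const n k
  ∑ᵀ-const (c ⊕ d) k = trans (cong₂ ℤ._+_ (∑ᵀ-const c k) (∑ᵀ-const d k))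
    (sym (ℤₚ.*-distribʳ-+ k (+ size c) (+ size d)))
  ∑ᵀ-const (c ⊗ d) k = trans (∑ᵀ-cong c λ _ → ∑ᵀ-const d k) (trans (∑ᵀ-const c (+ size d ℤ.* k))
    (trans (sym (ℤₚ.*-assoc (+ size c) (+ size d) k))
           (cong (ℤ._* k) (sym (ℤₚ.pos-* (size c) (size d))))))

  ∑ᵀ-zero : ∀ c {f : El c → ℤ} → (∀ x → f x ≡ 0ℤ) → ∑ᵀ c f ≡ 0ℤ
  ∑ᵀ-zero c e = trans (∑ᵀ-cong c e) (trans (∑ᵀ-const c 0ℤ) (ℤₚ.*-zeroʳ (+ size c)))

  ∑F-single : ∀ {n} (u : Fin n) {f : Fin n → ℤ} → (∀ w → w ≢ u → f w ≡ 0ℤ) → ∑F f ≡ f u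
  ∑F-single {suc n} zero    {f} e = trans (cong (λ t → f zero ℤ.+ t) (∑ᵀ-zero (fin n) λ x → e (suc x) λ ()))
    (ℤₚ.+-identityʳ (f zero))
  ∑F-single {suc n} (suc u) {f} e = trans (cong₂ ℤ._+_ (e zero λ ())
    (∑F-single u λ w w≢u → e (suc w) (w≢u ∘ Finₚ.suc-injective))) (ℤₚ.+-identityˡ (f (suc u)))

  ∑ᵀ-single : ∀ c (u : El c) {f : El c → ℤ} → (∀ w → w ≢ u → f w ≡ 0ℤ) → ∑ᵀ c f ≡ f u
  ∑ᵀ-single (fin n) u e = ∑F-single u e
  ∑ᵀ-single (c ⊕ d) (inj₁ u) {f} e = trans (cong₂ ℤ._+_
    (∑ᵀ-single c u λ w w≢u → e (inj₁ w) (w≢u ∘ ⊎ₚ.inj₁-injective))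
    (∑ᵀ-zero d λ x → e (inj₂ x) λ ())) (ℤₚ.+-identityʳ (f (inj₁ u)))
  ∑ᵀ-single (c ⊕ d) (inj₂ u) {f} e = trans (cong₂ ℤ._+_ (∑ᵀ-zero c λ x → e (inj₁ x) λ ())
    (∑ᵀ-single d u λ w w≢u → e (inj₂ w) (w≢u ∘ ⊎ₚ.inj₂-injective))) (ℤₚ.+-identityˡ (f (inj₂ u)))
  ∑ᵀ-single (c ⊗ d) (x , y) {f} e = trans
    (∑ᵀ-single c x λ w w≢x → ∑ᵀ-zero d λ z → e (w , z) (w≢x ∘ cong proj₁))
    (∑ᵀ-single d y λ w w≢y → e (x , w) (w≢y ∘ cong proj₂))

  cancel-mid : ∀ a b → a ≡ b ℤ.+ (a ℤ.- b)
  cancel-mid = ℤR.solve-∀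

  -- In a refined set every cluster but one repeats an old sign; this corrects the sum for the
  -- exceptional cluster.
  ∑ᵀ-change : ∀ c (u : El c) {f g : El c → ℤ} → (∀ w → w ≢ u → f w ≡ g w) →
    ∑ᵀ c f ≡ ∑ᵀ c g ℤ.+ (f u ℤ.- g u)
  ∑ᵀ-change c u {f} {g} e = trans (∑ᵀ-cong c λ w → cancel-mid (f w) (g w))
    (trans (∑ᵀ-+ c g (λ w → f w ℤ.- g w)) (cong (λ t → ∑ᵀ c g ℤ.+ t)
      (∑ᵀ-single c u λ w w≢u → trans (cong (ℤ._- g w) (e w w≢u)) (ℤₚ.+-inverseʳ (g w)))))

  -- Encoding as initial segments of ℕ.

  encode : ∀ c → El c → Fin (size c)
  encode (fin n) x        = x
  encode (c ⊕ d) (inj₁ x) = encode c x ↑ˡ size d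
  encode (c ⊕ d) (inj₂ y) = size c ↑ʳ encode d y
  encode (c ⊗ d) (x , y)  = Fin.combine (encode c x) (encode d y)

  decode : ∀ c → Fin (size c) → El c
  decode⊎ : ∀ c d → Fin (size c) ⊎ Fin (size d) → El c ⊎ El d
  decode (fin n) i = i
  decode (c ⊕ d) i = decode⊎ c d (Fin.splitAt (size c) i)
  decode (c ⊗ d) i = decode c (proj₁ (Fin.remQuot {size c} (size d) i)) ,
                     decode d (proj₂ (Fin.remQuot {size c} (size d) i))
  decode⊎ c d (inj₁ i) = inj₁ (decode c i)
  decode⊎ c d (inj₂ i) = inj₂ (decode d i)

  decode-encode : ∀ c x → decode c (encode c x) ≡ x
  decode-encode (fin n) x        = refl
  decode-encode (c ⊕ d) (inj₁ x) rewrite Finₚ.splitAt-↑ˡ (size c) (encode c x) (size d) =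
    cong inj₁ (decode-encode c x)
  decode-encode (c ⊕ d) (inj₂ y) rewrite Finₚ.splitAt-↑ʳ (size c) (size d) (encode d y) =
    cong inj₂ (decode-encode d y)
  decode-encode (c ⊗ d) (x , y) = cong₂ _,_
    (trans (cong (decode c ∘ proj₁) eq) (decode-encode c x))
    (trans (cong (decode d ∘ proj₂) eq) (decode-encode d y))
    where eq = Finₚ.remQuot-combine {size c} {size d} (encode c x) (encode d y)

  encode-decode : ∀ c i → encode c (decode c i) ≡ i
  encode-decode (fin n) i = refl
  encode-decode (c ⊕ d) i with Fin.splitAt (size c) i in eq
  ... | inj₁ j = trans (cong (_↑ˡ size d) (encode-decode c j)) (Finₚ.splitAt⁻¹-↑ˡ eq)
  ... | inj₂ j = trans (cong (size c ↑ʳ_) (encode-decode d j)) (Finₚ.splitAt⁻¹-↑ʳ eq)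
  encode-decode (c ⊗ d) i = trans (cong₂ Fin.combine (encode-decode c _) (encode-decode d _))
    (Finₚ.combine-remQuot {size c} (size d) i)

  encode-injective : ∀ c {x y} → encode c x ≡ encode c y → x ≡ y
  encode-injective c {x} {y} e =
    trans (sym (decode-encode c x)) (trans (cong (decode c) e) (decode-encode c y))

  ∑F-split : ∀ m n (f : Fin (m ℕ.+ n) → ℤ) → ∑F f ≡ ∑F (f ∘ (_↑ˡ n)) ℤ.+ ∑F (f ∘ (m ↑ʳ_))
  ∑F-split zero    n f = sym (ℤₚ.+-identityˡ (∑F f))
  ∑F-split (suc m) n f = trans (cong (λ t → f zero ℤ.+ t) (∑F-split m n (f ∘ suc)))
    (sym (ℤₚ.+-assoc (f zero) (∑F (λ i → f (suc (i ↑ˡ n)))) (∑F (λ i → f (suc (m ↑ʳ i))))))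

  ∑F-combine : ∀ m n (f : Fin (m ℕ.* n) → ℤ) →
    ∑F f ≡ ∑F {m} λ i → ∑F {n} λ j → f (Fin.combine i j)
  ∑F-combine zero    n f = refl
  ∑F-combine (suc m) n f = trans (∑F-split n (m ℕ.* n) f)
    (cong (λ t → ∑F (λ j → f (j ↑ˡ (m ℕ.* n))) ℤ.+ t) (∑F-combine m n (λ i → f (n ↑ʳ i))))

  ∑F-encode : ∀ c (f : Fin (size c) → ℤ) → ∑F f ≡ ∑ᵀ c (f ∘ encode c)
  ∑F-encode (fin n) f = refl
  ∑F-encode (c ⊕ d) f = trans (∑F-split (size c) (size d) f)
    (cong₂ ℤ._+_ (∑F-encode c (λ i → f (i ↑ˡ size d))) (∑F-encode d (λ i → f (size c ↑ʳ i))))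
  ∑F-encode (c ⊗ d) f = trans (∑F-combine (size c) (size d) f)
    (trans (∑F-cong λ i → ∑F-encode d (λ j → f (Fin.combine {size c} i j)))
           (∑F-encode c (λ i → ∑ᵀ d λ y → f (Fin.combine {size c} i (encode d y)))))

  -- Signs of integers.

  sg : ℤ → ℤ
  sg +0       = 0ℤ
  sg +[1+ n ] = 1ℤ
  sg -[1+ n ] = -1ℤ

  sg-neg : ∀ a → sg (ℤ.- a) ≡ ℤ.- sg a
  sg-neg +0       = refl
  sg-neg +[1+ n ] = refl
  sg-neg -[1+ n ] = refl

  sg-* : ∀ a b → sg (a ℤ.* b) ≡ sg a ℤ.* sg b
  sg-* +0       b        = cong sg (ℤₚ.*-zeroˡ b)
  sg-* +[1+ m ] +0       = cong sg (ℤₚ.*-zeroʳ +[1+ m ])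
  sg-* -[1+ m ] +0       = cong sg (ℤₚ.*-zeroʳ -[1+ m ])
  sg-* +[1+ m ] +[1+ n ] = refl
  sg-* +[1+ m ] -[1+ n ] = refl
  sg-* -[1+ m ] +[1+ n ] = refl
  sg-* -[1+ m ] -[1+ n ] = refl

  sg-pos : ∀ {a} → 0ℤ ℤ.< a → sg a ≡ 1ℤ
  sg-pos {+[1+ n ]} _ = refl
  sg-pos {+0} (ℤ.+<+ ())

  sg≡0⇒≡0 : ∀ {a} → sg a ≡ 0ℤ → a ≡ 0ℤ
  sg≡0⇒≡0 {+0} _ = refl

  ∣sub∣ : ∀ a b → ∣ a ∣ ℕ.≤ ∣ a ℤ.+ b ∣ ℕ.+ ∣ b ∣
  ∣sub∣ a b = subst (λ x → ∣ x ∣ ℕ.≤ ∣ a ℤ.+ b ∣ ℕ.+ ∣ b ∣) (lem a b) (ℤₚ.∣i-j∣≤∣i∣+∣j∣ (a ℤ.+ b) b)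
    where
    lem : ∀ a b → (a ℤ.+ b) ℤ.- b ≡ a
    lem = ℤR.solve-∀

  2*≡ : ∀ n → 2 ℕ.* n ≡ n ℕ.+ n
  2*≡ = ℕR.solve-∀

  sg-dom : ∀ m e → ∣ e ∣ ℕ.< ∣ m ∣ → sg (m ℤ.+ e) ≡ sg m
  sg-dom +[1+ m ] (+ e)    lt = refl
  sg-dom +[1+ m ] -[1+ e ] (s≤s lt) = sg-pos (subst (0ℤ ℤ.<_) (sym (trans (ℤₚ.[1+m]⊖[1+n]≡m⊖n m e) (ℤₚ.⊖-≥ (ℕₚ.<⇒≤ lt))))
    (ℤ.+<+ (ℕₚ.m<n⇒0<n∸m lt)))
  sg-dom -[1+ m ] -[1+ e ] lt = refl
  sg-dom -[1+ m ] (+ e)    (s≤s lt) = trans (cong sg (ℤₚ.⊖-< (s≤s lt)))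
    (trans (sg-neg (+ (suc m ℕ.∸ e))) (cong ℤ.-_ (sg-pos (ℤ.+<+ (ℕₚ.m<n⇒0<n∸m (s≤s lt))))))
  sg-dom (+ 0) e ()

  half-dom : ∀ m e → 2 ℕ.* ∣ e ∣ ℕ.≤ ∣ m ∣ → ∣ m ∣ ℕ.≤ 2 ℕ.* ∣ m ℤ.+ e ∣
  half-dom m e h = ℕₚ.+-cancelʳ-≤ ∣ m ∣ ∣ m ∣ (2 ℕ.* ∣ m ℤ.+ e ∣) (begin
    ∣ m ∣ ℕ.+ ∣ m ∣                       ≡⟨ 2*≡ ∣ m ∣ ⟨
    2 ℕ.* ∣ m ∣                           ≤⟨ ℕₚ.*-monoʳ-≤ 2 (∣sub∣ m e) ⟩
    2 ℕ.* (∣ m ℤ.+ e ∣ ℕ.+ ∣ e ∣)         ≡⟨ ℕₚ.*-distribˡ-+ 2 ∣ m ℤ.+ e ∣ ∣ e ∣ ⟩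
    2 ℕ.* ∣ m ℤ.+ e ∣ ℕ.+ 2 ℕ.* ∣ e ∣     ≤⟨ ℕₚ.+-monoʳ-≤ (2 ℕ.* ∣ m ℤ.+ e ∣) h ⟩
    2 ℕ.* ∣ m ℤ.+ e ∣ ℕ.+ ∣ m ∣           ∎)
    where open ℕₚ.≤-Reasoning

  half⇒< : ∀ {k m} → 2 ℕ.* k ℕ.≤ m → 1 ℕ.≤ m → k ℕ.< m
  half⇒< {zero}  h 1≤m = 1≤m
  half⇒< {suc k} {m} h 1≤m = ℕₚ.≤-trans (s≤s (ℕₚ.m≤n+m (suc k) k))
    (subst (ℕ._≤ m) (2*≡ (suc k)) h)

  ∣∣≥1 : ∀ {a} → a ≢ 0ℤ → 1 ℕ.≤ ∣ a ∣
  ∣∣≥1 {+0}       h = contradiction refl h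
  ∣∣≥1 {+[1+ n ]} h = s≤s z≤n
  ∣∣≥1 { -[1+ n ]} h = s≤s z≤n

  sg-half : ∀ m e → m ≢ 0ℤ → 2 ℕ.* ∣ e ∣ ℕ.≤ ∣ m ∣ → sg (m ℤ.+ e) ≡ sg m
  sg-half m e m≢0 h = sg-dom m e (half⇒< h (∣∣≥1 m≢0))

-- Levels of the planar construction and the inequalities behind a refinement

module Levels where

  open FiniteTypes
  open import Data.Nat as ℕ using (ℕ; zero; suc; s≤s; z≤n)
  import Data.Nat.Properties as ℕₚ
  open import Data.Integer as ℤ using (ℤ; +_; -[1+_]; 0ℤ; 1ℤ; -1ℤ; ∣_∣)
  import Data.Integer.Properties as ℤₚ
  import Data.Integer.Tactic.RingSolver as ℤR
  import Data.Nat.Tactic.RingSolver as ℕR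
  open import Data.Fin using (Fin; toℕ)
  open import Data.Sum using (inj₁; inj₂)
  open import Function using (_∘_)
  open import Relation.Binary.PropositionalEquality

  -- Linear arithmetic over ℕ: l ≤ r follows from x ≤ y once l + y + s ≡ r + x.
  by-cert : ∀ {x y l r} s → x ℕ.≤ y → l ℕ.+ y ℕ.+ s ≡ r ℕ.+ x → l ℕ.≤ r
  by-cert {x} {y} {l} {r} s x≤y e = ℕₚ.+-cancelʳ-≤ y l r (begin
    l ℕ.+ y          ≤⟨ ℕₚ.m≤m+n (l ℕ.+ y) s ⟩
    l ℕ.+ y ℕ.+ s    ≡⟨ e ⟩
    r ℕ.+ x          ≤⟨ ℕₚ.+-monoʳ-≤ r x≤y ⟩
    r ℕ.+ y          ∎)
    where open ℕₚ.≤-Reasoning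

  infixl 6 _⊞_
  _⊞_ : ∀ {a b c d} → a ℕ.≤ b → c ℕ.≤ d → a ℕ.+ c ℕ.≤ b ℕ.+ d
  _⊞_ = ℕₚ.+-mono-≤

  infixr 7 _⊠_
  _⊠_ : ∀ {a b} k → a ℕ.≤ b → k ℕ.* a ℕ.≤ k ℕ.* b
  k ⊠ h = ℕₚ.*-monoʳ-≤ k h

  ∣a-b∣ : ∀ a b → ∣ a ℤ.- b ∣ ℕ.≤ ∣ a ∣ ℕ.+ ∣ b ∣
  ∣a-b∣ = ℤₚ.∣i-j∣≤∣i∣+∣j∣

  ∣a+b∣ : ∀ a b → ∣ a ℤ.+ b ∣ ℕ.≤ ∣ a ∣ ℕ.+ ∣ b ∣
  ∣a+b∣ = ℤₚ.∣i+j∣≤∣i∣+∣j∣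

  ∣*∣≤ : ∀ a b {m n} → ∣ a ∣ ℕ.≤ m → ∣ b ∣ ℕ.≤ n → ∣ a ℤ.* b ∣ ℕ.≤ m ℕ.* n
  ∣*∣≤ a b {m} {n} h k = subst (ℕ._≤ m ℕ.* n) (sym (ℤₚ.abs-* a b)) (ℕₚ.*-mono-≤ h k)

  ∣+∣≤ : ∀ a b {m n} → ∣ a ∣ ℕ.≤ m → ∣ b ∣ ℕ.≤ n → ∣ a ℤ.+ b ∣ ℕ.≤ m ℕ.+ n
  ∣+∣≤ a b h k = ℕₚ.≤-trans (∣a+b∣ a b) (h ⊞ k)

  ∣-∣≤ : ∀ a b {m n} → ∣ a ∣ ℕ.≤ m → ∣ b ∣ ℕ.≤ n → ∣ a ℤ.- b ∣ ℕ.≤ m ℕ.+ n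
  ∣-∣≤ a b h k = ℕₚ.≤-trans (∣a-b∣ a b) (h ⊞ k)

  -- A level of the planar construction. Every bold point carries exactly Δ edges,
  -- one for each slot, leading to distinct plain points.

  module Edges (U V S : Ty) (π : El V → El S → El U) (z y : El (U ⊕ V) → ℤ) where

    ℓ : El V → El S → ℤ
    ℓ v s = z (inj₁ (π v s)) ℤ.- z (inj₂ v)

    η : El V → El S → ℤ
    η v s = y (inj₁ (π v s)) ℤ.- y (inj₂ v)

    -- The determinant of the edge vector and the vector from the bold end to `w`; its sign tells on
    -- which side of the edge `w` lies.
    D : El V → El S → El (U ⊕ V) → ℤ
    D v s w = ℓ v s ℤ.* (y w ℤ.- y (inj₂ v)) ℤ.- η v s ℤ.* (z w ℤ.- z (inj₂ v))

  record Level (Δ T B : ℕ) : Set where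
    field
      U V S : Ty
      π     : El V → El S → El U
      z y   : El (U ⊕ V) → ℤ
    open Edges U V S π z y public
    field
      size-S : size S ≡ Δ
      1≤Δ    : 1 ℕ.≤ Δ
      1≤T    : 1 ℕ.≤ T
      1≤B    : 1 ℕ.≤ B
      π-inj  : ∀ v {s s₂} → π v s ≡ π v s₂ → s ≡ s₂
      ℓ≢0    : ∀ v s → ℓ v s ≢ 0ℤ
      -- The left side is what the errors of the next step are measured by: tilting an edge changes
      -- its determinant at `w` by the tilt times a combination of these two horizontal distances.
      sep    : ∀ v s w → w ≢ inj₂ v → w ≢ inj₁ (π v s) →
               ∣ ℓ v s ∣ ℕ.+ ∣ z w ℤ.- z (inj₂ v) ∣ ℕ.≤ ∣ D v s w ∣
      -- Near its bold end an edge is not crossed by edges of other bold points: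
      -- within 1/T of the edge length, the sign of D v₂ s₂ is constant.
      seg    : ∀ v s v₂ s₂ → v ≢ v₂ →
               ∣ D v₂ s₂ (inj₁ (π v s)) ℤ.- D v₂ s₂ (inj₂ v) ∣ ℕ.≤ T ℕ.* ∣ D v₂ s₂ (inj₂ v) ∣
      bal    : ∀ v s → ∑ᵀ (U ⊕ V) (sg ∘ D v s) ≡ 0ℤ
      bz     : ∀ w → ∣ z w ∣ ℕ.≤ B
      by     : ∀ w → ∣ y w ∣ ℕ.≤ B

  -- Columns of points have vertical spacing 4. A line passes either through a point of the column
  -- or, shifted by 2, midway between two of them, and every point off the line is at least 2 away
  -- from it.
  gap : ℕ → ℕ → ℤ
  gap j t = + 4 ℤ.* (+ j ℤ.- + t)

  gap-suc : ∀ j t → gap (suc j) (suc t) ≡ gap j t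
  gap-suc j t = lem (+ j) (+ t)
    where
    lem : ∀ a b → + 4 ℤ.* ((1ℤ ℤ.+ a) ℤ.- (1ℤ ℤ.+ b)) ≡ + 4 ℤ.* (a ℤ.- b)
    lem = ℤR.solve-∀

  -- There are `t` negative terms, one zero, and `n - 1 - t` positive ones.
  ∑sg-gap : ∀ n t → t ℕ.< n → ∑F {n} (λ j → sg (gap (toℕ j) t)) ≡ + n ℤ.- 1ℤ ℤ.- + 2 ℤ.* + t
  ∑sg-gap (suc n) zero    _ = trans (cong (λ r → 0ℤ ℤ.+ r) (trans (∑F-const n 1ℤ) (ℤₚ.*-identityʳ (+ n)))) (lem (+ n))
    where
    lem : ∀ a → 0ℤ ℤ.+ a ≡ 1ℤ ℤ.+ a ℤ.- 1ℤ ℤ.- + 2 ℤ.* 0ℤ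
    lem = ℤR.solve-∀
  ∑sg-gap (suc n) (suc t) (s≤s h) = trans (cong (λ r → -1ℤ ℤ.+ r)
      (trans (∑F-cong {n} λ j → cong sg (gap-suc (toℕ j) t)) (∑sg-gap n t h))) (lem (+ n) (+ t))
    where
    lem : ∀ a b → -1ℤ ℤ.+ (a ℤ.- 1ℤ ℤ.- + 2 ℤ.* b) ≡ 1ℤ ℤ.+ a ℤ.- 1ℤ ℤ.- + 2 ℤ.* (1ℤ ℤ.+ b)
    lem = ℤR.solve-∀

  ∑sg-gap+2 : ∀ n t → t ℕ.≤ n → ∑F {n} (λ j → sg (gap (toℕ j) t ℤ.+ + 2)) ≡ + n ℤ.- + 2 ℤ.* + t
  ∑sg-gap+2 n zero    _ = trans (trans (∑F-cong {n} λ j → cong (λ i → sg (+ 4 ℤ.* i ℤ.+ + 2)) (ℤₚ.+-identityʳ (+ toℕ j)))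
      (trans (∑F-cong {n} λ j → cong (λ i → sg (i ℤ.+ + 2)) (sym (ℤₚ.pos-* 4 (toℕ j))))
        (trans (∑F-cong {n} λ j → sg-pos {+ (4 ℕ.* toℕ j ℕ.+ 2)} (ℤ.+<+ (ℕₚ.m≤n⇒m≤o+n (4 ℕ.* toℕ j) (s≤s z≤n))))
               (trans (∑F-const n 1ℤ) (ℤₚ.*-identityʳ (+ n)))))) (lem (+ n))
    where
    lem : ∀ a → a ≡ a ℤ.- + 2 ℤ.* 0ℤ
    lem = ℤR.solve-∀
  ∑sg-gap+2 (suc n) (suc t) (s≤s h) = trans (cong₂ ℤ._+_ (first t)
      (trans (∑F-cong {n} λ j → cong (λ i → sg (i ℤ.+ + 2)) (gap-suc (toℕ j) t)) (∑sg-gap+2 n t h))) (lem (+ n) (+ t))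
    where
    lem : ∀ a b → -1ℤ ℤ.+ (a ℤ.- + 2 ℤ.* b) ≡ 1ℤ ℤ.+ a ℤ.- + 2 ℤ.* (1ℤ ℤ.+ b)
    lem = ℤR.solve-∀
    neg : ∀ a → + 4 ℤ.* (0ℤ ℤ.- (1ℤ ℤ.+ a)) ℤ.+ + 2 ≡ ℤ.- (+ 2 ℤ.+ + 4 ℤ.* a)
    neg = ℤR.solve-∀
    first : ∀ t → sg (gap 0 (suc t) ℤ.+ + 2) ≡ -1ℤ
    first t = trans (cong sg (neg (+ t))) (trans (sg-neg (+ 2 ℤ.+ + 4 ℤ.* + t))
      (cong (λ i → ℤ.- sg (+ 2 ℤ.+ i)) (sym (ℤₚ.pos-* 4 t))))

  gap≥2 : ∀ {j t} → j ≢ t → 2 ℕ.≤ ∣ gap j t ∣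
  gap≥2 {j} {t} j≢t = subst (2 ℕ.≤_) (sym (ℤₚ.abs-* (+ 4) (+ j ℤ.- + t)))
    (ℕₚ.≤-trans (s≤s (s≤s z≤n)) (ℕₚ.*-monoʳ-≤ 4 (∣∣≥1 λ e → j≢t (ℤₚ.+-injective (ℤₚ.i-j≡0⇒i≡j (+ j) (+ t) e)))))

  4x+2≥2 : ∀ x → 2 ℕ.≤ ∣ + 4 ℤ.* x ℤ.+ + 2 ∣
  4x+2≥2 (+ n) = subst (λ i → 2 ℕ.≤ ∣ i ℤ.+ + 2 ∣) (ℤₚ.pos-* 4 n) (ℕₚ.m≤n+m 2 (4 ℕ.* n))
  4x+2≥2 -[1+ n ] = subst (2 ℕ.≤_) (sym (trans (cong ∣_∣ (lem (+ n))) (trans (ℤₚ.∣-i∣≡∣i∣ (+ 2 ℤ.+ + 4 ℤ.* + n))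
      (cong (λ i → ∣ + 2 ℤ.+ i ∣) (sym (ℤₚ.pos-* 4 n)))))) (ℕₚ.m≤m+n 2 (4 ℕ.* n))
    where
    lem : ∀ a → + 4 ℤ.* (ℤ.- (1ℤ ℤ.+ a)) ℤ.+ + 2 ≡ ℤ.- (+ 2 ℤ.+ + 4 ℤ.* a)
    lem = ℤR.solve-∀

  -- The estimates of the refinement step with the geometry removed. Here `ld` is the horizontal
  -- length of an edge, `dz` or `d3` a horizontal distance, and `Dn` the size of an old determinant,
  -- which `sep` bounds below by their sum. `M` bounds the tilts, `4 * T` is the scaling of both
  -- coordinates and `16 * M` the further scaling of the ordinates.
  module Bounds where
    open import Data.Nat using (_+_; _*_; _≤_)

    far-AP : ∀ T M ld dz Dn {g c} → 1 ≤ T → ld + dz ≤ Dn → g ≤ 4 * T * M → c ≤ M →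
      2 * (ld * g + c * (4 * T * dz + ld)) ≤ 4 * T * (16 * M * Dn)
    far-AP (suc t) M ld dz Dn _ h g≤ c≤ = ℕₚ.≤-trans
      (2 ⊠ (ℕₚ.*-monoʳ-≤ ld g≤ ⊞ ℕₚ.*-monoˡ-≤ (4 * suc t * dz + ld) c≤))
      (by-cert (M * ((54 + 56 * t) * ld + (56 + 56 * t) * dz)) ((M * (64 + 64 * t)) ⊠ h) (lem t M ld dz Dn))
      where
      lem : ∀ t M ld dz Dn → 2 * (ld * (4 * suc t * M) + M * (4 * suc t * dz + ld)) + M * (64 + 64 * t) * Dn
        + M * ((54 + 56 * t) * ld + (56 + 56 * t) * dz) ≡ 4 * suc t * (16 * M * Dn) + M * (64 + 64 * t) * (ld + dz)
      lem = ℕR.solve-∀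

    far-X : ∀ T M ld dz Dn {c l3} → 1 ≤ T → ld + dz ≤ Dn → c ≤ M → l3 ≤ (T + 1) * Dn + dz →
      2 * (16 * M * (T * Dn) + ld * (3 * M) + c * (4 * T * dz + ld + l3)) ≤ 4 * T * (16 * M * Dn)
    far-X (suc t) M ld dz Dn _ h c≤ l≤ = ℕₚ.≤-trans
      (2 ⊠ (ℕₚ.≤-refl {16 * M * (suc t * Dn) + ld * (3 * M)} ⊞ ℕₚ.*-mono-≤ c≤ (ℕₚ.≤-refl {4 * suc t * dz + ld} ⊞ l≤)))
      (by-cert (M * ((20 + 30 * t) * ld + (18 + 22 * t) * dz)) ((M * (28 + 30 * t)) ⊠ h) (lem t M ld dz Dn))
      where
      lem : ∀ t M ld dz Dn →
        2 * (16 * M * (suc t * Dn) + ld * (3 * M) + M * (4 * suc t * dz + ld + ((suc t + 1) * Dn + dz)))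
        + M * (28 + 30 * t) * Dn + M * ((20 + 30 * t) * ld + (18 + 22 * t) * dz)
        ≡ 4 * suc t * (16 * M * Dn) + M * (28 + 30 * t) * (ld + dz)
      lem = ℕR.solve-∀

    far-sep : ∀ T M ld dz Dn {N Z l3} → 1 ≤ T → 1 ≤ M → ld + dz ≤ Dn → l3 ≤ (T + 1) * Dn + dz →
      4 * T * (16 * M * Dn) ≤ 2 * N → Z ≤ 4 * T * dz + ld + l3 → ld + Z ≤ N
    far-sep (suc t) M ld dz Dn {N} {Z} _ 1≤M h l≤ hN hZ = ℕₚ.*-cancelˡ-≤ 2 (ℕₚ.≤-trans
      (2 ⊠ (ℕₚ.≤-refl {ld} ⊞ ℕₚ.≤-trans hZ (ℕₚ.≤-refl {4 * suc t * dz + ld} ⊞ l≤)))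
      (ℕₚ.≤-trans (by-cert ((6 + 8 * t) * ld + (50 + 54 * t) * Dn)
        (((10 + 8 * t) ⊠ h) ⊞ ((64 * (1 + t) * Dn) ⊠ 1≤M)) (lem t M ld dz Dn)) hN))
      where
      lem : ∀ t M ld dz Dn →
        2 * (ld + (4 * suc t * dz + ld + ((suc t + 1) * Dn + dz)))
        + ((10 + 8 * t) * Dn + 64 * (1 + t) * Dn * M) + ((6 + 8 * t) * ld + (50 + 54 * t) * Dn)
        ≡ 4 * suc t * (16 * M * Dn) + ((10 + 8 * t) * (ld + dz) + 64 * (1 + t) * Dn * 1)
      lem = ℕR.solve-∀

    near-x : ∀ M ld d3 Dn {c} → ld + d3 ≤ Dn → c ≤ M → 2 * (c * (d3 + ld)) ≤ 16 * M * Dn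
    near-x M ld d3 Dn h c≤ = ℕₚ.≤-trans (2 ⊠ ℕₚ.*-monoˡ-≤ (d3 + ld) c≤)
      (by-cert (M * (14 * ld + 14 * d3)) ((16 * M) ⊠ h) (lem M ld d3 Dn))
      where
      lem : ∀ M ld d3 Dn → 2 * (M * (d3 + ld)) + 16 * M * Dn + M * (14 * ld + 14 * d3) ≡ 16 * M * Dn + 16 * M * (ld + d3)
      lem = ℕR.solve-∀

    near-x′ : ∀ M ld d3 Dn {c} → ld + d3 ≤ Dn → c ≤ M → 2 * (ld * (3 * M) + c * (d3 + ld)) ≤ 16 * M * Dn
    near-x′ M ld d3 Dn h c≤ = ℕₚ.≤-trans (2 ⊠ (ℕₚ.≤-refl {ld * (3 * M)} ⊞ ℕₚ.*-monoˡ-≤ (d3 + ld) c≤))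
      (by-cert (M * (8 * ld + 14 * d3)) ((16 * M) ⊠ h) (lem M ld d3 Dn))
      where
      lem : ∀ M ld d3 Dn → 2 * (ld * (3 * M) + M * (d3 + ld)) + 16 * M * Dn + M * (8 * ld + 14 * d3) ≡ 16 * M * Dn + 16 * M * (ld + d3)
      lem = ℕR.solve-∀

    near-sep : ∀ M ld d3 Dn {N Z} → 1 ≤ M → ld + d3 ≤ Dn → 16 * M * Dn ≤ 2 * N → Z ≤ d3 + ld → ld + Z ≤ N
    near-sep M ld d3 Dn 1≤M h hN hZ = ℕₚ.*-cancelˡ-≤ 2 (ℕₚ.≤-trans (2 ⊠ (ℕₚ.≤-refl {ld} ⊞ hZ))
      (ℕₚ.≤-trans (by-cert (2 * d3 + 12 * Dn) ((4 ⊠ h) ⊞ ((16 * Dn) ⊠ 1≤M)) (lem M ld d3 Dn)) hN))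
      where
      lem : ∀ M ld d3 Dn → 2 * (ld + (d3 + ld)) + (4 * Dn + 16 * Dn * M) + (2 * d3 + 12 * Dn) ≡ 16 * M * Dn + (4 * (ld + d3) + 16 * Dn * 1)
      lem = ℕR.solve-∀

    seg-far : ∀ T M dz Dn {l1 l2 N lam c1 c2} → 1 ≤ T → l2 + dz ≤ Dn → l1 ≤ (T + 1) * Dn + dz → c1 ≤ M → c2 ≤ M →
      4 * T * (16 * M * Dn) ≤ 2 * N → lam ≤ 4 * T →
      lam * (16 * M * (T * Dn) + l2 * c1 + c2 * l1) ≤ 4 * (4 * T) * N
    seg-far (suc t) M dz Dn {l1} {l2} {N} _ h hl c1≤ c2≤ hN lam≤ = ℕₚ.≤-trans
      (ℕₚ.*-mono-≤ lam≤ (ℕₚ.≤-refl {16 * M * (suc t * Dn)} ⊞ (ℕₚ.*-monoʳ-≤ l2 c1≤) ⊞ ℕₚ.*-mono-≤ c2≤ hl))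
      (ℕₚ.≤-trans (by-cert (4 * suc t * (M * ((109 + 111 * t) * Dn))) ((4 * suc t * M) ⊠ h) (lem t M dz Dn l2))
        (subst (8 * suc t * (4 * suc t * (16 * M * Dn)) ≤_) (lem2 t N) ((8 * suc t) ⊠ hN)))
      where
      lem : ∀ t M dz Dn l2 → 4 * suc t * (16 * M * (suc t * Dn) + l2 * M + M * ((suc t + 1) * Dn + dz))
        + 4 * suc t * M * Dn + 4 * suc t * (M * ((109 + 111 * t) * Dn))
        ≡ 8 * suc t * (4 * suc t * (16 * M * Dn)) + 4 * suc t * M * (l2 + dz)
      lem = ℕR.solve-∀
      lem2 : ∀ t N → 8 * suc t * (2 * N) ≡ 4 * (4 * suc t) * N
      lem2 = ℕR.solve-∀

    seg-near : ∀ T M Dn {l1 l2 N lam c1 c2} → l2 + l1 ≤ Dn → c1 ≤ M → c2 ≤ M →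
      16 * M * Dn ≤ 2 * N → lam ≤ 4 * T → lam * (16 * M * Dn + l2 * c1 + c2 * l1) ≤ 4 * (4 * T) * N
    seg-near T M Dn {l1} {l2} {N} h c1≤ c2≤ hN lam≤ = ℕₚ.≤-trans
      (ℕₚ.*-mono-≤ lam≤ (ℕₚ.≤-refl {16 * M * Dn} ⊞ ℕₚ.*-monoʳ-≤ l2 c1≤ ⊞ ℕₚ.*-monoˡ-≤ l1 c2≤))
      (ℕₚ.≤-trans (by-cert (4 * T * (15 * M * Dn)) ((4 * T * M) ⊠ h) (lem T M Dn l1 l2))
        (subst (8 * T * (16 * M * Dn) ≤_) (lem2 T N) ((8 * T) ⊠ hN)))
      where
      lem : ∀ T M Dn l1 l2 → 4 * T * (16 * M * Dn + l2 * M + M * l1) + 4 * T * M * Dn + 4 * T * (15 * M * Dn)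
        ≡ 8 * T * (16 * M * Dn) + 4 * T * M * (l2 + l1)
      lem = ℕR.solve-∀
      lem2 : ∀ T N → 8 * T * (2 * N) ≡ 4 * (4 * T) * N
      lem2 = ℕR.solve-∀

-- The refinement step: points become clusters, edges become bipartite families

module Refinement where

  open FiniteTypes
  open Levels
  open import Data.Nat as ℕ using (ℕ; zero; suc; s≤s; z≤n)
  import Data.Nat.Properties as ℕₚ
  open import Data.Integer as ℤ using (ℤ; +_; 0ℤ; 1ℤ; -1ℤ; ∣_∣)
  import Data.Integer.Properties as ℤₚ
  import Data.Integer.Tactic.RingSolver as ℤR
  import Data.Nat.Tactic.RingSolver as ℕR
  open import Data.Fin as Fin using (Fin; zero; suc; toℕ; _↑ˡ_; _↑ʳ_)
  import Data.Fin.Properties as Finₚ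
  open import Data.Product using (∃-syntax; _×_; _,_; proj₁; proj₂)
  open import Data.Sum using (inj₁; inj₂)
  import Data.Sum.Properties as ⊎ₚ
  open import Function using (_∘_)
  open import Relation.Nullary using (yes; no; contradiction)
  open import Relation.Binary.PropositionalEquality

  4T-1 : ∀ T → 1 ℕ.≤ T → ∃[ q ] (+ (4 ℕ.* T) ℤ.- 1ℤ ≡ + q × 4 ℕ.* T ≡ suc q × 3 ℕ.≤ q)
  4T-1 (suc t) _ = t ℕ.+ 3 ℕ.* suc t , refl , refl , ℕₚ.m≤n⇒m≤o+n t (ℕₚ.*-monoʳ-≤ 3 (s≤s z≤n))

  -- Both coordinates are multiplied by `Q`, ordinates moreover by `K`. A plain point becomes a
  -- vertical column of `A` points. A bold point becomes a column of `a` plain points and, for every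
  -- slot, a new bold point at the fraction `1/Q` of the edge and a plain mirror image of it beyond
  -- the old point, lowered by `O`. A new bold point is joined to the middle `a` points of the far
  -- column and to all `a` points of the near one: edges are multiplied by `2 * a = 12 * Δ`, points
  -- by `8 * Δ`.
  module Step {Δ T B : ℕ} (L : Level Δ T B) where
    open Level L
    open Bounds

    a A M K Q O : ℕ
    -- With `a = c * Δ` the ratio of edges to points is multiplied by 2c/(c + 2); the value c = 6
    -- gives 3/2.
    a = 6 ℕ.* Δ
    -- The two end pieces make this cluster as large as that of a bold point, which has `Δ` new bold
    -- points and `Δ` mirror images besides its column. Far clusters then contribute `A` times an
    -- old sum of signs.
    A = Δ ℕ.+ (a ℕ.+ Δ)
    M = 40 ℕ.* Δ
    -- The ordinates are stretched so that tilts up to `M` cost only a small part of any old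
    -- determinant.
    K = 16 ℕ.* M
    -- At the fraction `1/Q` of an edge, `seg` lets the determinants of edges at other bold points
    -- change by at most `T/Q`, a quarter.
    Q = 4 ℕ.* T
    -- More than twice any tilt: the mirror image of a new bold point lies below all edge lines
    -- through that point.
    O = 3 ℕ.* M

    U′ V′ S′ : Ty
    U′ = (U ⊗ fin A) ⊕ ((V ⊗ fin a) ⊕ (V ⊗ S))
    V′ = V ⊗ S
    S′ = fin a ⊕ fin a

    mid : Fin a → Fin A
    mid k = Δ ↑ʳ (k ↑ˡ Δ)

    toℕ-mid : ∀ k → toℕ (mid k) ≡ Δ ℕ.+ toℕ k
    toℕ-mid k = trans (Finₚ.toℕ-↑ʳ Δ (k ↑ˡ Δ)) (cong (Δ ℕ.+_) (Finₚ.toℕ-↑ˡ k Δ))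

    π′ : El V′ → El S′ → El U′
    π′ (v , s) (inj₁ k) = inj₁ (π v s , mid k)
    π′ (v , s) (inj₂ k) = inj₂ (inj₁ (v , k))

    cU : Fin A → ℤ
    cU j = gap (toℕ j) Δ

    cV : Fin a → ℤ
    cV k = + 4 ℤ.* + toℕ k ℤ.- + 2

    cS : El S′ → ℤ
    cS (inj₁ k) = + 4 ℤ.* + toℕ k
    cS (inj₂ k) = cV k

    z′ y′ : El (U′ ⊕ V′) → ℤ
    z′ (inj₁ (inj₁ (u , j)))        = + Q ℤ.* z (inj₁ u)
    z′ (inj₁ (inj₂ (inj₁ (v , k)))) = + Q ℤ.* z (inj₂ v)
    z′ (inj₁ (inj₂ (inj₂ (v , s)))) = + Q ℤ.* z (inj₂ v) ℤ.- ℓ v s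
    z′ (inj₂ (v , s))               = + Q ℤ.* z (inj₂ v) ℤ.+ ℓ v s
    y′ (inj₁ (inj₁ (u , j)))        = + Q ℤ.* (+ K ℤ.* y (inj₁ u)) ℤ.+ (+ Q ℤ.- 1ℤ) ℤ.* cU j
    y′ (inj₁ (inj₂ (inj₁ (v , k)))) = + Q ℤ.* (+ K ℤ.* y (inj₂ v)) ℤ.- cV k
    y′ (inj₁ (inj₂ (inj₂ (v , s)))) = + Q ℤ.* (+ K ℤ.* y (inj₂ v)) ℤ.- + K ℤ.* η v s ℤ.- + O
    y′ (inj₂ (v , s))               = + Q ℤ.* (+ K ℤ.* y (inj₂ v)) ℤ.+ + K ℤ.* η v s

    module New = Edges U′ V′ S′ π′ z′ y′

    -- The edges at the bold point (v , s) have directions (ℓ v s , K (η v s) + c) for varying c.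
    N : El V → El S → ℤ → El (U′ ⊕ V′) → ℤ
    N v s c W = ℓ v s ℤ.* (y′ W ℤ.- y′ (inj₂ (v , s))) ℤ.- (+ K ℤ.* η v s ℤ.+ c) ℤ.* (z′ W ℤ.- z′ (inj₂ (v , s)))

    -- The length of a new edge in units of its direction vector: `Q - 1` forward to the column of
    -- `π v s`, and `-1` back to the column of `v`.
    lam : El S′ → ℤ
    lam (inj₁ k) = + Q ℤ.- 1ℤ
    lam (inj₂ k) = -1ℤ

    ℓ′≡ : ∀ v s t → New.ℓ (v , s) t ≡ lam t ℤ.* ℓ v s
    ℓ′≡ v s (inj₁ k) = lem (+ Q) (z (inj₁ (π v s))) (z (inj₂ v))
      where
      lem : ∀ Q zu zv → Q ℤ.* zu ℤ.- (Q ℤ.* zv ℤ.+ (zu ℤ.- zv)) ≡ (Q ℤ.- 1ℤ) ℤ.* (zu ℤ.- zv)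
      lem = ℤR.solve-∀
    ℓ′≡ v s (inj₂ k) = lem (+ Q) (z (inj₂ v)) (ℓ v s)
      where
      lem : ∀ Q zv l → Q ℤ.* zv ℤ.- (Q ℤ.* zv ℤ.+ l) ≡ -1ℤ ℤ.* l
      lem = ℤR.solve-∀

    cU-mid : ∀ k → cU (mid k) ≡ + 4 ℤ.* + toℕ k
    cU-mid k = trans (cong (λ i → gap i Δ) (toℕ-mid k)) (lem (+ Δ) (+ toℕ k))
      where
      lem : ∀ d k → + 4 ℤ.* (d ℤ.+ k ℤ.- d) ≡ + 4 ℤ.* k
      lem = ℤR.solve-∀

    η′≡ : ∀ v s t → New.η (v , s) t ≡ lam t ℤ.* (+ K ℤ.* η v s ℤ.+ cS t)
    η′≡ v s (inj₁ k) = trans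
      (cong (λ c → (+ Q ℤ.* (+ K ℤ.* y (inj₁ (π v s))) ℤ.+ (+ Q ℤ.- 1ℤ) ℤ.* c) ℤ.- y′ (inj₂ (v , s))) (cU-mid k))
      (lem (+ Q) (+ K) (y (inj₁ (π v s))) (y (inj₂ v)) (cS (inj₁ k)))
      where
      lem : ∀ Q K yu yv c → (Q ℤ.* (K ℤ.* yu) ℤ.+ (Q ℤ.- 1ℤ) ℤ.* c) ℤ.- (Q ℤ.* (K ℤ.* yv) ℤ.+ K ℤ.* (yu ℤ.- yv))
        ≡ (Q ℤ.- 1ℤ) ℤ.* (K ℤ.* (yu ℤ.- yv) ℤ.+ c)
      lem = ℤR.solve-∀
    η′≡ v s (inj₂ k) = lem (+ Q) (+ K) (y (inj₂ v)) (η v s) (cV k)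
      where
      lem : ∀ Q K yv e c → (Q ℤ.* (K ℤ.* yv) ℤ.- c) ℤ.- (Q ℤ.* (K ℤ.* yv) ℤ.+ K ℤ.* e) ≡ -1ℤ ℤ.* (K ℤ.* e ℤ.+ c)
      lem = ℤR.solve-∀

    D′≡ : ∀ v s t W → New.D (v , s) t W ≡ lam t ℤ.* N v s (cS t) W
    D′≡ v s t W = trans
      (cong₂ (λ l e → l ℤ.* (y′ W ℤ.- y′ (inj₂ (v , s))) ℤ.- e ℤ.* (z′ W ℤ.- z′ (inj₂ (v , s)))) (ℓ′≡ v s t) (η′≡ v s t))
      (lem (lam t) (ℓ v s) (+ K ℤ.* η v s ℤ.+ cS t) (y′ W ℤ.- y′ (inj₂ (v , s))) (z′ W ℤ.- z′ (inj₂ (v , s))))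
      where
      lem : ∀ m l e Y Z → m ℤ.* l ℤ.* Y ℤ.- m ℤ.* e ℤ.* Z ≡ m ℤ.* (l ℤ.* Y ℤ.- e ℤ.* Z)
      lem = ℤR.solve-∀

    1≤M : 1 ℕ.≤ M
    1≤M = ℕₚ.≤-trans 1≤Δ (ℕₚ.m≤n*m Δ 40)

    3≤M : 3 ℕ.≤ M
    3≤M = ℕₚ.≤-trans (s≤s (s≤s (s≤s z≤n))) (ℕₚ.*-monoʳ-≤ 40 1≤Δ)

    ∣Q-1∣ : ∃[ q ] (+ Q ℤ.- 1ℤ ≡ + q × Q ≡ suc q × 3 ℕ.≤ q)
    ∣Q-1∣ = 4T-1 T 1≤T

    sg-Q-1 : sg (+ Q ℤ.- 1ℤ) ≡ 1ℤ
    sg-Q-1 = let q , e , _ , h = ∣Q-1∣ in trans (cong sg e) (sg-pos (ℤ.+<+ (ℕₚ.≤-trans (s≤s z≤n) h)))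

    1≤∣Q-1∣ : 1 ℕ.≤ ∣ + Q ℤ.- 1ℤ ∣
    1≤∣Q-1∣ = let q , e , _ , h = ∣Q-1∣ in subst (λ i → 1 ℕ.≤ ∣ i ∣) (sym e) (ℕₚ.≤-trans (s≤s z≤n) h)

    ∣Q-1∣≤ : ∣ + Q ℤ.- 1ℤ ∣ ℕ.≤ Q
    ∣Q-1∣≤ = let q , e , f , h = ∣Q-1∣ in subst₂ (λ i Q → ∣ i ∣ ℕ.≤ Q) (sym e) (sym f) (ℕₚ.n≤1+n q)

    1≤∣lam∣ : ∀ t → 1 ℕ.≤ ∣ lam t ∣
    1≤∣lam∣ (inj₁ k) = 1≤∣Q-1∣
    1≤∣lam∣ (inj₂ k) = s≤s z≤n

    ∣lam∣≤ : ∀ t → ∣ lam t ∣ ℕ.≤ Q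
    ∣lam∣≤ (inj₁ k) = ∣Q-1∣≤
    ∣lam∣≤ (inj₂ k) = ℕₚ.≤-trans 1≤∣Q-1∣ ∣Q-1∣≤

    ∣4k∣≤ : ∀ (k : Fin a) → ∣ + 4 ℤ.* + toℕ k ∣ ℕ.≤ 24 ℕ.* Δ
    ∣4k∣≤ k = subst (ℕ._≤ 24 ℕ.* Δ) (sym (ℤₚ.abs-* (+ 4) (+ toℕ k)))
      (ℕₚ.≤-trans (ℕₚ.*-monoʳ-≤ 4 (ℕₚ.<⇒≤ (Finₚ.toℕ<n k))) (ℕₚ.≤-reflexive (lem Δ)))
      where
      lem : ∀ d → 4 ℕ.* (6 ℕ.* d) ≡ 24 ℕ.* d
      lem = ℕR.solve-∀

    ∣cV∣≤ : ∀ k → ∣ cV k ∣ ℕ.≤ M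
    ∣cV∣≤ k = ℕₚ.≤-trans (∣-∣≤ (+ 4 ℤ.* + toℕ k) (+ 2) (∣4k∣≤ k) (ℕₚ.≤-refl {2}))
      (by-cert (14 ℕ.* Δ) (2 ⊠ 1≤Δ) (lem Δ))
      where
      lem : ∀ d → 24 ℕ.* d ℕ.+ 2 ℕ.+ 2 ℕ.* d ℕ.+ 14 ℕ.* d ≡ 40 ℕ.* d ℕ.+ 2 ℕ.* 1
      lem = ℕR.solve-∀

    ∣cS∣≤ : ∀ t → ∣ cS t ∣ ℕ.≤ M
    ∣cS∣≤ (inj₁ k) = ℕₚ.≤-trans (∣4k∣≤ k) (ℕₚ.*-monoˡ-≤ Δ (ℕₚ.m≤m+n 24 16))
    ∣cS∣≤ (inj₂ k) = ∣cV∣≤ k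

    ∣cU∣≤ : ∀ j → ∣ cU j ∣ ℕ.≤ M
    ∣cU∣≤ j = ℕₚ.≤-trans (∣*∣≤ (+ 4) (+ toℕ j ℤ.- + Δ) {4} ℕₚ.≤-refl
        (∣-∣≤ (+ toℕ j) (+ Δ) (ℕₚ.<⇒≤ (Finₚ.toℕ<n j)) ℕₚ.≤-refl))
      (ℕₚ.≤-trans (ℕₚ.≤-reflexive (lem Δ)) (ℕₚ.*-monoˡ-≤ Δ (ℕₚ.m≤m+n 36 4)))
      where
      lem : ∀ d → 4 ℕ.* (d ℕ.+ (6 ℕ.* d ℕ.+ d) ℕ.+ d) ≡ 36 ℕ.* d
      lem = ℕR.solve-∀

    dz : El V → El (U ⊕ V) → ℤ
    dz v w = z w ℤ.- z (inj₂ v)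

    main : El V → El S → El (U ⊕ V) → ℤ
    main v s w = + Q ℤ.* (+ K ℤ.* D v s w)

    -- In this and the next two identities the scaled old determinant is split off. What remains is
    -- the error due to the tilt `c` and to the displacement of the point within its cluster.
    N-AP : ∀ v s c w g → ℓ v s ℤ.* ((+ Q ℤ.* (+ K ℤ.* y w) ℤ.+ g) ℤ.- y′ (inj₂ (v , s)))
        ℤ.- (+ K ℤ.* η v s ℤ.+ c) ℤ.* (+ Q ℤ.* z w ℤ.- z′ (inj₂ (v , s)))
      ≡ main v s w ℤ.+ (ℓ v s ℤ.* g ℤ.- c ℤ.* (+ Q ℤ.* dz v w ℤ.- ℓ v s))
    N-AP v s c w g = lem (+ Q) (+ K) (z (inj₁ (π v s))) (z (inj₂ v)) (y (inj₁ (π v s))) (y (inj₂ v)) (z w) (y w) c g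
      where
      lem : ∀ Q K zu zv yu yv zw yw c g →
        (zu ℤ.- zv) ℤ.* ((Q ℤ.* (K ℤ.* yw) ℤ.+ g) ℤ.- (Q ℤ.* (K ℤ.* yv) ℤ.+ K ℤ.* (yu ℤ.- yv)))
          ℤ.- (K ℤ.* (yu ℤ.- yv) ℤ.+ c) ℤ.* (Q ℤ.* zw ℤ.- (Q ℤ.* zv ℤ.+ (zu ℤ.- zv)))
        ≡ Q ℤ.* (K ℤ.* ((zu ℤ.- zv) ℤ.* (yw ℤ.- yv) ℤ.- (yu ℤ.- yv) ℤ.* (zw ℤ.- zv)))
          ℤ.+ ((zu ℤ.- zv) ℤ.* g ℤ.- c ℤ.* (Q ℤ.* (zw ℤ.- zv) ℤ.- (zu ℤ.- zv)))
      lem = ℤR.solve-∀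

    N-x : ∀ v s c v₃ s₃ → N v s c (inj₂ (v₃ , s₃)) ≡ main v s (inj₂ v₃)
      ℤ.+ (+ K ℤ.* (D v s (inj₁ (π v₃ s₃)) ℤ.- D v s (inj₂ v₃))
           ℤ.- c ℤ.* ((+ Q ℤ.* dz v (inj₂ v₃) ℤ.- ℓ v s) ℤ.+ ℓ v₃ s₃))
    N-x v s c v₃ s₃ = lem (+ Q) (+ K) (z (inj₁ (π v s))) (z (inj₂ v)) (y (inj₁ (π v s))) (y (inj₂ v))
      (z (inj₂ v₃)) (y (inj₂ v₃)) (z (inj₁ (π v₃ s₃))) (y (inj₁ (π v₃ s₃))) c
      where
      lem : ∀ Q K zu zv yu yv zw yw z3 y3 c →
        (zu ℤ.- zv) ℤ.* ((Q ℤ.* (K ℤ.* yw) ℤ.+ K ℤ.* (y3 ℤ.- yw)) ℤ.- (Q ℤ.* (K ℤ.* yv) ℤ.+ K ℤ.* (yu ℤ.- yv)))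
          ℤ.- (K ℤ.* (yu ℤ.- yv) ℤ.+ c) ℤ.* ((Q ℤ.* zw ℤ.+ (z3 ℤ.- zw)) ℤ.- (Q ℤ.* zv ℤ.+ (zu ℤ.- zv)))
        ≡ Q ℤ.* (K ℤ.* ((zu ℤ.- zv) ℤ.* (yw ℤ.- yv) ℤ.- (yu ℤ.- yv) ℤ.* (zw ℤ.- zv)))
          ℤ.+ (K ℤ.* (((zu ℤ.- zv) ℤ.* (y3 ℤ.- yv) ℤ.- (yu ℤ.- yv) ℤ.* (z3 ℤ.- zv))
                      ℤ.- ((zu ℤ.- zv) ℤ.* (yw ℤ.- yv) ℤ.- (yu ℤ.- yv) ℤ.* (zw ℤ.- zv)))
               ℤ.- c ℤ.* ((Q ℤ.* (zw ℤ.- zv) ℤ.- (zu ℤ.- zv)) ℤ.+ (z3 ℤ.- zw)))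
      lem = ℤR.solve-∀

    N-x′ : ∀ v s c v₃ s₃ → N v s c (inj₁ (inj₂ (inj₂ (v₃ , s₃)))) ≡ main v s (inj₂ v₃)
      ℤ.+ (ℤ.- (+ K ℤ.* (D v s (inj₁ (π v₃ s₃)) ℤ.- D v s (inj₂ v₃))) ℤ.- ℓ v s ℤ.* + O
           ℤ.- c ℤ.* ((+ Q ℤ.* dz v (inj₂ v₃) ℤ.- ℓ v s) ℤ.- ℓ v₃ s₃))
    N-x′ v s c v₃ s₃ = lem (+ Q) (+ K) (z (inj₁ (π v s))) (z (inj₂ v)) (y (inj₁ (π v s))) (y (inj₂ v))
      (z (inj₂ v₃)) (y (inj₂ v₃)) (z (inj₁ (π v₃ s₃))) (y (inj₁ (π v₃ s₃))) c (+ O)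
      where
      lem : ∀ Q K zu zv yu yv zw yw z3 y3 c O →
        (zu ℤ.- zv) ℤ.* ((Q ℤ.* (K ℤ.* yw) ℤ.- K ℤ.* (y3 ℤ.- yw) ℤ.- O) ℤ.- (Q ℤ.* (K ℤ.* yv) ℤ.+ K ℤ.* (yu ℤ.- yv)))
          ℤ.- (K ℤ.* (yu ℤ.- yv) ℤ.+ c) ℤ.* ((Q ℤ.* zw ℤ.- (z3 ℤ.- zw)) ℤ.- (Q ℤ.* zv ℤ.+ (zu ℤ.- zv)))
        ≡ Q ℤ.* (K ℤ.* ((zu ℤ.- zv) ℤ.* (yw ℤ.- yv) ℤ.- (yu ℤ.- yv) ℤ.* (zw ℤ.- zv)))
          ℤ.+ (ℤ.- (K ℤ.* (((zu ℤ.- zv) ℤ.* (y3 ℤ.- yv) ℤ.- (yu ℤ.- yv) ℤ.* (z3 ℤ.- zv))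
                      ℤ.- ((zu ℤ.- zv) ℤ.* (yw ℤ.- yv) ℤ.- (yu ℤ.- yv) ℤ.* (zw ℤ.- zv)))) ℤ.- (zu ℤ.- zv) ℤ.* O
               ℤ.- c ℤ.* ((Q ℤ.* (zw ℤ.- zv) ℤ.- (zu ℤ.- zv)) ℤ.- (z3 ℤ.- zw)))
      lem = ℤR.solve-∀

    -- What is needed of a point W′ whose orientation should be governed by the value m.
    record Follows (v : El V) (s : El S) (c m : ℤ) (W : El (U′ ⊕ V′)) : Set where
      field
        sign : sg (N v s c W) ≡ sg m
        gapped : ∣ ℓ v s ∣ ℕ.+ ∣ z′ W ℤ.- z′ (inj₂ (v , s)) ∣ ℕ.≤ ∣ N v s c W ∣
    open Follows

    ld : El V → El S → ℕ
    ld v s = ∣ ℓ v s ∣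

    Far : El V → El S → El (U ⊕ V) → Set
    Far v s w = w ≢ inj₂ v × w ≢ inj₁ (π v s)

    D≢0 : ∀ {v s w} → Far v s w → D v s w ≢ 0ℤ
    D≢0 {v} {s} {w} (p , q) e = contradiction
      (ℕₚ.≤-trans (ℕₚ.≤-trans (∣∣≥1 (ℓ≢0 v s)) (ℕₚ.m≤m+n (∣ ℓ v s ∣) (∣ z w ℤ.- z (inj₂ v) ∣))) (subst (λ i → ∣ ℓ v s ∣ ℕ.+ ∣ z w ℤ.- z (inj₂ v) ∣ ℕ.≤ ∣ i ∣) e (sep v s w p q))) λ ()

    1≤Q : 1 ℕ.≤ Q
    1≤Q = ℕₚ.≤-trans 1≤T (ℕₚ.m≤n*m T 4)

    1≤K : 1 ℕ.≤ K
    1≤K = ℕₚ.≤-trans 1≤M (ℕₚ.m≤n*m M 16)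

    sg-+ : ∀ {n} → 1 ℕ.≤ n → sg (+ n) ≡ 1ℤ
    sg-+ h = sg-pos (ℤ.+<+ h)

    sg-main : ∀ v s w → sg (main v s w) ≡ sg (D v s w)
    sg-main v s w = trans (sg-* (+ Q) (+ K ℤ.* D v s w)) (trans (cong₂ ℤ._*_ (sg-+ 1≤Q)
      (trans (sg-* (+ K) (D v s w)) (trans (cong (ℤ._* sg (D v s w)) (sg-+ 1≤K)) (ℤₚ.*-identityˡ _)))) (ℤₚ.*-identityˡ _))

    ∣main∣ : ∀ v s w → ∣ main v s w ∣ ≡ Q ℕ.* (K ℕ.* ∣ D v s w ∣)
    ∣main∣ v s w = trans (ℤₚ.abs-* (+ Q) (+ K ℤ.* D v s w)) (cong (Q ℕ.*_) (ℤₚ.abs-* (+ K) (D v s w)))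

    sg≢0 : ∀ {a b} → sg a ≡ sg b → b ≢ 0ℤ → a ≢ 0ℤ
    sg≢0 e h refl = h (sg≡0⇒≡0 (sym e))

    -- Far points: the error is at most half of the main term.

    far-half : ∀ {v s c w W e} → Far v s w → N v s c W ≡ main v s w ℤ.+ e →
      2 ℕ.* ∣ e ∣ ℕ.≤ Q ℕ.* (K ℕ.* ∣ D v s w ∣) →
      sg (N v s c W) ≡ sg (D v s w) × Q ℕ.* (K ℕ.* ∣ D v s w ∣) ℕ.≤ 2 ℕ.* ∣ N v s c W ∣
    far-half {v} {s} {c} {w} {W} {e} far eq h =
      trans (cong sg eq) (trans (sg-half (main v s w) e (sg≢0 (sg-main v s w) (D≢0 far)) h′) (sg-main v s w)) ,
      subst₂ (λ l r → l ℕ.≤ 2 ℕ.* ∣ r ∣) (∣main∣ v s w) (sym eq) (half-dom (main v s w) e h′)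
      where
      h′ : 2 ℕ.* ∣ e ∣ ℕ.≤ ∣ main v s w ∣
      h′ = subst (2 ℕ.* ∣ e ∣ ℕ.≤_) (sym (∣main∣ v s w)) h

    far-AP′ : ∀ {v s c w W} g → Far v s w → ∣ c ∣ ℕ.≤ M → ∣ g ∣ ℕ.≤ Q ℕ.* M →
      z′ W ≡ + Q ℤ.* z w → y′ W ≡ + Q ℤ.* (+ K ℤ.* y w) ℤ.+ g → Follows v s c (D v s w) W
    far-AP′ {v} {s} {c} {w} {W} g far c≤ g≤ ez ey = record
      { sign = proj₁ fh
      ; gapped = far-sep T M (ld v s) ∣ dz v w ∣ ∣ D v s w ∣ {l3 = 0} 1≤T 1≤M sp z≤n
          (ℕₚ.≤-trans (ℕₚ.≤-reflexive (cong (Q ℕ.*_) refl)) (proj₂ fh))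
          (ℕₚ.≤-trans (subst (λ Z → ∣ Z ℤ.- z′ (inj₂ (v , s)) ∣ ℕ.≤ Q ℕ.* ∣ dz v w ∣ ℕ.+ ld v s) (sym ez)
            (subst (λ i → ∣ i ∣ ℕ.≤ Q ℕ.* ∣ dz v w ∣ ℕ.+ ld v s) (sym (lem (+ Q) (z w) (z (inj₂ v)) (ℓ v s))) qd))
            (ℕₚ.≤-reflexive (sym (ℕₚ.+-identityʳ _))))
      }
      where
      sp : ld v s ℕ.+ ∣ dz v w ∣ ℕ.≤ ∣ D v s w ∣
      sp = sep v s w (proj₁ far) (proj₂ far)
      lem : ∀ Q zw zv l → Q ℤ.* zw ℤ.- (Q ℤ.* zv ℤ.+ l) ≡ Q ℤ.* (zw ℤ.- zv) ℤ.- l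
      lem = ℤR.solve-∀
      qd : ∣ + Q ℤ.* dz v w ℤ.- ℓ v s ∣ ℕ.≤ Q ℕ.* ∣ dz v w ∣ ℕ.+ ld v s
      qd = ∣-∣≤ (+ Q ℤ.* dz v w) (ℓ v s) (∣*∣≤ (+ Q) (dz v w) {Q} ℕₚ.≤-refl ℕₚ.≤-refl) ℕₚ.≤-refl
      e : ℤ
      e = ℓ v s ℤ.* g ℤ.- c ℤ.* (+ Q ℤ.* dz v w ℤ.- ℓ v s)
      e≤ : ∣ e ∣ ℕ.≤ ld v s ℕ.* ∣ g ∣ ℕ.+ ∣ c ∣ ℕ.* (Q ℕ.* ∣ dz v w ∣ ℕ.+ ld v s)
      e≤ = ∣-∣≤ (ℓ v s ℤ.* g) (c ℤ.* (+ Q ℤ.* dz v w ℤ.- ℓ v s))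
        (∣*∣≤ (ℓ v s) g ℕₚ.≤-refl ℕₚ.≤-refl) (∣*∣≤ c (+ Q ℤ.* dz v w ℤ.- ℓ v s) {∣ c ∣} ℕₚ.≤-refl qd)
      fh = far-half {v} {s} {c} {w} {W} {e} far
        (trans (cong₂ (λ Y Z → ℓ v s ℤ.* (Y ℤ.- y′ (inj₂ (v , s))) ℤ.- (+ K ℤ.* η v s ℤ.+ c) ℤ.* (Z ℤ.- z′ (inj₂ (v , s)))) ey ez)
          (N-AP v s c w g))
        (ℕₚ.≤-trans (2 ⊠ e≤) (far-AP T M (ld v s) ∣ dz v w ∣ ∣ D v s w ∣ 1≤T sp g≤ c≤))

    far-U : ∀ {v s c} u j → Far v s (inj₁ u) → ∣ c ∣ ℕ.≤ M → Follows v s c (D v s (inj₁ u)) (inj₁ (inj₁ (u , j)))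
    far-U u j far c≤ = far-AP′ ((+ Q ℤ.- 1ℤ) ℤ.* cU j) far c≤ (∣*∣≤ (+ Q ℤ.- 1ℤ) (cU j) ∣Q-1∣≤ (∣cU∣≤ j)) refl refl

    far-V : ∀ {v s c} v₃ k → Far v s (inj₂ v₃) → ∣ c ∣ ℕ.≤ M → Follows v s c (D v s (inj₂ v₃)) (inj₁ (inj₂ (inj₁ (v₃ , k))))
    far-V v₃ k far c≤ = far-AP′ (ℤ.- cV k) far c≤
      (subst (ℕ._≤ Q ℕ.* M) (sym (ℤₚ.∣-i∣≡∣i∣ (cV k))) (ℕₚ.≤-trans (∣cV∣≤ k) (ℕₚ.m≤n*m M Q {{ℕ.>-nonZero 1≤Q}}))) refl refl

    -- The length of an edge is controlled by the orientation of its bold end.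
    ℓ₃≤ : ∀ v s v₃ s₃ → v₃ ≢ v → ∣ ℓ v₃ s₃ ∣ ℕ.≤ (T ℕ.+ 1) ℕ.* ∣ D v s (inj₂ v₃) ∣ ℕ.+ ∣ dz v (inj₂ v₃) ∣
    ℓ₃≤ v s v₃ s₃ v₃≢v = ℕₚ.≤-trans
      (subst (λ i → ∣ i ∣ ℕ.≤ ∣ dz v u₃ ∣ ℕ.+ ∣ dz v (inj₂ v₃) ∣) (lem (z u₃) (z (inj₂ v₃)) (z (inj₂ v)))
        (∣a-b∣ (dz v u₃) (dz v (inj₂ v₃))))
      (ℕₚ.+-monoˡ-≤ _ d₃≤)
      where
      u₃ = inj₁ (π v₃ s₃)
      Dn = ∣ D v s (inj₂ v₃) ∣
      lem : ∀ a b c → (a ℤ.- c) ℤ.- (b ℤ.- c) ≡ a ℤ.- b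
      lem = ℤR.solve-∀
      D₃≤ : ∣ D v s u₃ ∣ ℕ.≤ (T ℕ.+ 1) ℕ.* Dn
      D₃≤ = ℕₚ.≤-trans (subst (λ i → ∣ i ∣ ℕ.≤ ∣ D v s u₃ ℤ.- D v s (inj₂ v₃) ∣ ℕ.+ Dn)
          (lem2 (D v s u₃) (D v s (inj₂ v₃))) (∣a+b∣ (D v s u₃ ℤ.- D v s (inj₂ v₃)) (D v s (inj₂ v₃))))
        (ℕₚ.≤-trans (ℕₚ.+-monoˡ-≤ Dn (seg v₃ s₃ v s v₃≢v)) (ℕₚ.≤-reflexive (lem3 T Dn)))
        where
        lem2 : ∀ a b → (a ℤ.- b) ℤ.+ b ≡ a
        lem2 = ℤR.solve-∀
        lem3 : ∀ T d → T ℕ.* d ℕ.+ d ≡ (T ℕ.+ 1) ℕ.* d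
        lem3 = ℕR.solve-∀
      d₃≤ : ∣ dz v u₃ ∣ ℕ.≤ (T ℕ.+ 1) ℕ.* Dn
      d₃≤ with u₃ ≟ inj₁ (π v s)
        where _≟_ = _≟ᵀ_ {U ⊕ V}
      ... | no ≢u = ℕₚ.≤-trans (ℕₚ.≤-trans (ℕₚ.m≤n+m _ _) (sep v s u₃ (λ ()) ≢u)) D₃≤
      ... | yes e = ℕₚ.≤-trans (ℕₚ.≤-reflexive (cong (λ w → ∣ dz v w ∣) e))
        (ℕₚ.≤-trans (ℕₚ.≤-trans (ℕₚ.m≤m+n (ld v s) _) (sep v s (inj₂ v₃) (v₃≢v ∘ ⊎ₚ.inj₂-injective) λ ()))
          (ℕₚ.m≤n*m Dn (T ℕ.+ 1) {{ℕ.>-nonZero (ℕₚ.m≤n+m 1 T)}}))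

    far-V-far : ∀ {v s v₃} → v₃ ≢ v → Far v s (inj₂ v₃)
    far-V-far h = h ∘ ⊎ₚ.inj₂-injective , λ ()

    -- The new bold points and, up to `O`, the mirror images of another cluster lie on the line of
    -- an old edge. There `seg` limits the change of the determinant to a quarter of the main term.
    module FarX (v : El V) (s : El S) (c : ℤ) (c≤ : ∣ c ∣ ℕ.≤ M) (v₃ : El V) (s₃ : El S) (v₃≢v : v₃ ≢ v) where
      Dn l3 d3 : ℕ
      Dn = ∣ D v s (inj₂ v₃) ∣
      l3 = ∣ ℓ v₃ s₃ ∣
      d3 = ∣ dz v (inj₂ v₃) ∣
      far : Far v s (inj₂ v₃)
      far = far-V-far v₃≢v
      sp : ld v s ℕ.+ d3 ℕ.≤ Dn
      sp = sep v s (inj₂ v₃) (proj₁ far) (proj₂ far)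
      X Y : ℤ
      X = + K ℤ.* (D v s (inj₁ (π v₃ s₃)) ℤ.- D v s (inj₂ v₃))
      Y = + Q ℤ.* dz v (inj₂ v₃) ℤ.- ℓ v s
      X≤ : ∣ X ∣ ℕ.≤ K ℕ.* (T ℕ.* Dn)
      X≤ = ∣*∣≤ (+ K) (D v s (inj₁ (π v₃ s₃)) ℤ.- D v s (inj₂ v₃)) {K} ℕₚ.≤-refl (seg v₃ s₃ v s v₃≢v)
      Y≤ : ∣ Y ∣ ℕ.≤ Q ℕ.* d3 ℕ.+ ld v s
      Y≤ = ∣-∣≤ (+ Q ℤ.* dz v (inj₂ v₃)) (ℓ v s) (∣*∣≤ (+ Q) (dz v (inj₂ v₃)) {Q} ℕₚ.≤-refl ℕₚ.≤-refl) ℕₚ.≤-refl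

      x : (Follows v s c (D v s (inj₂ v₃)) (inj₂ (v₃ , s₃))) ×
          Q ℕ.* (K ℕ.* Dn) ℕ.≤ 2 ℕ.* ∣ N v s c (inj₂ (v₃ , s₃)) ∣
      x = record
        { sign = proj₁ fh
        ; gapped = far-sep T M (ld v s) d3 Dn 1≤T 1≤M sp (ℓ₃≤ v s v₃ s₃ v₃≢v) (proj₂ fh)
            (subst (λ i → ∣ i ∣ ℕ.≤ Q ℕ.* d3 ℕ.+ ld v s ℕ.+ l3) (lem (+ Q) (z (inj₂ v₃)) (z (inj₂ v)) (ℓ v s) (ℓ v₃ s₃))
              (∣+∣≤ Y (ℓ v₃ s₃) Y≤ ℕₚ.≤-refl))
        } , proj₂ fh
        where
        lem : ∀ Q zw zv l l3 → (Q ℤ.* (zw ℤ.- zv) ℤ.- l) ℤ.+ l3 ≡ (Q ℤ.* zw ℤ.+ l3) ℤ.- (Q ℤ.* zv ℤ.+ l)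
        lem = ℤR.solve-∀
        e≤ : ∣ X ℤ.- c ℤ.* (Y ℤ.+ ℓ v₃ s₃) ∣ ℕ.≤ K ℕ.* (T ℕ.* Dn) ℕ.+ ld v s ℕ.* O ℕ.+ ∣ c ∣ ℕ.* (Q ℕ.* d3 ℕ.+ ld v s ℕ.+ l3)
        e≤ = ∣-∣≤ X (c ℤ.* (Y ℤ.+ ℓ v₃ s₃)) (ℕₚ.≤-trans X≤ (ℕₚ.m≤m+n _ _))
          (∣*∣≤ c (Y ℤ.+ ℓ v₃ s₃) {∣ c ∣} ℕₚ.≤-refl (∣+∣≤ Y (ℓ v₃ s₃) Y≤ ℕₚ.≤-refl))
        fh = far-half {W = inj₂ (v₃ , s₃)} far (N-x v s c v₃ s₃)
          (ℕₚ.≤-trans (2 ⊠ e≤) (far-X T M (ld v s) d3 Dn 1≤T sp c≤ (ℓ₃≤ v s v₃ s₃ v₃≢v)))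

      x′ : Follows v s c (D v s (inj₂ v₃)) (inj₁ (inj₂ (inj₂ (v₃ , s₃))))
      x′ = record
        { sign = proj₁ fh
        ; gapped = far-sep T M (ld v s) d3 Dn 1≤T 1≤M sp (ℓ₃≤ v s v₃ s₃ v₃≢v) (proj₂ fh)
            (subst (λ i → ∣ i ∣ ℕ.≤ Q ℕ.* d3 ℕ.+ ld v s ℕ.+ l3) (lem (+ Q) (z (inj₂ v₃)) (z (inj₂ v)) (ℓ v s) (ℓ v₃ s₃))
              (∣-∣≤ Y (ℓ v₃ s₃) Y≤ ℕₚ.≤-refl))
        }
        where
        lem : ∀ Q zw zv l l3 → (Q ℤ.* (zw ℤ.- zv) ℤ.- l) ℤ.- l3 ≡ (Q ℤ.* zw ℤ.- l3) ℤ.- (Q ℤ.* zv ℤ.+ l)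
        lem = ℤR.solve-∀
        e≤ : ∣ ℤ.- X ℤ.- ℓ v s ℤ.* + O ℤ.- c ℤ.* (Y ℤ.- ℓ v₃ s₃) ∣ ℕ.≤ K ℕ.* (T ℕ.* Dn) ℕ.+ ld v s ℕ.* O ℕ.+ ∣ c ∣ ℕ.* (Q ℕ.* d3 ℕ.+ ld v s ℕ.+ l3)
        e≤ = ∣-∣≤ (ℤ.- X ℤ.- ℓ v s ℤ.* + O) (c ℤ.* (Y ℤ.- ℓ v₃ s₃))
          (∣-∣≤ (ℤ.- X) (ℓ v s ℤ.* + O) (ℕₚ.≤-trans (ℕₚ.≤-reflexive (ℤₚ.∣-i∣≡∣i∣ X)) X≤) (∣*∣≤ (ℓ v s) (+ O) ℕₚ.≤-refl ℕₚ.≤-refl))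
          (∣*∣≤ c (Y ℤ.- ℓ v₃ s₃) {∣ c ∣} ℕₚ.≤-refl (∣-∣≤ Y (ℓ v₃ s₃) Y≤ ℕₚ.≤-refl))
        fh = far-half {W = inj₁ (inj₂ (inj₂ (v₃ , s₃)))} far (N-x′ v s c v₃ s₃)
          (ℕₚ.≤-trans (2 ⊠ e≤) (far-X T M (ld v s) d3 Dn 1≤T sp c≤ (ℓ₃≤ v s v₃ s₃ v₃≢v)))

    -- The other new bold points of the same cluster. Since the determinant at `v` itself is 0, the
    -- main term is `K` times the old determinant at `π v s₃`, and the mirror image receives the
    -- opposite sign. These pairs cancel in the balance.
    module Near (v : El V) (s : El S) (c : ℤ) (c≤ : ∣ c ∣ ℕ.≤ M) (s₃ : El S) (s₃≢s : s₃ ≢ s) where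
      u u₃ : El (U ⊕ V)
      u  = inj₁ (π v s)
      u₃ = inj₁ (π v s₃)
      Dn d3 : ℕ
      Dn = ∣ D v s u₃ ∣
      d3 = ∣ dz v u₃ ∣
      far : Far v s u₃
      far = (λ ()) , (s₃≢s ∘ π-inj v ∘ ⊎ₚ.inj₁-injective)
      sp : ld v s ℕ.+ d3 ℕ.≤ Dn
      sp = sep v s u₃ (proj₁ far) (proj₂ far)
      m : ℤ
      m = + K ℤ.* D v s u₃
      ∣m∣ : ∣ m ∣ ≡ K ℕ.* Dn
      ∣m∣ = ℤₚ.abs-* (+ K) (D v s u₃)
      sg-m : sg m ≡ sg (D v s u₃)
      sg-m = trans (sg-* (+ K) (D v s u₃)) (trans (cong (ℤ._* sg (D v s u₃)) (sg-+ 1≤K)) (ℤₚ.*-identityˡ _))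

      N≡ : N v s c (inj₂ (v , s₃)) ≡ m ℤ.+ ℤ.- (c ℤ.* (dz v u₃ ℤ.- ℓ v s))
      N≡ = lem (+ Q) (+ K) (z u) (z (inj₂ v)) (y u) (y (inj₂ v)) (z u₃) (y u₃) c
        where
        lem : ∀ Q K zu zv yu yv z3 y3 c →
          (zu ℤ.- zv) ℤ.* ((Q ℤ.* (K ℤ.* yv) ℤ.+ K ℤ.* (y3 ℤ.- yv)) ℤ.- (Q ℤ.* (K ℤ.* yv) ℤ.+ K ℤ.* (yu ℤ.- yv)))
            ℤ.- (K ℤ.* (yu ℤ.- yv) ℤ.+ c) ℤ.* ((Q ℤ.* zv ℤ.+ (z3 ℤ.- zv)) ℤ.- (Q ℤ.* zv ℤ.+ (zu ℤ.- zv)))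
          ≡ K ℤ.* ((zu ℤ.- zv) ℤ.* (y3 ℤ.- yv) ℤ.- (yu ℤ.- yv) ℤ.* (z3 ℤ.- zv))
            ℤ.+ ℤ.- (c ℤ.* ((z3 ℤ.- zv) ℤ.- (zu ℤ.- zv)))
        lem = ℤR.solve-∀

      e≤ : ∣ ℤ.- (c ℤ.* (dz v u₃ ℤ.- ℓ v s)) ∣ ℕ.≤ ∣ c ∣ ℕ.* (d3 ℕ.+ ld v s)
      e≤ = ℕₚ.≤-trans (ℕₚ.≤-reflexive (ℤₚ.∣-i∣≡∣i∣ (c ℤ.* (dz v u₃ ℤ.- ℓ v s))))
        (∣*∣≤ c (dz v u₃ ℤ.- ℓ v s) {∣ c ∣} ℕₚ.≤-refl (∣a-b∣ (dz v u₃) (ℓ v s)))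

      2e≤ : 2 ℕ.* ∣ ℤ.- (c ℤ.* (dz v u₃ ℤ.- ℓ v s)) ∣ ℕ.≤ ∣ m ∣
      2e≤ = subst (2 ℕ.* ∣ ℤ.- (c ℤ.* (dz v u₃ ℤ.- ℓ v s)) ∣ ℕ.≤_) (sym ∣m∣) (ℕₚ.≤-trans (2 ⊠ e≤) (near-x M (ld v s) d3 Dn sp c≤))

      half : K ℕ.* Dn ℕ.≤ 2 ℕ.* ∣ N v s c (inj₂ (v , s₃)) ∣
      half = subst₂ (λ l r → l ℕ.≤ 2 ℕ.* ∣ r ∣) ∣m∣ (sym N≡) (half-dom m (ℤ.- (c ℤ.* (dz v u₃ ℤ.- ℓ v s))) 2e≤)

      x : Follows v s c (D v s u₃) (inj₂ (v , s₃))
      x = record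
        { sign = trans (cong sg N≡) (trans (sg-half m (ℤ.- (c ℤ.* (dz v u₃ ℤ.- ℓ v s))) (sg≢0 sg-m (D≢0 far)) 2e≤) sg-m)
        ; gapped = near-sep M (ld v s) d3 Dn 1≤M sp half
            (subst (λ i → ∣ i ∣ ℕ.≤ d3 ℕ.+ ld v s) (lem (+ Q) (z (inj₂ v)) (dz v u₃) (ℓ v s)) (∣a-b∣ (dz v u₃) (ℓ v s)))
        }
        where
        lem : ∀ Q zv d l → d ℤ.- l ≡ (Q ℤ.* zv ℤ.+ d) ℤ.- (Q ℤ.* zv ℤ.+ l)
        lem = ℤR.solve-∀

      e′ : ℤ
      e′ = c ℤ.* (dz v u₃ ℤ.+ ℓ v s) ℤ.- ℓ v s ℤ.* + O

      N′≡ : N v s c (inj₁ (inj₂ (inj₂ (v , s₃)))) ≡ ℤ.- m ℤ.+ e′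
      N′≡ = lem (+ Q) (+ K) (z u) (z (inj₂ v)) (y u) (y (inj₂ v)) (z u₃) (y u₃) c (+ O)
        where
        lem : ∀ Q K zu zv yu yv z3 y3 c O →
          (zu ℤ.- zv) ℤ.* ((Q ℤ.* (K ℤ.* yv) ℤ.- K ℤ.* (y3 ℤ.- yv) ℤ.- O) ℤ.- (Q ℤ.* (K ℤ.* yv) ℤ.+ K ℤ.* (yu ℤ.- yv)))
            ℤ.- (K ℤ.* (yu ℤ.- yv) ℤ.+ c) ℤ.* ((Q ℤ.* zv ℤ.- (z3 ℤ.- zv)) ℤ.- (Q ℤ.* zv ℤ.+ (zu ℤ.- zv)))
          ≡ ℤ.- (K ℤ.* ((zu ℤ.- zv) ℤ.* (y3 ℤ.- yv) ℤ.- (yu ℤ.- yv) ℤ.* (z3 ℤ.- zv)))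
            ℤ.+ (c ℤ.* ((z3 ℤ.- zv) ℤ.+ (zu ℤ.- zv)) ℤ.- (zu ℤ.- zv) ℤ.* O)
        lem = ℤR.solve-∀

      e′≤ : ∣ e′ ∣ ℕ.≤ ld v s ℕ.* O ℕ.+ ∣ c ∣ ℕ.* (d3 ℕ.+ ld v s)
      e′≤ = ℕₚ.≤-trans (∣-∣≤ (c ℤ.* (dz v u₃ ℤ.+ ℓ v s)) (ℓ v s ℤ.* + O)
        (∣*∣≤ c (dz v u₃ ℤ.+ ℓ v s) {∣ c ∣} ℕₚ.≤-refl (∣a+b∣ (dz v u₃) (ℓ v s)))
        (∣*∣≤ (ℓ v s) (+ O) ℕₚ.≤-refl ℕₚ.≤-refl)) (ℕₚ.≤-reflexive (ℕₚ.+-comm (∣ c ∣ ℕ.* (d3 ℕ.+ ld v s)) _))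

      ∣-m∣ : ∣ ℤ.- m ∣ ≡ K ℕ.* Dn
      ∣-m∣ = trans (ℤₚ.∣-i∣≡∣i∣ m) ∣m∣

      2e′≤ : 2 ℕ.* ∣ e′ ∣ ℕ.≤ ∣ ℤ.- m ∣
      2e′≤ = subst (2 ℕ.* ∣ e′ ∣ ℕ.≤_) (sym ∣-m∣) (ℕₚ.≤-trans (2 ⊠ e′≤) (near-x′ M (ld v s) d3 Dn sp c≤))

      sg-m′ : sg (ℤ.- m) ≡ sg (ℤ.- D v s u₃)
      sg-m′ = trans (sg-neg m) (trans (cong ℤ.-_ sg-m) (sym (sg-neg (D v s u₃))))

      x′ : Follows v s c (ℤ.- D v s u₃) (inj₁ (inj₂ (inj₂ (v , s₃))))
      x′ = record
        { sign = trans (cong sg N′≡) (trans (sg-half (ℤ.- m) e′ (λ e → sg≢0 sg-m (D≢0 far) (ℤₚ.neg-injective e)) 2e′≤) sg-m′)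
        ; gapped = near-sep M (ld v s) d3 Dn 1≤M sp
            (subst₂ (λ l r → l ℕ.≤ 2 ℕ.* ∣ r ∣) ∣-m∣ (sym N′≡) (half-dom (ℤ.- m) e′ 2e′≤))
            (subst (λ i → i ℕ.≤ d3 ℕ.+ ld v s) (trans (sym (ℤₚ.∣-i∣≡∣i∣ (dz v u₃ ℤ.+ ℓ v s)))
              (cong ∣_∣ (lem (+ Q) (z (inj₂ v)) (dz v u₃) (ℓ v s)))) (∣a+b∣ (dz v u₃) (ℓ v s)))
        }
        where
        lem : ∀ Q zv d l → ℤ.- (d ℤ.+ l) ≡ (Q ℤ.* zv ℤ.- d) ℤ.- (Q ℤ.* zv ℤ.+ l)
        lem = ℤR.solve-∀

    -- Here and in the three identities that follow no error term occurs: at the two columns of its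
    -- own edge the determinant measures the difference between the column offset and `c`, at its
    -- own mirror image that between `O` and `2 * c`.
    own-U : ∀ v s c j → N v s c (inj₁ (inj₁ (π v s , j))) ≡ ℓ v s ℤ.* ((+ Q ℤ.- 1ℤ) ℤ.* (cU j ℤ.- c))
    own-U v s c j = lem (+ Q) (+ K) (z (inj₁ (π v s))) (z (inj₂ v)) (y (inj₁ (π v s))) (y (inj₂ v)) (cU j) c
      where
      lem : ∀ Q K zu zv yu yv g c →
        (zu ℤ.- zv) ℤ.* ((Q ℤ.* (K ℤ.* yu) ℤ.+ (Q ℤ.- 1ℤ) ℤ.* g) ℤ.- (Q ℤ.* (K ℤ.* yv) ℤ.+ K ℤ.* (yu ℤ.- yv)))
          ℤ.- (K ℤ.* (yu ℤ.- yv) ℤ.+ c) ℤ.* (Q ℤ.* zu ℤ.- (Q ℤ.* zv ℤ.+ (zu ℤ.- zv)))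
        ≡ (zu ℤ.- zv) ℤ.* ((Q ℤ.- 1ℤ) ℤ.* (g ℤ.- c))
      lem = ℤR.solve-∀

    own-V : ∀ v s c k → N v s c (inj₁ (inj₂ (inj₁ (v , k)))) ≡ ℓ v s ℤ.* ℤ.- (cV k ℤ.- c)
    own-V v s c k = lem (+ Q) (+ K) (z (inj₁ (π v s))) (z (inj₂ v)) (y (inj₁ (π v s))) (y (inj₂ v)) (cV k) c
      where
      lem : ∀ Q K zu zv yu yv g c →
        (zu ℤ.- zv) ℤ.* ((Q ℤ.* (K ℤ.* yv) ℤ.- g) ℤ.- (Q ℤ.* (K ℤ.* yv) ℤ.+ K ℤ.* (yu ℤ.- yv)))
          ℤ.- (K ℤ.* (yu ℤ.- yv) ℤ.+ c) ℤ.* (Q ℤ.* zv ℤ.- (Q ℤ.* zv ℤ.+ (zu ℤ.- zv)))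
        ≡ (zu ℤ.- zv) ℤ.* ℤ.- (g ℤ.- c)
      lem = ℤR.solve-∀

    own-x : ∀ v s c → N v s c (inj₂ (v , s)) ≡ 0ℤ
    own-x v s c = lem (ℓ v s) (y′ (inj₂ (v , s))) (+ K ℤ.* η v s ℤ.+ c) (z′ (inj₂ (v , s)))
      where
      lem : ∀ a b c d → a ℤ.* (b ℤ.- b) ℤ.- c ℤ.* (d ℤ.- d) ≡ 0ℤ
      lem = ℤR.solve-∀

    own-x′ : ∀ v s c → N v s c (inj₁ (inj₂ (inj₂ (v , s)))) ≡ ℓ v s ℤ.* (ℤ.- + O ℤ.+ + 2 ℤ.* c)
    own-x′ v s c = lem (+ Q) (+ K) (z (inj₁ (π v s))) (z (inj₂ v)) (y (inj₁ (π v s))) (y (inj₂ v)) (+ O) c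
      where
      lem : ∀ Q K zu zv yu yv O c →
        (zu ℤ.- zv) ℤ.* ((Q ℤ.* (K ℤ.* yv) ℤ.- K ℤ.* (yu ℤ.- yv) ℤ.- O) ℤ.- (Q ℤ.* (K ℤ.* yv) ℤ.+ K ℤ.* (yu ℤ.- yv)))
          ℤ.- (K ℤ.* (yu ℤ.- yv) ℤ.+ c) ℤ.* ((Q ℤ.* zv ℤ.- (zu ℤ.- zv)) ℤ.- (Q ℤ.* zv ℤ.+ (zu ℤ.- zv)))
        ≡ (zu ℤ.- zv) ℤ.* (ℤ.- O ℤ.+ + 2 ℤ.* c)
      lem = ℤR.solve-∀

    ∣2c∣≤ : ∀ {c} → ∣ c ∣ ℕ.≤ M → ∣ + 2 ℤ.* c ∣ ℕ.≤ 2 ℕ.* M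
    ∣2c∣≤ {c} h = ∣*∣≤ (+ 2) c {2} ℕₚ.≤-refl h

    ∣-O∣ : ∣ ℤ.- + O ∣ ≡ O
    ∣-O∣ = ℤₚ.∣-i∣≡∣i∣ (+ O)

    sg-x′ : ∀ {c} → ∣ c ∣ ℕ.≤ M → sg (ℤ.- + O ℤ.+ + 2 ℤ.* c) ≡ -1ℤ
    sg-x′ {c} h = trans (sg-dom (ℤ.- + O) (+ 2 ℤ.* c) (subst (∣ + 2 ℤ.* c ∣ ℕ.<_) (sym ∣-O∣)
        (ℕₚ.≤-<-trans (∣2c∣≤ {c} h) (ℕₚ.*-monoˡ-< M {{ℕ.>-nonZero 1≤M}} {2} {3} ℕₚ.≤-refl))))
      (trans (sg-neg (+ O)) (cong ℤ.-_ (sg-+ (ℕₚ.≤-trans 1≤M (ℕₚ.m≤n*m M 3)))))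

    3≤∣x′∣ : ∀ {c} → ∣ c ∣ ℕ.≤ M → 3 ℕ.≤ ∣ ℤ.- + O ℤ.+ + 2 ℤ.* c ∣
    3≤∣x′∣ {c} h = ℕₚ.≤-trans 3≤M (by-cert 0 (ℕₚ.≤-trans (subst (ℕ._≤ ∣ ℤ.- + O ℤ.+ + 2 ℤ.* c ∣ ℕ.+ ∣ + 2 ℤ.* c ∣) ∣-O∣ (∣sub∣ (ℤ.- + O) (+ 2 ℤ.* c)))
        (ℕₚ.+-monoʳ-≤ _ (∣2c∣≤ {c} h))) (lem M ∣ ℤ.- + O ℤ.+ + 2 ℤ.* c ∣))
      where
      lem : ∀ M x → M ℕ.+ (x ℕ.+ 2 ℕ.* M) ℕ.+ 0 ≡ x ℕ.+ 3 ℕ.* M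
      lem = ℕR.solve-∀

    split-gap : ∀ (t : ℕ) (k : ℕ) j → gap j t ℤ.- + 4 ℤ.* + k ≡ gap j (t ℕ.+ k)
    split-gap t k j = lem (+ t) (+ k) (+ j)
      where
      lem : ∀ t k j → + 4 ℤ.* (j ℤ.- t) ℤ.- + 4 ℤ.* k ≡ + 4 ℤ.* (j ℤ.- (t ℤ.+ k))
      lem = ℤR.solve-∀

    cU-c₁ : ∀ j k → cU j ℤ.- cS (inj₁ k) ≡ gap (toℕ j) (Δ ℕ.+ toℕ k)
    cU-c₁ j k = split-gap Δ (toℕ k) (toℕ j)

    cU-c₂ : ∀ j k → cU j ℤ.- cS (inj₂ k) ≡ gap (toℕ j) (Δ ℕ.+ toℕ k) ℤ.+ + 2
    cU-c₂ j k = trans (lem (cU j) (+ 4 ℤ.* + toℕ k)) (cong (ℤ._+ + 2) (cU-c₁ j k))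
      where
      lem : ∀ a b → a ℤ.- (b ℤ.- + 2) ≡ a ℤ.- b ℤ.+ + 2
      lem = ℤR.solve-∀

    cV-c₁ : ∀ j k → cV j ℤ.- cS (inj₁ k) ≡ gap (toℕ j) (suc (toℕ k)) ℤ.+ + 2
    cV-c₁ j k = lem (+ toℕ j) (+ toℕ k)
      where
      lem : ∀ j k → + 4 ℤ.* j ℤ.- + 2 ℤ.- + 4 ℤ.* k ≡ + 4 ℤ.* (j ℤ.- (1ℤ ℤ.+ k)) ℤ.+ + 2
      lem = ℤR.solve-∀

    cV-c₂ : ∀ j k → cV j ℤ.- cS (inj₂ k) ≡ gap (toℕ j) (toℕ k)
    cV-c₂ j k = lem (+ toℕ j) (+ toℕ k)
      where
      lem : ∀ j k → + 4 ℤ.* j ℤ.- + 2 ℤ.- (+ 4 ℤ.* k ℤ.- + 2) ≡ + 4 ℤ.* (j ℤ.- k)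
      lem = ℤR.solve-∀

    cU-c≥2 : ∀ v s t j → inj₁ (inj₁ (π v s , j)) ≢ inj₁ {B = El V′} (π′ (v , s) t) → 2 ℕ.≤ ∣ cU j ℤ.- cS t ∣
    cU-c≥2 v s (inj₁ k) j h = subst (λ i → 2 ℕ.≤ ∣ i ∣) (sym (cU-c₁ j k)) (gap≥2 λ e →
      h (cong (λ i → inj₁ (inj₁ (π v s , i))) (Finₚ.toℕ-injective (trans e (sym (toℕ-mid k))))))
    cU-c≥2 v s (inj₂ k) j h = subst (λ i → 2 ℕ.≤ ∣ i ∣) (sym (cU-c₂ j k)) (4x+2≥2 (+ toℕ j ℤ.- + (Δ ℕ.+ toℕ k)))

    cV-c≥2 : ∀ v s t j → inj₁ (inj₂ (inj₁ (v , j))) ≢ inj₁ {B = El V′} (π′ (v , s) t) → 2 ℕ.≤ ∣ cV j ℤ.- cS t ∣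
    cV-c≥2 v s (inj₁ k) j h = subst (λ i → 2 ℕ.≤ ∣ i ∣) (sym (cV-c₁ j k)) (4x+2≥2 (+ toℕ j ℤ.- + suc (toℕ k)))
    cV-c≥2 v s (inj₂ k) j h = subst (λ i → 2 ℕ.≤ ∣ i ∣) (sym (cV-c₂ j k)) (gap≥2 λ e →
      h (cong (λ i → inj₁ (inj₂ (inj₁ (v , i)))) (Finₚ.toℕ-injective e)))

    SU SV : El S′ → ℤ
    SU t = ∑F λ j → sg (cU j ℤ.- cS t)
    SV t = ∑F λ j → sg (cV j ℤ.- cS t)

    -- Turning a line about the new bold point loses on the far column what it gains on the near
    -- one, so the difference does not depend on the direction. Its value 1 is compensated by the
    -- mirror image of the point.
    SU-SV : ∀ t → SU t ℤ.- SV t ≡ 1ℤ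
    SU-SV (inj₁ k) = trans (cong₂ ℤ._-_
        (trans (∑F-cong λ j → cong sg (cU-c₁ j k)) (∑sg-gap A (Δ ℕ.+ toℕ k) (ℕₚ.+-monoʳ-< Δ (ℕₚ.<-≤-trans (Finₚ.toℕ<n k) (ℕₚ.m≤m+n a Δ)))))
        (trans (∑F-cong λ j → cong sg (cV-c₁ j k)) (∑sg-gap+2 a (suc (toℕ k)) (Finₚ.toℕ<n k))))
      (lem (+ Δ) (+ a) (+ toℕ k))
      where
      lem : ∀ d a k → (d ℤ.+ (a ℤ.+ d)) ℤ.- 1ℤ ℤ.- + 2 ℤ.* (d ℤ.+ k) ℤ.- (a ℤ.- + 2 ℤ.* (1ℤ ℤ.+ k)) ≡ 1ℤ
      lem = ℤR.solve-∀
    SU-SV (inj₂ k) = trans (cong₂ ℤ._-_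
        (trans (∑F-cong λ j → cong sg (cU-c₂ j k)) (∑sg-gap+2 A (Δ ℕ.+ toℕ k) (ℕₚ.+-monoʳ-≤ Δ (ℕₚ.<⇒≤ (ℕₚ.<-≤-trans (Finₚ.toℕ<n k) (ℕₚ.m≤m+n a Δ))))))
        (trans (∑F-cong λ j → cong sg (cV-c₂ j k)) (∑sg-gap a (toℕ k) (Finₚ.toℕ<n k))))
      (lem (+ Δ) (+ a) (+ toℕ k))
      where
      lem : ∀ d a k → (d ℤ.+ (a ℤ.+ d)) ℤ.- + 2 ℤ.* (d ℤ.+ k) ℤ.- (a ℤ.- 1ℤ ℤ.- + 2 ℤ.* k) ≡ 1ℤ
      lem = ℤR.solve-∀

    _≟V_ = _≟ᵀ_ {V}
    _≟U_ = _≟ᵀ_ {U}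
    _≟S_ = _≟ᵀ_ {S}

    gapped-by : ∀ {v s c W Z X} → N v s c W ≡ ℓ v s ℤ.* X → z′ W ℤ.- z′ (inj₂ (v , s)) ≡ Z →
      ld v s ℕ.+ ∣ Z ∣ ℕ.≤ ld v s ℕ.* ∣ X ∣ → ld v s ℕ.+ ∣ z′ W ℤ.- z′ (inj₂ (v , s)) ∣ ℕ.≤ ∣ N v s c W ∣
    gapped-by {v} {s} {X = X} eN eZ h = subst₂ (λ Z n → ld v s ℕ.+ ∣ Z ∣ ℕ.≤ n) (sym eZ)
      (sym (trans (cong ∣_∣ eN) (ℤₚ.abs-* (ℓ v s) X))) h

    gapped-all : ∀ v s t W → W ≢ inj₂ (v , s) → W ≢ inj₁ (π′ (v , s) t) →
      ld v s ℕ.+ ∣ z′ W ℤ.- z′ (inj₂ (v , s)) ∣ ℕ.≤ ∣ N v s (cS t) W ∣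
    gapped-all v s t (inj₁ (inj₁ (u , j))) _ W≢ with u ≟U π v s
    ... | no  u≢ = gapped (far-U {v} {s} {cS t} u j ((λ ()) , u≢ ∘ ⊎ₚ.inj₁-injective) (∣cS∣≤ t))
    ... | yes refl = gapped-by {v} {s} {cS t} {inj₁ (inj₁ (u , j))} (own-U v s (cS t) j) (lem (+ Q) (z (inj₁ (π v s))) (z (inj₂ v)))
        (subst₂ (λ a b → ld v s ℕ.+ a ℕ.≤ ld v s ℕ.* b) (sym (ℤₚ.abs-* (+ Q ℤ.- 1ℤ) (ℓ v s))) (sym (ℤₚ.abs-* (+ Q ℤ.- 1ℤ) (cU j ℤ.- cS t)))
          (ℕₚ.≤-trans (by-cert 0 (ld v s ⊠ 1≤∣Q-1∣) (lem2 (ld v s) ∣ + Q ℤ.- 1ℤ ∣))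
            (ℕₚ.*-monoʳ-≤ (ld v s) (ℕₚ.*-monoʳ-≤ ∣ + Q ℤ.- 1ℤ ∣ (cU-c≥2 v s t j W≢)))))
      where
      lem : ∀ Q zu zv → Q ℤ.* zu ℤ.- (Q ℤ.* zv ℤ.+ (zu ℤ.- zv)) ≡ (Q ℤ.- 1ℤ) ℤ.* (zu ℤ.- zv)
      lem = ℤR.solve-∀
      lem2 : ∀ l q → l ℕ.+ q ℕ.* l ℕ.+ l ℕ.* q ℕ.+ 0 ≡ l ℕ.* (q ℕ.* 2) ℕ.+ l ℕ.* 1
      lem2 = ℕR.solve-∀
    gapped-all v s t (inj₁ (inj₂ (inj₁ (v₃ , k)))) _ W≢ with v₃ ≟V v
    ... | no  v₃≢ = gapped (far-V {v} {s} {cS t} v₃ k (far-V-far v₃≢) (∣cS∣≤ t))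
    ... | yes refl = gapped-by {v} {s} {cS t} {inj₁ (inj₂ (inj₁ (v , k)))} (own-V v s (cS t) k) (lem (+ Q) (z (inj₂ v)) (ℓ v s))
        (subst₂ (λ a b → ld v s ℕ.+ a ℕ.≤ ld v s ℕ.* b) (sym (ℤₚ.∣-i∣≡∣i∣ (ℓ v s))) (sym (ℤₚ.∣-i∣≡∣i∣ (cV k ℤ.- cS t)))
          (ℕₚ.≤-trans (ℕₚ.≤-reflexive (lem2 (ld v s))) (ℕₚ.*-monoʳ-≤ (ld v s) (cV-c≥2 v s t k W≢))))
      where
      lem : ∀ Q zv l → Q ℤ.* zv ℤ.- (Q ℤ.* zv ℤ.+ l) ≡ ℤ.- l
      lem = ℤR.solve-∀
      lem2 : ∀ l → l ℕ.+ l ≡ l ℕ.* 2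
      lem2 = ℕR.solve-∀
    gapped-all v s t (inj₁ (inj₂ (inj₂ (v₃ , s₃)))) _ _ with v₃ ≟V v
    ... | no  v₃≢ = gapped (FarX.x′ v s (cS t) (∣cS∣≤ t) v₃ s₃ v₃≢)
    ... | yes refl with s₃ ≟S s
    ...   | no  s₃≢ = gapped (Near.x′ v s (cS t) (∣cS∣≤ t) s₃ s₃≢)
    ...   | yes refl = gapped-by {v} {s} {cS t} {inj₁ (inj₂ (inj₂ (v , s)))} (own-x′ v s (cS t)) (lem (+ Q) (z (inj₂ v)) (ℓ v s))
        (ℕₚ.≤-trans (ℕₚ.+-monoʳ-≤ (ld v s) (∣-∣≤ (ℤ.- ℓ v s) (ℓ v s) (ℕₚ.≤-reflexive (ℤₚ.∣-i∣≡∣i∣ (ℓ v s))) ℕₚ.≤-refl))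
          (ℕₚ.≤-trans (ℕₚ.≤-reflexive (lem2 (ld v s))) (ℕₚ.*-monoʳ-≤ (ld v s) (3≤∣x′∣ (∣cS∣≤ t)))))
      where
      lem : ∀ Q zv l → (Q ℤ.* zv ℤ.- l) ℤ.- (Q ℤ.* zv ℤ.+ l) ≡ ℤ.- l ℤ.- l
      lem = ℤR.solve-∀
      lem2 : ∀ l → l ℕ.+ (l ℕ.+ l) ≡ l ℕ.* 3
      lem2 = ℕR.solve-∀
    gapped-all v s t (inj₂ (v₃ , s₃)) W≢ _ with v₃ ≟V v
    ... | no  v₃≢ = gapped (proj₁ (FarX.x v s (cS t) (∣cS∣≤ t) v₃ s₃ v₃≢))
    ... | yes refl with s₃ ≟S s
    ...   | no  s₃≢ = gapped (Near.x v s (cS t) (∣cS∣≤ t) s₃ s₃≢)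
    ...   | yes refl = contradiction refl W≢

    sep′ : ∀ x t W → W ≢ inj₂ x → W ≢ inj₁ (π′ x t) →
      ∣ New.ℓ x t ∣ ℕ.+ ∣ z′ W ℤ.- z′ (inj₂ x) ∣ ℕ.≤ ∣ New.D x t W ∣
    sep′ (v , s) t W p q = begin
      ∣ New.ℓ (v , s) t ∣ ℕ.+ Z              ≡⟨ cong (ℕ._+ Z) (trans (cong ∣_∣ (ℓ′≡ v s t)) (ℤₚ.abs-* (lam t) (ℓ v s))) ⟩
      ∣ lam t ∣ ℕ.* ld v s ℕ.+ Z             ≤⟨ ℕₚ.+-monoʳ-≤ (∣ lam t ∣ ℕ.* ld v s) (ℕₚ.m≤n*m Z ∣ lam t ∣ {{ℕ.>-nonZero (1≤∣lam∣ t)}}) ⟩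
      ∣ lam t ∣ ℕ.* ld v s ℕ.+ ∣ lam t ∣ ℕ.* Z ≡⟨ ℕₚ.*-distribˡ-+ ∣ lam t ∣ (ld v s) Z ⟨
      ∣ lam t ∣ ℕ.* (ld v s ℕ.+ Z)           ≤⟨ ℕₚ.*-monoʳ-≤ ∣ lam t ∣ (gapped-all v s t W p q) ⟩
      ∣ lam t ∣ ℕ.* ∣ N v s (cS t) W ∣       ≡⟨ trans (cong ∣_∣ (D′≡ v s t W)) (ℤₚ.abs-* (lam t) (N v s (cS t) W)) ⟨
      ∣ New.D (v , s) t W ∣                  ∎
      where
      open ℕₚ.≤-Reasoning
      Z = ∣ z′ W ℤ.- z′ (inj₂ (v , s)) ∣

    D-plain : ∀ v s → D v s (inj₁ (π v s)) ≡ 0ℤ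
    D-plain v s = lem (ℓ v s) (η v s)
      where
      lem : ∀ a b → a ℤ.* b ℤ.- b ℤ.* a ≡ 0ℤ
      lem = ℤR.solve-∀

    D-bold : ∀ v s → D v s (inj₂ v) ≡ 0ℤ
    D-bold v s = lem (ℓ v s) (η v s) (y (inj₂ v)) (z (inj₂ v))
      where
      lem : ∀ a b c d → a ℤ.* (c ℤ.- c) ℤ.- b ℤ.* (d ℤ.- d) ≡ 0ℤ
      lem = ℤR.solve-∀

    module Balance (v : El V) (s : El S) (t : El S′) where
      c σ : ℤ
      c = cS t
      σ = sg (ℓ v s)
      sN : El (U′ ⊕ V′) → ℤ
      sN W = sg (N v s c W)
      sD : El (U ⊕ V) → ℤ
      sD = sg ∘ D v s

      overU : El U → ℤ
      overU u = ∑F λ j → sN (inj₁ (inj₁ (u , j)))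
      overV₁ overV₂ overV : El V → ℤ
      overV₁ v₃ = ∑F λ k → sN (inj₁ (inj₂ (inj₁ (v₃ , k))))
      overV₂ v₃ = ∑ᵀ S λ s₃ → sN (inj₁ (inj₂ (inj₂ (v₃ , s₃)))) ℤ.+ sN (inj₂ (v₃ , s₃))
      overV v₃ = overV₁ v₃ ℤ.+ overV₂ v₃

      overU-far : ∀ u → u ≢ π v s → overU u ≡ + A ℤ.* sD (inj₁ u)
      overU-far u u≢ = trans (∑F-cong λ j → sign (far-U {v} {s} {c} u j ((λ ()) , u≢ ∘ ⊎ₚ.inj₁-injective) (∣cS∣≤ t)))
        (∑F-const A (sD (inj₁ u)))

      overU-own : overU (π v s) ≡ σ ℤ.* SU t
      overU-own = trans (∑F-cong λ j → trans (cong sg (own-U v s c j)) (trans (sg-* (ℓ v s) _) (cong (σ ℤ.*_)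
        (trans (sg-* (+ Q ℤ.- 1ℤ) (cU j ℤ.- c)) (trans (cong (ℤ._* sg (cU j ℤ.- c)) sg-Q-1) (ℤₚ.*-identityˡ _))))))
        (∑F-* σ (λ j → sg (cU j ℤ.- c)))

      overV-far : ∀ v₃ → v₃ ≢ v → overV v₃ ≡ + A ℤ.* sD (inj₂ v₃)
      overV-far v₃ v₃≢ = trans (cong₂ ℤ._+_
          (trans (∑F-cong λ k → sign (far-V {v} {s} {c} v₃ k (far-V-far v₃≢) (∣cS∣≤ t))) (∑F-const a (sD (inj₂ v₃))))
          (trans (∑ᵀ-cong S λ s₃ → cong₂ ℤ._+_ (sign (FarX.x′ v s c (∣cS∣≤ t) v₃ s₃ v₃≢)) (sign (proj₁ (FarX.x v s c (∣cS∣≤ t) v₃ s₃ v₃≢))))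
            (trans (∑ᵀ-const S (sD (inj₂ v₃) ℤ.+ sD (inj₂ v₃))) (cong (λ n → + n ℤ.* (sD (inj₂ v₃) ℤ.+ sD (inj₂ v₃))) size-S))))
        (lem (+ Δ) (+ a) (sD (inj₂ v₃)))
        where
        lem : ∀ d a x → a ℤ.* x ℤ.+ d ℤ.* (x ℤ.+ x) ≡ (d ℤ.+ (a ℤ.+ d)) ℤ.* x
        lem = ℤR.solve-∀

      overV₂-near : ∀ s₃ → s₃ ≢ s → sN (inj₁ (inj₂ (inj₂ (v , s₃)))) ℤ.+ sN (inj₂ (v , s₃)) ≡ 0ℤ
      overV₂-near s₃ s₃≢ = trans (cong₂ ℤ._+_
        (trans (sign (Near.x′ v s c (∣cS∣≤ t) s₃ s₃≢)) (sg-neg (D v s (inj₁ (π v s₃))))) (sign (Near.x v s c (∣cS∣≤ t) s₃ s₃≢)))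
        (ℤₚ.+-inverseˡ (sD (inj₁ (π v s₃))))

      overV-own : overV v ≡ σ ℤ.* ℤ.- SV t ℤ.+ σ ℤ.* -1ℤ
      overV-own = cong₂ ℤ._+_
        (trans (∑F-cong λ k → trans (cong sg (own-V v s c k)) (trans (sg-* (ℓ v s) (ℤ.- (cV k ℤ.- c)))
            (cong (σ ℤ.*_) (trans (sg-neg (cV k ℤ.- c)) (sym (ℤₚ.-1*i≡-i (sg (cV k ℤ.- c))))))))
          (trans (∑F-* σ (λ k → -1ℤ ℤ.* sg (cV k ℤ.- c))) (cong (σ ℤ.*_) (trans (∑F-* -1ℤ (λ k → sg (cV k ℤ.- c))) (ℤₚ.-1*i≡-i (SV t))))))
        (trans (∑ᵀ-single S s overV₂-near) (trans (cong₂ ℤ._+_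
          (trans (cong sg (own-x′ v s c)) (trans (sg-* (ℓ v s) _) (cong (σ ℤ.*_) (sg-x′ (∣cS∣≤ t)))))
          (cong sg (own-x v s c))) (ℤₚ.+-identityʳ (σ ℤ.* -1ℤ))))

      total : ∑ᵀ (U′ ⊕ V′) sN ≡ 0ℤ
      total = begin
        (∑ᵀ U overU ℤ.+ (∑ᵀ V overV₁ ℤ.+ ∑ᵀ V (λ v₃ → ∑ᵀ S λ s₃ → sN (inj₁ (inj₂ (inj₂ (v₃ , s₃)))))))
          ℤ.+ ∑ᵀ V (λ v₃ → ∑ᵀ S λ s₃ → sN (inj₂ (v₃ , s₃)))
          ≡⟨ assoc (∑ᵀ U overU) (∑ᵀ V overV₁) _ _ ⟩
        ∑ᵀ U overU ℤ.+ (∑ᵀ V overV₁ ℤ.+ (∑ᵀ V (λ v₃ → ∑ᵀ S λ s₃ → sN (inj₁ (inj₂ (inj₂ (v₃ , s₃)))))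
          ℤ.+ ∑ᵀ V (λ v₃ → ∑ᵀ S λ s₃ → sN (inj₂ (v₃ , s₃)))))
          ≡⟨ cong (λ r → ∑ᵀ U overU ℤ.+ (∑ᵀ V overV₁ ℤ.+ r)) (trans (sym (∑ᵀ-+ V _ _))
               (∑ᵀ-cong V λ v₃ → sym (∑ᵀ-+ S (λ s₃ → sN (inj₁ (inj₂ (inj₂ (v₃ , s₃))))) (λ s₃ → sN (inj₂ (v₃ , s₃)))))) ⟩
        ∑ᵀ U overU ℤ.+ (∑ᵀ V overV₁ ℤ.+ ∑ᵀ V overV₂)
          ≡⟨ cong (λ r → ∑ᵀ U overU ℤ.+ r) (∑ᵀ-+ V overV₁ overV₂) ⟨
        ∑ᵀ U overU ℤ.+ ∑ᵀ V overV
          -- All clusters except those at the two ends of the old edge count `A` times the old sign.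
          -- The ends have old sign 0, and their exact sums are inserted instead.
          ≡⟨ cong₂ ℤ._+_ (trans (∑ᵀ-change U (π v s) overU-far) (cong₂ ℤ._+_ (∑ᵀ-* U (+ A) (sD ∘ inj₁))
               (cong₂ ℤ._-_ overU-own (cong (λ d → + A ℤ.* sg d) (D-plain v s)))))
             (trans (∑ᵀ-change V v overV-far) (cong₂ ℤ._+_ (∑ᵀ-* V (+ A) (sD ∘ inj₂))
               (cong₂ ℤ._-_ overV-own (cong (λ d → + A ℤ.* sg d) (D-bold v s))))) ⟩
        (+ A ℤ.* ∑ᵀ U (sD ∘ inj₁) ℤ.+ (σ ℤ.* SU t ℤ.- + A ℤ.* 0ℤ)) ℤ.+
          (+ A ℤ.* ∑ᵀ V (sD ∘ inj₂) ℤ.+ ((σ ℤ.* ℤ.- SV t ℤ.+ σ ℤ.* -1ℤ) ℤ.- + A ℤ.* 0ℤ))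
          ≡⟨ regroup (+ A) (∑ᵀ U (sD ∘ inj₁)) (∑ᵀ V (sD ∘ inj₂)) σ (SU t) (SV t) ⟩
        + A ℤ.* ∑ᵀ (U ⊕ V) sD ℤ.+ σ ℤ.* ((SU t ℤ.- SV t) ℤ.- 1ℤ)
          ≡⟨ cong₂ (λ x y → + A ℤ.* x ℤ.+ σ ℤ.* (y ℤ.- 1ℤ)) (bal v s) (SU-SV t) ⟩
        + A ℤ.* 0ℤ ℤ.+ σ ℤ.* 0ℤ
          ≡⟨ cong₂ ℤ._+_ (ℤₚ.*-zeroʳ (+ A)) (ℤₚ.*-zeroʳ σ) ⟩
        0ℤ ∎
        where
        open ≡-Reasoning
        assoc : ∀ a b c d → (a ℤ.+ (b ℤ.+ c)) ℤ.+ d ≡ a ℤ.+ (b ℤ.+ (c ℤ.+ d))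
        assoc = ℤR.solve-∀
        regroup : ∀ A X Y σ s₁ s₂ → (A ℤ.* X ℤ.+ (σ ℤ.* s₁ ℤ.- A ℤ.* 0ℤ)) ℤ.+ (A ℤ.* Y ℤ.+ ((σ ℤ.* ℤ.- s₂ ℤ.+ σ ℤ.* -1ℤ) ℤ.- A ℤ.* 0ℤ))
          ≡ A ℤ.* (X ℤ.+ Y) ℤ.+ σ ℤ.* ((s₁ ℤ.- s₂) ℤ.- 1ℤ)
        regroup = ℤR.solve-∀

    bal′ : ∀ x t → ∑ᵀ (U′ ⊕ V′) (sg ∘ New.D x t) ≡ 0ℤ
    bal′ (v , s) t = trans (∑ᵀ-cong (U′ ⊕ V′) λ W → trans (cong sg (D′≡ v s t W)) (sg-* (lam t) (N v s (cS t) W)))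
      (trans (∑ᵀ-* (U′ ⊕ V′) (sg (lam t)) (λ W → sg (N v s (cS t) W)))
        (trans (cong (sg (lam t) ℤ.*_) (Balance.total v s t)) (ℤₚ.*-zeroʳ (sg (lam t)))))

    -- D v₂ s₂ varies along a new edge by a multiple of the cross product of the directions.
    module Seg (v : El V) (s : El S) (t : El S′) (v₂ : El V) (s₂ : El S) (t₂ : El S′) where
      cr : ℤ
      cr = + K ℤ.* (D v₂ s₂ (inj₁ (π v s)) ℤ.- D v₂ s₂ (inj₂ v)) ℤ.+ ℓ v₂ s₂ ℤ.* cS t ℤ.- cS t₂ ℤ.* ℓ v s
      lhs≡ : New.D (v₂ , s₂) t₂ (inj₁ (π′ (v , s) t)) ℤ.- New.D (v₂ , s₂) t₂ (inj₂ (v , s)) ≡ lam t₂ ℤ.* (lam t ℤ.* cr)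
      lhs≡ = begin
        New.D (v₂ , s₂) t₂ u ℤ.- New.D (v₂ , s₂) t₂ x
          ≡⟨ cong₂ ℤ._-_ (D′≡ v₂ s₂ t₂ u) (D′≡ v₂ s₂ t₂ x) ⟩
        lam t₂ ℤ.* N v₂ s₂ (cS t₂) u ℤ.- lam t₂ ℤ.* N v₂ s₂ (cS t₂) x
          ≡⟨ diff (lam t₂) (ℓ v₂ s₂) (+ K ℤ.* η v₂ s₂ ℤ.+ cS t₂) (y′ u) (y′ x) (y′ (inj₂ (v₂ , s₂))) (z′ u) (z′ x) (z′ (inj₂ (v₂ , s₂))) ⟩
        lam t₂ ℤ.* (ℓ v₂ s₂ ℤ.* New.η (v , s) t ℤ.- (+ K ℤ.* η v₂ s₂ ℤ.+ cS t₂) ℤ.* New.ℓ (v , s) t)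
          ≡⟨ cong₂ (λ e l → lam t₂ ℤ.* (ℓ v₂ s₂ ℤ.* e ℤ.- (+ K ℤ.* η v₂ s₂ ℤ.+ cS t₂) ℤ.* l)) (η′≡ v s t) (ℓ′≡ v s t) ⟩
        lam t₂ ℤ.* (ℓ v₂ s₂ ℤ.* (lam t ℤ.* (+ K ℤ.* η v s ℤ.+ cS t)) ℤ.- (+ K ℤ.* η v₂ s₂ ℤ.+ cS t₂) ℤ.* (lam t ℤ.* ℓ v s))
          ≡⟨ fin-eq (lam t₂) (lam t) (+ K) (ℓ v₂ s₂) (η v₂ s₂) (cS t) (cS t₂) (y (inj₁ (π v s))) (y (inj₂ v)) (y (inj₂ v₂))
               (z (inj₁ (π v s))) (z (inj₂ v)) (z (inj₂ v₂)) ⟩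
        lam t₂ ℤ.* (lam t ℤ.* cr) ∎
        where
        open ≡-Reasoning
        u x : El (U′ ⊕ V′)
        u = inj₁ (π′ (v , s) t)
        x = inj₂ (v , s)
        diff : ∀ m l e yu yx y₂ zu zx z₂ → m ℤ.* (l ℤ.* (yu ℤ.- y₂) ℤ.- e ℤ.* (zu ℤ.- z₂)) ℤ.- m ℤ.* (l ℤ.* (yx ℤ.- y₂) ℤ.- e ℤ.* (zx ℤ.- z₂))
          ≡ m ℤ.* (l ℤ.* (yu ℤ.- yx) ℤ.- e ℤ.* (zu ℤ.- zx))
        diff = ℤR.solve-∀
        fin-eq : ∀ m₂ m K l₂ e₂ c c₂ yu yv y₂ zu zv z₂ →
          m₂ ℤ.* (l₂ ℤ.* (m ℤ.* (K ℤ.* (yu ℤ.- yv) ℤ.+ c)) ℤ.- (K ℤ.* e₂ ℤ.+ c₂) ℤ.* (m ℤ.* (zu ℤ.- zv)))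
          ≡ m₂ ℤ.* (m ℤ.* (K ℤ.* ((l₂ ℤ.* (yu ℤ.- y₂) ℤ.- e₂ ℤ.* (zu ℤ.- z₂)) ℤ.- (l₂ ℤ.* (yv ℤ.- y₂) ℤ.- e₂ ℤ.* (zv ℤ.- z₂)))
              ℤ.+ l₂ ℤ.* c ℤ.- c₂ ℤ.* (zu ℤ.- zv)))
        fin-eq = ℤR.solve-∀

      cr≤ : ∀ {X} → ∣ D v₂ s₂ (inj₁ (π v s)) ℤ.- D v₂ s₂ (inj₂ v) ∣ ℕ.≤ X →
        ∣ cr ∣ ℕ.≤ K ℕ.* X ℕ.+ ld v₂ s₂ ℕ.* ∣ cS t ∣ ℕ.+ ∣ cS t₂ ∣ ℕ.* ld v s
      cr≤ {X} h = ∣-∣≤ (+ K ℤ.* (D v₂ s₂ (inj₁ (π v s)) ℤ.- D v₂ s₂ (inj₂ v)) ℤ.+ ℓ v₂ s₂ ℤ.* cS t) (cS t₂ ℤ.* ℓ v s)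
        (∣+∣≤ (+ K ℤ.* (D v₂ s₂ (inj₁ (π v s)) ℤ.- D v₂ s₂ (inj₂ v))) (ℓ v₂ s₂ ℤ.* cS t)
          (∣*∣≤ (+ K) _ {K} ℕₚ.≤-refl h) (∣*∣≤ (ℓ v₂ s₂) (cS t) ℕₚ.≤-refl ℕₚ.≤-refl))
        (∣*∣≤ (cS t₂) (ℓ v s) ℕₚ.≤-refl ℕₚ.≤-refl)

      finish : ∀ {X} → ∣ cr ∣ ℕ.≤ X → ∣ lam t ∣ ℕ.* X ℕ.≤ 4 ℕ.* Q ℕ.* ∣ N v₂ s₂ (cS t₂) (inj₂ (v , s)) ∣ →
        ∣ New.D (v₂ , s₂) t₂ (inj₁ (π′ (v , s) t)) ℤ.- New.D (v₂ , s₂) t₂ (inj₂ (v , s)) ∣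
        ℕ.≤ 4 ℕ.* Q ℕ.* ∣ New.D (v₂ , s₂) t₂ (inj₂ (v , s)) ∣
      finish {X} cr≤X h = begin
        ∣ New.D (v₂ , s₂) t₂ (inj₁ (π′ (v , s) t)) ℤ.- New.D (v₂ , s₂) t₂ (inj₂ (v , s)) ∣
          ≡⟨ trans (cong ∣_∣ lhs≡) (trans (ℤₚ.abs-* (lam t₂) _) (cong (∣ lam t₂ ∣ ℕ.*_) (ℤₚ.abs-* (lam t) cr))) ⟩
        ∣ lam t₂ ∣ ℕ.* (∣ lam t ∣ ℕ.* ∣ cr ∣)
          ≤⟨ ℕₚ.*-monoʳ-≤ ∣ lam t₂ ∣ (ℕₚ.≤-trans (ℕₚ.*-monoʳ-≤ ∣ lam t ∣ cr≤X) h) ⟩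
        ∣ lam t₂ ∣ ℕ.* (4 ℕ.* Q ℕ.* ∣ N v₂ s₂ (cS t₂) (inj₂ (v , s)) ∣)
          ≡⟨ lem (∣ lam t₂ ∣) (4 ℕ.* Q) (∣ N v₂ s₂ (cS t₂) (inj₂ (v , s)) ∣) ⟩
        4 ℕ.* Q ℕ.* (∣ lam t₂ ∣ ℕ.* ∣ N v₂ s₂ (cS t₂) (inj₂ (v , s)) ∣)
          ≡⟨ cong (4 ℕ.* Q ℕ.*_) (trans (cong ∣_∣ (D′≡ v₂ s₂ t₂ (inj₂ (v , s)))) (ℤₚ.abs-* (lam t₂) _)) ⟨
        4 ℕ.* Q ℕ.* ∣ New.D (v₂ , s₂) t₂ (inj₂ (v , s)) ∣ ∎
        where
        open ℕₚ.≤-Reasoning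
        lem : ∀ a b c → a ℕ.* (b ℕ.* c) ≡ b ℕ.* (a ℕ.* c)
        lem = ℕR.solve-∀

    -- For new bold points in different clusters the old `seg` is used. Within one cluster the old
    -- determinant at the bold end vanishes, and `sep` for the other slot takes over.
    seg′ : ∀ x t x₂ t₂ → x ≢ x₂ →
      ∣ New.D x₂ t₂ (inj₁ (π′ x t)) ℤ.- New.D x₂ t₂ (inj₂ x) ∣ ℕ.≤ 4 ℕ.* Q ℕ.* ∣ New.D x₂ t₂ (inj₂ x) ∣
    seg′ (v , s) t (v₂ , s₂) t₂ x≢ with v ≟V v₂
    ... | no v≢ = finish (cr≤ (seg v s v₂ s₂ v≢))
        (seg-far T M ∣ dz v₂ (inj₂ v) ∣ ∣ D v₂ s₂ (inj₂ v) ∣ {ld v s} {ld v₂ s₂} 1≤T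
          (FarX.sp v₂ s₂ (cS t₂) (∣cS∣≤ t₂) v s v≢) (ℓ₃≤ v₂ s₂ v s v≢) (∣cS∣≤ t) (∣cS∣≤ t₂)
          (proj₂ (FarX.x v₂ s₂ (cS t₂) (∣cS∣≤ t₂) v s v≢)) (∣lam∣≤ t))
      where open Seg v s t v₂ s₂ t₂
    ... | yes refl with s ≟S s₂
    ...   | yes refl = contradiction refl x≢
    ...   | no s≢ = finish (cr≤ (ℕₚ.≤-reflexive (cong ∣_∣ (trans (cong (λ d → D v s₂ (inj₁ (π v s)) ℤ.- d) (D-bold v s₂))
          (ℤₚ.+-identityʳ (D v s₂ (inj₁ (π v s))))))))
        (seg-near T M ∣ D v s₂ (inj₁ (π v s)) ∣ {ld v s} {ld v s₂} (Near.sp v s₂ (cS t₂) (∣cS∣≤ t₂) s s≢)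
          (∣cS∣≤ t) (∣cS∣≤ t₂) (Near.half v s₂ (cS t₂) (∣cS∣≤ t₂) s s≢) (∣lam∣≤ t))
      where open Seg v s t v s₂ t₂

    π′-inj : ∀ x {t t₂} → π′ x t ≡ π′ x t₂ → t ≡ t₂
    π′-inj (v , s) {inj₁ k} {inj₁ k₂} e = cong inj₁ (Finₚ.↑ˡ-injective Δ k k₂ (Finₚ.↑ʳ-injective Δ (k ↑ˡ Δ) (k₂ ↑ˡ Δ)
      (cong proj₂ (⊎ₚ.inj₁-injective e))))
    π′-inj (v , s) {inj₂ k} {inj₂ k₂} e = cong (inj₂ ∘ proj₂) (⊎ₚ.inj₁-injective (⊎ₚ.inj₂-injective e))

    ℓ′≢0 : ∀ x t → New.ℓ x t ≢ 0ℤ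
    ℓ′≢0 (v , s) t e = contradiction (ℕₚ.≤-trans (ℕₚ.*-mono-≤ (1≤∣lam∣ t) (∣∣≥1 (ℓ≢0 v s)))
      (ℕₚ.≤-reflexive (trans (sym (ℤₚ.abs-* (lam t) (ℓ v s))) (cong ∣_∣ (trans (sym (ℓ′≡ v s t)) e))))) λ ()

    B′ : ℕ
    B′ = 4 ℕ.* (Q ℕ.* (K ℕ.* B))

    QB≤ : Q ℕ.* B ℕ.+ (B ℕ.+ B) ℕ.≤ B′
    QB≤ = by-cert (3 ℕ.* (Q ℕ.* (K ℕ.* B)) ℕ.∸ 2 ℕ.* (Q ℕ.* (K ℕ.* B)))
      ((Q ⊠ ℕₚ.*-monoˡ-≤ B 1≤K) ⊞ (ℕₚ.*-monoˡ-≤ (K ℕ.* B) 1≤Q) ⊞ ℕₚ.*-monoˡ-≤ B 1≤K ⊞ ℕₚ.*-monoˡ-≤ (K ℕ.* B) 1≤Q ⊞ ℕₚ.*-monoˡ-≤ B 1≤K)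
      (trans (cong (λ r → Q ℕ.* B ℕ.+ (B ℕ.+ B) ℕ.+ (Q ℕ.* (K ℕ.* B) ℕ.+ Q ℕ.* (K ℕ.* B) ℕ.+ K ℕ.* B ℕ.+ Q ℕ.* (K ℕ.* B) ℕ.+ K ℕ.* B) ℕ.+ r)
        (trans (sym (ℕₚ.*-distribʳ-∸ (Q ℕ.* (K ℕ.* B)) 3 2)) (ℕₚ.*-identityˡ (Q ℕ.* (K ℕ.* B))))) (lem Q (K ℕ.* B) B))
      where
      lem : ∀ Q KB B → Q ℕ.* B ℕ.+ (B ℕ.+ B) ℕ.+ (Q ℕ.* KB ℕ.+ Q ℕ.* KB ℕ.+ KB ℕ.+ Q ℕ.* KB ℕ.+ KB) ℕ.+ Q ℕ.* KB
        ≡ 4 ℕ.* (Q ℕ.* KB) ℕ.+ (Q ℕ.* (1 ℕ.* B) ℕ.+ 1 ℕ.* KB ℕ.+ 1 ℕ.* B ℕ.+ 1 ℕ.* KB ℕ.+ 1 ℕ.* B)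
      lem = ℕR.solve-∀

    ∣ℓ∣≤ : ∀ v s → ∣ ℓ v s ∣ ℕ.≤ B ℕ.+ B
    ∣ℓ∣≤ v s = ∣-∣≤ (z (inj₁ (π v s))) (z (inj₂ v)) (bz _) (bz _)

    ∣Qz∣≤ : ∀ w → ∣ + Q ℤ.* z w ∣ ℕ.≤ Q ℕ.* B
    ∣Qz∣≤ w = ∣*∣≤ (+ Q) (z w) {Q} ℕₚ.≤-refl (bz w)

    bz′ : ∀ W → ∣ z′ W ∣ ℕ.≤ B′
    bz′ (inj₁ (inj₁ (u , j)))        = ℕₚ.≤-trans (∣Qz∣≤ (inj₁ u)) (ℕₚ.m+n≤o⇒m≤o _ QB≤)
    bz′ (inj₁ (inj₂ (inj₁ (v , k)))) = ℕₚ.≤-trans (∣Qz∣≤ (inj₂ v)) (ℕₚ.m+n≤o⇒m≤o _ QB≤)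
    bz′ (inj₁ (inj₂ (inj₂ (v , s)))) = ℕₚ.≤-trans (∣-∣≤ (+ Q ℤ.* z (inj₂ v)) (ℓ v s) (∣Qz∣≤ (inj₂ v)) (∣ℓ∣≤ v s)) QB≤
    bz′ (inj₂ (v , s))               = ℕₚ.≤-trans (∣+∣≤ (+ Q ℤ.* z (inj₂ v)) (ℓ v s) (∣Qz∣≤ (inj₂ v)) (∣ℓ∣≤ v s)) QB≤

    ∣QKy∣≤ : ∀ w → ∣ + Q ℤ.* (+ K ℤ.* y w) ∣ ℕ.≤ Q ℕ.* (K ℕ.* B)
    ∣QKy∣≤ w = ∣*∣≤ (+ Q) (+ K ℤ.* y w) {Q} ℕₚ.≤-refl (∣*∣≤ (+ K) (y w) {K} ℕₚ.≤-refl (by w))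

    ∣Kη∣≤ : ∀ v s → ∣ + K ℤ.* η v s ∣ ℕ.≤ K ℕ.* (B ℕ.+ B)
    ∣Kη∣≤ v s = ∣*∣≤ (+ K) (η v s) {K} ℕₚ.≤-refl (∣-∣≤ (y (inj₁ (π v s))) (y (inj₂ v)) (by _) (by _))

    K≤ : K ℕ.≤ K ℕ.* B
    K≤ = ℕₚ.m≤m*n K B {{ℕ.>-nonZero 1≤B}}

    x≤B′ : ∀ {r} → r ℕ.≤ K → Q ℕ.* (K ℕ.* B) ℕ.+ K ℕ.* (B ℕ.+ B) ℕ.+ r ℕ.≤ B′
    x≤B′ h = ℕₚ.≤-trans (ℕₚ.+-monoʳ-≤ (Q ℕ.* (K ℕ.* B) ℕ.+ K ℕ.* (B ℕ.+ B)) (ℕₚ.≤-trans h K≤))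
      (by-cert 0 (3 ⊠ ℕₚ.*-monoˡ-≤ (K ℕ.* B) 1≤Q) (lem Q K B))
      where
      lem : ∀ Q K B → Q ℕ.* (K ℕ.* B) ℕ.+ K ℕ.* (B ℕ.+ B) ℕ.+ K ℕ.* B ℕ.+ 3 ℕ.* (Q ℕ.* (K ℕ.* B)) ℕ.+ 0
        ≡ 4 ℕ.* (Q ℕ.* (K ℕ.* B)) ℕ.+ 3 ℕ.* (1 ℕ.* (K ℕ.* B))
      lem = ℕR.solve-∀

    QM≤ : Q ℕ.* (K ℕ.* B) ℕ.+ Q ℕ.* M ℕ.≤ B′
    QM≤ = ℕₚ.≤-trans (ℕₚ.+-monoʳ-≤ (Q ℕ.* (K ℕ.* B)) (ℕₚ.*-monoʳ-≤ Q (ℕₚ.≤-trans (ℕₚ.m≤n*m M 16) K≤)))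
      (ℕₚ.≤-trans (ℕₚ.≤-reflexive (lem (Q ℕ.* (K ℕ.* B)))) (ℕₚ.*-monoˡ-≤ (Q ℕ.* (K ℕ.* B)) (ℕₚ.m≤m+n 2 2)))
      where
      lem : ∀ x → x ℕ.+ x ≡ 2 ℕ.* x
      lem = ℕR.solve-∀

    by′ : ∀ W → ∣ y′ W ∣ ℕ.≤ B′
    by′ (inj₁ (inj₁ (u , j)))        = ℕₚ.≤-trans (∣+∣≤ (+ Q ℤ.* (+ K ℤ.* y (inj₁ u))) ((+ Q ℤ.- 1ℤ) ℤ.* cU j) (∣QKy∣≤ (inj₁ u))
      (∣*∣≤ (+ Q ℤ.- 1ℤ) (cU j) ∣Q-1∣≤ (∣cU∣≤ j))) QM≤
    by′ (inj₁ (inj₂ (inj₁ (v , k)))) = ℕₚ.≤-trans (∣-∣≤ (+ Q ℤ.* (+ K ℤ.* y (inj₂ v))) (cV k) (∣QKy∣≤ (inj₂ v))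
      (ℕₚ.≤-trans (∣cV∣≤ k) (ℕₚ.m≤n*m M Q {{ℕ.>-nonZero 1≤Q}}))) QM≤
    by′ (inj₁ (inj₂ (inj₂ (v , s)))) = ℕₚ.≤-trans (∣-∣≤ (+ Q ℤ.* (+ K ℤ.* y (inj₂ v)) ℤ.- + K ℤ.* η v s) (+ O)
      (∣-∣≤ (+ Q ℤ.* (+ K ℤ.* y (inj₂ v))) (+ K ℤ.* η v s) (∣QKy∣≤ (inj₂ v)) (∣Kη∣≤ v s)) (ℕₚ.*-monoˡ-≤ M {3} {16} (ℕₚ.m≤m+n 3 13))) (x≤B′ ℕₚ.≤-refl)
    by′ (inj₂ (v , s))               = ℕₚ.≤-trans (∣+∣≤ (+ Q ℤ.* (+ K ℤ.* y (inj₂ v))) (+ K ℤ.* η v s) (∣QKy∣≤ (inj₂ v)) (∣Kη∣≤ v s))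
      (ℕₚ.≤-trans (ℕₚ.m≤m+n _ 0) (x≤B′ z≤n))

    next : Level (a ℕ.+ a) (4 ℕ.* Q) B′
    next = record
      { U = U′ ; V = V′ ; S = S′ ; π = π′ ; z = z′ ; y = y′
      ; size-S = refl
      ; 1≤Δ = ℕₚ.≤-trans 1≤Δ (ℕₚ.≤-trans (ℕₚ.m≤n*m Δ 6) (ℕₚ.m≤m+n a a))
      ; 1≤T = ℕₚ.≤-trans 1≤Q (ℕₚ.m≤n*m Q 4)
      ; 1≤B = ℕₚ.*-mono-≤ {1} {4} (s≤s z≤n) (ℕₚ.*-mono-≤ 1≤Q (ℕₚ.*-mono-≤ 1≤K 1≤B))
      ; π-inj = π′-inj ; ℓ≢0 = ℓ′≢0 ; sep = sep′ ; seg = seg′ ; bal = bal′ ; bz = bz′ ; by = by′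
      }

-- Iterated refinement, its size, and separation of the abscissae

module PlanarSets where

  open FiniteTypes
  open Levels
  open Refinement
  open import Data.Nat as ℕ using (ℕ; zero; suc; s≤s; z≤n)
  import Data.Nat.Properties as ℕₚ
  import Data.Nat.DivMod as DM
  open import Data.Integer as ℤ using (ℤ; +_; -[1+_]; 0ℤ; 1ℤ; ∣_∣)
  import Data.Integer.Properties as ℤₚ
  import Data.Integer.Tactic.RingSolver as ℤR
  import Data.Nat.Tactic.RingSolver as ℕR
  open import Data.Fin as Fin using (Fin; zero; suc; toℕ)
  import Data.Fin.Properties as Finₚ
  open import Data.Product using (_,_; proj₁; proj₂)
  open import Data.Sum using (inj₁; inj₂)
  import Data.Sum.Properties as ⊎ₚ
  open import Function using (_∘_)
  open import Relation.Nullary using (yes; no; contradiction)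
  open import Relation.Binary.PropositionalEquality

  Δs Ts Bs : ℕ → ℕ
  Δs zero    = 1
  Δs (suc r) = 6 ℕ.* Δs r ℕ.+ 6 ℕ.* Δs r
  Ts zero    = 1
  Ts (suc r) = 4 ℕ.* (4 ℕ.* Ts r)
  Bs zero    = 1
  Bs (suc r) = 4 ℕ.* (4 ℕ.* Ts r ℕ.* (16 ℕ.* (40 ℕ.* Δs r) ℕ.* Bs r))

  base : Level 1 1 1
  base = record
    { U = fin 1 ; V = fin 1 ; S = fin 1 ; π = λ _ _ → zero
    ; z = λ { (inj₁ _) → 1ℤ ; (inj₂ _) → 0ℤ } ; y = λ _ → 0ℤ
    ; size-S = refl ; 1≤Δ = s≤s z≤n ; 1≤T = s≤s z≤n ; 1≤B = s≤s z≤n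
    ; π-inj = λ { _ {zero} {zero} _ → refl }
    ; ℓ≢0 = λ _ _ ()
    ; sep = λ { zero _ (inj₁ zero) _ q → contradiction refl q ; zero _ (inj₂ zero) p _ → contradiction refl p }
    ; seg = λ { zero _ zero _ h → contradiction refl h }
    ; bal = λ { zero zero → refl }
    ; bz = λ { (inj₁ _) → s≤s z≤n ; (inj₂ _) → z≤n } ; by = λ _ → z≤n
    }

  lev : ∀ r → Level (Δs r) (Ts r) (Bs r)
  lev zero    = base
  lev (suc r) = Step.next (lev r)

  points edges : ℕ → ℕ
  points r = size (Level.U (lev r) ⊕ Level.V (lev r))
  edges r  = size (Level.V (lev r) ⊗ Level.S (lev r))

  points-suc : ∀ r → points (suc r) ≡ 8 ℕ.* Δs r ℕ.* points r
  points-suc r = trans (cong (λ n → size U ℕ.* (Δs r ℕ.+ (6 ℕ.* Δs r ℕ.+ Δs r)) ℕ.+ (size V ℕ.* (6 ℕ.* Δs r) ℕ.+ size V ℕ.* n) ℕ.+ size V ℕ.* n) size-S)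
    (lem (Δs r) (size U) (size V))
    where
    open Level (lev r)
    lem : ∀ d u v → u ℕ.* (d ℕ.+ (6 ℕ.* d ℕ.+ d)) ℕ.+ (v ℕ.* (6 ℕ.* d) ℕ.+ v ℕ.* d) ℕ.+ v ℕ.* d ≡ 8 ℕ.* d ℕ.* (u ℕ.+ v)
    lem = ℕR.solve-∀

  -- One edge on two points at the start, and a factor 12/8 per step: the ratio is (3/2)^r / 2,
  -- multiplied out.
  edges-points : ∀ r → edges r ℕ.* 2 ℕ.* 2 ℕ.^ r ≡ points r ℕ.* 3 ℕ.^ r
  edges-points zero    = refl
  edges-points (suc r) = begin
    size V ℕ.* size S ℕ.* (6 ℕ.* Δs r ℕ.+ 6 ℕ.* Δs r) ℕ.* 2 ℕ.* (2 ℕ.* 2 ℕ.^ r) ≡⟨ lem (edges r) (Δs r) (2 ℕ.^ r) ⟩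
    24 ℕ.* Δs r ℕ.* (edges r ℕ.* 2 ℕ.* 2 ℕ.^ r)                               ≡⟨ cong (24 ℕ.* Δs r ℕ.*_) (edges-points r) ⟩
    24 ℕ.* Δs r ℕ.* (points r ℕ.* 3 ℕ.^ r)                                    ≡⟨ lem2 (Δs r) (points r) (3 ℕ.^ r) ⟩
    8 ℕ.* Δs r ℕ.* points r ℕ.* (3 ℕ.* 3 ℕ.^ r)                               ≡⟨ cong (ℕ._* (3 ℕ.* 3 ℕ.^ r)) (points-suc r) ⟨
    points (suc r) ℕ.* (3 ℕ.* 3 ℕ.^ r) ∎
    where
    open ≡-Reasoning
    open Level (lev r)
    lem : ∀ e d p → e ℕ.* (6 ℕ.* d ℕ.+ 6 ℕ.* d) ℕ.* 2 ℕ.* (2 ℕ.* p) ≡ 24 ℕ.* d ℕ.* (e ℕ.* 2 ℕ.* p)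
    lem = ℕR.solve-∀
    lem2 : ∀ d m p → 24 ℕ.* d ℕ.* (m ℕ.* p) ≡ 8 ℕ.* d ℕ.* m ℕ.* (3 ℕ.* p)
    lem2 = ℕR.solve-∀

  halfPoints : ℕ → ℕ
  halfPoints zero    = 1
  halfPoints (suc r) = 8 ℕ.* Δs r ℕ.* halfPoints r

  points-even : ∀ r → points r ≡ halfPoints r ℕ.+ halfPoints r
  points-even zero    = refl
  points-even (suc r) = trans (points-suc r) (trans (cong (8 ℕ.* Δs r ℕ.*_) (points-even r))
    (ℕₚ.*-distribˡ-+ (8 ℕ.* Δs r) (halfPoints r) (halfPoints r)))

  1≤halfPoints : ∀ r → 1 ℕ.≤ halfPoints r
  1≤halfPoints zero    = s≤s z≤n
  1≤halfPoints (suc r) = ℕₚ.*-mono-≤ {1} {8 ℕ.* Δs r} (ℕₚ.*-mono-≤ {1} {8} (s≤s z≤n) (Level.1≤Δ (lev r))) (1≤halfPoints r)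

  -- One step multiplies the coordinates by at most `2 ^ (14 + 8 * r)`, since `Δs r` and `Ts r` are
  -- at most 16^r. The increments of this exponent are `14 + 14 * r`, which also suffices for the
  -- number of points.
  expo : ℕ → ℕ
  expo r = 7 ℕ.* (r ℕ.* suc r)

  expo-suc : ∀ r → 14 ℕ.+ 14 ℕ.* r ℕ.+ expo r ≡ expo (suc r)
  expo-suc r = lem r
    where
    lem : ∀ r → 14 ℕ.+ 14 ℕ.* r ℕ.+ 7 ℕ.* (r ℕ.* (1 ℕ.+ r)) ≡ 7 ℕ.* ((1 ℕ.+ r) ℕ.* (2 ℕ.+ r))
    lem = ℕR.solve-∀

  Δs≤ : ∀ r → Δs r ℕ.≤ 2 ℕ.^ (4 ℕ.* r)
  Δs≤ zero    = s≤s z≤n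
  Δs≤ (suc r) = begin
    6 ℕ.* Δs r ℕ.+ 6 ℕ.* Δs r  ≡⟨ ℕₚ.*-distribʳ-+ (Δs r) 6 6 ⟨
    12 ℕ.* Δs r                ≤⟨ ℕₚ.*-mono-≤ {12} {16} (ℕₚ.m≤m+n 12 4) (Δs≤ r) ⟩
    16 ℕ.* 2 ℕ.^ (4 ℕ.* r)     ≡⟨ ℕₚ.^-distribˡ-+-* 2 4 (4 ℕ.* r) ⟨
    2 ℕ.^ (4 ℕ.+ 4 ℕ.* r)      ≡⟨ cong (2 ℕ.^_) (ℕₚ.*-suc 4 r) ⟨
    2 ℕ.^ (4 ℕ.* suc r)        ∎
    where open ℕₚ.≤-Reasoning

  Ts≤ : ∀ r → Ts r ℕ.≤ 2 ℕ.^ (4 ℕ.* r)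
  Ts≤ zero    = s≤s z≤n
  Ts≤ (suc r) = begin
    4 ℕ.* (4 ℕ.* Ts r)         ≡⟨ ℕₚ.*-assoc 4 4 (Ts r) ⟨
    16 ℕ.* Ts r                ≤⟨ ℕₚ.*-monoʳ-≤ 16 (Ts≤ r) ⟩
    16 ℕ.* 2 ℕ.^ (4 ℕ.* r)     ≡⟨ ℕₚ.^-distribˡ-+-* 2 4 (4 ℕ.* r) ⟨
    2 ℕ.^ (4 ℕ.+ 4 ℕ.* r)      ≡⟨ cong (2 ℕ.^_) (ℕₚ.*-suc 4 r) ⟨
    2 ℕ.^ (4 ℕ.* suc r)        ∎
    where open ℕₚ.≤-Reasoning

  Bs≤ : ∀ r → Bs r ℕ.≤ 2 ℕ.^ expo r
  Bs≤ zero    = s≤s z≤n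
  Bs≤ (suc r) = begin
    4 ℕ.* (4 ℕ.* Ts r ℕ.* (16 ℕ.* (40 ℕ.* Δs r) ℕ.* Bs r))
      ≤⟨ ℕₚ.*-monoʳ-≤ 4 (ℕₚ.*-mono-≤ (ℕₚ.*-monoʳ-≤ 4 (Ts≤ r)) (ℕₚ.*-mono-≤ (ℕₚ.*-monoʳ-≤ 16 (ℕₚ.*-mono-≤ {40} {64} (ℕₚ.m≤m+n 40 24) (Δs≤ r))) (Bs≤ r))) ⟩
    4 ℕ.* (4 ℕ.* P ℕ.* (16 ℕ.* (64 ℕ.* P) ℕ.* 2 ℕ.^ expo r))
      ≡⟨ lem P (2 ℕ.^ expo r) ⟩
    2 ℕ.^ 14 ℕ.* (P ℕ.* P) ℕ.* 2 ℕ.^ expo r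
      ≡⟨ cong (λ i → 2 ℕ.^ 14 ℕ.* i ℕ.* 2 ℕ.^ expo r) (ℕₚ.^-distribˡ-+-* 2 (4 ℕ.* r) (4 ℕ.* r)) ⟨
    2 ℕ.^ 14 ℕ.* 2 ℕ.^ (4 ℕ.* r ℕ.+ 4 ℕ.* r) ℕ.* 2 ℕ.^ expo r
      ≡⟨ cong (ℕ._* 2 ℕ.^ expo r) (ℕₚ.^-distribˡ-+-* 2 14 (4 ℕ.* r ℕ.+ 4 ℕ.* r)) ⟨
    2 ℕ.^ (14 ℕ.+ (4 ℕ.* r ℕ.+ 4 ℕ.* r)) ℕ.* 2 ℕ.^ expo r
      ≡⟨ ℕₚ.^-distribˡ-+-* 2 (14 ℕ.+ (4 ℕ.* r ℕ.+ 4 ℕ.* r)) (expo r) ⟨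
    2 ℕ.^ (14 ℕ.+ (4 ℕ.* r ℕ.+ 4 ℕ.* r) ℕ.+ expo r)
      ≤⟨ ℕₚ.^-monoʳ-≤ 2 (subst (14 ℕ.+ (4 ℕ.* r ℕ.+ 4 ℕ.* r) ℕ.+ expo r ℕ.≤_) (expo-suc r)
          (ℕₚ.+-monoˡ-≤ (expo r) (ℕₚ.+-monoʳ-≤ 14 (subst (ℕ._≤ 14 ℕ.* r) (ℕₚ.*-distribʳ-+ r 4 4) (ℕₚ.*-monoˡ-≤ r (ℕₚ.m≤m+n 8 6)))))) ⟩
    2 ℕ.^ expo (suc r) ∎
    where
    open ℕₚ.≤-Reasoning
    P = 2 ℕ.^ (4 ℕ.* r)
    lem : ∀ p q → 4 ℕ.* (4 ℕ.* p ℕ.* (16 ℕ.* (64 ℕ.* p) ℕ.* q)) ≡ 16384 ℕ.* (p ℕ.* p) ℕ.* q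
    lem = ℕR.solve-∀

  halfPoints≤ : ∀ r → halfPoints r ℕ.≤ 2 ℕ.^ expo r
  halfPoints≤ zero    = s≤s z≤n
  halfPoints≤ (suc r) = begin
    8 ℕ.* Δs r ℕ.* halfPoints r                         ≤⟨ ℕₚ.*-mono-≤ (ℕₚ.*-monoʳ-≤ 8 (Δs≤ r)) (halfPoints≤ r) ⟩
    2 ℕ.^ 3 ℕ.* 2 ℕ.^ (4 ℕ.* r) ℕ.* 2 ℕ.^ expo r          ≡⟨ cong (ℕ._* 2 ℕ.^ expo r) (ℕₚ.^-distribˡ-+-* 2 3 (4 ℕ.* r)) ⟨
    2 ℕ.^ (3 ℕ.+ 4 ℕ.* r) ℕ.* 2 ℕ.^ expo r                ≡⟨ ℕₚ.^-distribˡ-+-* 2 (3 ℕ.+ 4 ℕ.* r) (expo r) ⟨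
    2 ℕ.^ (3 ℕ.+ 4 ℕ.* r ℕ.+ expo r)                     ≤⟨ ℕₚ.^-monoʳ-≤ 2 (subst (3 ℕ.+ 4 ℕ.* r ℕ.+ expo r ℕ.≤_) (expo-suc r)
      (ℕₚ.+-monoˡ-≤ (expo r) (ℕₚ.+-mono-≤ {3} {14} (ℕₚ.m≤m+n 3 11) (ℕₚ.*-monoˡ-≤ r (ℕₚ.m≤m+n 4 10))))) ⟩
    2 ℕ.^ expo (suc r) ∎
    where open ℕₚ.≤-Reasoning

  -- A planar point set with many halving edges whose first coordinates are
  -- pairwise distinct modulo the number of points.

  record Planar (Λ : ℕ) : Set where
    field
      W E : Ty
      bold plain : El E → El W
      p : El W → ℕ
      y : El W → ℤ
      half : ℕ
    m : ℕ
    m = size W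
    orient : El E → El W → ℤ
    orient e w = (+ p (plain e) ℤ.- + p (bold e)) ℤ.* (y w ℤ.- y (bold e))
      ℤ.- (y (plain e) ℤ.- y (bold e)) ℤ.* (+ p w ℤ.- + p (bold e))
    field
      m≡half   : m ≡ half ℕ.+ half
      1≤m      : 1 ℕ.≤ m
      p<Λ      : ∀ w → p w ℕ.< Λ
      -- Translates by multiples of `m` are disjoint, so that several copies of the set can share
      -- one line.
      p-inj    : ∀ w w′ l l′ → p w ℕ.+ m ℕ.* l ≡ p w′ ℕ.+ m ℕ.* l′ → w ≡ w′
      edge-inj : ∀ e e′ → bold e ≡ bold e′ → plain e ≡ plain e′ → e ≡ e′
      b≢p      : ∀ e e′ → bold e ≢ plain e′
      orient≢0 : ∀ e w → w ≢ bold e → w ≢ plain e → orient e w ≢ 0ℤ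
      balanced : ∀ e → ∑ᵀ W (sg ∘ orient e) ≡ 0ℤ

  -- The points of a column have equal abscissae. Stretching by `m * C` and adding the number of the
  -- point makes the abscissae distinct even modulo `m`. The added numbers change a determinant by
  -- at most `8 * m * B`, which is less than `m * C`, so the determinants that are nonzero integers
  -- keep their signs.
  module Thicken (r : ℕ) where
    open Level (lev r)

    W : Ty
    W = U ⊕ V

    m B C : ℕ
    m = size W
    B = Bs r
    C = 8 ℕ.* B ℕ.+ 1

    Λ : ℕ
    Λ = m ℕ.* (C ℕ.* (B ℕ.+ B)) ℕ.+ m

    idx : El W → ℕ
    idx w = toℕ (encode W w)

    p : El W → ℕ
    p w = m ℕ.* (C ℕ.* ∣ z w ℤ.+ + B ∣) ℕ.+ idx w

    bold plain : El (V ⊗ S) → El W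
    bold (v , s)  = inj₂ v
    plain (v , s) = inj₁ (π v s)

    shift≥0 : ∀ {i n} → ∣ i ∣ ℕ.≤ n → + ∣ i ℤ.+ + n ∣ ≡ i ℤ.+ + n
    shift≥0 {+ k}      h = refl
    shift≥0 { -[1+ k ]} {n} h = trans (cong (λ i → + ∣ i ∣) (ℤₚ.⊖-≥ h)) (sym (ℤₚ.⊖-≥ h))

    +p : ∀ w → + p w ≡ + m ℤ.* (+ C ℤ.* (z w ℤ.+ + B)) ℤ.+ + idx w
    +p w = cong (ℤ._+ + idx w) (trans (ℤₚ.pos-* m _) (cong (+ m ℤ.*_) (trans (ℤₚ.pos-* C _) (cong (+ C ℤ.*_) (shift≥0 {z w} (bz w))))))

    instance
      m≢0 : ℕ.NonZero m
      m≢0 = ℕ.>-nonZero (subst (1 ℕ.≤_) (sym (points-even r)) (ℕₚ.≤-trans (1≤halfPoints r) (ℕₚ.m≤m+n _ _)))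

    p-inj : ∀ w w′ l l′ → p w ℕ.+ m ℕ.* l ≡ p w′ ℕ.+ m ℕ.* l′ → w ≡ w′
    p-inj w w′ l l′ e = encode-injective W (Finₚ.toℕ-injective (trans (sym (residue w l)) (trans (cong (DM._% m) e) (residue w′ l′))))
      where
      residue : ∀ w l → (p w ℕ.+ m ℕ.* l) DM.% m ≡ idx w
      residue w l = trans (cong (DM._% m) (lem m (C ℕ.* ∣ z w ℤ.+ + B ∣) (idx w) l))
        (trans (DM.[m+kn]%n≡m%n (idx w) (C ℕ.* ∣ z w ℤ.+ + B ∣ ℕ.+ l) m) (DM.m<n⇒m%n≡m (Finₚ.toℕ<n (encode W w))))
        where
        lem : ∀ m a i l → m ℕ.* a ℕ.+ i ℕ.+ m ℕ.* l ≡ i ℕ.+ (a ℕ.+ l) ℕ.* m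
        lem = ℕR.solve-∀

    orient : El (V ⊗ S) → El W → ℤ
    orient e w = (+ p (plain e) ℤ.- + p (bold e)) ℤ.* (y w ℤ.- y (bold e))
      ℤ.- (y (plain e) ℤ.- y (bold e)) ℤ.* (+ p w ℤ.- + p (bold e))

    err : El (V ⊗ S) → El W → ℤ
    err e w = (+ idx (plain e) ℤ.- + idx (bold e)) ℤ.* (y w ℤ.- y (bold e))
      ℤ.- (y (plain e) ℤ.- y (bold e)) ℤ.* (+ idx w ℤ.- + idx (bold e))

    orient≡ : ∀ e w → orient e w ≡ + (m ℕ.* C) ℤ.* D (proj₁ e) (proj₂ e) w ℤ.+ err e w
    orient≡ e w = trans
      (cong₂ (λ a b → a ℤ.* (y w ℤ.- y (bold e)) ℤ.- (y (plain e) ℤ.- y (bold e)) ℤ.* b)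
        (cong₂ ℤ._-_ (+p (plain e)) (+p (bold e))) (cong₂ ℤ._-_ (+p w) (+p (bold e))))
      (trans (lem (+ m) (+ C) (+ B) (z (plain e)) (z (bold e)) (z w) (y (plain e)) (y (bold e)) (y w) (+ idx (plain e)) (+ idx (bold e)) (+ idx w))
        (cong (λ i → i ℤ.* D (proj₁ e) (proj₂ e) w ℤ.+ err e w) (sym (ℤₚ.pos-* m C))))
      where
      lem : ∀ m C B zu zv zw yu yv yw iu iv iw →
        ((m ℤ.* (C ℤ.* (zu ℤ.+ B)) ℤ.+ iu) ℤ.- (m ℤ.* (C ℤ.* (zv ℤ.+ B)) ℤ.+ iv)) ℤ.* (yw ℤ.- yv)
          ℤ.- (yu ℤ.- yv) ℤ.* ((m ℤ.* (C ℤ.* (zw ℤ.+ B)) ℤ.+ iw) ℤ.- (m ℤ.* (C ℤ.* (zv ℤ.+ B)) ℤ.+ iv))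
        ≡ (m ℤ.* C) ℤ.* ((zu ℤ.- zv) ℤ.* (yw ℤ.- yv) ℤ.- (yu ℤ.- yv) ℤ.* (zw ℤ.- zv))
          ℤ.+ ((iu ℤ.- iv) ℤ.* (yw ℤ.- yv) ℤ.- (yu ℤ.- yv) ℤ.* (iw ℤ.- iv))
      lem = ℤR.solve-∀

    idx≤ : ∀ w → ∣ + idx w ∣ ℕ.≤ m
    idx≤ w = ℕₚ.<⇒≤ (Finₚ.toℕ<n (encode W w))

    err≤ : ∀ e w → ∣ err e w ∣ ℕ.≤ (m ℕ.+ m) ℕ.* (B ℕ.+ B) ℕ.+ (B ℕ.+ B) ℕ.* (m ℕ.+ m)
    err≤ e w = ∣-∣≤ ((+ idx (plain e) ℤ.- + idx (bold e)) ℤ.* (y w ℤ.- y (bold e))) ((y (plain e) ℤ.- y (bold e)) ℤ.* (+ idx w ℤ.- + idx (bold e)))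
      (∣*∣≤ (+ idx (plain e) ℤ.- + idx (bold e)) (y w ℤ.- y (bold e))
        (∣-∣≤ (+ idx (plain e)) (+ idx (bold e)) (idx≤ (plain e)) (idx≤ (bold e))) (∣-∣≤ (y w) (y (bold e)) (by w) (by (bold e))))
      (∣*∣≤ (y (plain e) ℤ.- y (bold e)) (+ idx w ℤ.- + idx (bold e)) (∣-∣≤ (y (plain e)) (y (bold e)) (by _) (by (bold e)))
        (∣-∣≤ (+ idx w) (+ idx (bold e)) (idx≤ w) (idx≤ (bold e))))

    mC≥1 : 1 ℕ.≤ m ℕ.* C
    mC≥1 = ℕₚ.*-mono-≤ {1} (ℕ.>-nonZero⁻¹ m) (ℕₚ.m≤n+m 1 (8 ℕ.* B))

    sg-orient : ∀ v s w → w ≢ inj₂ v → w ≢ inj₁ (π v s) → sg (orient (v , s) w) ≡ sg (D v s w)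
    sg-orient v s w h k = trans (cong sg (orient≡ (v , s) w)) (trans (sg-dom (+ (m ℕ.* C) ℤ.* D v s w) (err (v , s) w)
        (ℕₚ.≤-<-trans (err≤ (v , s) w) (subst (_ ℕ.<_) (sym (ℤₚ.abs-* (+ (m ℕ.* C)) (D v s w)))
          (ℕₚ.<-≤-trans lt (ℕₚ.m≤m*n (m ℕ.* C) (∣ D v s w ∣) {{ℕ.>-nonZero (∣∣≥1 (Step.D≢0 (lev r) (h , k)))}})))))
      (trans (sg-* (+ (m ℕ.* C)) (D v s w)) (trans (cong (ℤ._* sg (D v s w)) (sg-pos (ℤ.+<+ mC≥1))) (ℤₚ.*-identityˡ _))))
      where
      lt : (m ℕ.+ m) ℕ.* (B ℕ.+ B) ℕ.+ (B ℕ.+ B) ℕ.* (m ℕ.+ m) ℕ.< m ℕ.* C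
      lt = subst₂ ℕ._<_ (lem1 m B) (lem2 m B) (ℕₚ.m<m+n (8 ℕ.* (m ℕ.* B)) (ℕ.>-nonZero⁻¹ m))
        where
        lem1 : ∀ m B → 8 ℕ.* (m ℕ.* B) ≡ (m ℕ.+ m) ℕ.* (B ℕ.+ B) ℕ.+ (B ℕ.+ B) ℕ.* (m ℕ.+ m)
        lem1 = ℕR.solve-∀
        lem2 : ∀ m B → 8 ℕ.* (m ℕ.* B) ℕ.+ m ≡ m ℕ.* (8 ℕ.* B ℕ.+ 1)
        lem2 = ℕR.solve-∀

    sg-orient′ : ∀ v s w → sg (orient (v , s) w) ≡ sg (D v s w)
    sg-orient′ v s w with _≟ᵀ_ {W} w (inj₂ v)
    ... | yes refl = trans (cong sg (lem (+ p (inj₁ (π v s)) ℤ.- + p (inj₂ v)) (y (inj₂ v)) (y (inj₁ (π v s)) ℤ.- y (inj₂ v)) (+ p (inj₂ v)))) (cong sg (sym (Step.D-bold (lev r) v s)))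
      where
      lem : ∀ a b c d → a ℤ.* (b ℤ.- b) ℤ.- c ℤ.* (d ℤ.- d) ≡ 0ℤ
      lem = ℤR.solve-∀
    ... | no h with _≟ᵀ_ {W} w (inj₁ (π v s))
    ...   | yes refl = trans (cong sg (lem (+ p (inj₁ (π v s)) ℤ.- + p (inj₂ v)) (y (inj₁ (π v s)) ℤ.- y (inj₂ v)))) (cong sg (sym (Step.D-plain (lev r) v s)))
      where
      lem : ∀ a b → a ℤ.* b ℤ.- b ℤ.* a ≡ 0ℤ
      lem = ℤR.solve-∀
    ...   | no k = sg-orient v s w h k

    planar : Planar Λ
    planar = record
      { W = W ; E = V ⊗ S ; bold = bold ; plain = plain ; p = p ; y = y ; half = halfPoints r
      ; m≡half = points-even r
      ; 1≤m = ℕ.>-nonZero⁻¹ m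
      ; p<Λ = λ w → ℕₚ.+-mono-≤-< (ℕₚ.*-monoʳ-≤ m (ℕₚ.*-monoʳ-≤ C (∣+∣≤ (z w) (+ B) (bz w) ℕₚ.≤-refl))) (Finₚ.toℕ<n (encode W w))
      ; p-inj = p-inj
      ; edge-inj = λ { (v , s) (v , s′) refl e → cong (v ,_) (π-inj v (⊎ₚ.inj₁-injective e)) }
      ; b≢p = λ _ _ ()
      ; orient≢0 = λ { (v , s) w h k e → Step.D≢0 (lev r) (h , k) (sg≡0⇒≡0 (trans (sym (sg-orient v s w h k)) (cong sg e))) }
      ; balanced = λ { (v , s) → trans (∑ᵀ-cong W (sg-orient′ v s)) (bal v s) }
      }

-- Rational vectors, small parameters, and elimination

module RationalVectors where

  import Tactic.RingSolver.Core.AlmostCommutativeRing as ACR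
  open import Tactic.RingSolver using (solve-∀)
  open import Algebra.Bundles using (CommutativeRing)
  open import Data.Nat as ℕ using (ℕ; zero; suc; s≤s; z≤n)
  import Data.Nat.Properties as ℕₚ
  open import Data.Rational using (ℚ; 0ℚ; 1ℚ; ½; _+_; _*_; _-_; -_; _<_; _≤_; ∣_∣; 1/_; _⊓_; NonZero; Positive)
  import Data.Rational as ℚ
  import Data.Rational.Properties as ℚₚ
  open import Data.Fin as Fin using (Fin; zero; suc; punchIn)
  import Data.Fin.Properties as Finₚ
  open import Data.Maybe using (Maybe; just; nothing)
  open import Data.List using (List; []; _∷_; length)
  open import Data.Product using (Σ; ∃-syntax; _×_; _,_; proj₁; proj₂)
  open import Data.Sum using (_⊎_; inj₁; inj₂)
  open import Data.Vec.Functional using (Vector; tail; insertAt) renaming (_∷_ to _∷ᵥ_)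
  open import Function using (_∘_)
  open import Level using (0ℓ)
  open import Relation.Nullary using (Dec; yes; no; contradiction; ¬?; decidable-stable)
  open import Relation.Binary using (tri<; tri≈; tri>)
  open import Relation.Binary.PropositionalEquality

  ℚring : ACR.AlmostCommutativeRing 0ℓ 0ℓ
  ℚring = ACR.fromCommutativeRing ℚₚ.+-*-commutativeRing λ x → decide (0ℚ ℚₚ.≟ x)
    where
    decide : ∀ {x} → Dec (0ℚ ≡ x) → Maybe (0ℚ ≡ x)
    decide (yes p) = just p
    decide (no _)  = nothing

  open import Algebra.Properties.Semiring.Sum (CommutativeRing.semiring ℚₚ.+-*-commutativeRing)
    using (sum; sum-cong-≗; ∑-distrib-+; ∑-comm; *-distribˡ-sum; *-distribʳ-sum; sum-remove; sum-replicate-zero)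

  ≤-by : ∀ {l r} d → 0ℚ ≤ d → l + d ≡ r → l ≤ r
  ≤-by {l} {r} d h e = subst₂ _≤_ (ℚₚ.+-identityʳ l) e (ℚₚ.+-monoʳ-≤ l h)

  <-by : ∀ {l r} d → 0ℚ < d → l + d ≡ r → l < r
  <-by {l} {r} d h e = subst₂ _<_ (ℚₚ.+-identityʳ l) e (ℚₚ.+-monoʳ-< l h)

  <⇒0< : ∀ {l r} → l < r → 0ℚ < r - l
  <⇒0< {l} {r} h = subst (_< r - l) (ℚₚ.+-inverseʳ l) (ℚₚ.+-monoˡ-< (- l) h)

  ≤⇒0≤ : ∀ {l r} → l ≤ r → 0ℚ ≤ r - l
  ≤⇒0≤ {l} {r} h = subst (_≤ r - l) (ℚₚ.+-inverseʳ l) (ℚₚ.+-monoˡ-≤ (- l) h)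

  0<+ : ∀ {a b} → 0ℚ < a → 0ℚ < b → 0ℚ < a + b
  0<+ = ℚₚ.+-mono-<

  0<+≤ : ∀ {a b} → 0ℚ < a → 0ℚ ≤ b → 0ℚ < a + b
  0<+≤ = ℚₚ.+-mono-<-≤

  0≤+ : ∀ {a b} → 0ℚ ≤ a → 0ℚ ≤ b → 0ℚ ≤ a + b
  0≤+ = ℚₚ.+-mono-≤

  0<* : ∀ {a b} → 0ℚ < a → 0ℚ < b → 0ℚ < a * b
  0<* {a} {b} ha hb = subst (_< a * b) (ℚₚ.*-zeroʳ a) (ℚₚ.*-monoʳ-<-pos a {{ℚ.positive ha}} hb)

  0≤* : ∀ {a b} → 0ℚ ≤ a → 0ℚ ≤ b → 0ℚ ≤ a * b
  0≤* {a} {b} ha hb = subst (_≤ a * b) (ℚₚ.*-zeroʳ a) (ℚₚ.*-monoˡ-≤-nonNeg a {{ℚ.nonNegative ha}} hb)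

  *-mono-≤ : ∀ {a b c d} → 0ℚ ≤ a → 0ℚ ≤ d → a ≤ b → c ≤ d → a * c ≤ b * d
  *-mono-≤ {a} {b} {c} {d} ha hd ab cd = ℚₚ.≤-trans (ℚₚ.*-monoˡ-≤-nonNeg a {{ℚ.nonNegative ha}} cd)
    (ℚₚ.*-monoʳ-≤-nonNeg d {{ℚ.nonNegative hd}} ab)

  0<1 : 0ℚ < 1ℚ
  0<1 = ℚₚ.positive⁻¹ 1ℚ

  0<½ : ∀ {a} → 0ℚ < a → 0ℚ < ½ * a
  0<½ = 0<* (ℚₚ.positive⁻¹ ½)

  ½+½ : ∀ a → ½ * a + ½ * a ≡ a
  ½+½ a = trans (sym (ℚₚ.*-distribʳ-+ a ½ ½)) (ℚₚ.*-identityˡ a)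

  ½< : ∀ {a} → 0ℚ < a → ½ * a < a
  ½< {a} h = <-by (½ * a) (0<½ h) (½+½ a)

  ≤∣∣ : ∀ a → a ≤ ∣ a ∣
  ≤∣∣ a with ℚₚ.≤-total 0ℚ a
  ... | inj₁ h = ℚₚ.≤-reflexive (sym (ℚₚ.0≤p⇒∣p∣≡p h))
  ... | inj₂ h = ℚₚ.≤-trans h (ℚₚ.0≤∣p∣ a)

  -≤∣∣ : ∀ a → - a ≤ ∣ a ∣
  -≤∣∣ a = subst (- a ≤_) (ℚₚ.∣-p∣≡∣p∣ a) (≤∣∣ (- a))

  ∣∣≤ : ∀ {a b} → a ≤ b → - a ≤ b → ∣ a ∣ ≤ b
  ∣∣≤ {a} {b} h k with ℚₚ.∣p∣≡p∨∣p∣≡-p a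
  ... | inj₁ e = subst (_≤ b) (sym e) h
  ... | inj₂ e = subst (_≤ b) (sym e) k

  ∣∣< : ∀ {a b} → a < b → - a < b → ∣ a ∣ < b
  ∣∣< {a} {b} h k with ℚₚ.∣p∣≡p∨∣p∣≡-p a
  ... | inj₁ e = subst (_< b) (sym e) h
  ... | inj₂ e = subst (_< b) (sym e) k

  *-≢0 : ∀ {a b} → a ≢ 0ℚ → b ≢ 0ℚ → a * b ≢ 0ℚ
  *-≢0 {a} {b} ha hb e = hb (begin
    b                ≡⟨ ℚₚ.*-identityˡ b ⟨
    1ℚ * b           ≡⟨ cong (_* b) (ℚₚ.*-inverseˡ a) ⟨
    1/ a * a * b     ≡⟨ ℚₚ.*-assoc (1/ a) a b ⟩
    1/ a * (a * b)   ≡⟨ cong (1/ a *_) e ⟩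
    1/ a * 0ℚ        ≡⟨ ℚₚ.*-zeroʳ (1/ a) ⟩
    0ℚ               ∎)
    where
    open ≡-Reasoning
    instance _ = ℚ.≢-nonZero ha

  *-cancel0 : ∀ {a b} → b ≢ 0ℚ → a * b ≡ 0ℚ → a ≡ 0ℚ
  *-cancel0 {a} {b} hb e with a ℚₚ.≟ 0ℚ
  ... | yes p = p
  ... | no  p = contradiction e (*-≢0 p hb)

  -- The formal small parameter: truth for all sufficiently small positive rationals. It is closed
  -- under finite conjunctions and always has a witness, so finitely many requirements can be met by
  -- one number.
  Ev : (ℚ → Set) → Set
  Ev P = ∃[ δ ] (0ℚ < δ × (∀ t → 0ℚ < t → t < δ → P t))

  Ev-always : ∀ {P : ℚ → Set} → (∀ t → 0ℚ < t → P t) → Ev P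
  Ev-always h = 1ℚ , 0<1 , λ t 0<t _ → h t 0<t

  Ev-map : ∀ {P Q : ℚ → Set} → (∀ t → 0ℚ < t → P t → Q t) → Ev P → Ev Q
  Ev-map f (δ , 0<δ , h) = δ , 0<δ , λ t 0<t t<δ → f t 0<t (h t 0<t t<δ)

  Ev-× : ∀ {P Q : ℚ → Set} → Ev P → Ev Q → Ev (λ t → P t × Q t)
  Ev-× (δ , 0<δ , h) (ε , 0<ε , k) = δ ⊓ ε , 0<⊓ , λ t 0<t t< →
    h t 0<t (ℚₚ.<-≤-trans t< (ℚₚ.p⊓q≤p δ ε)) , k t 0<t (ℚₚ.<-≤-trans t< (ℚₚ.p⊓q≤q δ ε))
    where
    0<⊓ : 0ℚ < δ ⊓ ε
    0<⊓ with ℚₚ.⊓-sel δ ε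
    ... | inj₁ e = subst (0ℚ <_) (sym e) 0<δ
    ... | inj₂ e = subst (0ℚ <_) (sym e) 0<ε

  Ev-∀ : ∀ {n} {P : Fin n → ℚ → Set} → (∀ i → Ev (P i)) → Ev (λ t → ∀ i → P i t)
  Ev-∀ {zero}  h = Ev-always λ _ _ ()
  Ev-∀ {suc n} h = Ev-map (λ { t _ (p , q) zero → p ; t _ (p , q) (suc i) → q i }) (Ev-× (h zero) (Ev-∀ (h ∘ suc)))

  Ev-lists : ∀ {N} k {P : List (Fin N) → ℚ → Set} → (∀ xs → length xs ℕ.≤ k → Ev (P xs)) →
    Ev (λ t → ∀ xs → length xs ℕ.≤ k → P xs t)
  Ev-lists zero    h = Ev-map (λ { t _ p [] _ → p }) (h [] z≤n)
  Ev-lists (suc k) h = Ev-map (λ { t _ (p , q) [] _ → p ; t _ (p , q) (x ∷ xs) (s≤s l) → q x xs l })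
    (Ev-× (h [] z≤n) (Ev-∀ λ x → Ev-lists k λ xs l → h (x ∷ xs) (s≤s l)))

  Ev-witness : ∀ {P : ℚ → Set} → Ev P → ∃[ t ] (0ℚ < t × P t)
  Ev-witness (δ , 0<δ , h) = ½ * δ , 0<½ 0<δ , h (½ * δ) (0<½ 0<δ) (½< 0<δ)

  Bounded : (ℚ → ℚ) → Set
  Bounded f = ∃[ B ] Ev (λ t → ∣ f t ∣ ≤ B)

  0<1+∣∣ : ∀ B → 0ℚ < 1ℚ + ∣ B ∣
  0<1+∣∣ B = 0<+≤ 0<1 (ℚₚ.0≤∣p∣ B)

  Ev-small : ∀ {a} B → 0ℚ < a → Ev (λ t → t * (1ℚ + ∣ B ∣) < a)
  Ev-small {a} B 0<a = a * 1/ b , 0<* 0<a (ℚₚ.positive⁻¹ (1/ b) {{ℚₚ.1/pos⇒pos b}}) , λ t _ t< →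
    subst (t * b <_) (trans (ℚₚ.*-assoc a (1/ b) b) (trans (cong (a *_) (ℚₚ.*-inverseˡ b)) (ℚₚ.*-identityʳ a)))
      (ℚₚ.*-monoˡ-<-pos b t<)
    where
    b = 1ℚ + ∣ B ∣
    instance
      b-pos : Positive b
      b-pos = ℚ.positive (0<1+∣∣ B)
      b-nz : NonZero b
      b-nz = ℚₚ.pos⇒nonZero b

  Ev-< : ∀ a → 0ℚ < a → Ev (λ t → t < a)
  Ev-< a 0<a = a , 0<a , λ _ _ h → h

  -- The source of all later sign statements: near 0 a nonzero constant term dominates.
  Ev-pos : ∀ {a f} → 0ℚ < a → Bounded f → Ev (λ t → 0ℚ < a + t * f t)
  Ev-pos {a} {f} 0<a (B , ev) = Ev-map go (Ev-× ev (Ev-small B 0<a))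
    where
    go : ∀ t → 0ℚ < t → ∣ f t ∣ ≤ B × t * (1ℚ + ∣ B ∣) < a → 0ℚ < a + t * f t
    go t 0<t (fB , t<) = subst (0ℚ <_) (lem a t (f t) ∣ B ∣)
      (0<+≤ (0<+ (<⇒0< t<) 0<t) (0≤* (ℚₚ.<⇒≤ 0<t)
        (≤⇒0≤ (ℚₚ.≤-trans (-≤∣∣ (f t)) (ℚₚ.≤-trans fB (≤∣∣ B))))))
      where
      lem : ∀ a t f B → (a - t * (1ℚ + B)) + t + t * (B - - f) ≡ a + t * f
      lem = solve-∀ ℚring

  Bounded-neg : ∀ {f} → Bounded f → Bounded (λ t → - f t)
  Bounded-neg {f} (B , ev) = B , Ev-map (λ t _ h → subst (_≤ B) (sym (ℚₚ.∣-p∣≡∣p∣ (f t))) h) ev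

  Bounded-+ : ∀ {f g} → Bounded f → Bounded g → Bounded (λ t → f t + g t)
  Bounded-+ {f} {g} (B , ev) (C , ew) = B + C , Ev-map (λ t _ (h , k) →
    ℚₚ.≤-trans (ℚₚ.∣p+q∣≤∣p∣+∣q∣ (f t) (g t)) (ℚₚ.+-mono-≤ h k)) (Ev-× ev ew)

  Bounded-* : ∀ {f g} → Bounded f → Bounded g → Bounded (λ t → f t * g t)
  Bounded-* {f} {g} (B , ev) (C , ew) = ∣ B ∣ * ∣ C ∣ , Ev-map (λ t _ (h , k) →
    subst (_≤ ∣ B ∣ * ∣ C ∣) (sym (ℚₚ.∣p*q∣≡∣p∣*∣q∣ (f t) (g t)))
      (*-mono-≤ (ℚₚ.0≤∣p∣ (f t)) (ℚₚ.0≤∣p∣ C) (ℚₚ.≤-trans h (≤∣∣ B)) (ℚₚ.≤-trans k (≤∣∣ C)))) (Ev-× ev ew)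

  Bounded-const : ∀ c → Bounded (λ _ → c)
  Bounded-const c = ∣ c ∣ , Ev-always λ _ _ → ℚₚ.≤-refl

  Bounded-id : Bounded (λ t → t)
  Bounded-id = 1ℚ , Ev-map (λ t 0<t t<1 → ∣∣≤ (ℚₚ.<⇒≤ t<1) (ℚₚ.≤-trans (ℚₚ.neg-antimono-≤ (ℚₚ.<⇒≤ 0<t)) (ℚₚ.<⇒≤ 0<1))) (Ev-< 1ℚ 0<1)

  Bounded-≗ : ∀ {f g} → (∀ t → f t ≡ g t) → Bounded f → Bounded g
  Bounded-≗ e (B , ev) = B , Ev-map (λ t _ h → subst (λ x → ∣ x ∣ ≤ B) (e t) h) ev

  neg⇒pos : ∀ {a} → a < 0ℚ → 0ℚ < - a
  neg⇒pos h = ℚₚ.neg-antimono-< h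

  pos⇒neg : ∀ {a} → 0ℚ < - a → a < 0ℚ
  pos⇒neg {a} h = subst (_< 0ℚ) (lem a) (ℚₚ.neg-antimono-< h)
    where
    lem : ∀ a → - (- a) ≡ a
    lem = solve-∀ ℚring

  Ev-neg : ∀ {a f} → a < 0ℚ → Bounded f → Ev (λ t → a + t * f t < 0ℚ)
  Ev-neg {a} {f} a<0 bf = Ev-map (λ t _ h → pos⇒neg (subst (0ℚ <_) (lem a t (f t)) h))
    (Ev-pos (neg⇒pos a<0) (Bounded-neg bf))
    where
    lem : ∀ a t f → - a + t * - f ≡ - (a + t * f)
    lem = solve-∀ ℚring

  pos≢0 : ∀ {a} → 0ℚ < a → a ≢ 0ℚ
  pos≢0 h e = ℚₚ.<⇒≢ h (sym e)

  neg≢0 : ∀ {a} → a < 0ℚ → a ≢ 0ℚ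
  neg≢0 h e = ℚₚ.<⇒≢ h e

  Ev-≢0 : ∀ {a f} → a ≢ 0ℚ → Bounded f → Ev (λ t → a + t * f t ≢ 0ℚ)
  Ev-≢0 {a} a≢0 bf with ℚₚ.<-cmp a 0ℚ
  ... | tri< h _ _ = Ev-map (λ _ _ → neg≢0) (Ev-neg h bf)
  ... | tri≈ _ e _ = contradiction e a≢0
  ... | tri> _ _ h = Ev-map (λ _ _ → pos≢0) (Ev-pos h bf)

  NonZeroV : ∀ {n} → Vector ℚ n → Set
  NonZeroV f = ∃[ i ] f i ≢ 0ℚ

  zero? : ∀ {n} (f : Vector ℚ n) → NonZeroV f ⊎ (∀ i → f i ≡ 0ℚ)
  zero? f with Finₚ.any? (λ i → ¬? (f i ℚₚ.≟ 0ℚ))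
  ... | yes p = inj₁ p
  ... | no  p = inj₂ λ i → decidable-stable (f i ℚₚ.≟ 0ℚ) λ ne → p (i , ne)

  infix 8 _·_
  opaque
    _·_ : ∀ {n} → Vector ℚ n → Vector ℚ n → ℚ
    f · v = sum λ i → f i * v i

  sum-zero : ∀ {n} {f : Vector ℚ n} → (∀ i → f i ≡ 0ℚ) → sum f ≡ 0ℚ
  sum-zero {n} e = trans (sum-cong-≗ e) (sum-replicate-zero n)

  sum-punch : ∀ {n} p (t : Vector ℚ (suc n)) → sum t ≡ t p + sum (t ∘ punchIn p)
  sum-punch p t = sum-remove {i = p} t

  opaque
    unfolding _·_

    ·-zeroˡ : ∀ {n} {f : Vector ℚ n} v → (∀ i → f i ≡ 0ℚ) → f · v ≡ 0ℚ
    ·-zeroˡ v e = sum-zero λ i → trans (cong (_* v i) (e i)) (ℚₚ.*-zeroˡ (v i))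

    ·-combo : ∀ {n} a b (f g v : Vector ℚ n) → (λ i → a * f i + b * g i) · v ≡ a * (f · v) + b * (g · v)
    ·-combo a b f g v = trans (sum-cong-≗ λ i → lem a b (f i) (g i) (v i))
      (trans (∑-distrib-+ (λ i → a * (f i * v i)) (λ i → b * (g i * v i)))
        (cong₂ _+_ (sym (*-distribˡ-sum a λ i → f i * v i)) (sym (*-distribˡ-sum b λ i → g i * v i))))
      where
      lem : ∀ a b f g v → (a * f + b * g) * v ≡ a * (f * v) + b * (g * v)
      lem = solve-∀ ℚring

    ·-comm : ∀ {n} (f v : Vector ℚ n) → f · v ≡ v · f
    ·-comm f v = sum-cong-≗ λ i → ℚₚ.*-comm (f i) (v i)

    ·-scaleʳ : ∀ {n} t (f v : Vector ℚ n) → f · (λ i → t * v i) ≡ t * (f · v)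
    ·-scaleʳ t f v = trans (sum-cong-≗ λ i → lem (f i) t (v i)) (sym (*-distribˡ-sum t λ i → f i * v i))
      where
      lem : ∀ a t p → a * (t * p) ≡ t * (a * p)
      lem = solve-∀ ℚring

    ·-+ʳ : ∀ {n} (f v w : Vector ℚ n) → f · (λ i → v i + w i) ≡ f · v + f · w
    ·-+ʳ f v w = trans (sum-cong-≗ λ i → ℚₚ.*-distribˡ-+ (f i) (v i) (w i)) (∑-distrib-+ (λ i → f i * v i) (λ i → f i * w i))

    ·-cong : ∀ {n} {f g v w : Vector ℚ n} → (∀ i → f i ≡ g i) → (∀ i → v i ≡ w i) → f · v ≡ g · w
    ·-cong e k = sum-cong-≗ λ i → cong₂ _*_ (e i) (k i)

    ·-sum-def : ∀ {n} (f v : Vector ℚ n) → f · v ≡ sum λ i → f i * v i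
    ·-sum-def f v = refl

    ·-[] : (f v : Vector ℚ 0) → f · v ≡ 0ℚ
    ·-[] f v = refl

    ·-suc : ∀ {n} (f v : Vector ℚ (suc n)) → f · v ≡ f zero * v zero + tail f · tail v
    ·-suc f v = refl

  insertAt-same : ∀ {n} (f : Vector ℚ n) p x → insertAt f p x p ≡ x
  insertAt-same f zero x = refl
  insertAt-same {suc n} f (suc p) x = insertAt-same (tail f) p x

  insertAt-punchIn : ∀ {n} (f : Vector ℚ n) p x j → insertAt f p x (punchIn p j) ≡ f j
  insertAt-punchIn f zero x j = refl
  insertAt-punchIn {suc n} f (suc p) x zero = refl
  insertAt-punchIn {suc n} f (suc p) x (suc j) = insertAt-punchIn (tail f) p x j

  opaque
    unfolding _·_

    ·-insert : ∀ {n} (r : Vector ℚ (suc n)) f p x → r · insertAt f p x ≡ r p * x + (r ∘ punchIn p) · f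
    ·-insert r f p x = trans (sum-punch p (λ i → r i * insertAt f p x i))
      (cong₂ _+_ (cong (r p *_) (insertAt-same f p x)) (sum-cong-≗ λ j → cong (r (punchIn p j) *_) (insertAt-punchIn f p x j)))

    -- Gaussian elimination. A nonzero coefficient of the first equation is the pivot; the remaining
    -- equations are reduced to one unknown less, and `x` is found by back substitution.
    kernel : ∀ k {n} (rows : Fin k → Vector ℚ n) → k ℕ.< n → ∃[ f ] (NonZeroV f × (∀ i → rows i · f ≡ 0ℚ))
    kernel zero {suc n} rows _ = (λ _ → 1ℚ) , (zero , pos≢0 0<1) , λ ()
    kernel (suc k) {suc n} rows (s≤s k<n) with zero? (rows zero)
    ... | inj₂ z = let f , f≢0 , h = kernel k (rows ∘ suc) (ℕₚ.m<n⇒m<1+n k<n) in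
          f , f≢0 , λ { zero → ·-zeroˡ f z ; (suc i) → h i }
    ... | inj₁ (p , rp≢0) = f , (punchIn p j , λ e → *-≢0 rp≢0 gj≢0 (trans (sym (insertAt-punchIn f′ p x j)) e)) , sol
      where
      r : Vector ℚ (suc n)
      r = rows zero
      -- Cross-multiplied, so that the pivot is never inverted; the solution is rescaled by `r p` in
      -- return.
      elim : Fin k → Vector ℚ n
      elim i j = r p * rows (suc i) (punchIn p j) + - rows (suc i) p * r (punchIn p j)
      rec : ∃[ g ] (NonZeroV g × (∀ i → elim i · g ≡ 0ℚ))
      rec = kernel k elim k<n
      g : Vector ℚ n
      g = proj₁ rec
      j : Fin n
      j = proj₁ (proj₁ (proj₂ rec))
      gj≢0 : g j ≢ 0ℚ
      gj≢0 = proj₂ (proj₁ (proj₂ rec))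
      f′ : Vector ℚ n
      f′ j = r p * g j
      x : ℚ
      x = - ((r ∘ punchIn p) · g)
      f : Vector ℚ (suc n)
      f = insertAt f′ p x
      ·-f′ : ∀ (v : Vector ℚ n) → v · f′ ≡ r p * (v · g)
      ·-f′ v = trans (sum-cong-≗ λ j → lem (v j) (r p) (g j)) (sym (*-distribˡ-sum (r p) λ j → v j * g j))
        where
        lem : ∀ v r g → v * (r * g) ≡ r * (v * g)
        lem = solve-∀ ℚring
      sol : ∀ i → rows i · f ≡ 0ℚ
      sol zero = trans (·-insert r f′ p x) (trans (cong (r p * x +_) (·-f′ (r ∘ punchIn p))) (lem (r p) ((r ∘ punchIn p) · g)))
        where
        lem : ∀ a s → a * - s + a * s ≡ 0ℚ
        lem = solve-∀ ℚring
      sol (suc i) = trans (·-insert (rows (suc i)) f′ p x) (trans (cong (rows (suc i) p * x +_) (·-f′ (rows (suc i) ∘ punchIn p)))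
        (trans (lem (rows (suc i) p) ((r ∘ punchIn p) · g) (r p) ((rows (suc i) ∘ punchIn p) · g))
          (trans (sym (·-combo (r p) (- rows (suc i) p) (rows (suc i) ∘ punchIn p) (r ∘ punchIn p) g)) (proj₂ (proj₂ rec) i))))
        where
        lem : ∀ b s a u → b * - s + a * u ≡ a * u + - b * s
        lem = solve-∀ ℚring

    -- A family with a dual family is a basis: the family and one unit vector satisfy a linear
    -- relation by `kernel`, and duality excludes that the unit vector has coefficient 0 in it. The
    -- numbers `γ` do not depend on `g`, so they apply to a whole sequence of approximating
    -- functionals at once.
    coordinates : ∀ {n} (v φ : Fin n → Vector ℚ n) → (∀ i → φ i · v i ≢ 0ℚ) → (∀ i j → i ≢ j → φ i · v j ≡ 0ℚ) →
      ∀ l → Σ (Fin n → ℚ) λ γ → ∀ (g : Vector ℚ n) → g l ≡ sum λ k → γ k * (g · v k)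
    coordinates {n} v φ diag off l = γ , formula
      where
      unit : Vector ℚ n
      unit l′ with l′ Fin.≟ l
      ... | yes _ = 1ℚ
      ... | no  _ = 0ℚ
      unit-l : unit l ≡ 1ℚ
      unit-l with l Fin.≟ l
      ... | yes _ = refl
      ... | no ne = contradiction refl ne
      unit-≢ : ∀ {l′} → l′ ≢ l → unit l′ ≡ 0ℚ
      unit-≢ {l′} ne with l′ Fin.≟ l
      ... | yes e = contradiction e ne
      ... | no _  = refl
      rows : Fin n → Vector ℚ (suc n)
      rows l′ = unit l′ ∷ᵥ λ k → v k l′
      rec : ∃[ f ] (NonZeroV f × (∀ i → rows i · f ≡ 0ℚ))
      rec = kernel n rows (ℕₚ.n<1+n n)
      f : Vector ℚ (suc n)
      f = proj₁ rec
      α : ℚ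
      α = f zero
      β : Vector ℚ n
      β = tail f
      rel : ∀ l′ → unit l′ * α + sum (λ k → v k l′ * β k) ≡ 0ℚ
      rel = proj₂ (proj₂ rec)

      swap : ∀ (g : Vector ℚ n) → sum (λ l′ → g l′ * sum (λ k → v k l′ * β k)) ≡ sum (λ k → β k * (g · v k))
      swap g = begin
        sum (λ l′ → g l′ * sum (λ k → v k l′ * β k))   ≡⟨ sum-cong-≗ (λ l′ → *-distribˡ-sum (g l′) (λ k → v k l′ * β k)) ⟩
        sum (λ l′ → sum (λ k → g l′ * (v k l′ * β k))) ≡⟨ ∑-comm (λ l′ k → g l′ * (v k l′ * β k)) ⟩
        sum (λ k → sum (λ l′ → g l′ * (v k l′ * β k))) ≡⟨ sum-cong-≗ (λ k → trans (sum-cong-≗ λ l′ → lem (g l′) (v k l′) (β k))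
                                                            (sym (*-distribˡ-sum (β k) λ l′ → g l′ * v k l′))) ⟩
        sum (λ k → β k * (g · v k)) ∎
        where
        open ≡-Reasoning
        lem : ∀ a b c → a * (b * c) ≡ c * (a * b)
        lem = solve-∀ ℚring

      sum-single : ∀ (g : Vector ℚ n) → sum (λ l′ → g l′ * unit l′) ≡ g l
      sum-single g = single g unit unit-l unit-≢
        where
        single : ∀ {n} {l : Fin n} (g u : Vector ℚ n) → u l ≡ 1ℚ → (∀ {l′} → l′ ≢ l → u l′ ≡ 0ℚ) → sum (λ l′ → g l′ * u l′) ≡ g l
        single {suc n} {l} g u e h = trans (sum-punch l (λ l′ → g l′ * u l′)) (trans (cong₂ _+_ (trans (cong (g l *_) e) (ℚₚ.*-identityʳ (g l)))
          (sum-zero λ j → trans (cong (g (punchIn l j) *_) (h (Finₚ.punchInᵢ≢i l j))) (ℚₚ.*-zeroʳ (g (punchIn l j))))) (ℚₚ.+-identityʳ (g l)))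

      applied : ∀ (g : Vector ℚ n) → g l * α + sum (λ k → β k * (g · v k)) ≡ 0ℚ
      applied g = begin
        g l * α + sum (λ k → β k * (g · v k))
          ≡⟨ cong₂ (λ a b → a * α + b) (sum-single g) (swap g) ⟨
        sum (λ l′ → g l′ * unit l′) * α + sum (λ l′ → g l′ * sum (λ k → v k l′ * β k))
          ≡⟨ cong (_+ sum (λ l′ → g l′ * sum (λ k → v k l′ * β k))) (*-distribʳ-sum α (λ l′ → g l′ * unit l′)) ⟩
        sum (λ l′ → g l′ * unit l′ * α) + sum (λ l′ → g l′ * sum (λ k → v k l′ * β k))
          ≡⟨ ∑-distrib-+ (λ l′ → g l′ * unit l′ * α) _ ⟨
        sum (λ l′ → g l′ * unit l′ * α + g l′ * sum (λ k → v k l′ * β k))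
          ≡⟨ sum-zero (λ l′ → trans (lem (g l′) (unit l′) α (sum (λ k → v k l′ * β k))) (trans (cong (g l′ *_) (rel l′)) (ℚₚ.*-zeroʳ (g l′)))) ⟩
        0ℚ ∎
        where
        open ≡-Reasoning
        lem : ∀ a b c d → a * b * c + a * d ≡ a * (b * c + d)
        lem = solve-∀ ℚring

      α≢0 : α ≢ 0ℚ
      α≢0 e with proj₁ (proj₂ rec)
      ... | zero , ne = ne e
      ... | suc k , ne = ne (*-cancel0 (diag k) (begin
        β k * (φ k · v k)                           ≡⟨ lemma ⟨
        sum (λ j → β j * (φ k · v j))               ≡⟨ ℚₚ.+-identityˡ _ ⟨
        0ℚ + sum (λ j → β j * (φ k · v j))          ≡⟨ cong (_+ sum (λ j → β j * (φ k · v j))) (trans (cong (φ k l *_) e) (ℚₚ.*-zeroʳ (φ k l))) ⟨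
        φ k l * α + sum (λ j → β j * (φ k · v j))   ≡⟨ applied (φ k) ⟩
        0ℚ                                          ∎))
        where
        open ≡-Reasoning
        single : ∀ {m} (i : Fin m) (t : Vector ℚ m) → (∀ j → i ≢ j → t j ≡ 0ℚ) → sum t ≡ t i
        single {suc m} i t h = trans (sum-punch i t) (trans (cong (t i +_) (sum-zero λ j → h (punchIn i j) (Finₚ.punchInᵢ≢i i j ∘ sym)))
          (ℚₚ.+-identityʳ (t i)))
        lemma : sum (λ j → β j * (φ k · v j)) ≡ β k * (φ k · v k)
        lemma = single k (λ j → β j * (φ k · v j)) λ j ne → trans (cong (β j *_) (off k j ne)) (ℚₚ.*-zeroʳ (β j))

      instance
        α-nz : NonZero α
        α-nz = ℚ.≢-nonZero α≢0

      γ : Vector ℚ n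
      γ k = - (1/ α) * β k

      formula : ∀ g → g l ≡ sum (λ k → γ k * (g · v k))
      formula g = begin
        g l                                                          ≡⟨ lem0 (g l) (1/ α) α S (ℚₚ.*-inverseʳ α) ⟩
        - (1/ α) * S + 1/ α * (g l * α + S)                          ≡⟨ cong (λ x → - (1/ α) * S + 1/ α * x) (applied g) ⟩
        - (1/ α) * S + 1/ α * 0ℚ                                     ≡⟨ cong (- (1/ α) * S +_) (ℚₚ.*-zeroʳ (1/ α)) ⟩
        - (1/ α) * S + 0ℚ                                            ≡⟨ ℚₚ.+-identityʳ _ ⟩
        - (1/ α) * S                                                 ≡⟨ *-distribˡ-sum (- (1/ α)) (λ k → β k * (g · v k)) ⟩
        sum (λ k → - (1/ α) * (β k * (g · v k)))                     ≡⟨ sum-cong-≗ (λ k → sym (ℚₚ.*-assoc (- (1/ α)) (β k) (g · v k))) ⟩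
        sum (λ k → γ k * (g · v k)) ∎
        where
        open ≡-Reasoning
        S : ℚ
        S = sum (λ k → β k * (g · v k))
        lem0 : ∀ x i a s → a * i ≡ 1ℚ → x ≡ - i * s + i * (x * a + s)
        lem0 x i a s e = trans (sym (trans (cong (x *_) e) (ℚₚ.*-identityʳ x))) (lem x i a s)
          where
          lem : ∀ x i a s → x * (a * i) ≡ - i * s + i * (x * a + s)
          lem = solve-∀ ℚring

-- General position by moving points along the moment curve

module Perturbation where

  open RationalVectors
  open import Tactic.RingSolver using (solve-∀)
  open import Algebra.Bundles using (CommutativeRing)
  open import Data.Nat as ℕ using (ℕ; zero; suc; s≤s)
  import Data.Nat.Properties as ℕₚ
  open import Data.Integer using (ℤ; 1ℤ; -1ℤ)
  open import Data.Rational using (ℚ; 0ℚ; 1ℚ; _+_; _*_; _-_; -_; _<_; _≤_; ∣_∣)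
  import Data.Rational.Properties as ℚₚ
  open import Data.Fin as Fin using (Fin; zero; suc; toℕ; fromℕ<)
  import Data.Fin.Properties as Finₚ
  open import Data.List using (List; _∷_; length; filter; lookup)
  import Data.List.Properties as Listₚ
  open import Data.List.Membership.Propositional using (_∈_; lose)
  import Data.List.Membership.Propositional.Properties as ∈ₚ
  open import Data.List.Relation.Unary.Any as Any using (index)
  import Data.List.Relation.Unary.Any.Properties as Anyₚ
  open import Data.Product using (Σ; ∃-syntax; _×_; _,_; proj₁; proj₂)
  open import Data.Sum using (_⊎_; inj₁; inj₂)
  open import Data.Vec.Functional using (Vector; tail; updateAt) renaming (_∷_ to _∷ᵥ_)
  open import Data.Vec.Functional.Properties using (updateAt-updates; updateAt-minimal)
  open import Function using (_∘_)
  open import Relation.Nullary using (¬_; yes; no; contradiction; ¬?)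
  open import Relation.Binary.PropositionalEquality

  open import Algebra.Properties.Semiring.Sum (CommutativeRing.semiring ℚₚ.+-*-commutativeRing)
    using (sum; sum-cong-≗; ∑-distrib-+; *-distribˡ-sum)

  -- Points are moved along small pieces of the moment curve.

  hat : ∀ {d} → Vector ℚ d → Vector ℚ (suc d)
  hat x = 1ℚ ∷ᵥ x

  pw : ∀ {n} → ℚ → Vector ℚ n
  pw t zero    = 1ℚ
  pw t (suc i) = t * pw t i

  move : ∀ {d} → Vector ℚ d → ℚ → Vector ℚ d
  move x t j = x j + t * pw t j

  ·-pw : ∀ {n} (f : Vector ℚ (suc n)) t → f · pw t ≡ f zero + t * (tail f · pw t)
  ·-pw f t = trans (·-suc f (pw t)) (cong₂ _+_ (ℚₚ.*-identityʳ (f zero)) (·-scaleʳ t (tail f) (pw t)))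

  ·-hat : ∀ {d} (f : Vector ℚ (suc d)) x → f · hat x ≡ f zero + tail f · x
  ·-hat f x = trans (·-suc f (hat x)) (cong (_+ tail f · x) (ℚₚ.*-identityʳ (f zero)))

  ·-move : ∀ {d} (f : Vector ℚ (suc d)) x t → f · hat (move x t) ≡ f · hat x + t * (tail f · pw t)
  ·-move f x t = trans (·-hat f (move x t)) (trans (cong (f zero +_) (trans (·-+ʳ (tail f) x (λ j → t * pw t j))
      (cong (tail f · x +_) (·-scaleʳ t (tail f) (pw t)))))
    (trans (sym (ℚₚ.+-assoc (f zero) (tail f · x) (t * (tail f · pw t)))) (cong (_+ t * (tail f · pw t)) (sym (·-hat f x)))))

  Bounded-pw : ∀ {n} (f : Vector ℚ n) → Bounded (λ t → f · pw t)
  Bounded-pw {zero}  f = Bounded-≗ (λ t → sym (·-[] f (pw t))) (Bounded-const 0ℚ)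
  Bounded-pw {suc n} f = Bounded-≗ (λ t → sym (·-pw f t))
    (Bounded-+ (Bounded-const (f zero)) (Bounded-* Bounded-id (Bounded-pw (tail f))))

  -- A nonzero polynomial has no zeros just to the right of 0, since its lowest nonzero coefficient
  -- dominates there.
  Ev-pw≢0 : ∀ {n} (f : Vector ℚ n) → NonZeroV f → Ev (λ t → f · pw t ≢ 0ℚ)
  Ev-pw≢0 {suc n} f (i , fi≢0) with f zero ℚₚ.≟ 0ℚ
  ... | no ne = Ev-map (λ t _ h e → h (trans (sym (·-pw f t)) e)) (Ev-≢0 ne (Bounded-pw (tail f)))
  Ev-pw≢0 {suc n} f (zero , fi≢0)  | yes e = contradiction e fi≢0
  Ev-pw≢0 {suc n} f (suc i , fi≢0) | yes e = Ev-map (λ t 0<t h e′ → *-≢0 (pos≢0 0<t) h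
      (trans (sym (trans (·-pw f t) (trans (cong (_+ t * (tail f · pw t)) e) (ℚₚ.+-identityˡ (t * (tail f · pw t)))))) e′))
    (Ev-pw≢0 (tail f) (i , fi≢0))

  -- Along the curve the functional becomes a polynomial in `t` with constant term `f · hat x` and
  -- further coefficients `tail f`. These cannot all vanish: if the tail is 0, the constant term is
  -- `f zero`.
  Ev-move≢0 : ∀ {d} (f : Vector ℚ (suc d)) x → NonZeroV f → Ev (λ t → f · hat (move x t) ≢ 0ℚ)
  Ev-move≢0 {d} f x f≢0 = Ev-map (λ t _ h e → h (trans (·-pw g t) (trans (sym (·-move f x t)) e))) (Ev-pw≢0 g (g≢0 f≢0))
    where
    g : Vector ℚ (suc d)
    g = (f · hat x) ∷ᵥ tail f
    g≢0 : NonZeroV f → NonZeroV g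
    g≢0 _ with zero? (tail f)
    g≢0 _            | inj₁ (i , ne) = suc i , ne
    g≢0 (suc i , ne) | inj₂ z = contradiction (z i) ne
    g≢0 (zero , ne)  | inj₂ z = zero , λ e → ne (trans (sym (trans (·-hat f x) (trans (cong (f zero +_) (·-zeroˡ x z)) (ℚₚ.+-identityʳ (f zero))))) e)

  module _ {N : ℕ} where

    others : Fin N → List (Fin N) → List (Fin N)
    others i = filter (λ j → ¬? (j Fin.≟ i))

    others⁻ : ∀ {i j xs} → j ∈ others i xs → j ∈ xs × j ≢ i
    others⁻ {i} {j} {xs} j∈ = ∈ₚ.∈-filter⁻ (λ j → ¬? (j Fin.≟ i)) {xs = xs} j∈

    others⁺ : ∀ {i j xs} → j ∈ xs → j ≢ i → j ∈ others i xs
    others⁺ {i} j∈ j≢i = ∈ₚ.∈-filter⁺ (λ j → ¬? (j Fin.≟ i)) j∈ j≢i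

    others-shorter : ∀ {i xs} → i ∈ xs → length (others i xs) ℕ.< length xs
    others-shorter {i} {xs} i∈ = Listₚ.filter-notAll (λ j → ¬? (j Fin.≟ i)) xs (lose i∈ λ ne → ne refl)

  -- Independence of the vectors v i with i in a list, expressed by a dual family.

  module _ {N n : ℕ} where

    Independent : (Fin N → Vector ℚ n) → List (Fin N) → Set
    Independent v xs = ∀ i → i ∈ xs → Σ (Vector ℚ n) λ φ → φ · v i ≢ 0ℚ × (∀ j → j ∈ xs → j ≢ i → φ · v j ≡ 0ℚ)

    vanishing : ∀ (v : Fin N → Vector ℚ n) (xs : List (Fin N)) → length xs ℕ.< n →
      Σ (Vector ℚ n) λ h → NonZeroV h × (∀ j → j ∈ xs → h · v j ≡ 0ℚ)
    vanishing v xs l = let h , h≢0 , z = kernel (length xs) (λ k → v (lookup xs k)) l in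
      h , h≢0 , λ j j∈ → trans (·-comm h (v j)) (trans (cong (λ a → v a · h) (Anyₚ.lookup-index j∈)) (z (index j∈)))

    -- A functional that vanishes on the old vectors but not on the new one is the dual functional
    -- of the new one. The other dual functionals are corrected by multiples of it.
    module Extend (v v′ : Fin N → Vector ℚ n) (i : Fin N) (xs : List (Fin N)) (keep : ∀ {j} → j ≢ i → v′ j ≡ v j)
      (old : Independent v (others i xs)) (h : Vector ℚ n) (h0 : ∀ j → j ∈ others i xs → h · v j ≡ 0ℚ) (hp≢0 : h · v′ i ≢ 0ℚ) where

      p : Vector ℚ n
      p = v′ i

      mix : Vector ℚ n → Vector ℚ n
      mix φ l = (h · p) * φ l + - (φ · p) * h l

      mix-old : ∀ φ {j} → j ∈ xs → j ≢ i → mix φ · v′ j ≡ (h · p) * (φ · v j)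
      mix-old φ {j} j∈ j≢i = trans (cong (mix φ ·_) (keep j≢i)) (trans (·-combo (h · p) (- (φ · p)) φ h (v j))
        (trans (cong (λ q → (h · p) * (φ · v j) + - (φ · p) * q) (h0 j (others⁺ j∈ j≢i))) (lem ((h · p) * (φ · v j)) (- (φ · p)))))
        where
        lem : ∀ a b → a + b * 0ℚ ≡ a
        lem = solve-∀ ℚring

      mix-new : ∀ φ → mix φ · v′ i ≡ 0ℚ
      mix-new φ = trans (·-combo (h · p) (- (φ · p)) φ h p) (lem (h · p) (φ · p))
        where
        lem : ∀ a b → a * b + - b * a ≡ 0ℚ
        lem = solve-∀ ℚring

      old-case : ∀ a → a ∈ xs → a ≢ i → Σ (Vector ℚ n) λ φ → φ · v′ a ≢ 0ℚ × (∀ j → j ∈ xs → j ≢ a → φ · v′ j ≡ 0ℚ)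
      old-case a a∈ a≢i with old a (others⁺ a∈ a≢i)
      ... | φ , ne , z = mix φ , (λ e → *-≢0 hp≢0 ne (trans (sym (mix-old φ a∈ a≢i)) e)) , off
        where
        off : ∀ j → j ∈ xs → j ≢ a → mix φ · v′ j ≡ 0ℚ
        off j j∈ j≢a with j Fin.≟ i
        ... | yes refl = mix-new φ
        ... | no j≢i = trans (mix-old φ j∈ j≢i) (trans (cong ((h · p) *_) (z j (others⁺ j∈ j≢i) j≢a)) (ℚₚ.*-zeroʳ (h · p)))

      extended : Independent v′ xs
      extended a a∈ with a Fin.≟ i
      ... | yes refl = h , hp≢0 , λ j j∈ j≢i → trans (cong (h ·_) (keep j≢i)) (h0 j (others⁺ j∈ j≢i))
      ... | no a≢i = old-case a a∈ a≢i

    Independent-extend : ∀ (v v′ : Fin N → Vector ℚ n) i xs → (∀ {j} → j ≢ i → v′ j ≡ v j) →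
      (¬ i ∈ xs ⊎ i ∈ xs → (¬ i ∈ xs × Independent v xs) ⊎
        (Independent v (others i xs) × Σ (Vector ℚ n) λ h → (∀ j → j ∈ others i xs → h · v j ≡ 0ℚ) × h · v′ i ≢ 0ℚ)) →
      Independent v′ xs
    Independent-extend v v′ i xs keep cases with Any.any? (i Fin.≟_) xs
    ... | yes i∈ = go (cases (inj₂ i∈))
      where
      go : _ → Independent v′ xs
      go (inj₁ (i∉ , _)) = contradiction i∈ i∉
      go (inj₂ (old , h , h0 , hp)) = Extend.extended v v′ i xs keep old h h0 hp
    ... | no i∉ = go (cases (inj₁ i∉))
      where
      go : _ → Independent v′ xs
      go (inj₂ (old , h , h0 , hp)) = Extend.extended v v′ i xs keep old h h0 hp
      go (inj₁ (_ , ind)) a a∈ = let φ , ne , z = ind a a∈ in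
        φ , (λ e → ne (trans (cong (φ ·_) (sym (keep (≢i a∈)))) e)) , λ j j∈ j≢a → trans (cong (φ ·_) (keep (≢i j∈))) (z j j∈ j≢a)
        where
        ≢i : ∀ {j} → j ∈ xs → j ≢ i
        ≢i j∈ refl = i∉ j∈

  module _ {N d : ℕ} where

    Config : Set
    Config = Fin N → Vector ℚ d

    upd : Config → Fin N → ℚ → Config
    upd x i t = updateAt x i λ p → move p t

    upd-same : ∀ x i t → upd x i t i ≡ move (x i) t
    upd-same x i t = updateAt-updates i x

    upd-other : ∀ x {i j} t → j ≢ i → upd x i t j ≡ x j
    upd-other x {i} {j} t j≢i = updateAt-minimal j i x j≢i

    -- Such a condition is kept while the points are brought into general position one at a time.
    Stable : (Config → Set) → Set
    Stable P = ∀ x → P x → ∀ i → Ev (λ t → P (upd x i t))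

    Stable-× : ∀ {P Q} → Stable P → Stable Q → Stable (λ x → P x × Q x)
    Stable-× sP sQ x (p , q) i = Ev-× (sP x p i) (sQ x q i)

    Stable-∀ : ∀ {n} {P : Fin n → Config → Set} → (∀ k → Stable (P k)) → Stable (λ x → ∀ k → P k x)
    Stable-∀ s x p i = Ev-∀ λ k → s k x (p k) i

    Near : Config → ℚ → Config → Set
    Near b ε x = ∀ i j → ∣ x i j - b i j ∣ < ε

    Stable-Near : ∀ b ε → Stable (Near b ε)
    Stable-Near b ε x near i = Ev-∀ λ a → Ev-∀ λ j → go a j
      where
      go : ∀ a j → Ev (λ t → ∣ upd x i t a j - b a j ∣ < ε)
      go a j with a Fin.≟ i
      ... | no  a≢i = Ev-always λ t _ → subst (λ p → ∣ p j - b a j ∣ < ε) (sym (upd-other x t a≢i)) (near a j)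
      ... | yes refl = Ev-map (λ t _ (h , k) → subst (λ p → ∣ p j - b a j ∣ < ε) (sym (upd-same x i t))
              (∣∣< (<-by _ h (lem₁ (x i j) (b i j) ε t (pw t j))) (<-by _ k (lem₂ (x i j) (b i j) ε t (pw t j)))))
            (Ev-× (Ev-pos {ε - (x i j - b i j)} (<⇒0< (ℚₚ.≤-<-trans (≤∣∣ (x i j - b i j)) (near i j))) (Bounded-neg (bd j)))
                  (Ev-pos {ε - - (x i j - b i j)} (<⇒0< (ℚₚ.≤-<-trans (-≤∣∣ (x i j - b i j)) (near i j))) (bd j)))
        where
        bd : ∀ {n} (j : Fin n) → Bounded (λ t → pw t j)
        bd zero    = Bounded-const 1ℚ
        bd (suc j) = Bounded-* Bounded-id (bd j)
        lem₁ : ∀ x b ε t p → (x + t * p - b) + (ε - (x - b) + t * - p) ≡ ε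
        lem₁ = solve-∀ ℚring
        lem₂ : ∀ x b ε t p → - (x + t * p - b) + (ε - - (x - b) + t * p) ≡ ε
        lem₂ = solve-∀ ℚring

    Ind : Config → List (Fin N) → Set
    Ind x = Independent (hat ∘ x)

    GenPos : Config → Set
    GenPos x = ∀ xs → length xs ℕ.≤ suc d → Ind x xs

    private
      GenPos< : ℕ → Config → Set
      GenPos< k x = ∀ xs → length xs ℕ.≤ suc d → (∀ j → j ∈ xs → toℕ j ℕ.< k) → Ind x xs

      -- Only finitely many functionals have to be avoided: for every list of at most `d` indices,
      -- the one that elimination finds vanishing on these points.
      Avoids : Config → Fin N → ℚ → Set
      Avoids x i t = ∀ xs → length xs ℕ.≤ d → (l : length xs ℕ.≤ d) → proj₁ (vanishing (hat ∘ x) xs (s≤s l)) · hat (move (x i) t) ≢ 0ℚ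

      Ev-avoids : ∀ x i → Ev (Avoids x i)
      Ev-avoids x i = Ev-lists d {P = λ xs t → (l : length xs ℕ.≤ d) → proj₁ (vanishing (hat ∘ x) xs (s≤s l)) · hat (move (x i) t) ≢ 0ℚ}
        λ xs l → Ev-map (λ t _ h l′ → subst (λ l → proj₁ (vanishing (hat ∘ x) xs (s≤s l)) · hat (move (x i) t) ≢ 0ℚ) (ℕₚ.≤-irrelevant l l′) h)
          (Ev-move≢0 (proj₁ (vanishing (hat ∘ x) xs (s≤s l))) (x i) (proj₁ (proj₂ (vanishing (hat ∘ x) xs (s≤s l)))))

      module Extension {k} (x : Config) (gpk : GenPos< k x) (i : Fin N) (toℕ-i : toℕ i ≡ k) (t : ℚ) (avoid : Avoids x i t)
        (xs : List (Fin N)) (len : length xs ℕ.≤ suc d) (old : ∀ j → j ∈ xs → toℕ j ℕ.< suc k) where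

        older : ∀ j → j ∈ xs → j ≢ i → toℕ j ℕ.< k
        older j j∈ j≢i = ℕₚ.≤∧≢⇒< (ℕ.s≤s⁻¹ (old j j∈)) λ e → j≢i (Finₚ.toℕ-injective (trans e (sym toℕ-i)))

        without : ¬ i ∈ xs → Ind x xs
        without i∉ = gpk xs len λ j j∈ → older j j∈ λ j≡i → i∉ (subst (_∈ xs) j≡i j∈)

        ly : i ∈ xs → length (others i xs) ℕ.≤ d
        ly i∈ = ℕ.s≤s⁻¹ (ℕₚ.<-≤-trans (others-shorter i∈) len)

        van : (i∈ : i ∈ xs) → Σ (Vector ℚ (suc d)) λ h → NonZeroV h × (∀ j → j ∈ others i xs → h · hat (x j) ≡ 0ℚ)
        van i∈ = vanishing (hat ∘ x) (others i xs) (s≤s (ly i∈))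

        rest : i ∈ xs → Ind x (others i xs)
        rest i∈ = gpk (others i xs) (ℕₚ.≤-trans (ly i∈) (ℕₚ.n≤1+n d)) (λ j j∈ → older j (proj₁ (others⁻ {xs = xs} j∈)) (proj₂ (others⁻ {xs = xs} j∈)))

        off : (i∈ : i ∈ xs) → proj₁ (van i∈) · hat (upd x i t i) ≢ 0ℚ
        off i∈ e = avoid (others i xs) (ly i∈) (ly i∈) (trans (cong (λ p → proj₁ (van i∈) · hat p) (sym (upd-same x i t))) e)

        extension : Ind (upd x i t) xs
        extension = Independent-extend (hat ∘ x) (hat ∘ upd x i t) i xs (λ j≢i → cong hat (upd-other x t j≢i)) cases
          where
          cases : ¬ i ∈ xs ⊎ i ∈ xs → (¬ i ∈ xs × Ind x xs) ⊎ (Ind x (others i xs) ×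
            Σ (Vector ℚ (suc d)) λ h → (∀ j → j ∈ others i xs → h · hat (x j) ≡ 0ℚ) × h · hat (upd x i t i) ≢ 0ℚ)
          cases (inj₁ i∉) = inj₁ (i∉ , without i∉)
          cases (inj₂ i∈) = inj₂ (rest i∈ , proj₁ (van i∈) , proj₂ (proj₂ (van i∈)) , off i∈)

      gp-extend : ∀ {k} (k<N : k ℕ.< N) x → GenPos< k x → ∀ t → Avoids x (fromℕ< k<N) t → GenPos< (suc k) (upd x (fromℕ< k<N) t)
      gp-extend k<N x gpk t avoid xs len old = Extension.extension x gpk (fromℕ< k<N) (Finₚ.toℕ-fromℕ< k<N) t avoid xs len old

      GP-Result : (Config → Set) → ℕ → Set
      GP-Result P k = Σ Config λ x → P x × GenPos< k x

      gp-next : ∀ {P} → Stable P → ∀ {k} (k<N : k ℕ.< N) → GP-Result P k → GP-Result P (suc k)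
      gp-next {P} sP {k} k<N (x , px , gpx) = finish (Ev-witness (Ev-× (sP x px i) (Ev-avoids x i)))
        where
        i : Fin N
        i = fromℕ< k<N
        finish : (∃[ t ] (0ℚ < t × P (upd x i t) × Avoids x i t)) → GP-Result P (suc k)
        finish (t , _ , p , av) = upd x i t , p , gp-extend k<N x gpx t av

      gp-all : ∀ {P} → Stable P → ∀ x → P x → ∀ k → k ℕ.≤ N → GP-Result P k
      gp-all sP x px zero    _   = x , px , λ xs _ none i i∈ → contradiction (none i i∈) λ ()
      gp-all sP x px (suc k) k<N = gp-next sP k<N (gp-all sP x px k (ℕₚ.<⇒≤ k<N))

    abstract
      -- The points are moved in the order of their indices. After `k` moves all short lists among
      -- the first `k` points are independent, and the next move only has to leave finitely many
      -- zero sets.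
      general-position : ∀ {P} → Stable P → ∀ x → P x → Σ Config λ x′ → P x′ × GenPos x′
      general-position sP x px = let x′ , px′ , gp = gp-all sP x px N ℕₚ.≤-refl in
        x′ , px′ , λ xs l → gp xs l λ j _ → Finₚ.toℕ<n j

    -- A hyperplane through the points s, with the other points on prescribed sides.

  data Side : ℤ → ℚ → Set where
    above : ∀ {q} → 0ℚ < q → Side 1ℤ q
    below : ∀ {q} → q < 0ℚ → Side -1ℤ q

  Side-scale : ∀ {σ q a} → 0ℚ < a → Side σ q → Side σ (a * q)
  Side-scale ha (above h) = above (0<* ha h)
  Side-scale {q = q} {a} ha (below h) = below (pos⇒neg (subst (0ℚ <_) (lem a q) (0<* ha (neg⇒pos h))))
    where
    lem : ∀ a q → a * - q ≡ - (a * q)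
    lem = solve-∀ ℚring

  Ev-Side : ∀ {σ a f} → Side σ a → Bounded f → Ev (λ t → Side σ (a + t * f t))
  Ev-Side (above h) b = Ev-map (λ _ _ → above) (Ev-pos h b)
  Ev-Side (below h) b = Ev-map (λ _ _ → below) (Ev-neg h b)

  module _ {N d : ℕ} (s : Fin d → Fin N) (ê : Vector ℚ (suc d)) (σ : Fin N → ℤ) where

    -- Up to nonzero factors, `φ` and `h` form the basis dual to the `d` chosen points and the
    -- direction `ê`. This certifies that the points determine the hyperplane, and `ê` stays fixed
    -- while any of the points moves.
    record Cell (x : Config {N} {d}) : Set where
      field
        φ      : Fin d → Vector ℚ (suc d)
        h      : Vector ℚ (suc d)
        φ-diag : ∀ k → 0ℚ < φ k · hat (x (s k))
        φ-off  : ∀ k j → k ≢ j → φ k · hat (x (s j)) ≡ 0ℚ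
        φ-ê    : ∀ k → φ k · ê ≡ 0ℚ
        h-ê    : h · ê ≢ 0ℚ
        h-on   : ∀ k → h · hat (x (s k)) ≡ 0ℚ
        h-side : ∀ i → (∀ k → s k ≢ i) → Side (σ i) (h · hat (x i))

    -- If a point off the hyperplane moves, `h` is kept and the strict inequality persists. If `s k`
    -- moves to `p`, then `(φ k · p) h - (h · p) φ k` vanishes at `p` and at the other `s j`. It is
    -- close to a positive multiple of `h`, so all sides are kept; the other `φ j` are corrected in
    -- the same way.
    Stable-Cell : Stable Cell
    Stable-Cell x cell i with Finₚ.any? (λ k → s k Fin.≟ i)
    ... | no none = Ev-map build (Ev-Side (h-side i λ k e → none (k , e)) (Bounded-pw (tail h)))
      where
      open Cell cell
      build : ∀ t → 0ℚ < t → Side (σ i) (h · hat (x i) + t * (tail h · pw t)) → Cell (upd x i t)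
      build t _ side = record
        { φ = φ ; h = h
        ; φ-diag = λ k → subst (λ p → 0ℚ < φ k · hat p) (sym (keep k)) (φ-diag k)
        ; φ-off = λ k j k≢j → trans (cong (λ p → φ k · hat p) (keep j)) (φ-off k j k≢j)
        ; φ-ê = φ-ê ; h-ê = h-ê
        ; h-on = λ k → trans (cong (λ p → h · hat p) (keep k)) (h-on k)
        ; h-side = sides
        }
        where
        keep : ∀ k → upd x i t (s k) ≡ x (s k)
        keep k = upd-other x t λ e → none (k , e)
        sides : ∀ a → (∀ k → s k ≢ a) → Side (σ a) (h · hat (upd x i t a))
        sides a a∉ with a Fin.≟ i
        ... | yes refl = subst (Side (σ a)) (trans (sym (·-move h (x a) t)) (cong (λ p → h · hat p) (sym (upd-same x a t)))) side
        ... | no a≢i   = subst (λ p → Side (σ a) (h · hat p)) (sym (upd-other x t a≢i)) (h-side a a∉)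
    ... | yes (k , refl) = Ev-map build (Ev-× (Ev-pos (φ-diag k) (Bounded-pw (tail (φ k)))) (Ev-∀ {P = λ a t → (∀ j → s j ≢ a) → Side (σ a) (new a t)} sides))
      where
      open Cell cell
      u w : ℚ → ℚ
      u t = tail (φ k) · pw t
      w t = tail h · pw t
      α : ℚ
      α = φ k · hat (x (s k))
      -- The value of the updated functional at the point `a`, sorted into the constant term and `t`
      -- times a bounded function.
      new : Fin N → ℚ → ℚ
      new a t = α * (h · hat (x a)) + t * (u t * (h · hat (x a)) + - w t * (φ k · hat (x a)))
      sides : ∀ a → Ev (λ t → (∀ j → s j ≢ a) → Side (σ a) (new a t))
      sides a with Finₚ.any? (λ j → s j Fin.≟ a)
      ... | yes (j , e) = Ev-always λ t _ a∉ → contradiction e (a∉ j)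
      ... | no none = Ev-map (λ t _ h _ → h) (Ev-Side (Side-scale (φ-diag k) (h-side a λ j e → none (j , e)))
        (Bounded-+ (Bounded-* (Bounded-pw (tail (φ k))) (Bounded-const _)) (Bounded-* (Bounded-neg (Bounded-pw (tail h))) (Bounded-const _))))
      build : ∀ t → 0ℚ < t → 0ℚ < α + t * u t × (∀ a → (∀ j → s j ≢ a) → Side (σ a) (new a t)) → Cell (upd x (s k) t)
      build t _ (0<A , sd) = record
        { φ = φ′ ; h = h′
        ; φ-diag = diag
        ; φ-off = off
        ; φ-ê = φ′-ê
        ; h-ê = λ e → *-≢0 A≢0 h-ê (trans (sym (trans (·-combo A (- (h · p)) h (φ k) ê)
            (trans (cong (λ q → A * (h · ê) + - (h · p) * q) (φ-ê k)) (lem0 (A * (h · ê)) (- (h · p)))))) e)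
        ; h-on = on
        ; h-side = λ a a∉ → subst (Side (σ a)) (side≡ a (λ e → a∉ k (sym e))) (sd a a∉)
        }
        where
        x′ : Config
        x′ = upd x (s k) t
        p : Vector ℚ (suc d)
        p = hat (x′ (s k))
        A : ℚ
        A = φ k · p
        A≡ : A ≡ α + t * u t
        A≡ = trans (cong (λ q → φ k · hat q) (upd-same x (s k) t)) (·-move (φ k) (x (s k)) t)
        hp≡ : h · p ≡ t * w t
        hp≡ = trans (cong (λ q → h · hat q) (upd-same x (s k) t)) (trans (·-move h (x (s k)) t)
          (trans (cong (_+ t * w t) (h-on k)) (ℚₚ.+-identityˡ (t * w t))))
        A≢0 : A ≢ 0ℚ
        A≢0 = pos≢0 (subst (0ℚ <_) (sym A≡) 0<A)
        lem0 : ∀ a b → a + b * 0ℚ ≡ a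
        lem0 = solve-∀ ℚring
        cross : ∀ a b → a * b + - b * a ≡ 0ℚ
        cross = solve-∀ ℚring
        h′ : Vector ℚ (suc d)
        h′ l = A * h l + - (h · p) * φ k l
        φ′ : Fin d → Vector ℚ (suc d)
        φ′ j with j Fin.≟ k
        ... | yes _ = φ k
        ... | no _  = λ l → A * φ j l + - (φ j · p) * φ k l
        away : ∀ {j} → j ≢ k → x′ (s j) ≡ x (s j)
        away {j} j≢k = upd-other x t λ e → pos≢0 (φ-diag k) (trans (cong (λ i → φ k · hat (x i)) (sym e)) (φ-off k j (j≢k ∘ sym)))
        at : ∀ (f : Vector ℚ (suc d)) {j} → j ≢ k → (λ l → A * f l + - (f · p) * φ k l) · hat (x′ (s j)) ≡ A * (f · hat (x (s j)))
        at f {j} j≢k = trans (cong (λ q → (λ l → A * f l + - (f · p) * φ k l) · hat q) (away j≢k))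
          (trans (·-combo A (- (f · p)) f (φ k) (hat (x (s j))))
            (trans (cong (λ q → A * (f · hat (x (s j))) + - (f · p) * q) (φ-off k j (j≢k ∘ sym))) (lem0 (A * (f · hat (x (s j)))) (- (f · p)))))
        diag : ∀ j → 0ℚ < φ′ j · hat (x′ (s j))
        diag j with j Fin.≟ k
        ... | yes refl = subst (0ℚ <_) (sym A≡) 0<A
        ... | no j≢k = subst (0ℚ <_) (sym (at (φ j) j≢k)) (0<* (subst (0ℚ <_) (sym A≡) 0<A) (φ-diag j))
        off : ∀ i j → i ≢ j → φ′ i · hat (x′ (s j)) ≡ 0ℚ
        off i j i≢j with i Fin.≟ k
        ... | yes refl = trans (cong (λ q → φ i · hat q) (away (i≢j ∘ sym))) (φ-off i j i≢j)
        ... | no i≢k with j Fin.≟ k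
        ...   | yes refl = trans (·-combo A (- (φ i · p)) (φ i) (φ k) p) (cross A (φ i · p))
        ...   | no j≢k = trans (at (φ i) j≢k) (trans (cong (A *_) (φ-off i j i≢j)) (ℚₚ.*-zeroʳ A))
        φ′-ê : ∀ j → φ′ j · ê ≡ 0ℚ
        φ′-ê j with j Fin.≟ k
        ... | yes _ = φ-ê k
        ... | no _  = trans (·-combo A (- (φ j · p)) (φ j) (φ k) ê) (trans (cong₂ (λ a b → A * a + - (φ j · p) * b) (φ-ê j) (φ-ê k)) (lem A (- (φ j · p))))
          where
          lem : ∀ a b → a * 0ℚ + b * 0ℚ ≡ 0ℚ
          lem = solve-∀ ℚring
        on : ∀ j → h′ · hat (x′ (s j)) ≡ 0ℚ
        on j with j Fin.≟ k
        ... | yes refl = trans (·-combo A (- (h · p)) h (φ k) p) (cross A (h · p))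
        ... | no j≢k = trans (at h j≢k) (trans (cong (A *_) (h-on j)) (ℚₚ.*-zeroʳ A))
        side≡ : ∀ a → a ≢ s k → new a t ≡ h′ · hat (x′ a)
        side≡ a a≢ = sym (trans (cong (λ q → h′ · hat q) (upd-other x t a≢)) (trans (·-combo A (- (h · p)) h (φ k) (hat (x a)))
          (trans (cong₂ (λ A B → A * (h · hat (x a)) + - B * (φ k · hat (x a))) A≡ hp≡)
            (lem α t (u t) (w t) (h · hat (x a)) (φ k · hat (x a))))))
          where
          lem : ∀ α t u w ha fa → (α + t * u) * ha + - (t * w) * fa ≡ α * ha + t * (u * ha + - w * fa)
          lem = solve-∀ ℚring

-- Integers inside ℚ, sides, and interpolation by dual bases

module Interpolation where

  open FiniteTypes
  open RationalVectors
  open Perturbation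
  open import Tactic.RingSolver using (solve-∀)
  open import Algebra.Bundles using (CommutativeRing)
  open import Data.Nat using (zero; suc; s≤s; z≤n)
  import Data.Nat.Properties as ℕₚ
  import Data.Nat.Coprimality as C
  open import Data.Integer as ℤ using (ℤ; +[1+_]; +0; -[1+_]; 0ℤ; 1ℤ)
  import Data.Integer.Properties as ℤₚ
  open import Data.Rational using (ℚ; mkℚ; 0ℚ; 1ℚ; _+_; _*_; _-_; -_; _<_; _≤_; ∣_∣; 1/_; *<*; *≤*)
  import Data.Rational as ℚ
  import Data.Rational.Properties as ℚₚ
  import Data.Rational.Unnormalised as ℚᵘ
  import Data.Rational.Unnormalised.Properties as ℚᵘₚ
  open import Data.Fin as Fin using (Fin; zero; suc)
  import Data.Fin.Properties as Finₚ
  open import Data.List using (List; tabulate)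
  import Data.List.Properties as Listₚ
  import Data.List.Membership.Propositional.Properties as ∈ₚ
  open import Data.Product using (Σ; _×_; _,_; proj₁; proj₂)
  open import Data.Vec.Functional using (Vector; tail) renaming (_∷_ to _∷ᵥ_)
  open import Function using (_∘_; Injective)
  open import Relation.Nullary using (contradiction)
  open import Relation.Binary.PropositionalEquality

  open import Algebra.Properties.Semiring.Sum (CommutativeRing.semiring ℚₚ.+-*-commutativeRing)
    using (sum; sum-cong-≗; ∑-comm; *-distribˡ-sum)

  -- Already in lowest terms, so that its numerator is visible; `/1≡ι` connects it with division by
  -- 1.
  ι : ℤ → ℚ
  ι i = mkℚ i 0 (C.sym (C.1-coprimeTo ℤ.∣ i ∣))

  /1≡ι : ∀ i → i ℚ./ 1 ≡ ι i
  /1≡ι i = ℚₚ.↥p/↧p≡p (ι i)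

  ι-+ : ∀ i j → ι (i ℤ.+ j) ≡ ι i + ι j
  ι-+ i j = ℚₚ.toℚᵘ-injective (ℚᵘₚ.≃-trans (ℚᵘ.*≡* (cong (ℤ._* 1ℤ) (sym (cong₂ ℤ._+_ (ℤₚ.*-identityʳ i) (ℤₚ.*-identityʳ j)))))
    (ℚᵘₚ.≃-sym (ℚₚ.toℚᵘ-homo-+ (ι i) (ι j))))

  ι-* : ∀ i j → ι (i ℤ.* j) ≡ ι i * ι j
  ι-* i j = ℚₚ.toℚᵘ-injective (ℚᵘₚ.≃-trans (ℚᵘ.*≡* refl) (ℚᵘₚ.≃-sym (ℚₚ.toℚᵘ-homo-* (ι i) (ι j))))

  ι-neg : ∀ i → ι (ℤ.- i) ≡ - ι i
  ι-neg i = ℚₚ.toℚᵘ-injective (ℚᵘₚ.≃-trans (ℚᵘ.*≡* refl) (ℚᵘₚ.≃-sym (ℚₚ.toℚᵘ-homo‿- (ι i))))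

  ι-- : ∀ i j → ι (i ℤ.- j) ≡ ι i - ι j
  ι-- i j = trans (ι-+ i (ℤ.- j)) (cong (ι i +_) (ι-neg j))

  ι-< : ∀ {i j} → i ℤ.< j → ι i < ι j
  ι-< {i} {j} h = *<* (subst₂ ℤ._<_ (sym (ℤₚ.*-identityʳ i)) (sym (ℤₚ.*-identityʳ j)) h)

  ι-≤ : ∀ {i j} → i ℤ.≤ j → ι i ≤ ι j
  ι-≤ {i} {j} h = *≤* (subst₂ ℤ._≤_ (sym (ℤₚ.*-identityʳ i)) (sym (ℤₚ.*-identityʳ j)) h)

  ι≢0 : ∀ {i} → i ≢ 0ℤ → ι i ≢ 0ℚ
  ι≢0 h e = h (cong ℚ.numerator e)

  Side-ι : ∀ i → i ≢ 0ℤ → Side (sg i) (ι i)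
  Side-ι +0       h = contradiction refl h
  Side-ι +[1+ n ] h = above (ι-< (ℤ.+<+ (s≤s z≤n)))
  Side-ι -[1+ n ] h = below (ι-< ℤ.-<+)

  sgq : ℚ → ℤ
  sgq (mkℚ i _ _) = sg i

  Side-sgq : ∀ {q} → q ≢ 0ℚ → Side (sgq q) q
  Side-sgq {q@(mkℚ +0       n c)} h = contradiction (ℚₚ.↥p≡0⇒p≡0 q refl) h
  Side-sgq {mkℚ +[1+ m ] n c} h = above (ℚₚ.positive⁻¹ _)
  Side-sgq {mkℚ -[1+ m ] n c} h = below (ℚₚ.negative⁻¹ _)

  Side-neg : ∀ {σ q} → Side σ q → Side (ℤ.- σ) (- q)
  Side-neg (above h) = below (ℚₚ.neg-antimono-< h)
  Side-neg (below h) = above (neg⇒pos h)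

  Side-* : ∀ {σ τ p q} → Side σ p → Side τ q → Side (σ ℤ.* τ) (p * q)
  Side-* (above h) k = subst (λ i → Side i _) (sym (ℤₚ.*-identityˡ _)) (Side-scale h k)
  Side-* {p = p} {q} (below h) k = subst₂ Side (sym (ℤₚ.-1*i≡-i _)) (lem p q) (Side-neg (Side-scale (neg⇒pos h) k))
    where
    lem : ∀ p q → - (- p * q) ≡ p * q
    lem = solve-∀ ℚring

  opaque
    unfolding _·_

    ·-sum : ∀ {m n} (c : Fin m → ℚ) (φ : Fin m → Vector ℚ n) (v : Vector ℚ n) →
      (λ l → sum λ k → c k * φ k l) · v ≡ sum λ k → c k * (φ k · v)
    ·-sum c φ v = begin
      sum (λ l → sum (λ k → c k * φ k l) * v l)      ≡⟨ sum-cong-≗ (λ l → trans (ℚₚ.*-comm _ (v l)) (*-distribˡ-sum (v l) (λ k → c k * φ k l))) ⟩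
      sum (λ l → sum (λ k → v l * (c k * φ k l)))    ≡⟨ ∑-comm (λ l k → v l * (c k * φ k l)) ⟩
      sum (λ k → sum (λ l → v l * (c k * φ k l)))    ≡⟨ sum-cong-≗ (λ k → trans (sum-cong-≗ λ l → lem (v l) (c k) (φ k l))
                                                          (sym (*-distribˡ-sum (c k) (λ l → φ k l * v l)))) ⟩
      sum (λ k → c k * sum (λ l → φ k l * v l))      ∎
      where
      open ≡-Reasoning
      lem : ∀ a b c → a * (b * c) ≡ b * (c * a)
      lem = solve-∀ ℚring

  -- The point with coordinates `c` and `k` in the frame with origin `o` and axes towards `a` and
  -- `e`. All lifted points have this form, so a functional is known on them from its values at the
  -- atoms.
  affine : ∀ {d} → Vector ℚ d → Vector ℚ d → Vector ℚ d → ℚ → ℚ → Vector ℚ d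
  affine o a e c k l = o l + (c * (a l + -1ℚ * o l) + k * (e l + -1ℚ * o l))
    where -1ℚ = - 1ℚ

  ·-affine : ∀ {d} (f : Vector ℚ (suc d)) o a e c k →
    f · hat (affine o a e c k) ≡ f · hat o + (c * (f · hat a - f · hat o) + k * (f · hat e - f · hat o))
  ·-affine {d} f o a e c k = begin
    f · hat (affine o a e c k)
      ≡⟨ ·-hat f (affine o a e c k) ⟩
    f zero + g · affine o a e c k
      ≡⟨ cong (f zero +_) (trans (·-+ʳ g o _) (cong (g · o +_) (trans (·-+ʳ g _ _)
           (cong₂ _+_ (trans (·-scaleʳ c g _) (cong (c *_) (diff a))) (trans (·-scaleʳ k g _) (cong (k *_) (diff e))))))) ⟩
    f zero + (g · o + (c * (g · a + - 1ℚ * (g · o)) + k * (g · e + - 1ℚ * (g · o))))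
      ≡⟨ lem (f zero) (g · o) (g · a) (g · e) c k ⟩
    (f zero + g · o) + (c * ((f zero + g · a) - (f zero + g · o)) + k * ((f zero + g · e) - (f zero + g · o)))
      ≡⟨ cong₂ _+_ (sym (·-hat f o)) (cong₂ _+_ (cong (c *_) (cong₂ _-_ (sym (·-hat f a)) (sym (·-hat f o))))
           (cong (k *_) (cong₂ _-_ (sym (·-hat f e)) (sym (·-hat f o))))) ⟩
    f · hat o + (c * (f · hat a - f · hat o) + k * (f · hat e - f · hat o)) ∎
    where
    open ≡-Reasoning
    g : Vector ℚ d
    g = tail f
    diff : ∀ a → g · (λ l → a l + - 1ℚ * o l) ≡ g · a + - 1ℚ * (g · o)
    diff a = trans (·-+ʳ g a (λ l → - 1ℚ * o l)) (cong (g · a +_) (·-scaleʳ (- 1ℚ) g o))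
    lem : ∀ z o a e c k → z + (o + (c * (a + - 1ℚ * o) + k * (e + - 1ℚ * o)))
      ≡ (z + o) + (c * ((z + a) - (z + o)) + k * ((z + e) - (z + o)))
    lem = solve-∀ ℚring

  Dual : ∀ {n} → (Fin n → Vector ℚ n) → Set
  Dual {n} v = Σ (Fin n → Vector ℚ n) λ φ → (∀ i → φ i · v i ≢ 0ℚ) × (∀ i j → i ≢ j → φ i · v j ≡ 0ℚ)

  tuple-dual : ∀ {N d} (x : Config {N} {d}) → GenPos x → (s : Fin (suc d) → Fin N) → Injective _≡_ _≡_ s → Dual (hat ∘ x ∘ s)
  tuple-dual {N} {d} x gp s inj = (λ k → proj₁ (ind k)) , (λ k → proj₁ (proj₂ (ind k))) ,
    λ i j i≢j → proj₂ (proj₂ (ind i)) (s j) (∈ₚ.∈-tabulate⁺ {f = s} j) λ e → i≢j (sym (inj e))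
    where
    ind : ∀ k → Σ (Vector ℚ (suc d)) λ φ → φ · hat (x (s k)) ≢ 0ℚ × (∀ j → _ → j ≢ s k → φ · hat (x j) ≡ 0ℚ)
    ind k = gp (tabulate s) (ℕₚ.≤-reflexive (Listₚ.length-tabulate s)) (s k) (∈ₚ.∈-tabulate⁺ {f = s} k)

  sum-single : ∀ {n} (i : Fin n) (t : Vector ℚ n) → (∀ j → i ≢ j → t j ≡ 0ℚ) → sum t ≡ t i
  sum-single {suc n} i t h = trans (sum-punch i t) (trans (cong (t i +_) (sum-zero λ j → h (Fin.punchIn i j) (Finₚ.punchInᵢ≢i i j ∘ sym)))
    (ℚₚ.+-identityʳ (t i)))

  interpolate : ∀ {n} {v : Fin n → Vector ℚ n} → Dual v → (a : Fin n → ℚ) → Σ (Vector ℚ n) λ f → ∀ k → f · v k ≡ a k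
  interpolate {n} {v} (φ , diag , off) a = (λ l → sum λ k → c k * φ k l) , λ j → trans (·-sum c φ (v j))
    (trans (sum-single j (λ k → c k * (φ k · v j)) λ k j≢k → trans (cong (c k *_) (off k j (j≢k ∘ sym))) (ℚₚ.*-zeroʳ (c k))) (value j))
    where
    inv : Fin n → ℚ
    inv k = (1/ (φ k · v k)) {{ℚ.≢-nonZero (diag k)}}
    c : Fin n → ℚ
    c k = a k * inv k
    value : ∀ j → c j * (φ j · v j) ≡ a j
    value j = trans (ℚₚ.*-assoc (a j) (inv j) (φ j · v j)) (trans (cong (a j *_) (ℚₚ.*-inverseˡ (φ j · v j) {{ℚ.≢-nonZero (diag j)}})) (ℚₚ.*-identityʳ (a j)))

  Dual-zero : ∀ {n} {v : Fin n → Vector ℚ n} → Dual v → ∀ f → (∀ k → f · v k ≡ 0ℚ) → ∀ w → f · w ≡ 0ℚ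
  Dual-zero {v = v} (φ , diag , off) f z w = ·-zeroˡ w λ l → let γ , formula = coordinates v φ diag off l in
    trans (formula f) (sum-zero λ k → trans (cong (γ k *_) (z k)) (ℚₚ.*-zeroʳ (γ k)))

-- Lifting planar halving edges to hyperplanes in dimension d

module Lifting where

  open FiniteTypes
  open Levels using (gap; ∑sg-gap+2; 4x+2≥2)
  open PlanarSets using (Planar)
  open RationalVectors
  open Perturbation
  open Interpolation
  open import Tactic.RingSolver using (solve-∀)
  import Data.Integer.Tactic.RingSolver as ℤR
  open import Data.Nat as ℕ using (ℕ; zero; suc; s≤s; z≤n)
  import Data.Nat.Properties as ℕₚ
  open import Data.Integer as ℤ using (ℤ; 0ℤ; 1ℤ; -1ℤ)
  import Data.Integer.Properties as ℤₚ
  open import Data.Rational using (ℚ; 0ℚ; 1ℚ; _+_; _*_; _-_; -_; _<_; _≤_; ∣_∣)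
  import Data.Rational.Properties as ℚₚ
  open import Data.Fin as Fin using (Fin; zero; suc; toℕ)
  open import Data.Fin.Patterns using (0F; 1F)
  open import Data.Product using (Σ; ∃-syntax; _×_; _,_; proj₁; proj₂)
  open import Data.Sum using (_⊎_; inj₁; inj₂)
  import Data.Sum.Properties as ⊎ₚ
  open import Data.Vec.Functional using (Vector) renaming (_∷_ to _∷ᵥ_)
  open import Function using (_∘_; Injective)
  open import Relation.Nullary using (¬_; Dec; yes; no; contradiction)
  open import Relation.Binary.PropositionalEquality

  -- Tilts of the classes of B-points, alternating from `-1` on. Over `κ` classes they sum to 0 or
  -- `-1`; in the second case the central point supplies the missing 1.
  alt : ℕ → ℤ
  alt zero    = -1ℤ
  alt (suc k) = ℤ.- alt k

  parity : ℕ → ℕ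
  parity zero          = 0
  parity (suc zero)    = 1
  parity (suc (suc k)) = parity k

  alt≢0 : ∀ k → alt k ≢ 0ℤ
  alt≢0 zero    ()
  alt≢0 (suc k) e = alt≢0 k (ℤₚ.neg-injective {alt k} {0ℤ} e)

  sg-alt : ∀ k → sg (alt k) ≡ alt k
  sg-alt zero    = refl
  sg-alt (suc k) = trans (sg-neg (alt k)) (cong ℤ.-_ (sg-alt k))

  ∑-alt : ∀ κ → ∑F {κ} (λ k → alt (toℕ k)) ℤ.+ ℤ.+ parity κ ≡ 0ℤ
  ∑-alt zero          = refl
  ∑-alt (suc zero)    = refl
  ∑-alt (suc (suc κ)) = trans (lem (∑F {κ} λ k → ℤ.- (ℤ.- alt (toℕ k))) (ℤ.+ parity κ))
    (trans (cong (λ r → r ℤ.+ ℤ.+ parity κ) (∑F-cong {κ} λ k → ℤₚ.neg-involutive (alt (toℕ k)))) (∑-alt κ))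
    where
    lem : ∀ x p → -1ℤ ℤ.+ (1ℤ ℤ.+ x) ℤ.+ p ≡ x ℤ.+ p
    lem = ℤR.solve-∀

  -- The dimension is `κ + 2`. The atoms are an origin, a transversal point, and one point for every
  -- row and every B-point. `Ix` lists one member of each antipodal pair, and for odd `κ` one
  -- central point is added.
  module Build {Λ : ℕ} (κ : ℕ) (Pl : Planar Λ) (Row : Ty) (β rest : ℕ) (offset : El Row → ℕ) where
    open Planar Pl

    d odd : ℕ
    d   = suc (suc κ)
    odd = parity κ

    Bt At Ix Pt : Ty
    Bt = (fin κ ⊗ fin β) ⊕ fin rest
    At = fin 2 ⊕ (Row ⊕ Bt)
    Ix  = (Row ⊗ W) ⊕ Bt
    Pt = (Ix ⊗ fin 2) ⊕ fin odd

    atO atE : El At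
    atO = inj₁ 0F
    atE = inj₁ 1F

    atom : El Ix → El At
    atom (inj₁ (ρ , w)) = inj₂ (inj₁ ρ)
    atom (inj₂ q)       = inj₂ (inj₂ q)

    pos : El Row → El W → ℕ
    pos ρ w = suc (offset ρ ℕ.+ p w)

    coef : El Ix → ℚ
    coef (inj₁ (ρ , w)) = ι (ℤ.+ pos ρ w)
    coef (inj₂ q)       = 1ℚ

    height : El Ix → ℚ
    height (inj₁ (ρ , w)) = ι (y w)
    height (inj₂ q)       = 0ℚ

    -- Which way the antipode is moved off the central hyperplane.
    tilt : El Ix → ℤ
    tilt (inj₁ (ρ , w))          = gap (toℕ (encode W w)) half ℤ.+ ℤ.+ 2
    tilt (inj₂ (inj₁ (k , i)))   = alt (toℕ k)
    tilt (inj₂ (inj₂ r))         = 1ℤ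

    tilt≢0 : ∀ j → tilt j ≢ 0ℤ
    tilt≢0 (inj₁ (ρ , w)) e = contradiction (subst (λ i → 2 ℕ.≤ ℤ.∣ i ∣) e (4x+2≥2 (ℤ.+ toℕ (encode W w) ℤ.- ℤ.+ half))) λ ()
    tilt≢0 (inj₂ (inj₁ (k , i))) = alt≢0 (toℕ k)
    tilt≢0 (inj₂ (inj₂ r)) ()

    1≤coef : ∀ j → 0ℚ < coef j
    1≤coef (inj₁ (ρ , w)) = ι-< (ℤ.+<+ (s≤s z≤n))
    1≤coef (inj₂ q) = 0<1

    -- A hyperplane is chosen by a row, an edge of the planar set and one B-point of each class.
    Choice : Set
    Choice = El Row × El E × (Fin κ → Fin β)

    selected : Choice → Fin d → El Pt
    selected (ρ , e , bs) zero          = inj₁ (inj₁ (ρ , bold e) , 0F)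
    selected (ρ , e , bs) (suc zero)    = inj₁ (inj₁ (ρ , plain e) , 0F)
    selected (ρ , e , bs) (suc (suc k)) = inj₁ (inj₂ (inj₁ (k , bs k)) , 0F)

    module Place (x : El At → Vector ℚ d) where

      -- The planar heights enter at order `η²`, the tilts of the antipodes at order `η`. Atoms off
      -- the limit hyperplane are therefore decided without either, and antipodes of atoms on it by
      -- their tilts alone.
      place : ℚ → El Pt → Vector ℚ d
      place η (inj₁ (j , 0F)) = affine (x atO) (x (atom j)) (x atE) (coef j) (η * η * height j)
      place η (inj₁ (j , 1F)) = affine (x atO) (x (atom j)) (x atE) (- coef j) (η * ι (tilt j))
      place η (inj₂ _)        = affine (x atO) (x atE) (x atE) 0ℚ η

      ê : Vector ℚ (suc d)
      ê l = hat (x atE) l + - 1ℚ * hat (x atO) l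

      opaque
        unfolding _·_
        ·-ê : ∀ f → f · ê ≡ f · hat (x atE) - f · hat (x atO)
        ·-ê f = trans (·-+ʳ f (hat (x atE)) (λ l → - 1ℚ * hat (x atO) l))
          (cong (f · hat (x atE) +_) (trans (·-scaleʳ (- 1ℚ) f (hat (x atO))) (lem (f · hat (x atO)))))
          where
          lem : ∀ a → - 1ℚ * a ≡ - a
          lem = solve-∀ ℚring

    module Hyper (x : El At → Vector ℚ d)
      (gp : ∀ (t : Fin (suc d) → El At) → Injective _≡_ _≡_ t → Dual (hat ∘ x ∘ t))
      (ch : Choice) where
      open Place x

      ρ : El Row
      ρ = proj₁ ch
      e : El E
      e = proj₁ (proj₂ ch)
      bs : Fin κ → Fin β
      bs = proj₂ (proj₂ ch)

      sel : El At → Set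
      sel a = (a ≡ inj₂ (inj₁ ρ)) ⊎ ∃[ k ] (a ≡ inj₂ (inj₂ (inj₁ (k , bs k))))

      sel? : ∀ a → Dec (sel a)
      sel? (inj₁ i) = no λ { (inj₁ ()) ; (inj₂ ()) }
      sel? (inj₂ (inj₁ ρ′)) with _≟ᵀ_ {Row} ρ′ ρ
      ... | yes refl = yes (inj₁ refl)
      ... | no ne = no λ { (inj₁ refl) → ne refl }
      sel? (inj₂ (inj₂ (inj₁ (k , i)))) with i Fin.≟ bs k
      ... | yes refl = yes (inj₂ (k , refl))
      ... | no ne = no λ { (inj₂ (k , refl)) → ne refl }
      sel? (inj₂ (inj₂ (inj₂ r))) = no λ { (inj₁ ()) ; (inj₂ ()) }

      basis : El At → Fin (suc d) → El At
      basis a zero                = atO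
      basis a (suc zero)          = a
      basis a (suc (suc zero))    = inj₂ (inj₁ ρ)
      basis a (suc (suc (suc k))) = inj₂ (inj₂ (inj₁ (k , bs k)))

      basis-inj : ∀ a → a ≢ atO → ¬ sel a → Injective _≡_ _≡_ (basis a)
      basis-inj a a≢o ns {zero} {zero} eq = refl
      basis-inj a a≢o ns {zero} {suc zero} eq = contradiction (sym eq) a≢o
      basis-inj a a≢o ns {zero} {suc (suc zero)} ()
      basis-inj a a≢o ns {zero} {suc (suc (suc k))} ()
      basis-inj a a≢o ns {suc (suc zero)} {zero} ()
      basis-inj a a≢o ns {suc (suc (suc k))} {zero} ()
      basis-inj a a≢o ns {suc (suc zero)} {suc (suc (suc k))} ()
      basis-inj a a≢o ns {suc (suc (suc k))} {suc (suc zero)} ()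
      basis-inj a a≢o ns {suc zero} {zero} eq = contradiction eq a≢o
      basis-inj a a≢o ns {suc zero} {suc zero} eq = refl
      basis-inj a a≢o ns {suc zero} {suc (suc zero)} eq = contradiction (inj₁ eq) ns
      basis-inj a a≢o ns {suc zero} {suc (suc (suc k))} eq = contradiction (inj₂ (k , eq)) ns
      basis-inj a a≢o ns {suc (suc zero)} {suc zero} eq = contradiction (inj₁ (sym eq)) ns
      basis-inj a a≢o ns {suc (suc zero)} {suc (suc zero)} eq = refl
      basis-inj a a≢o ns {suc (suc (suc k))} {suc zero} eq = contradiction (inj₂ (k , sym eq)) ns
      basis-inj a a≢o ns {suc (suc (suc k))} {suc (suc (suc k′))} eq = cong (λ i → suc (suc (suc i)))
        (cong proj₁ (⊎ₚ.inj₁-injective (⊎ₚ.inj₂-injective (⊎ₚ.inj₂-injective eq))))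

      ¬sel-e : ¬ sel atE
      ¬sel-e (inj₁ ())
      ¬sel-e (inj₂ ())

      F : Vector ℚ (suc d) → El At → ℚ
      F f a = f · hat (x a)

      functional : (o e r : ℚ) (q : Fin κ → ℚ) → Σ (Vector ℚ (suc d)) λ f →
        F f atO ≡ o × F f atE ≡ e × F f (inj₂ (inj₁ ρ)) ≡ r × (∀ k → F f (inj₂ (inj₂ (inj₁ (k , bs k)))) ≡ q k)
      functional o e r q = proj₁ int , proj₂ int zero , proj₂ int (suc zero) , proj₂ int (suc (suc zero)) , λ k → proj₂ int (suc (suc (suc k)))
        where
        target : Fin (suc d) → ℚ
        target zero                = o
        target (suc zero)          = e
        target (suc (suc zero))    = r
        target (suc (suc (suc k))) = q k
        int : Σ (Vector ℚ (suc d)) λ f → ∀ k → f · hat (x (basis atE k)) ≡ target k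
        int = interpolate (gp (basis atE) (basis-inj atE (λ ()) ¬sel-e)) target

      pb pu yb yu Δp Δy : ℚ
      pb = ι (ℤ.+ pos ρ (bold e))
      pu = ι (ℤ.+ pos ρ (plain e))
      yb = ι (y (bold e))
      yu = ι (y (plain e))
      Δp = pu - pb
      Δy = yu - yb

      Δpℤ : ℤ
      Δpℤ = ℤ.+ pos ρ (plain e) ℤ.- ℤ.+ pos ρ (bold e)

      Δp≡ : Δp ≡ ι Δpℤ
      Δp≡ = sym (ι-- (ℤ.+ pos ρ (plain e)) (ℤ.+ pos ρ (bold e)))

      Δpℤ≢0 : Δpℤ ≢ 0ℤ
      Δpℤ≢0 eq = b≢p e e (sym (p-inj (plain e) (bold e) 0 0 (cong (ℕ._+ m ℕ.* 0)
        (ℕₚ.+-cancelˡ-≡ (offset ρ) _ _ (ℕₚ.suc-injective (ℤₚ.+-injective (ℤₚ.i-j≡0⇒i≡j (ℤ.+ pos ρ (plain e)) (ℤ.+ pos ρ (bold e)) eq)))))))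

      δ : ℤ
      δ = sg Δpℤ

      Side-Δp : Side δ Δp
      Side-Δp = subst (Side δ) (sym Δp≡) (Side-ι Δpℤ Δpℤ≢0)

      Δp≢0 : Δp ≢ 0ℚ
      Δp≢0 eq = ι≢0 Δpℤ≢0 (trans (sym Δp≡) eq)

      abstract
        -- The limit hyperplane at `η = 0`: through the origin, the row and the chosen B-points. Its
        -- value at the transversal point is `Δp`, because there the planar determinant multiplies
        -- heights by `Δp`.
        h0s : Σ (Vector ℚ (suc d)) λ f → F f atO ≡ 0ℚ × F f atE ≡ Δp × F f (inj₂ (inj₁ ρ)) ≡ 0ℚ ×
          (∀ k → F f (inj₂ (inj₂ (inj₁ (k , bs k)))) ≡ 0ℚ)
        h0s = functional 0ℚ Δp 0ℚ (λ _ → 0ℚ)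

      -- The planar determinant of the edge evaluated at the point (0, 0).
      κ₀ : ℚ
      κ₀ = Δy * pb - yb * Δp

      abstract
        -- The second-order correction. Along the row it is affine with constant term `κ₀` and slope
        -- `- Δy`; added to `Δp` times the height this is the planar determinant. It vanishes at the
        -- chosen B-points, which thus stay on the hyperplane.
        h1s : Σ (Vector ℚ (suc d)) λ f → F f atO ≡ κ₀ × F f atE ≡ κ₀ × F f (inj₂ (inj₁ ρ)) ≡ κ₀ - Δy ×
          (∀ k → F f (inj₂ (inj₂ (inj₁ (k , bs k)))) ≡ 0ℚ)
        h1s = functional κ₀ κ₀ (κ₀ - Δy) (λ _ → 0ℚ)

      h0 h1 : Vector ℚ (suc d)
      h0 = proj₁ h0s
      h1 = proj₁ h1s

      h0-sel : ∀ a → sel a → F h0 a ≡ 0ℚ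
      h0-sel a (inj₁ refl)       = proj₁ (proj₂ (proj₂ (proj₂ h0s)))
      h0-sel a (inj₂ (k , refl)) = proj₂ (proj₂ (proj₂ (proj₂ h0s))) k

      -- Otherwise `h0` would vanish at `d + 1` atoms in general position, hence everywhere, whereas
      -- its value at `atE` is `Δp`.
      h0≢0 : ∀ a → a ≢ atO → ¬ sel a → F h0 a ≢ 0ℚ
      h0≢0 a a≢o ns eq = Δp≢0 (trans (sym (proj₁ (proj₂ (proj₂ h0s)))) (Dual-zero (gp (basis a) (basis-inj a a≢o ns)) h0 kills (hat (x atE))))
        where
        kills : ∀ k → h0 · hat (x (basis a k)) ≡ 0ℚ
        kills zero                = proj₁ (proj₂ h0s)
        kills (suc zero)          = eq
        kills (suc (suc zero))    = h0-sel _ (inj₁ refl)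
        kills (suc (suc (suc k))) = h0-sel _ (inj₂ (k , refl))

      hη : ℚ → Vector ℚ (suc d)
      hη η l = 1ℚ * h0 l + (η * η) * h1 l

      F-hη : ∀ η a → F (hη η) a ≡ F h0 a + (η * η) * F h1 a
      F-hη η a = trans (·-combo 1ℚ (η * η) h0 h1 (hat (x a))) (cong (_+ (η * η) * F h1 a) (ℚₚ.*-identityˡ (F h0 a)))

      F-hη-o : ∀ η → F (hη η) atO ≡ (η * η) * κ₀
      F-hη-o η = trans (F-hη η atO) (trans (cong₂ (λ a b → a + (η * η) * b) (proj₁ (proj₂ h0s)) (proj₁ (proj₂ h1s))) (ℚₚ.+-identityˡ ((η * η) * κ₀)))

      F-hη-e : ∀ η → F (hη η) atE ≡ Δp + (η * η) * κ₀
      F-hη-e η = trans (F-hη η atE) (cong₂ (λ a b → a + (η * η) * b) (proj₁ (proj₂ (proj₂ h0s))) (proj₁ (proj₂ (proj₂ h1s))))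

      val : ∀ η a c k → hη η · hat (affine (x atO) (x a) (x atE) c k) ≡
        (η * η) * κ₀ + (c * ((F h0 a + (η * η) * F h1 a) - (η * η) * κ₀) + k * ((Δp + (η * η) * κ₀) - (η * η) * κ₀))
      val η a c k = trans (·-affine (hη η) (x atO) (x a) (x atE) c k)
        (trans (cong₂ (λ o a → o + (c * (a - o) + k * (F (hη η) atE - o))) (F-hη-o η) (F-hη η a))
          (cong (λ e → (η * η) * κ₀ + (c * ((F h0 a + (η * η) * F h1 a) - (η * η) * κ₀) + k * (e - (η * η) * κ₀))) (F-hη-e η)))

      C⁺ C⁻ : El Ix → ℚ
      C⁺ j = κ₀ + (coef j * (F h1 (atom j) - κ₀) + height j * Δp)
      C⁻ j = κ₀ + - coef j * (F h1 (atom j) - κ₀)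

      val⁺ : ∀ η j → hη η · hat (place η (inj₁ (j , 0F))) ≡ coef j * F h0 (atom j) + η * (η * C⁺ j)
      val⁺ η j = trans (val η (atom j) (coef j) (η * η * height j)) (lem η κ₀ (coef j) (F h0 (atom j)) (F h1 (atom j)) (height j) Δp)
        where
        lem : ∀ η k c a b y D → (η * η) * k + (c * ((a + (η * η) * b) - (η * η) * k) + η * η * y * ((D + (η * η) * k) - (η * η) * k))
          ≡ c * a + η * (η * (k + (c * (b - k) + y * D)))
        lem = solve-∀ ℚring

      val⁻ : ∀ η j → hη η · hat (place η (inj₁ (j , 1F))) ≡ - (coef j * F h0 (atom j)) + η * (ι (tilt j) * Δp + η * C⁻ j)
      val⁻ η j = trans (val η (atom j) (- coef j) (η * ι (tilt j))) (lem η κ₀ (coef j) (F h0 (atom j)) (F h1 (atom j)) (ι (tilt j)) Δp)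
        where
        lem : ∀ η k c a b y D → (η * η) * k + (- c * ((a + (η * η) * b) - (η * η) * k) + η * y * ((D + (η * η) * k) - (η * η) * k))
          ≡ - (c * a) + η * (y * D + η * (k + - c * (b - k)))
        lem = solve-∀ ℚring

      val-centre : ∀ η i → hη η · hat (place η (inj₂ i)) ≡ η * (Δp + η * κ₀)
      val-centre η i = trans (val η atE 0ℚ η) (lem η κ₀ (F h0 atE) (F h1 atE) Δp)
        where
        lem : ∀ η k a b D → (η * η) * k + (0ℚ * ((a + (η * η) * b) - (η * η) * k) + η * ((D + (η * η) * k) - (η * η) * k)) ≡ η * (D + η * k)
        lem = solve-∀ ℚring

      -- The constants in `h0s` and `h1s` are made for this identity. The displacement of the row by
      -- `offset` drops out because only differences of positions occur.
      C⁺-row : ∀ w → C⁺ (inj₁ (ρ , w)) ≡ ι (orient e w)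
      C⁺-row w = trans (cong (λ b → κ₀ + (pw′ * (b - κ₀) + yw * Δp)) (proj₁ (proj₂ (proj₂ (proj₂ h1s)))))
        (trans (lem pw′ yw pb pu yb yu) (trans (cong₂ _-_ (cong₂ _*_ (dp (plain e)) (sym (ι-- (y w) (y (bold e))))) (cong₂ _*_ (sym (ι-- (y (plain e)) (y (bold e)))) (dp w)))
          (sym (trans (ι-- (A ℤ.* B) (Cz ℤ.* Dz)) (cong₂ _-_ (ι-* A B) (ι-* Cz Dz))))))
        where
        pw′ yw : ℚ
        pw′ = ι (ℤ.+ pos ρ w)
        yw = ι (y w)
        A B Cz Dz : ℤ
        A = ℤ.+ p (plain e) ℤ.- ℤ.+ p (bold e)
        B = y w ℤ.- y (bold e)
        Cz = y (plain e) ℤ.- y (bold e)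
        Dz = ℤ.+ p w ℤ.- ℤ.+ p (bold e)
        dp : ∀ w → ι (ℤ.+ pos ρ w) - pb ≡ ι (ℤ.+ p w ℤ.- ℤ.+ p (bold e))
        dp w = trans (sym (ι-- (ℤ.+ pos ρ w) (ℤ.+ pos ρ (bold e)))) (cong ι (lemℤ (ℤ.+ offset ρ) (ℤ.+ p w) (ℤ.+ p (bold e))))
          where
          lemℤ : ∀ o a b → (1ℤ ℤ.+ (o ℤ.+ a)) ℤ.- (1ℤ ℤ.+ (o ℤ.+ b)) ≡ a ℤ.- b
          lemℤ = ℤR.solve-∀
        lem : ∀ pw yw pb pu yb yu → let k = (yu - yb) * pb - yb * (pu - pb) in
          k + (pw * ((k - (yu - yb)) - k) + yw * (pu - pb)) ≡ (pu - pb) * (yw - yb) - (yu - yb) * (pw - pb)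
        lem = solve-∀ ℚring

      pick : ∀ {a} → Dec (sel a) → ℤ → ℤ → ℤ
      pick (yes _) i j = i
      pick (no _)  i j = j

      pick-yes : ∀ {a} (d : Dec (sel a)) i j → sel a → pick d i j ≡ i
      pick-yes (yes _) i j s = refl
      pick-yes (no ns) i j s = contradiction s ns

      pick-no : ∀ {a} (d : Dec (sel a)) i j → ¬ sel a → pick d i j ≡ j
      pick-no (yes s) i j ns = contradiction s ns
      pick-no (no _)  i j ns = refl

      inRow : El Ix → ℤ
      inRow (inj₁ (_ , w)) = sg (orient e w)
      inRow (inj₂ q)       = 0ℤ

      side : El At → ℤ
      side a = sgq (F h0 a)

      σ : El Pt → ℤ
      σ (inj₁ (j , 0F)) = pick (sel? (atom j)) (inRow j) (side (atom j))
      σ (inj₁ (j , 1F)) = pick (sel? (atom j)) (sg (tilt j) ℤ.* δ) (ℤ.- side (atom j))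
      σ (inj₂ _)        = δ

      atom≢o : ∀ j → atom j ≢ atO
      atom≢o (inj₁ _) ()
      atom≢o (inj₂ _) ()

      Side-base : ∀ j → ¬ sel (atom j) → Side (side (atom j)) (coef j * F h0 (atom j))
      Side-base j ns = Side-scale (1≤coef j) (Side-sgq (h0≢0 (atom j) (atom≢o j) ns))

      kill : ∀ c {a} b → a ≡ 0ℚ → c * a + b ≡ b
      kill c b refl = trans (cong (_+ b) (ℚₚ.*-zeroʳ c)) (ℚₚ.+-identityˡ b)

      kill⁻ : ∀ c {a} b → a ≡ 0ℚ → - (c * a) + b ≡ b
      kill⁻ c b refl = trans (cong (λ x → - x + b) (ℚₚ.*-zeroʳ c)) (ℚₚ.+-identityˡ b)

      linear : ∀ c → Bounded (λ η → η * c)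
      linear c = Bounded-* Bounded-id (Bounded-const c)

      -- Off the selected atoms the term of order 1 decides. On the selected row it is 0, and the
      -- term of order `η²` is a planar determinant, nonzero away from the two ends of the edge.
      ev⁺ : ∀ j (d : Dec (sel (atom j))) → (∀ k → selected ch k ≢ inj₁ (j , 0F)) →
        Ev (λ η → Side (pick d (inRow j) (side (atom j))) (hη η · hat (place η (inj₁ (j , 0F)))))
      ev⁺ j (no ns) _ = Ev-map (λ η _ → subst (Side (side (atom j))) (sym (val⁺ η j))) (Ev-Side (Side-base j ns) (linear (C⁺ j)))
      ev⁺ j@(inj₁ (.ρ , w)) (yes s@(inj₁ refl)) off = Ev-always λ η 0<η →
        subst (Side (sg (orient e w))) (sym (trans (val⁺ η j) (trans (kill (coef j) (η * (η * C⁺ j)) (h0-sel (atom j) s)) (cong (λ c → η * (η * c)) (C⁺-row w)))))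
          (Side-scale 0<η (Side-scale 0<η (Side-ι (orient e w) (orient≢0 e w (λ { refl → off zero refl }) (λ { refl → off (suc zero) refl })))))
      ev⁺ (inj₁ (_ , w)) (yes (inj₂ (k , ()))) off
      ev⁺ (inj₂ q) (yes (inj₁ ())) off
      ev⁺ (inj₂ .(inj₁ (k , bs k))) (yes (inj₂ (k , refl))) off = contradiction refl (off (suc (suc k)))

      -- At a selected atom the term of order 1 vanishes, and the tilt, at order `η`, outweighs
      -- everything of order `η²`.
      ev⁻ : ∀ j (d : Dec (sel (atom j))) →
        Ev (λ η → Side (pick d (sg (tilt j) ℤ.* δ) (ℤ.- side (atom j))) (hη η · hat (place η (inj₁ (j , 1F)))))
      ev⁻ j (no ns) = Ev-map (λ η _ → subst (Side (ℤ.- side (atom j))) (sym (val⁻ η j)))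
        (Ev-Side (Side-neg (Side-base j ns)) (Bounded-+ (Bounded-const (ι (tilt j) * Δp)) (linear (C⁻ j))))
      ev⁻ j (yes s) = Ev-map (λ η 0<η sd → subst (Side (sg (tilt j) ℤ.* δ))
          (sym (trans (val⁻ η j) (kill⁻ (coef j) (η * (ι (tilt j) * Δp + η * C⁻ j)) (h0-sel (atom j) s)))) (Side-scale 0<η sd))
        (Ev-Side (Side-* (Side-ι (tilt j) (tilt≢0 j)) Side-Δp) (Bounded-const (C⁻ j)))

      ev-side : ∀ P → (∀ k → selected ch k ≢ P) → Ev (λ η → Side (σ P) (hη η · hat (place η P)))
      ev-side (inj₁ (j , 0F)) off = ev⁺ j (sel? (atom j)) off
      ev-side (inj₁ (j , 1F)) off = ev⁻ j (sel? (atom j))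
      ev-side (inj₂ i) off = Ev-map (λ η 0<η sd → subst (Side δ) (sym (val-centre η i)) (Side-scale 0<η sd))
        (Ev-Side Side-Δp (Bounded-const κ₀))

      pair : El Ix → ℤ
      pair j = σ (inj₁ (j , 0F)) ℤ.+ (σ (inj₁ (j , 1F)) ℤ.+ 0ℤ)

      pair-no : ∀ j → ¬ sel (atom j) → pair j ≡ 0ℤ
      pair-no j ns = trans (cong₂ (λ a b → a ℤ.+ (b ℤ.+ 0ℤ)) (pick-no (sel? (atom j)) _ _ ns) (pick-no (sel? (atom j)) _ _ ns)) (lem (side (atom j)))
        where
        lem : ∀ a → a ℤ.+ (ℤ.- a ℤ.+ 0ℤ) ≡ 0ℤ
        lem = ℤR.solve-∀

      pair-yes : ∀ j → sel (atom j) → pair j ≡ inRow j ℤ.+ δ ℤ.* sg (tilt j)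
      pair-yes j s = trans (cong₂ (λ a b → a ℤ.+ (b ℤ.+ 0ℤ)) (pick-yes (sel? (atom j)) _ _ s) (pick-yes (sel? (atom j)) _ _ s))
        (cong (λ a → inRow j ℤ.+ a) (trans (ℤₚ.+-identityʳ _) (ℤₚ.*-comm (sg (tilt j)) δ)))

      -- Indices below `half` are tilted to one side and the remaining `half` indices to the other.
      ∑-tilt : ∑ᵀ W (λ w → sg (tilt (inj₁ (ρ , w)))) ≡ 0ℤ
      ∑-tilt = trans (sym (∑F-encode W (λ i → sg (gap (toℕ i) half ℤ.+ ℤ.+ 2)))) (trans (∑sg-gap+2 m half (subst (half ℕ.≤_) (sym m≡half) (ℕₚ.m≤m+n half half)))
        (trans (cong (λ n → ℤ.+ n ℤ.- ℤ.+ 2 ℤ.* ℤ.+ half) m≡half) (lem (ℤ.+ half))))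
        where
        lem : ∀ h → (h ℤ.+ h) ℤ.- ℤ.+ 2 ℤ.* h ≡ 0ℤ
        lem = ℤR.solve-∀

      ∑-row : ∑ᵀ (Row ⊗ W) (pair ∘ inj₁) ≡ 0ℤ
      ∑-row = trans (∑ᵀ-single Row ρ λ ρ′ ne → ∑ᵀ-zero W λ w → pair-no (inj₁ (ρ′ , w)) λ { (inj₁ refl) → ne refl })
        (trans (∑ᵀ-cong W λ w → pair-yes (inj₁ (ρ , w)) (inj₁ refl)) (trans (∑ᵀ-+ W (sg ∘ orient e) (λ w → δ ℤ.* sg (tilt (inj₁ (ρ , w)))))
          (trans (cong₂ ℤ._+_ (balanced e) (trans (∑ᵀ-* W δ (λ w → sg (tilt (inj₁ (ρ , w))))) (trans (cong (δ ℤ.*_) ∑-tilt) (ℤₚ.*-zeroʳ δ)))) refl)))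

      ∑-B : ∑ᵀ Bt (pair ∘ inj₂) ≡ δ ℤ.* ∑F {κ} (λ k → alt (toℕ k))
      ∑-B = trans (cong₂ ℤ._+_
          (trans (∑F-cong {κ} λ k → trans (∑F-single (bs k) λ i ne → pair-no (inj₂ (inj₁ (k , i))) λ { (inj₁ ()) ; (inj₂ (_ , refl)) → ne refl })
            (trans (pair-yes (inj₂ (inj₁ (k , bs k))) (inj₂ (k , refl))) (trans (ℤₚ.+-identityˡ _) (cong (δ ℤ.*_) (sg-alt (toℕ k))))))
            (∑F-* δ (λ (k : Fin κ) → alt (toℕ k))))
          (∑ᵀ-zero (fin rest) λ r → pair-no (inj₂ (inj₂ r)) λ { (inj₁ ()) ; (inj₂ (_ , ())) })) (ℤₚ.+-identityʳ _)

      -- Pairs off the hyperplane cancel. The selected row contributes the planar balance and its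
      -- tilts, each 0; the antipodes of the chosen B-points contribute alternating signs, completed
      -- by the central point when `κ` is odd.
      ∑σ : ∑ᵀ Pt σ ≡ 0ℤ
      ∑σ = trans (cong₂ ℤ._+_ (cong₂ ℤ._+_ ∑-row ∑-B) (∑F-const odd δ))
        (trans (lem δ (∑F {κ} (λ k → alt (toℕ k))) (ℤ.+ odd)) (trans (cong (δ ℤ.*_) (∑-alt κ)) (ℤₚ.*-zeroʳ δ)))
        where
        lem : ∀ δ a p → (0ℤ ℤ.+ δ ℤ.* a) ℤ.+ p ℤ.* δ ≡ δ ℤ.* (a ℤ.+ p)
        lem = ℤR.solve-∀

      valφ : ∀ f η j → F f atE ≡ F f atO → f · hat (place η (inj₁ (j , 0F))) ≡ F f atO + coef j * (F f (atom j) - F f atO)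
      valφ f η j eo = trans (·-affine f (x atO) (x (atom j)) (x atE) (coef j) (η * η * height j))
        (trans (cong (λ e → F f atO + (coef j * (F f (atom j) - F f atO) + η * η * height j * (e - F f atO))) eo)
          (lem (F f atO) (coef j) (F f (atom j)) (η * η * height j)))
        where
        lem : ∀ o c a k → o + (c * (a - o) + k * (o - o)) ≡ o + c * (a - o)
        lem = solve-∀ ℚring

      unit : Fin κ → Fin κ → ℚ
      unit k j with k Fin.≟ j
      ... | yes _ = 1ℚ
      ... | no _  = 0ℚ

      unit-same : ∀ k → unit k k ≡ 1ℚ
      unit-same k with k Fin.≟ k
      ... | yes _ = refl
      ... | no ne = contradiction refl ne

      unit-other : ∀ {k j} → k ≢ j → unit k j ≡ 0ℚ
      unit-other {k} {j} ne with k Fin.≟ j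
      ... | yes eq = contradiction eq ne
      ... | no _   = refl

      -- With these values at the origin and at the row, the first two functionals take on the row
      -- the values `Δp * (pu - pos)` and `Δp * (pos - pb)`. The factor `Δp` makes the diagonal
      -- entries the square of `Δp`, positive whichever end of the edge comes first.
      φo φr : Fin d → ℚ
      φo zero          = pu * Δp
      φo (suc zero)    = - (pb * Δp)
      φo (suc (suc k)) = 0ℚ
      φr zero          = pu * Δp - Δp
      φr (suc zero)    = - (pb * Δp) + Δp
      φr (suc (suc k)) = 0ℚ
      φq : Fin d → Fin κ → ℚ
      φq zero          = λ _ → 0ℚ
      φq (suc zero)    = λ _ → 0ℚ
      φq (suc (suc k)) = unit k

      abstract
        φs : ∀ k → Σ (Vector ℚ (suc d)) λ f → F f atO ≡ φo k × F f atE ≡ φo k × F f (inj₂ (inj₁ ρ)) ≡ φr k ×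
          (∀ j → F f (inj₂ (inj₂ (inj₁ (j , bs j)))) ≡ φq k j)
        φs k = functional (φo k) (φo k) (φr k) (φq k)

      φ : Fin d → Vector ℚ (suc d)
      φ k = proj₁ (φs k)

      φ-eo : ∀ k → F (φ k) atE ≡ F (φ k) atO
      φ-eo k = trans (proj₁ (proj₂ (proj₂ (φs k)))) (sym (proj₁ (proj₂ (φs k))))

      φ-row : ∀ k η w → φ k · hat (place η (inj₁ (inj₁ (ρ , w) , 0F))) ≡ φo k + ι (ℤ.+ pos ρ w) * (φr k - φo k)
      φ-row k η w = trans (valφ (φ k) η (inj₁ (ρ , w)) (φ-eo k))
        (cong₂ (λ o r → o + ι (ℤ.+ pos ρ w) * (r - o)) (proj₁ (proj₂ (φs k))) (proj₁ (proj₂ (proj₂ (proj₂ (φs k))))))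

      φ-B : ∀ k η j → φ k · hat (place η (inj₁ (inj₂ (inj₁ (j , bs j)) , 0F))) ≡ φq k j
      φ-B k η j = trans (valφ (φ k) η (inj₂ (inj₁ (j , bs j))) (φ-eo k))
        (trans (lem (F (φ k) atO) (F (φ k) (inj₂ (inj₂ (inj₁ (j , bs j)))))) (proj₂ (proj₂ (proj₂ (proj₂ (φs k)))) j))
        where
        lem : ∀ o a → o + 1ℚ * (a - o) ≡ a
        lem = solve-∀ ℚring

      0<Δp² : 0ℚ < Δp * Δp
      0<Δp² = go Side-Δp
        where
        go : ∀ {δ} → Side δ Δp → 0ℚ < Δp * Δp
        go (above h) = 0<* h h
        go (below h) = subst (0ℚ <_) (lem Δp) (0<* (neg⇒pos h) (neg⇒pos h))
          where
          lem : ∀ a → - a * - a ≡ a * a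
          lem = solve-∀ ℚring

      φ-diag : ∀ η k → 0ℚ < φ k · hat (place η (selected ch k))
      φ-diag η zero       = subst (0ℚ <_) (sym (trans (φ-row zero η (bold e)) (lem pb pu))) 0<Δp²
        where
        lem : ∀ pb pu → let D = pu - pb in pu * D + pb * ((pu * D - D) - pu * D) ≡ D * D
        lem = solve-∀ ℚring
      φ-diag η (suc zero) = subst (0ℚ <_) (sym (trans (φ-row (suc zero) η (plain e)) (lem pb pu))) 0<Δp²
        where
        lem : ∀ pb pu → let D = pu - pb in - (pb * D) + pu * ((- (pb * D) + D) - - (pb * D)) ≡ D * D
        lem = solve-∀ ℚring
      φ-diag η (suc (suc k)) = subst (0ℚ <_) (sym (trans (φ-B (suc (suc k)) η k) (unit-same k))) 0<1

      φ-off : ∀ η k j → k ≢ j → φ k · hat (place η (selected ch j)) ≡ 0ℚ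
      φ-off η zero zero ne = contradiction refl ne
      φ-off η zero (suc zero) _ = trans (φ-row zero η (plain e)) (lem pb pu)
        where
        lem : ∀ pb pu → let D = pu - pb in pu * D + pu * ((pu * D - D) - pu * D) ≡ 0ℚ
        lem = solve-∀ ℚring
      φ-off η zero (suc (suc j)) _ = φ-B zero η j
      φ-off η (suc zero) zero _ = trans (φ-row (suc zero) η (bold e)) (lem pb pu)
        where
        lem : ∀ pb pu → let D = pu - pb in - (pb * D) + pb * ((- (pb * D) + D) - - (pb * D)) ≡ 0ℚ
        lem = solve-∀ ℚring
      φ-off η (suc zero) (suc zero) ne = contradiction refl ne
      φ-off η (suc zero) (suc (suc j)) _ = φ-B (suc zero) η j
      φ-off η (suc (suc k)) zero _ = trans (φ-row (suc (suc k)) η (bold e)) (lem pb)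
        where
        lem : ∀ a → 0ℚ + a * (0ℚ - 0ℚ) ≡ 0ℚ
        lem = solve-∀ ℚring
      φ-off η (suc (suc k)) (suc zero) _ = trans (φ-row (suc (suc k)) η (plain e)) (lem pu)
        where
        lem : ∀ a → 0ℚ + a * (0ℚ - 0ℚ) ≡ 0ℚ
        lem = solve-∀ ℚring
      φ-off η (suc (suc k)) (suc (suc j)) ne = trans (φ-B (suc (suc k)) η j) (unit-other {k} {j} λ { refl → ne refl })

      φ-ê : ∀ k → φ k · ê ≡ 0ℚ
      φ-ê k = trans (·-ê (φ k)) (trans (cong (_- F (φ k) atO) (φ-eo k)) (ℚₚ.+-inverseʳ (F (φ k) atO)))

      h-ê : ∀ η → hη η · ê ≢ 0ℚ
      h-ê η eq = Δp≢0 (trans (sym (trans (·-ê (hη η)) (trans (cong₂ _-_ (F-hη-e η) (F-hη-o η)) (lem Δp ((η * η) * κ₀))))) eq)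
        where
        lem : ∀ a b → a + b - b ≡ a
        lem = solve-∀ ℚring

      on-row : ∀ η w → orient e w ≡ 0ℤ → hη η · hat (place η (inj₁ (inj₁ (ρ , w) , 0F))) ≡ 0ℚ
      on-row η w eq = trans (val⁺ η (inj₁ (ρ , w))) (trans (kill (coef (inj₁ (ρ , w))) (η * (η * C⁺ (inj₁ (ρ , w)))) (h0-sel _ (inj₁ refl)))
        (trans (cong (λ c → η * (η * c)) (trans (C⁺-row w) (cong ι eq))) (lem η)))
        where
        lem : ∀ η → η * (η * 0ℚ) ≡ 0ℚ
        lem = solve-∀ ℚring

      h-on : ∀ η k → hη η · hat (place η (selected ch k)) ≡ 0ℚ
      h-on η zero = on-row η (bold e) (lem (ℤ.+ p (plain e) ℤ.- ℤ.+ p (bold e)) (y (bold e)) (y (plain e) ℤ.- y (bold e)) (ℤ.+ p (bold e)))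
        where
        lem : ∀ a b c d → a ℤ.* (b ℤ.- b) ℤ.- c ℤ.* (d ℤ.- d) ≡ 0ℤ
        lem = ℤR.solve-∀
      h-on η (suc zero) = on-row η (plain e) (lem (ℤ.+ p (plain e) ℤ.- ℤ.+ p (bold e)) (y (plain e) ℤ.- y (bold e)))
        where
        lem : ∀ a b → a ℤ.* b ℤ.- b ℤ.* a ≡ 0ℤ
        lem = ℤR.solve-∀
      h-on η (suc (suc k)) = trans (val⁺ η (inj₂ (inj₁ (k , bs k)))) (trans (kill (coef (inj₂ (inj₁ (k , bs k)))) (η * (η * C⁺ (inj₂ (inj₁ (k , bs k))))) (h0-sel _ (inj₂ (k , refl))))
        (trans (cong (λ a → η * (η * (κ₀ + (1ℚ * (a - κ₀) + 0ℚ * Δp)))) (proj₂ (proj₂ (proj₂ (proj₂ h1s))) k)) (lem η κ₀ Δp)))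
        where
        lem : ∀ η k D → η * (η * (k + (1ℚ * (0ℚ - k) + 0ℚ * D))) ≡ 0ℚ
        lem = solve-∀ ℚring

-- Assembling the rational configuration

module Assembly where

  open FiniteTypes
  open PlanarSets using (Planar)
  open RationalVectors
  open Perturbation
  open Interpolation
  open Lifting
  open import Tactic.RingSolver using (solve-∀)
  open import Data.Nat as ℕ using (ℕ; zero; suc; z≤n)
  open import Data.Integer as ℤ using (ℤ; 0ℤ)
  open import Data.Rational using (ℚ; 0ℚ; 1ℚ; ½; _+_; _*_; _-_; -_; _<_; _≤_; ∣_∣; 1/_; NonZero; Positive)
  import Data.Rational as ℚ
  import Data.Rational.Properties as ℚₚ
  open import Data.Fin as Fin using (Fin; zero; suc)
  open import Data.Fin.Patterns using (0F; 1F)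
  import Data.Fin.Properties as Finₚ
  open import Data.Product using (Σ; ∃-syntax; _×_; _,_)
  open import Data.Sum using (inj₁; inj₂)
  open import Data.Vec.Functional using (Vector) renaming (_∷_ to _∷ᵥ_)
  open import Function using (_∘_; Injective)
  open import Relation.Nullary using (Dec; yes; no; contradiction)
  open import Relation.Binary.PropositionalEquality

  Ev-abs< : ∀ {a ε f} → ∣ a ∣ < ε → Bounded f → Ev (λ t → ∣ a + t * f t ∣ < ε)
  Ev-abs< {a} {ε} {f} h b = Ev-map (λ t _ (p , q) → ∣∣< (<-by _ p (lem₁ a ε t (f t))) (<-by _ q (lem₂ a ε t (f t))))
    (Ev-× (Ev-pos {ε - a} (<⇒0< (ℚₚ.≤-<-trans (≤∣∣ a) h)) (Bounded-neg b))
          (Ev-pos {ε - - a} (<⇒0< (ℚₚ.≤-<-trans (-≤∣∣ a) h)) b))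
    where
    lem₁ : ∀ a ε t f → (a + t * f) + (ε - a + t * - f) ≡ ε
    lem₁ = solve-∀ ℚring
    lem₂ : ∀ a ε t f → - (a + t * f) + (ε - - a + t * f) ≡ ε
    lem₂ = solve-∀ ℚring

  ¼ ⅛ : ℚ
  ¼ = ½ * ½
  ⅛ = ½ * ¼

  0<⅛ : 0ℚ < ⅛
  0<⅛ = 0<½ (0<½ (0<½ 0<1))

  module Assemble {Λ : ℕ} (κ : ℕ) (Pl : Planar Λ) (Row : Ty) (β rest : ℕ) (offset : El Row → ℕ)
    (x₀ : El (Build.At κ Pl Row β rest offset) → Vector ℚ (suc (suc κ)))
    (R : ℕ) (coef≤ : ∀ j → Build.coef κ Pl Row β rest offset j ≤ ι (ℤ.+ R)) where

    open Planar Pl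
    open Build κ Pl Row β rest offset

    ideal : El Pt → Vector ℚ d
    ideal = Place.place x₀ 0ℚ

    Hx : Ty
    Hx = Row ⊗ E ⊗ fin (β ℕ.^ κ)

    choice : El Hx → Choice
    choice (ρ , e , i) = ρ , e , Fin.finToFun i

    tuple : El Hx → Fin d → Fin (size Pt)
    tuple f = encode Pt ∘ selected (choice f)

    record Halves (f : El Hx) (x : Config {size Pt} {d}) : Set where
      field
        dir  : Vector ℚ (suc d)
        σ    : Fin (size Pt) → ℤ
        cell : Cell (tuple f) dir σ x
        -- It is a direction and not a point, which will force the normal vector to be nonzero.
        dir₀ : dir zero ≡ 0ℚ
        ∑σ   : ∑F σ ≡ 0ℤ
        σ-on : ∀ k → σ (tuple f k) ≡ 0ℤ

    b : ℚ
    b = 1ℚ + (ι (ℤ.+ R) + ι (ℤ.+ R))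

    0≤R : 0ℚ ≤ ι (ℤ.+ R)
    0≤R = ι-≤ (ℤ.+≤+ z≤n)

    0<b : 0ℚ < b
    0<b = 0<+≤ 0<1 (0≤+ 0≤R 0≤R)

    instance
      b-pos : Positive b
      b-pos = ℚ.positive 0<b
      b-nz : NonZero b
      b-nz = ℚₚ.pos⇒nonZero b

    -- At `η = 0` a point depends on its atom and on the origin with coefficients at most `R` in
    -- absolute value. Moving the atoms by `δ₀` hence moves it by less than `(1 + 2 * R) * δ₀`,
    -- which is 1/8.
    δ₀ : ℚ
    δ₀ = ⅛ * 1/ b

    0<δ₀ : 0ℚ < δ₀
    0<δ₀ = 0<* 0<⅛ (ℚₚ.positive⁻¹ (1/ b) {{ℚₚ.1/pos⇒pos b}})

    δ₀b : δ₀ * b ≡ ⅛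
    δ₀b = trans (ℚₚ.*-assoc ⅛ (1/ b) b) (trans (cong (⅛ *_) (ℚₚ.*-inverseˡ b)) (ℚₚ.*-identityʳ ⅛))

    affine₀ : ∀ {o a e : Vector ℚ d} {c k} l → affine o a e c k l ≡ affine o a e c 0ℚ l + k * (e l + - 1ℚ * o l)
    affine₀ {o} {a} {e} {c} {k} l = lem (o l) (a l) (e l) c k
      where
      lem : ∀ o a e c k → o + (c * (a + - 1ℚ * o) + k * (e + - 1ℚ * o)) ≡ (o + (c * (a + - 1ℚ * o) + 0ℚ * (e + - 1ℚ * o))) + k * (e + - 1ℚ * o)
      lem = solve-∀ ℚring

    module _ (x : El At → Vector ℚ d) (near : ∀ a l → ∣ x a l - x₀ a l ∣ < δ₀) where

      near-affine : ∀ a c → ∣ c ∣ ≤ ι (ℤ.+ R) → ∀ l →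
        ∣ affine (x atO) (x a) (x atE) c 0ℚ l - affine (x₀ atO) (x₀ a) (x₀ atE) c 0ℚ l ∣ < ⅛
      near-affine a c c≤ l = subst₂ _<_ (cong ∣_∣ (sym (lem (x atO l) (x a l) (x atE l) (x₀ atO l) (x₀ a l) (x₀ atE l) c))) δ₀b (ℚₚ.≤-<-trans
          (ℚₚ.≤-trans (ℚₚ.∣p+q∣≤∣p∣+∣q∣ Δo (c * Δa + - (c * Δo))) (ℚₚ.+-monoʳ-≤ ∣ Δo ∣ (ℚₚ.≤-trans (ℚₚ.∣p-q∣≤∣p∣+∣q∣ (c * Δa) (c * Δo))
            (ℚₚ.+-mono-≤ (mul Δa (near a l)) (mul Δo (near atO l))))))
          (<-by _ (<⇒0< (near atO l)) (fin-eq ∣ Δo ∣ δ₀ (ι (ℤ.+ R)))))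
        where
        Δo Δa : ℚ
        Δo = x atO l - x₀ atO l
        Δa = x a l - x₀ a l
        mul : ∀ q → ∣ q ∣ < δ₀ → ∣ c * q ∣ ≤ ι (ℤ.+ R) * δ₀
        mul q h = subst (_≤ ι (ℤ.+ R) * δ₀) (sym (ℚₚ.∣p*q∣≡∣p∣*∣q∣ c q)) (*-mono-≤ (ℚₚ.0≤∣p∣ c) (ℚₚ.<⇒≤ 0<δ₀) c≤ (ℚₚ.<⇒≤ h))
        lem : ∀ o a e o₀ a₀ e₀ c → (o + (c * (a + - 1ℚ * o) + 0ℚ * (e + - 1ℚ * o))) - (o₀ + (c * (a₀ + - 1ℚ * o₀) + 0ℚ * (e₀ + - 1ℚ * o₀)))
          ≡ (o - o₀) + (c * (a - a₀) + - (c * (o - o₀)))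
        lem = solve-∀ ℚring
        fin-eq : ∀ D δ R → (D + (R * δ + R * δ)) + (δ - D) ≡ δ * (1ℚ + (R + R))
        fin-eq = solve-∀ ℚring

      open Place x

      ∣coef∣ : ∀ j → ∣ coef j ∣ ≤ ι (ℤ.+ R)
      ∣coef∣ j = ∣∣≤ (coef≤ j) (ℚₚ.≤-trans (ℚₚ.neg-antimono-≤ (ℚₚ.<⇒≤ (1≤coef j))) 0≤R)

      ev-near-affine : ∀ a c k g l → ∣ c ∣ ≤ ι (ℤ.+ R) → k ≡ 0ℚ → Bounded g →
        Ev (λ η → ∣ affine (x atO) (x a) (x atE) c (η * g η) l - affine (x₀ atO) (x₀ a) (x₀ atE) c k l ∣ < ¼)
      ev-near-affine a c .0ℚ g l c≤ refl bg = Ev-map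
        (λ η _ h → subst (λ q → ∣ q ∣ < ¼) (trans (lem A A₀ η (g η) (x atE l + - 1ℚ * x atO l)) (cong (_- A₀) (sym (affine₀ {x atO} {x a} {x atE} {c} {η * g η} l)))) h)
        (Ev-abs< (ℚₚ.<-trans (near-affine a c c≤ l) (½< (0<½ (0<½ 0<1)))) (Bounded-* bg (Bounded-const (x atE l + - 1ℚ * x atO l))))
        where
        A A₀ : ℚ
        A = affine (x atO) (x a) (x atE) c 0ℚ l
        A₀ = affine (x₀ atO) (x₀ a) (x₀ atE) c 0ℚ l
        lem : ∀ A A₀ η g e → (A - A₀) + η * (g * e) ≡ (A + η * g * e) - A₀
        lem = solve-∀ ℚring

      ev-near : ∀ P l → Ev (λ η → ∣ place η P l - ideal P l ∣ < ¼)
      ev-near (inj₁ (j , 0F)) l = Ev-map (λ η _ → subst (λ k → ∣ affine (x atO) (x (atom j)) (x atE) (coef j) k l - ideal (inj₁ (j , 0F)) l ∣ < ¼)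
          (sym (ℚₚ.*-assoc η η (height j))))
        (ev-near-affine (atom j) (coef j) (0ℚ * 0ℚ * height j) (λ η → η * height j) l (∣coef∣ j) (lem (height j)) (Bounded-* Bounded-id (Bounded-const (height j))))
        where
        lem : ∀ h → 0ℚ * 0ℚ * h ≡ 0ℚ
        lem = solve-∀ ℚring
      ev-near (inj₁ (j , 1F)) l = ev-near-affine (atom j) (- coef j) (0ℚ * ι (tilt j)) (λ η → ι (tilt j)) l
        (subst (_≤ ι (ℤ.+ R)) (sym (ℚₚ.∣-p∣≡∣p∣ (coef j))) (∣coef∣ j)) (ℚₚ.*-zeroˡ (ι (tilt j))) (Bounded-const (ι (tilt j)))
      ev-near (inj₂ i) l = Ev-map (λ η _ → subst (λ k → ∣ affine (x atO) (x atE) (x atE) 0ℚ k l - ideal (inj₂ i) l ∣ < ¼) (ℚₚ.*-identityʳ η))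
        (ev-near-affine atE 0ℚ 0ℚ (λ _ → 1ℚ) l 0≤R refl (Bounded-const 1ℚ))

      conf : ℚ → Config {size Pt} {d}
      conf η i = place η (decode Pt i)

      ev-near-all : Ev (λ η → Near (ideal ∘ decode Pt) ¼ (conf η))
      ev-near-all = Ev-∀ λ i → Ev-∀ λ l → ev-near (decode Pt i) l

      module _ (gp : ∀ (t : Fin (suc d) → El At) → Injective _≡_ _≡_ t → Dual (hat ∘ x ∘ t)) where

        σs : El Hx → Fin (size Pt) → ℤ
        σs f = Hyper.σ x gp (choice f) ∘ decode Pt

        ∑σs : ∀ f → ∑F (σs f) ≡ 0ℤ
        ∑σs f = trans (∑F-encode Pt (σs f)) (trans (∑ᵀ-cong Pt λ P → cong (Hyper.σ x gp (choice f)) (decode-encode Pt P)) (Hyper.∑σ x gp (choice f)))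

        at : ∀ f (g : Vector ℚ (suc d)) η k → g · hat (conf η (tuple f k)) ≡ g · hat (place η (selected (choice f) k))
        at f g η k = cong (λ P → g · hat (place η P)) (decode-encode Pt (selected (choice f) k))

        ev-cell : ∀ f → Ev (λ η → Cell (tuple f) ê (σs f) (conf η))
        ev-cell f = Ev-map build (Ev-∀ {P = λ i η → (∀ k → tuple f k ≢ i) → Side (σs f i) (H.hη η · hat (conf η i))} sides)
          where
          module H = Hyper x gp (choice f)
          sides : ∀ i → Ev (λ η → (∀ k → tuple f k ≢ i) → Side (σs f i) (H.hη η · hat (conf η i)))
          sides i = go (Finₚ.any? λ k → tuple f k Fin.≟ i)
            where
            go : Dec (∃[ k ] tuple f k ≡ i) → Ev (λ η → (∀ k → tuple f k ≢ i) → Side (σs f i) (H.hη η · hat (conf η i)))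
            go (yes (k , eq)) = Ev-always λ η _ off → contradiction eq (off k)
            go (no none) = Ev-map (λ η _ h _ → h) (H.ev-side (decode Pt i) λ k eq →
              none (k , trans (cong (encode Pt) eq) (encode-decode Pt i)))
          build : ∀ η → 0ℚ < η → (∀ i → (∀ k → tuple f k ≢ i) → Side (σs f i) (H.hη η · hat (conf η i))) → Cell (tuple f) ê (σs f) (conf η)
          build η _ sd = record
            { φ = H.φ ; h = H.hη η
            ; φ-diag = λ k → subst (0ℚ <_) (sym (at f (H.φ k) η k)) (H.φ-diag η k)
            ; φ-off = λ k j ne → trans (at f (H.φ k) η j) (H.φ-off η k j ne)
            ; φ-ê = H.φ-ê
            ; h-ê = H.h-ê η
            ; h-on = λ k → trans (at f (H.hη η) η k) (H.h-on η k)
            ; h-side = sd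
            }

        σs-on : ∀ f k → σs f (tuple f k) ≡ 0ℤ
        σs-on f k = trans (cong H.σ (decode-encode Pt (selected (choice f) k))) (go k)
          where
          module H = Hyper x gp (choice f)
          go : ∀ k → H.σ (selected (choice f) k) ≡ 0ℤ
          go zero = trans (H.pick-yes (H.sel? (inj₂ (inj₁ H.ρ))) _ _ (inj₁ refl)) (cong sg (lem (ℤ.+ p (plain H.e) ℤ.- ℤ.+ p (bold H.e)) (y (bold H.e)) (y (plain H.e) ℤ.- y (bold H.e)) (ℤ.+ p (bold H.e))))
            where
            open import Data.Integer.Tactic.RingSolver using () renaming (solve-∀ to solveℤ)
            lem : ∀ a b c d → a ℤ.* (b ℤ.- b) ℤ.- c ℤ.* (d ℤ.- d) ≡ 0ℤ
            lem = solveℤ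
          go (suc zero) = trans (H.pick-yes (H.sel? (inj₂ (inj₁ H.ρ))) _ _ (inj₁ refl)) (cong sg (lem (ℤ.+ p (plain H.e) ℤ.- ℤ.+ p (bold H.e)) (y (plain H.e) ℤ.- y (bold H.e))))
            where
            open import Data.Integer.Tactic.RingSolver using () renaming (solve-∀ to solveℤ)
            lem : ∀ a b → a ℤ.* b ℤ.- b ℤ.* a ≡ 0ℤ
            lem = solveℤ
          go (suc (suc k)) = H.pick-yes (H.sel? (inj₂ (inj₂ (inj₁ (k , H.bs k))))) _ _ (inj₂ (k , refl))

        finish : Σ (Config {size Pt} {d}) λ X → Near (ideal ∘ decode Pt) ¼ X × GenPos X × (∀ f → Halves f X)
        finish = go (Ev-witness (Ev-× ev-near-all (Ev-∀ λ i → ev-cell (decode Hx i))))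
          where
          P : Config {size Pt} {d} → Set
          P X = Near (ideal ∘ decode Pt) ¼ X × (∀ i → Cell (tuple (decode Hx i)) ê (σs (decode Hx i)) X)
          stable : Stable P
          stable = Stable-× (Stable-Near (ideal ∘ decode Pt) ¼) (Stable-∀ λ i → Stable-Cell (tuple (decode Hx i)) ê (σs (decode Hx i)))
          cell-at : ∀ {X} → (∀ i → Cell (tuple (decode Hx i)) ê (σs (decode Hx i)) X) → ∀ f → Cell (tuple f) ê (σs f) X
          cell-at {X} cs f = subst (λ f → Cell (tuple f) ê (σs f) X) (decode-encode Hx f) (cs (encode Hx f))
          ê₀ : ê zero ≡ 0ℚ
          ê₀ = refl
          go : (∃[ η ] (0ℚ < η × P (conf η))) → _
          go (η , _ , pη) = wrap (general-position stable (conf η) pη)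
            where
            wrap : (Σ (Config {size Pt} {d}) λ X → P X × GenPos X) → _
            wrap (X , (nr , cs) , gpX) = X , nr , gpX , λ f → record
              { dir = ê ; σ = σs f ; cell = cell-at cs f ; dir₀ = ê₀ ; ∑σ = ∑σs f ; σ-on = σs-on f }

    abstract
      -- The order of the choices matters: atoms in general position close to `x₀`, then `η` small
      -- in terms of these atoms, and last a perturbation of all points, under which cells and
      -- nearness to the ideal positions are stable.
      configuration : Σ (Config {size Pt} {d}) λ X → Near (ideal ∘ decode Pt) ¼ X × GenPos X × (∀ f → Halves f X)
      configuration = go (general-position (Stable-Near (x₀ ∘ decode At) δ₀) (x₀ ∘ decode At) start)
        where
        start : Near (x₀ ∘ decode At) δ₀ (x₀ ∘ decode At)
        start i l = subst (λ q → ∣ q ∣ < δ₀) (sym (ℚₚ.+-inverseʳ (x₀ (decode At i) l))) 0<δ₀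
        go : (Σ (Config {size At} {d}) λ X → Near (x₀ ∘ decode At) δ₀ X × GenPos X) →
          Σ (Config {size Pt} {d}) λ X → Near (ideal ∘ decode Pt) ¼ X × GenPos X × (∀ f → Halves f X)
        go (X , nr , gp) = finish (X ∘ encode At)
          (λ a l → subst (λ a′ → ∣ X (encode At a) l - x₀ a′ l ∣ < δ₀) (decode-encode At a) (nr (encode At a) l))
          (λ t inj → tuple-dual X gp (encode At ∘ t) (inj ∘ encode-injective At))

-- Rational estimates for powers and the exponential series

module ExponentialSeries where

  open import Defs
  open RationalVectors
  open Interpolation using (ι; ι-+; ι-*; ι-≤; ι-<)
  open import Tactic.RingSolver using (solve-∀)
  open import Data.Nat as ℕ using (ℕ; zero; suc; s≤s; z≤n; _!)
  import Data.Nat.Properties as ℕₚ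
  open import Data.Nat.Properties using (_!≢0)
  import Data.Nat.Coprimality as C
  open import Data.Integer as ℤ using (ℤ; 1ℤ)
  import Data.Integer.Properties as ℤₚ
  open import Data.Rational using (ℚ; mkℚ; 0ℚ; 1ℚ; ½; _+_; _*_; _-_; -_; _<_; _≤_; ∣_∣; *<*; *≤*)
  import Data.Rational as ℚ
  import Data.Rational.Properties as ℚₚ
  import Data.Rational.Unnormalised as ℚᵘ
  import Data.Rational.Unnormalised.Properties as ℚᵘₚ
  open import Data.Product using (∃-syntax; _×_; _,_; proj₁; proj₂)
  open import Relation.Nullary using (¬_; Dec; yes; no; contradiction)
  open import Relation.Binary.PropositionalEquality

  ν : ℕ → ℚ
  ν n = ι (ℤ.+ n)

  ν-suc : ∀ n → ν (suc n) ≡ 1ℚ + ν n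
  ν-suc n = ι-+ 1ℤ (ℤ.+ n)

  0≤ν : ∀ n → 0ℚ ≤ ν n
  0≤ν n = ι-≤ (ℤ.+≤+ z≤n)

  ν-≤ : ∀ {m n} → m ℕ.≤ n → ν m ≤ ν n
  ν-≤ h = ι-≤ (ℤ.+≤+ h)

  ν-* : ∀ m n → ν (m ℕ.* n) ≡ ν m * ν n
  ν-* m n = trans (cong ι (ℤₚ.pos-* m n)) (ι-* (ℤ.+ m) (ℤ.+ n))

  0<ν : ∀ {n} → 1 ℕ.≤ n → 0ℚ < ν n
  0<ν h = ι-< (ℤ.+<+ h)

  -- The reciprocal of `n + 1`, already in lowest terms.
  ε : ℕ → ℚ
  ε n = mkℚ (ℤ.+ 1) n (C.1-coprimeTo (suc n))

  0<ε : ∀ n → 0ℚ < ε n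
  0<ε n = ℚₚ.positive⁻¹ (ε n)

  ε-ν : ∀ n → ε n * ν (suc n) ≡ 1ℚ
  ε-ν n = ℚₚ.toℚᵘ-injective (ℚᵘₚ.≃-trans (ℚₚ.toℚᵘ-homo-* (ε n) (ν (suc n))) (ℚᵘ.*≡* (lem (ℤ.+ suc n))))
    where
    open import Data.Integer.Tactic.RingSolver using () renaming (solve-∀ to solveℤ)
    lem : ∀ n → ℤ.+ 1 ℤ.* n ℤ.* ℤ.+ 1 ≡ ℤ.+ 1 ℤ.* (n ℤ.* ℤ.+ 1)
    lem = solveℤ

  ε-small : ∀ {δ} → 0ℚ < δ → ∃[ N ] (∀ n → N ℕ.≤ n → ε n < δ)
  ε-small {mkℚ ℤ.+[1+ a ] b c} _ = suc b , λ n h → *<* (subst₂ ℤ._<_ (sym (ℤₚ.*-identityˡ (ℤ.+ suc b))) (ℤₚ.pos-* (suc a) (suc n))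
    (ℤ.+<+ (ℕₚ.<-≤-trans (s≤s h) (ℕₚ.m≤n*m (suc n) (suc a)))))
  ε-small {mkℚ (ℤ.+ 0) b c} (*<* (ℤ.+<+ ()))
  ε-small {mkℚ ℤ.-[1+ a ] b c} (*<* ())

  ceil : ℚ → ℕ
  ceil (mkℚ i b c) = suc ℤ.∣ i ∣

  <ceil : ∀ x → x < ν (ceil x)
  <ceil (mkℚ i b c) = *<* (subst (ℤ._< ℤ.+ suc ℤ.∣ i ∣ ℤ.* ℤ.+ suc b) (sym (ℤₚ.*-identityʳ i))
    (ℤₚ.≤-<-trans (i≤∣i∣ i) (subst (ℤ.+ ℤ.∣ i ∣ ℤ.<_) (ℤₚ.pos-* (suc ℤ.∣ i ∣) (suc b)) (ℤ.+<+ (ℕₚ.m≤m*n (suc ℤ.∣ i ∣) (suc b))))))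
    where
    i≤∣i∣ : ∀ i → i ℤ.≤ ℤ.+ ℤ.∣ i ∣
    i≤∣i∣ (ℤ.+ n) = ℤₚ.≤-refl
    i≤∣i∣ ℤ.-[1+ n ] = ℤ.-≤+

  -- A discrete intermediate value argument; roots, logarithms and the level of the construction are
  -- all found by it.
  crossing : ∀ (P : ℕ → Set) → (∀ j → Dec (P j)) → P 0 → ∀ J → ¬ P J → ∃[ j ] (P j × ¬ P (suc j))
  crossing P P? p0 zero    np = contradiction p0 np
  crossing P P? p0 (suc J) np = go (P? J)
    where
    go : Dec (P J) → ∃[ j ] (P j × ¬ P (suc j))
    go (yes p) = J , p , np
    go (no ¬p) = crossing P P? p0 J ¬p

  pow : ℚ → ℕ → ℚ
  pow a zero    = 1ℚ
  pow a (suc k) = a * pow a k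

  0≤pow : ∀ {a} k → 0ℚ ≤ a → 0ℚ ≤ pow a k
  0≤pow zero    h = ℚₚ.<⇒≤ 0<1
  0≤pow (suc k) h = 0≤* h (0≤pow k h)

  0<pow : ∀ {a} k → 0ℚ < a → 0ℚ < pow a k
  0<pow zero    h = 0<1
  0<pow (suc k) h = 0<* h (0<pow k h)

  pow-mono : ∀ {a b} k → 0ℚ ≤ a → a ≤ b → pow a k ≤ pow b k
  pow-mono zero    h l = ℚₚ.≤-refl
  pow-mono (suc k) h l = *-mono-≤ h (0≤pow k (ℚₚ.≤-trans h l)) l (pow-mono k h l)

  pow-ν : ∀ n k → pow (ν n) k ≡ ν (n ℕ.^ k)
  pow-ν n zero    = refl
  pow-ν n (suc k) = trans (cong (ν n *_) (pow-ν n k)) (sym (ν-* n (n ℕ.^ k)))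

  pow-distrib : ∀ a b k → pow (a * b) k ≡ pow a k * pow b k
  pow-distrib a b zero    = refl
  pow-distrib a b (suc k) = trans (cong ((a * b) *_) (pow-distrib a b k)) (lem a b (pow a k) (pow b k))
    where
    lem : ∀ a b p q → (a * b) * (p * q) ≡ (a * p) * (b * q)
    lem = solve-∀ ℚring

  ≤pow : ∀ {a k} → 1ℚ ≤ a → 1 ℕ.≤ k → a ≤ pow a k
  ≤pow {a} {suc k} h _ = subst (_≤ a * pow a k) (ℚₚ.*-identityʳ a)
    (*-mono-≤ (ℚₚ.≤-trans (ℚₚ.<⇒≤ 0<1) h) (0≤pow k (ℚₚ.≤-trans (ℚₚ.<⇒≤ 0<1) h)) (ℚₚ.≤-refl {a}) (1≤pow k))
    where
    1≤pow : ∀ k → 1ℚ ≤ pow a k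
    1≤pow zero    = ℚₚ.≤-refl
    1≤pow (suc k) = subst (_≤ a * pow a k) (ℚₚ.*-identityʳ 1ℚ)
      (*-mono-≤ (ℚₚ.<⇒≤ 0<1) (0≤pow k (ℚₚ.≤-trans (ℚₚ.<⇒≤ 0<1) h)) h (1≤pow k))

  -- Superadditivity makes the `k`-th root uniformly continuous: numbers that differ by less than
  -- `δ ^ k` have roots that differ by less than `δ`, up to the rounding of the roots.
  pow-super : ∀ {a b} k → 1 ℕ.≤ k → 0ℚ ≤ a → 0ℚ ≤ b → pow a k + pow b k ≤ pow (a + b) k
  pow-super {a} {b} (suc zero) _ ha hb = ℚₚ.≤-reflexive (lem a b)
    where
    lem : ∀ a b → a * 1ℚ + b * 1ℚ ≡ (a + b) * 1ℚ
    lem = solve-∀ ℚring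
  pow-super {a} {b} (suc (suc k)) _ ha hb = ℚₚ.≤-trans
    (≤-by (a * pow b (suc k) + b * pow a (suc k)) (0≤+ (0≤* ha (0≤pow (suc k) hb)) (0≤* hb (0≤pow (suc k) ha)))
      (lem a b (pow a (suc k)) (pow b (suc k))))
    (*-mono-≤ (0≤+ ha hb) (0≤pow (suc k) (0≤+ ha hb)) (ℚₚ.≤-refl {a + b}) (pow-super (suc k) (s≤s z≤n) ha hb))
    where
    lem : ∀ a b p q → (a * p + b * q) + (a * q + b * p) ≡ (a + b) * (p + q)
    lem = solve-∀ ℚring

  -- A Lipschitz constant of the `k`-th power on the interval from 0 to `b` for increments up to 1,
  -- built along the recursion of `pow`.
  modulus : ℚ → ℕ → ℚ
  modulus b zero    = 0ℚ
  modulus b (suc k) = pow b k + (b + 1ℚ) * modulus b k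

  0≤modulus : ∀ {b} k → 0ℚ ≤ b → 0ℚ ≤ modulus b k
  0≤modulus zero    h = ℚₚ.≤-refl
  0≤modulus (suc k) h = 0≤+ (0≤pow k h) (0≤* (0≤+ h (ℚₚ.<⇒≤ 0<1)) (0≤modulus k h))

  pow-+≤ : ∀ {u e b} k → 0ℚ ≤ u → u ≤ b → 0ℚ ≤ e → e ≤ 1ℚ → pow (u + e) k ≤ pow u k + e * modulus b k
  pow-+≤ {u} {e} {b} zero hu ub he e1 = ℚₚ.≤-reflexive (lem e)
    where
    lem : ∀ e → 1ℚ ≡ 1ℚ + e * 0ℚ
    lem = solve-∀ ℚring
  pow-+≤ {u} {e} {b} (suc k) hu ub he e1 = ℚₚ.≤-trans
    (*-mono-≤ (0≤+ hu he) (ℚₚ.≤-trans (0≤pow k (0≤+ hu he)) (pow-+≤ k hu ub he e1)) (ℚₚ.≤-refl {u + e}) (pow-+≤ k hu ub he e1))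
    (≤-by (e * ((pow b k - pow u k) + ((b - u) + (1ℚ - e)) * modulus b k))
      (0≤* he (0≤+ (≤⇒0≤ (pow-mono k hu ub)) (0≤* (0≤+ (≤⇒0≤ ub) (≤⇒0≤ e1)) (0≤modulus k (ℚₚ.≤-trans hu ub)))))
      (lem u e b (pow u k) (pow b k) (modulus b k)))
    where
    lem : ∀ u e b p q m → (u + e) * (p + e * m) + e * ((q - p) + ((b - u) + (1ℚ - e)) * m) ≡ u * p + e * (q + (b + 1ℚ) * m)
    lem = solve-∀ ℚring

  ε≤1 : ∀ n → ε n ≤ 1ℚ
  ε≤1 n = *≤* (subst₂ ℤ._≤_ (sym (ℤₚ.*-identityʳ (ℤ.+ 1))) (sym (ℤₚ.*-identityˡ (ℤ.+ suc n))) (ℤ.+≤+ (s≤s z≤n)))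

  ifact : ℕ → ℚ
  ifact m = ℚ._/_ (ℤ.+ 1) (m !) {{m !≢0}}

  ifact-! : ∀ m → ifact m * ν (m !) ≡ 1ℚ
  ifact-! m = go (m !) {{m !≢0}}
    where
    go : ∀ n {{_ : ℕ.NonZero n}} → (ℤ.+ 1 ℚ./ n) * ν n ≡ 1ℚ
    go (suc n) = trans (cong (_* ν (suc n)) (ℚₚ.↥p/↧p≡p (ε n))) (ε-ν n)

  0<ifact : ∀ m → 0ℚ < ifact m
  0<ifact m = go (m !) {{m !≢0}}
    where
    go : ∀ n {{_ : ℕ.NonZero n}} → 0ℚ < ℤ.+ 1 ℚ./ n
    go (suc n) = subst (0ℚ <_) (sym (ℚₚ.↥p/↧p≡p (ε n))) (0<ε n)

  ifact-suc : ∀ m → ν (suc m) * ifact (suc m) ≡ ifact m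
  ifact-suc m = begin
    ν (suc m) * ifact (suc m)                            ≡⟨ ℚₚ.*-identityʳ _ ⟨
    ν (suc m) * ifact (suc m) * 1ℚ                       ≡⟨ cong (ν (suc m) * ifact (suc m) *_) (ifact-! m) ⟨
    ν (suc m) * ifact (suc m) * (ifact m * ν (m !))      ≡⟨ lem (ν (suc m)) (ifact (suc m)) (ifact m) (ν (m !)) ⟩
    ifact m * (ifact (suc m) * (ν (suc m) * ν (m !)))    ≡⟨ cong (λ x → ifact m * (ifact (suc m) * x)) (ν-* (suc m) (m !)) ⟨
    ifact m * (ifact (suc m) * ν (suc m !))              ≡⟨ cong (ifact m *_) (ifact-! (suc m)) ⟩
    ifact m * 1ℚ                                         ≡⟨ ℚₚ.*-identityʳ (ifact m) ⟩
    ifact m ∎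
    where
    open ≡-Reasoning
    lem : ∀ a b c d → a * b * (c * d) ≡ c * (b * (a * d))
    lem = solve-∀ ℚring

  E : ℚ → ℕ → ℚ
  E x zero    = 0ℚ
  E x (suc m) = E x m + pow x m * ifact m

  term : ℚ → ℕ → ℚ
  term x m = pow x m * ifact m

  0≤term : ∀ {x} m → 0ℚ ≤ x → 0ℚ ≤ term x m
  0≤term m h = 0≤* (0≤pow m h) (ℚₚ.<⇒≤ (0<ifact m))

  term-mono : ∀ {x y} m → 0ℚ ≤ x → x ≤ y → term x m ≤ term y m
  term-mono m h l = *-mono-≤ (0≤pow m h) (ℚₚ.<⇒≤ (0<ifact m)) (pow-mono m h l) ℚₚ.≤-refl

  E-mono : ∀ {x y} M → 0ℚ ≤ x → x ≤ y → E x M ≤ E y M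
  E-mono zero    h l = ℚₚ.≤-refl
  E-mono (suc M) h l = ℚₚ.+-mono-≤ (E-mono M h l) (term-mono M h l)

  E-step : ∀ {x} M i → 0ℚ ≤ x → E x M ≤ E x (i ℕ.+ M)
  E-step M zero    h = ℚₚ.≤-refl
  E-step {x} M (suc i) h = ℚₚ.≤-trans (E-step M i h) (≤-by (term x (i ℕ.+ M)) (0≤term (i ℕ.+ M) h) refl)

  E-≤ : ∀ {x M M′} → M ℕ.≤ M′ → 0ℚ ≤ x → E x M ≤ E x M′
  E-≤ {x} {M} {M′} l h = subst (λ n → E x M ≤ E x n) (ℕₚ.m∸n+n≡m l) (E-step M (M′ ℕ.∸ M) h)

  0≤E : ∀ {x} M → 0ℚ ≤ x → 0ℚ ≤ E x M
  0≤E M h = E-≤ {M = 0} {M} z≤n h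

  1≤E : ∀ {x} M → 0ℚ ≤ x → 1ℚ ≤ E x (suc M)
  1≤E {x} M h = ℚₚ.≤-trans (ℚₚ.≤-reflexive refl) (E-≤ {x} {1} {suc M} (s≤s z≤n) h)

  -- The mean value inequalities for powers, proved by induction on the exponent instead of
  -- differentiation.
  pow-diff : ∀ {x y} m → 0ℚ ≤ x → x ≤ y →
    pow x (suc m) + ν (suc m) * (pow x m * (y - x)) ≤ pow y (suc m) ×
    pow y (suc m) ≤ pow x (suc m) + ν (suc m) * (pow y m * (y - x))
  pow-diff {x} {y} zero h l = ℚₚ.≤-reflexive (lem x y) , ℚₚ.≤-reflexive (sym (lem x y))
    where
    lem : ∀ x y → x * 1ℚ + 1ℚ * (1ℚ * (y - x)) ≡ y * 1ℚ
    lem = solve-∀ ℚring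
  pow-diff {x} {y} (suc m) h l = lower , upper
    where
    rec = pow-diff m h l
    hy = ℚₚ.≤-trans h l
    N = ν (suc m)
    P = pow x m
    Q = pow y m
    N≡ : ν (suc (suc m)) ≡ 1ℚ + N
    N≡ = ν-suc (suc m)
    lower : pow x (suc (suc m)) + ν (suc (suc m)) * (pow x (suc m) * (y - x)) ≤ pow y (suc (suc m))
    lower = ℚₚ.≤-trans (subst (λ n → x * (x * P) + n * (x * P * (y - x)) ≤ y * (x * P + N * (P * (y - x)))) (sym N≡)
        (≤-by (N * (P * ((y - x) * (y - x)))) (0≤* (0≤ν (suc m)) (0≤* (0≤pow m h) (0≤* (≤⇒0≤ l) (≤⇒0≤ l)))) (lem x y P N)))
      (*-mono-≤ hy (0≤pow (suc m) hy) (ℚₚ.≤-refl {y}) (proj₁ rec))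
      where
      lem : ∀ x y P N → (x * (x * P) + (1ℚ + N) * (x * P * (y - x))) + N * (P * ((y - x) * (y - x))) ≡ y * (x * P + N * (P * (y - x)))
      lem = solve-∀ ℚring
    upper : pow y (suc (suc m)) ≤ pow x (suc (suc m)) + ν (suc (suc m)) * (pow y (suc m) * (y - x))
    upper = ℚₚ.≤-trans (*-mono-≤ hy (ℚₚ.≤-trans (0≤pow (suc m) hy) (proj₂ rec)) (ℚₚ.≤-refl {y}) (proj₂ rec))
      (subst (λ n → y * (x * P + N * (Q * (y - x))) ≤ x * (x * P) + n * (y * Q * (y - x))) (sym N≡)
        (≤-by ((y - x) * (y * Q - x * P)) (0≤* (≤⇒0≤ l) (≤⇒0≤ (pow-mono (suc m) h l))) (lem x y P Q N)))
      where
      lem : ∀ x y P Q N → y * (x * P + N * (Q * (y - x))) + (y - x) * (y * Q - x * P) ≡ x * (x * P) + (1ℚ + N) * (y * Q * (y - x))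
      lem = solve-∀ ℚring

  -- The mean value inequalities for partial sums: the sum with `M` terms is the derivative of the
  -- sum with `M + 1` terms, and it is increasing.
  E-diff : ∀ {x y} M → 0ℚ ≤ x → x ≤ y →
    E x (suc M) + (y - x) * E x M ≤ E y (suc M) × E y (suc M) ≤ E x (suc M) + (y - x) * E y M
  E-diff {x} {y} zero h l = ℚₚ.≤-reflexive (lem (y - x)) , ℚₚ.≤-reflexive (sym (lem (y - x)))
    where
    lem : ∀ d → 0ℚ + 1ℚ * 1ℚ + d * 0ℚ ≡ 0ℚ + 1ℚ * 1ℚ
    lem = solve-∀ ℚring
  E-diff {x} {y} (suc M) h l = ℚₚ.≤-trans (ℚₚ.≤-reflexive (lemA (E x (suc M)) (E x M) (y - x) X (pow x M) f N F eq))
      (ℚₚ.+-mono-≤ (proj₁ rec) (*-mono-≤ {X + N * (pow x M * (y - x))} {Y} {F} {F} (0≤+ (0≤pow (suc M) h) (0≤* (0≤ν (suc M)) (0≤* (0≤pow M h) (≤⇒0≤ l))))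
        (ℚₚ.<⇒≤ (0<ifact (suc M))) (proj₁ pd) ℚₚ.≤-refl)) ,
    ℚₚ.≤-trans (ℚₚ.+-mono-≤ (proj₂ rec) (*-mono-≤ {Y} {X + N * (pow y M * (y - x))} {F} {F} (0≤pow (suc M) (ℚₚ.≤-trans h l)) (ℚₚ.<⇒≤ (0<ifact (suc M))) (proj₂ pd) ℚₚ.≤-refl))
      (ℚₚ.≤-reflexive (sym (lemA (E x (suc M)) (E y M) (y - x) X (pow y M) f N F eq)))
    where
    rec = E-diff M h l
    pd = pow-diff M h l
    X Y F f N : ℚ
    X = pow x (suc M)
    Y = pow y (suc M)
    F = ifact (suc M)
    f = ifact M
    N = ν (suc M)
    eq : N * F ≡ f
    eq = ifact-suc M
    lemA : ∀ e₁ e₀ d X p f N F → N * F ≡ f → (e₁ + X * F) + d * (e₀ + p * f) ≡ (e₁ + d * e₀) + (X + N * (p * d)) * F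
    lemA e₁ e₀ d X p f N F refl = lem e₁ e₀ d X p N F
      where
      lem : ∀ e₁ e₀ d X p N F → (e₁ + X * F) + d * (e₀ + p * (N * F)) ≡ (e₁ + d * e₀) + (X + N * (p * d)) * F
      lem = solve-∀ ℚring

  -- The tail of the series from 2B on is dominated by a geometric series.

  pow½ : ℕ → ℚ
  pow½ zero    = 1ℚ
  pow½ (suc j) = ½ * pow½ j

  0≤pow½ : ∀ j → 0ℚ ≤ pow½ j
  0≤pow½ zero    = ℚₚ.<⇒≤ 0<1
  0≤pow½ (suc j) = 0≤* (ℚₚ.<⇒≤ (ℚₚ.positive⁻¹ ½)) (0≤pow½ j)

  pow½-ν : ∀ j → pow½ j * ν (suc j) ≤ 1ℚ
  pow½-ν zero    = ℚₚ.≤-reflexive refl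
  pow½-ν (suc j) = ℚₚ.≤-trans (≤-by (½ * (pow½ j * ν j)) (0≤* (ℚₚ.<⇒≤ (ℚₚ.positive⁻¹ ½)) (0≤* (0≤pow½ j) (0≤ν j)))
      (trans (cong (λ n → ½ * pow½ j * n + ½ * (pow½ j * ν j)) (ν-suc (suc j))) (trans (cong (λ n → ½ * pow½ j * (1ℚ + n) + ½ * (pow½ j * ν j)) (ν-suc j))
        (trans (lem ½ (pow½ j) (ν j)) (trans (½+½ (pow½ j * (1ℚ + ν j))) (cong (pow½ j *_) (sym (ν-suc j))))))))
    (pow½-ν j)
    where
    lem : ∀ h p n → h * p * (1ℚ + (1ℚ + n)) + h * (p * n) ≡ h * (p * (1ℚ + n)) + h * (p * (1ℚ + n))
    lem = solve-∀ ℚring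

  pow½≤ε : ∀ j → pow½ j ≤ ε j
  pow½≤ε j = subst₂ _≤_ (trans (ℚₚ.*-assoc (pow½ j) (ν (suc j)) (ε j)) (trans (cong (pow½ j *_) (trans (ℚₚ.*-comm (ν (suc j)) (ε j)) (ε-ν j))) (ℚₚ.*-identityʳ (pow½ j))))
    (ℚₚ.*-identityˡ (ε j)) (ℚₚ.*-monoʳ-≤-nonNeg (ε j) {{ℚ.nonNegative (ℚₚ.<⇒≤ (0<ε j))}} (pow½-ν j))

  module Tail (B : ℕ) where

    term-half : ∀ {x} m → 0ℚ ≤ x → x ≤ ν B → B ℕ.+ B ℕ.≤ m → term x (suc m) + term x (suc m) ≤ term x m
    term-half {x} m h l 2B≤m = ≤-by (((ν (suc m) - (x + x)) * pow x m) * F)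
        (0≤* (0≤* (≤⇒0≤ (ℚₚ.≤-trans (ℚₚ.+-mono-≤ l l) (ℚₚ.≤-trans (ℚₚ.≤-reflexive (sym (ι-+ (ℤ.+ B) (ℤ.+ B)))) (ν-≤ (ℕₚ.≤-trans 2B≤m (ℕₚ.n≤1+n m)))))) (0≤pow m h)) (ℚₚ.<⇒≤ (0<ifact (suc m))))
        (trans (lem x (pow x m) (ν (suc m)) F) (cong (pow x m *_) (ifact-suc m)))
      where
      F : ℚ
      F = ifact (suc m)
      lem : ∀ x p n F → (x * p * F + x * p * F) + ((n - (x + x)) * p) * F ≡ p * (n * F)
      lem = solve-∀ ℚring

    E-tail : ∀ {x} m i → 0ℚ ≤ x → x ≤ ν B → B ℕ.+ B ℕ.≤ m →
      E x (i ℕ.+ m) + (term x (i ℕ.+ m) + term x (i ℕ.+ m)) ≤ E x m + (term x m + term x m)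
    E-tail m zero    h l b = ℚₚ.≤-refl
    E-tail {x} m (suc i) h l b = ℚₚ.≤-trans
      (≤-by (t - (t′ + t′)) (≤⇒0≤ (term-half (i ℕ.+ m) h l (ℕₚ.≤-trans b (ℕₚ.m≤n+m m i)))) (lem (E x (i ℕ.+ m)) t t′)) (E-tail m i h l b)
      where
      t t′ : ℚ
      t = term x (i ℕ.+ m)
      t′ = term x (suc (i ℕ.+ m))
      lem : ∀ e t t′ → ((e + t) + (t′ + t′)) + (t - (t′ + t′)) ≡ e + (t + t)
      lem = solve-∀ ℚring

    -- τ j bounds the tail from 2B + j on, for all 0 ≤ x ≤ B.
    τ : ℕ → ℚ
    τ j = term (ν B) (j ℕ.+ (B ℕ.+ B)) + term (ν B) (j ℕ.+ (B ℕ.+ B))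

    0≤τ : ∀ j → 0ℚ ≤ τ j
    0≤τ j = 0≤+ (0≤term (j ℕ.+ (B ℕ.+ B)) (0≤ν B)) (0≤term (j ℕ.+ (B ℕ.+ B)) (0≤ν B))

    E-upper : ∀ {x} j M → 0ℚ ≤ x → x ≤ ν B → j ℕ.+ (B ℕ.+ B) ℕ.≤ M → E x M ≤ E x (j ℕ.+ (B ℕ.+ B)) + τ j
    E-upper {x} j M h l m≤M = ℚₚ.≤-trans (≤-by (term x M + term x M) (0≤+ (0≤term M h) (0≤term M h)) refl)
      (ℚₚ.≤-trans (subst (λ n → E x n + (term x n + term x n) ≤ E x m + (term x m + term x m)) (ℕₚ.m∸n+n≡m m≤M)
          (E-tail m (M ℕ.∸ m) h l (ℕₚ.m≤n+m (B ℕ.+ B) j)))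
        (ℚₚ.+-monoʳ-≤ (E x m) (ℚₚ.+-mono-≤ (term-mono m h l) (term-mono m h l))))
      where
      m : ℕ
      m = j ℕ.+ (B ℕ.+ B)

    τ-geometric : ∀ j → τ j ≤ pow½ j * τ 0
    τ-geometric zero    = ℚₚ.≤-reflexive (sym (ℚₚ.*-identityˡ (τ 0)))
    τ-geometric (suc j) = ℚₚ.≤-trans (subst (_≤ ½ * τ j) (½+½ (τ (suc j)))
        (ℚₚ.≤-trans (ℚₚ.≤-reflexive (lem ½ (term (ν B) (suc m)) )) (ℚₚ.*-monoˡ-≤-nonNeg ½ (ℚₚ.+-mono-≤ th th))))
      (ℚₚ.≤-trans (ℚₚ.*-monoˡ-≤-nonNeg ½ (τ-geometric j)) (ℚₚ.≤-reflexive (sym (ℚₚ.*-assoc ½ (pow½ j) (τ 0)))))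
      where
      m : ℕ
      m = j ℕ.+ (B ℕ.+ B)
      th : term (ν B) (suc m) + term (ν B) (suc m) ≤ term (ν B) m
      th = term-half m (0≤ν B) ℚₚ.≤-refl (ℕₚ.m≤n+m (B ℕ.+ B) j)
      lem : ∀ h t → h * (t + t) + h * (t + t) ≡ h * ((t + t) + (t + t))
      lem = solve-∀ ℚring

    τ-small : ∀ {δ} → 0ℚ < δ → ∃[ N ] (∀ j → N ℕ.≤ j → τ j < δ)
    τ-small {δ} 0<δ = proj₁ s , λ j h → ℚₚ.≤-<-trans (ℚₚ.≤-trans (τ-geometric j) (ℚₚ.≤-trans
        (ℚₚ.*-monoʳ-≤-nonNeg (τ 0) {{ℚ.nonNegative (0≤τ 0)}} (pow½≤ε j)) (≤-by (ε j * (1ℚ + (∣ τ 0 ∣ - τ 0)))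
          (0≤* (ℚₚ.<⇒≤ (0<ε j)) (0≤+ (ℚₚ.<⇒≤ 0<1) (≤⇒0≤ (≤∣∣ (τ 0))))) (lem (ε j) (τ 0) ∣ τ 0 ∣))))
        (proj₂ (proj₂ ev) (ε j) (0<ε j) (proj₂ s j h))
      where
      ev = Ev-small (τ 0) 0<δ
      s = ε-small (proj₁ (proj₂ ev))
      lem : ∀ e t a → e * t + e * (1ℚ + (a - t)) ≡ e * (1ℚ + a)
      lem = solve-∀ ℚring

    -- A common bound of all partial sums on the interval from 0 to `B`, and therefore of their
    -- slopes.
    Lip : ℚ
    Lip = E (ν B) (B ℕ.+ B) + τ 0

    0≤Lip : 0ℚ ≤ Lip
    0≤Lip = 0≤+ (0≤E (B ℕ.+ B) (0≤ν B)) (0≤τ 0)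

    E≤Lip : ∀ {x} M → 0ℚ ≤ x → x ≤ ν B → E x M ≤ Lip
    E≤Lip M h l = ℚₚ.≤-trans (E-mono M h l) (ℚₚ.≤-trans (E-≤ {M = M} {M ℕ.+ (B ℕ.+ B)} (ℕₚ.m≤m+n M (B ℕ.+ B)) (0≤ν B))
      (E-upper 0 (M ℕ.+ (B ℕ.+ B)) (0≤ν B) ℚₚ.≤-refl (ℕₚ.m≤n+m (B ℕ.+ B) M)))

    E-Lip : ∀ {x y} M → 0ℚ ≤ x → x ≤ y → y ≤ ν B → E y M ≤ E x M + (y - x) * Lip
    E-Lip zero h l u = ≤-by _ (0≤* (≤⇒0≤ l) 0≤Lip) refl
    E-Lip {x} {y} (suc M) h l u = ℚₚ.≤-trans (proj₂ (E-diff M h l)) (ℚₚ.+-monoʳ-≤ (E x (suc M))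
      (ℚₚ.*-monoˡ-≤-nonNeg (y - x) {{ℚ.nonNegative (≤⇒0≤ l)}} (E≤Lip M (ℚₚ.≤-trans h l) u)))

-- Roots, exponentials and logarithms of Cauchy reals

module RealFunctions where

  open import Defs
  open RationalVectors
  open Interpolation using (/1≡ι; ι-+)
  open ExponentialSeries
  open import Tactic.RingSolver using (solve-∀)
  open import Data.Nat as ℕ using (ℕ; zero; suc; s≤s; z≤n)
  import Data.Nat.Properties as ℕₚ
  open import Data.Integer as ℤ using (ℤ)
  open import Data.Rational using (ℚ; mkℚ; 0ℚ; 1ℚ; ½; _+_; _*_; _-_; -_; _<_; _≤_; ∣_∣; _≤?_)
  import Data.Rational as ℚ
  import Data.Rational.Properties as ℚₚ
  open import Data.Rational.Solver using () renaming (module +-*-Solver to Sol)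
  open import Data.Product using (Σ; ∃-syntax; _×_; _,_; proj₁; proj₂)
  open import Data.Sum using (_⊎_; inj₁; inj₂)
  open import Relation.Nullary using (¬_; Dec; yes; no)
  open import Relation.Binary.PropositionalEquality hiding (J)

  by-contra : ∀ {a b} → ¬ (b < a) → a ≤ b
  by-contra {a} {b} h = ℚₚ.≮⇒≥ h

  seq-^ : ∀ x k n → seq (x ^ℝ k) n ≡ pow (seq x n) k
  seq-^ x zero    n = refl
  seq-^ x (suc k) n = cong (seq x n *_) (seq-^ x k n)

  seq-expSum : ∀ x m n → seq (expSum x m) n ≡ E (seq x n) m
  seq-expSum x zero    n = refl
  seq-expSum x (suc m) n = cong₂ _+_ (seq-expSum x m n) (cong (_* ifact m) (seq-^ x m n))

  module RootOf (k : ℕ) (1≤k : 1 ℕ.≤ k) (x : ℝ) (0≤x : ∀ n → 0ℚ ≤ seq x n) where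

    abstract
      -- The search runs through the multiples of `ε n` up to `ceil (seq x n)`, where the power
      -- certainly exceeds the approximation. It can be carried out because rational comparison is
      -- decidable.
      approx : ∀ n → Σ ℚ λ u → 0ℚ ≤ u × pow u k ≤ seq x n × seq x n < pow (u + ε n) k
      approx n = go (crossing P (λ j → pow (ν j * ε n) k ≤? seq x n) p0 J pJ)
        where
        P : ℕ → Set
        P j = pow (ν j * ε n) k ≤ seq x n
        J : ℕ
        J = ceil (seq x n) ℕ.* suc n
        pow0 : ∀ {k} → 1 ℕ.≤ k → pow 0ℚ k ≡ 0ℚ
        pow0 {suc k} _ = ℚₚ.*-zeroˡ (pow 0ℚ k)
        p0 : P 0
        p0 = subst (_≤ seq x n) (sym (trans (cong (λ a → pow a k) (ℚₚ.*-zeroˡ (ε n))) (pow0 1≤k))) (0≤x n)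
        Jε : ν J * ε n ≡ ν (ceil (seq x n))
        Jε = trans (cong (_* ε n) (ν-* (ceil (seq x n)) (suc n))) (trans (ℚₚ.*-assoc (ν (ceil (seq x n))) (ν (suc n)) (ε n))
          (trans (cong (ν (ceil (seq x n)) *_) (trans (ℚₚ.*-comm (ν (suc n)) (ε n)) (ε-ν n))) (ℚₚ.*-identityʳ _)))
        1≤ceil : ∀ q → 1 ℕ.≤ ceil q
        1≤ceil (mkℚ i b c) = s≤s z≤n
        pJ : ¬ P J
        pJ h = ℚₚ.<-irrefl refl (ℚₚ.<-≤-trans (<ceil (seq x n)) (ℚₚ.≤-trans (≤pow (ν-≤ {1} (1≤ceil (seq x n))) 1≤k)
          (subst (λ a → pow a k ≤ seq x n) Jε h)))
        go : ∃[ j ] (P j × ¬ P (suc j)) → Σ ℚ λ u → 0ℚ ≤ u × pow u k ≤ seq x n × seq x n < pow (u + ε n) k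
        go (j , p , np) = ν j * ε n , 0≤* (0≤ν j) (ℚₚ.<⇒≤ (0<ε n)) , p ,
          subst (λ a → seq x n < pow a k) (trans (cong (_* ε n) (ν-suc j)) (lem (ν j) (ε n))) (ℚₚ.≰⇒> np)
          where
          lem : ∀ a e → (1ℚ + a) * e ≡ a * e + e
          lem = solve-∀ ℚring

    u : ℕ → ℚ
    u n = proj₁ (approx n)

    0≤u : ∀ n → 0ℚ ≤ u n
    0≤u n = proj₁ (proj₂ (approx n))

    u^k≤ : ∀ n → pow (u n) k ≤ seq x n
    u^k≤ n = proj₁ (proj₂ (proj₂ (approx n)))

    <u+ε : ∀ n → seq x n < pow (u n + ε n) k
    <u+ε n = proj₂ (proj₂ (proj₂ (approx n)))

    close : ∀ m n δ → 0ℚ ≤ δ → ∣ seq x m - seq x n ∣ < pow δ k → u m ≤ u n + ε n + δ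
    close m n δ 0≤δ h = by-contra λ lt → ℚₚ.<-irrefl refl (begin-strict
      seq x n + pow δ k              <⟨ ℚₚ.+-monoˡ-< (pow δ k) (<u+ε n) ⟩
      pow (u n + ε n) k + pow δ k    ≤⟨ pow-super k 1≤k 0≤un 0≤δ ⟩
      pow (u n + ε n + δ) k          ≤⟨ pow-mono k (0≤+ 0≤un 0≤δ) (ℚₚ.<⇒≤ lt) ⟩
      pow (u m) k                    ≤⟨ u^k≤ m ⟩
      seq x m                        ≡⟨ lem (seq x m) (seq x n) ⟩
      seq x n + (seq x m - seq x n)  <⟨ ℚₚ.+-monoʳ-< (seq x n) (ℚₚ.≤-<-trans (≤∣∣ _) h) ⟩
      seq x n + pow δ k              ∎)
      where
      open ℚₚ.≤-Reasoning
      0≤un : 0ℚ ≤ u n + ε n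
      0≤un = 0≤+ (0≤u n) (ℚₚ.<⇒≤ (0<ε n))
      lem : ∀ a b → a ≡ b + (a - b)
      lem = solve-∀ ℚring

    u-cauchy : Cauchy u
    u-cauchy δ 0<δ = proj₁ c ℕ.⊔ proj₁ s , λ m n hm hn →
      ∣∣< (side m n (ℕₚ.m⊔n≤o⇒m≤o _ _ hm) (ℕₚ.m⊔n≤o⇒m≤o _ _ hn) (ℕₚ.m⊔n≤o⇒n≤o (proj₁ c) _ hn))
          (subst (_< δ) (lem (u m) (u n)) (side n m (ℕₚ.m⊔n≤o⇒m≤o _ _ hn) (ℕₚ.m⊔n≤o⇒m≤o _ _ hm) (ℕₚ.m⊔n≤o⇒n≤o (proj₁ c) _ hm)))
      where
      c = cauchy x (pow (½ * δ) k) (0<pow k (0<½ 0<δ))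
      s = ε-small (0<½ 0<δ)
      lem : ∀ a b → b - a ≡ - (a - b)
      lem = solve-∀ ℚring
      side : ∀ m n → proj₁ c ℕ.≤ m → proj₁ c ℕ.≤ n → proj₁ s ℕ.≤ n → u m - u n < δ
      side m n hm hn sn = ℚₚ.≤-<-trans (ℚₚ.+-monoˡ-≤ (- u n) (close m n (½ * δ) (ℚₚ.<⇒≤ (0<½ 0<δ)) (proj₂ c m n hm hn)))
        (subst₂ _<_ (sym (lem₁ (u n) (ε n) (½ * δ))) (½+½ δ) (ℚₚ.+-monoˡ-< (½ * δ) (proj₂ s n sn)))
        where
        lem₁ : ∀ a e h → (a + e + h) - a ≡ e + h
        lem₁ = solve-∀ ℚring

    root : ℝ
    root = mkℝ u u-cauchy

    0≤root : 0ℝ ≤ℝ root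
    0≤root (δ , 0<δ , N , h) = ℚₚ.<-irrefl refl (ℚₚ.<-trans (ℚₚ.≤-<-trans (0≤u N) (<-by δ 0<δ refl)) (h N ℕₚ.≤-refl))

    module _ (Bd : ℕ) (x≤ : ∀ n → seq x n ≤ ν Bd) where

      u≤ : ∀ n → u n ≤ ν (suc Bd)
      u≤ n = by-contra λ lt → ℚₚ.<-irrefl refl (begin-strict
        ν Bd           ≤⟨ ν-≤ (ℕₚ.n≤1+n Bd) ⟩
        ν (suc Bd)     <⟨ lt ⟩
        u n            ≤⟨ ≤pow (ℚₚ.≤-trans (ν-≤ {1} (s≤s z≤n)) (ℚₚ.<⇒≤ lt)) 1≤k ⟩
        pow (u n) k    ≤⟨ u^k≤ n ⟩
        seq x n        ≤⟨ x≤ n ⟩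
        ν Bd           ∎)
        where open ℚₚ.≤-Reasoning

      root^k : root ^ℝ k ≈ x
      root^k δ 0<δ = proj₁ s , λ n h → subst (λ a → ∣ a - seq x n ∣ < δ) (sym (seq-^ root k n))
        (∣∣< (ℚₚ.≤-<-trans (ℚₚ.+-monoˡ-≤ (- seq x n) (u^k≤ n)) (subst (_< δ) (sym (ℚₚ.+-inverseʳ (seq x n))) 0<δ))
          (subst (_< δ) (lem (pow (u n) k) (seq x n)) (ℚₚ.<-≤-trans
            (ℚₚ.+-monoˡ-< (- pow (u n) k) (ℚₚ.<-≤-trans (<u+ε n) (pow-+≤ k (0≤u n) (u≤ n) (ℚₚ.<⇒≤ (0<ε n)) (ε≤1 n))))
            (ℚₚ.≤-trans (≤-by (ε n * (1ℚ + (∣ Md ∣ - Md))) (0≤* (ℚₚ.<⇒≤ (0<ε n)) (0≤+ (ℚₚ.<⇒≤ 0<1) (≤⇒0≤ (≤∣∣ Md)))) (lem₂ (pow (u n) k) (ε n) Md ∣ Md ∣))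
              (ℚₚ.<⇒≤ (proj₂ (proj₂ ev) (ε n) (0<ε n) (proj₂ s n h)))))))
        where
        Md : ℚ
        Md = modulus (ν (suc Bd)) k
        ev = Ev-small Md 0<δ
        s = ε-small (proj₁ (proj₂ ev))
        lem : ∀ p x → x + - p ≡ - (p - x)
        lem = solve-∀ ℚring
        lem₂ : ∀ p e m a → ((p + e * m) + - p) + e * (1ℚ + (a - m)) ≡ e * (1ℚ + a)
        lem₂ = solve-∀ ℚring

      isRoot : Root k x root
      isRoot = 0≤root , root^k

  module ExpOf (B : ℕ) (x : ℝ) (0≤x : ∀ n → 0ℚ ≤ seq x n) (x≤ : ∀ n → seq x n ≤ ν B) where
    open Tail B

    -- A diagonal sequence: the argument and the number of terms are refined together.
    e : ℕ → ℚ
    e n = E (seq x n) n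

    Lip-abs : ∀ {y z} M → 0ℚ ≤ y → 0ℚ ≤ z → y ≤ ν B → E y M ≤ E z M + ∣ y - z ∣ * Lip
    Lip-abs {y} {z} M hy hz uy = go (ℚₚ.≤-total z y)
      where
      go : z ≤ y ⊎ y ≤ z → E y M ≤ E z M + ∣ y - z ∣ * Lip
      go (inj₁ l) = ℚₚ.≤-trans (E-Lip M hz l uy) (ℚₚ.+-monoʳ-≤ (E z M) (ℚₚ.*-monoʳ-≤-nonNeg Lip {{ℚ.nonNegative 0≤Lip}} (≤∣∣ (y - z))))
      go (inj₂ l) = ℚₚ.≤-trans (E-mono M hy l) (≤-by _ (0≤* (ℚₚ.0≤∣p∣ (y - z)) 0≤Lip) refl)

    e-cauchy : Cauchy e
    e-cauchy δ 0<δ = (j ℕ.+ (B ℕ.+ B)) ℕ.⊔ proj₁ c , λ m n hm hn →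
      ∣∣< (side m n (ℕₚ.m⊔n≤o⇒m≤o _ _ hm) (ℕₚ.m⊔n≤o⇒m≤o _ _ hn) (proj₂ c m n (ℕₚ.m⊔n≤o⇒n≤o (j ℕ.+ (B ℕ.+ B)) _ hm) (ℕₚ.m⊔n≤o⇒n≤o (j ℕ.+ (B ℕ.+ B)) _ hn)))
          (subst (_< δ) (lem (e m) (e n)) (side n m (ℕₚ.m⊔n≤o⇒m≤o _ _ hn) (ℕₚ.m⊔n≤o⇒m≤o _ _ hm)
            (proj₂ c n m (ℕₚ.m⊔n≤o⇒n≤o (j ℕ.+ (B ℕ.+ B)) _ hn) (ℕₚ.m⊔n≤o⇒n≤o (j ℕ.+ (B ℕ.+ B)) _ hm))))
      where
      t = τ-small (0<½ 0<δ)
      j : ℕ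
      j = proj₁ t
      ev = Ev-small Lip (0<½ 0<δ)
      c = cauchy x (proj₁ ev) (proj₁ (proj₂ ev))
      lem : ∀ a b → b - a ≡ - (a - b)
      lem = solve-∀ ℚring
      small : ∀ q → 0ℚ ≤ q → q < proj₁ ev → q * Lip ≤ ½ * δ
      small q 0≤q h = go (ℚₚ.≤-total q 0ℚ) h
        where
        go : q ≤ 0ℚ ⊎ 0ℚ ≤ q → q < proj₁ ev → q * Lip ≤ ½ * δ
        go (inj₁ l) _ = subst (λ q → q * Lip ≤ ½ * δ) (sym (ℚₚ.≤-antisym l 0≤q)) (subst (_≤ ½ * δ) (sym (ℚₚ.*-zeroˡ Lip)) (ℚₚ.<⇒≤ (0<½ 0<δ)))
        go (inj₂ l) h = go₂ (0ℚ ℚₚ.<? q)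
          where
          go₂ : Dec (0ℚ < q) → q * Lip ≤ ½ * δ
          go₂ (yes p) = ℚₚ.≤-trans (ℚₚ.*-monoˡ-≤-nonNeg q {{ℚ.nonNegative l}} (ℚₚ.≤-trans (≤∣∣ Lip) (≤-by 1ℚ (ℚₚ.<⇒≤ 0<1) (ℚₚ.+-comm ∣ Lip ∣ 1ℚ))))
            (ℚₚ.<⇒≤ (proj₂ (proj₂ ev) q p h))
          go₂ (no np) = go (inj₁ (ℚₚ.≮⇒≥ np)) h
      side : ∀ m n → j ℕ.+ (B ℕ.+ B) ℕ.≤ m → j ℕ.+ (B ℕ.+ B) ℕ.≤ n → ∣ seq x m - seq x n ∣ < proj₁ ev → e m - e n < δ
      side m n hm hn h = subst₂ _<_ refl (½+½ δ) (ℚₚ.≤-<-trans (ℚₚ.≤-trans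
          (ℚₚ.+-monoˡ-≤ (- e n) (ℚₚ.≤-trans (E-upper j m (0≤x m) (x≤ m) hm) (ℚₚ.+-monoˡ-≤ (τ j) (ℚₚ.≤-trans (Lip-abs (j ℕ.+ (B ℕ.+ B)) (0≤x m) (0≤x n) (x≤ m))
            (ℚₚ.+-monoˡ-≤ (∣ seq x m - seq x n ∣ * Lip) (E-≤ hn (0≤x n)))))))
          (ℚₚ.≤-reflexive (lem₂ (e n) (∣ seq x m - seq x n ∣ * Lip) (τ j))))
        (ℚₚ.+-mono-≤-< (small ∣ seq x m - seq x n ∣ (ℚₚ.0≤∣p∣ (seq x m - seq x n)) h) (proj₂ t j ℕₚ.≤-refl)))
        where
        lem₂ : ∀ a b c → (a + b + c) + - a ≡ b + c
        lem₂ = solve-∀ ℚring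

    expo : ℝ
    expo = mkℝ e e-cauchy

    isExp : Exp x expo
    isExp δ 0<δ = j ℕ.+ (B ℕ.+ B) , λ M hM →
      (½ * δ , 0<½ 0<δ , M , λ i hi → subst (λ a → a - e i + ½ * δ < δ) (sym (seq-expSum x M i))
        (ℚₚ.≤-<-trans (ℚₚ.+-monoˡ-≤ (½ * δ) (ℚₚ.≤-trans (ℚₚ.+-monoˡ-≤ (- e i) (E-≤ hi (0≤x i))) (ℚₚ.≤-reflexive (ℚₚ.+-inverseʳ (e i)))))
          (subst (_< δ) (sym (ℚₚ.+-identityˡ (½ * δ))) (½< 0<δ)))) ,
      (½ * δ , 0<½ 0<δ , M , λ i hi → subst (λ a → e i - a + ½ * δ < δ) (sym (seq-expSum x M i))
        (subst (e i - E (seq x i) M + ½ * δ <_) (½+½ δ) (ℚₚ.+-monoˡ-< (½ * δ) (ℚₚ.≤-<-trans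
          (ℚₚ.+-monoˡ-≤ (- E (seq x i) M) (ℚₚ.≤-trans (E-upper j i (0≤x i) (x≤ i) (ℕₚ.≤-trans hM hi)) (ℚₚ.+-monoˡ-≤ (τ j) (E-≤ hM (0≤x i)))))
          (subst (_< ½ * δ) (lem (E (seq x i) M) (τ j)) (proj₂ t j ℕₚ.≤-refl))))))
      where
      t = τ-small (0<½ 0<δ)
      j : ℕ
      j = proj₁ t
      lem : ∀ a t → t ≡ (a + t) + - a
      lem = solve-∀ ℚring

  1+≤E : ∀ {x} M → 0ℚ ≤ x → 1ℚ + x ≤ E x (suc (suc M))
  1+≤E {x} M h = ℚₚ.≤-trans (ℚₚ.+-mono-≤ (1≤E (suc M) ℚₚ.≤-refl)
      (ℚₚ.≤-trans (ℚₚ.≤-reflexive (lem x)) (ℚₚ.*-monoˡ-≤-nonNeg (x - 0ℚ) {{ℚ.nonNegative (≤⇒0≤ h)}} (1≤E M ℚₚ.≤-refl))))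
    (proj₁ (E-diff (suc M) ℚₚ.≤-refl h))
    where
    lem : ∀ x → x ≡ (x - 0ℚ) * 1ℚ
    lem = solve-∀ ℚring

  E0 : ∀ M → E 0ℚ M ≤ 1ℚ
  E0 zero          = ℚₚ.<⇒≤ 0<1
  E0 (suc zero)    = ℚₚ.≤-reflexive refl
  E0 (suc (suc M)) = ℚₚ.≤-trans (ℚₚ.≤-reflexive (trans (cong (λ a → E 0ℚ (suc M) + a * ifact (suc M)) (ℚₚ.*-zeroˡ (pow 0ℚ M)))
    (trans (cong (E 0ℚ (suc M) +_) (ℚₚ.*-zeroˡ (ifact (suc M)))) (ℚₚ.+-identityʳ (E 0ℚ (suc M)))))) (E0 (suc M))

  module LogOf (n : ℕ) (1≤n : 1 ℕ.≤ n) where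

    B : ℕ
    B = suc n
    open Tail B

    abstract
      -- Two terms are present from the start, so that `1 + x` is a lower bound of every partial sum
      -- used; hence the search ends at the argument `n`.
      approx : ∀ i → Σ ℚ λ l → 0ℚ ≤ l × E l (2 ℕ.+ i) ≤ ν n × ν n < E (l + ε i) (2 ℕ.+ i)
      approx i = go (crossing P (λ j → E (ν j * ε i) (2 ℕ.+ i) ≤? ν n) p0 J pJ)
        where
        P : ℕ → Set
        P j = E (ν j * ε i) (2 ℕ.+ i) ≤ ν n
        J : ℕ
        J = n ℕ.* suc i
        p0 : P 0
        p0 = ℚₚ.≤-trans (ℚₚ.≤-reflexive (cong (λ a → E a (2 ℕ.+ i)) (ℚₚ.*-zeroˡ (ε i)))) (ℚₚ.≤-trans (E0 (2 ℕ.+ i)) (ν-≤ {1} 1≤n))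
        Jε : ν J * ε i ≡ ν n
        Jε = trans (cong (_* ε i) (ν-* n (suc i))) (trans (ℚₚ.*-assoc (ν n) (ν (suc i)) (ε i))
          (trans (cong (ν n *_) (trans (ℚₚ.*-comm (ν (suc i)) (ε i)) (ε-ν i))) (ℚₚ.*-identityʳ _)))
        pJ : ¬ P J
        pJ h = ℚₚ.<-irrefl refl (ℚₚ.<-≤-trans (<-by 1ℚ 0<1 (ℚₚ.+-comm (ν n) 1ℚ)) (ℚₚ.≤-trans (1+≤E i (0≤ν n)) (subst (λ a → E a (2 ℕ.+ i) ≤ ν n) Jε h)))
        go : ∃[ j ] (P j × ¬ P (suc j)) → Σ ℚ λ l → 0ℚ ≤ l × E l (2 ℕ.+ i) ≤ ν n × ν n < E (l + ε i) (2 ℕ.+ i)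
        go (j , p , np) = ν j * ε i , 0≤* (0≤ν j) (ℚₚ.<⇒≤ (0<ε i)) , p ,
          subst (λ a → ν n < E a (2 ℕ.+ i)) (trans (cong (_* ε i) (ν-suc j)) (lem (ν j) (ε i))) (ℚₚ.≰⇒> np)
          where
          lem : ∀ a e → (1ℚ + a) * e ≡ a * e + e
          lem = solve-∀ ℚring

    l : ℕ → ℚ
    l i = proj₁ (approx i)
    0≤l : ∀ i → 0ℚ ≤ l i
    0≤l i = proj₁ (proj₂ (approx i))
    El≤ : ∀ i → E (l i) (2 ℕ.+ i) ≤ ν n
    El≤ i = proj₁ (proj₂ (proj₂ (approx i)))
    <El : ∀ i → ν n < E (l i + ε i) (2 ℕ.+ i)
    <El i = proj₂ (proj₂ (proj₂ (approx i)))

    l≤n : ∀ i → l i ≤ ν n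
    l≤n i = ℚₚ.≤-trans (≤-by 1ℚ (ℚₚ.<⇒≤ 0<1) (ℚₚ.+-comm (l i) 1ℚ)) (ℚₚ.≤-trans (1+≤E i (0≤l i)) (El≤ i))

    l≤B : ∀ i → l i ≤ ν B
    l≤B i = ℚₚ.≤-trans (l≤n i) (ν-≤ (ℕₚ.n≤1+n n))

    l+ε≤B : ∀ i → l i + ε i ≤ ν B
    l+ε≤B i = ℚₚ.≤-trans (ℚₚ.+-mono-≤ (l≤n i) (ε≤1 i)) (ℚₚ.≤-reflexive (trans (ℚₚ.+-comm (ν n) 1ℚ) (sym (ν-suc n))))

    -- Different cut-offs change the sum by at most `τ j`, and the slope is at least 1. A value
    -- `l p` larger than claimed would overshoot `n` by more than the cut-off can explain.
    close : ∀ j p q → j ℕ.+ (B ℕ.+ B) ℕ.≤ p → j ℕ.+ (B ℕ.+ B) ℕ.≤ q → l p ≤ (l q + ε q) + τ j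
    close j p q hp hq = by-contra λ lt → ℚₚ.<-irrefl refl (begin-strict
      ν n + τ j                                                       <⟨ ℚₚ.+-monoˡ-< (τ j) (<El q) ⟩
      E (l q + ε q) (2 ℕ.+ q) + τ j                                   ≤⟨ ℚₚ.+-monoʳ-≤ (E (l q + ε q) (2 ℕ.+ q)) (τ≤ lt) ⟩
      E (l q + ε q) (2 ℕ.+ q) + (l p - (l q + ε q)) * E (l q + ε q) (suc q)  ≤⟨ proj₁ (E-diff (suc q) 0≤lq (lq≤ lt)) ⟩
      E (l p) (2 ℕ.+ q)                                               ≤⟨ E-upper j (2 ℕ.+ q) (0≤l p) (l≤B p) (ℕₚ.m≤n⇒m≤o+n 2 hq) ⟩
      E (l p) (j ℕ.+ (B ℕ.+ B)) + τ j                                 ≤⟨ ℚₚ.+-monoˡ-≤ (τ j) (ℚₚ.≤-trans (E-≤ (ℕₚ.m≤n⇒m≤o+n 2 hp) (0≤l p)) (El≤ p)) ⟩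
      ν n + τ j                                                       ∎)
      where
      open ℚₚ.≤-Reasoning
      0≤lq : 0ℚ ≤ l q + ε q
      0≤lq = 0≤+ (0≤l q) (ℚₚ.<⇒≤ (0<ε q))
      τ≤diff : (l q + ε q) + τ j < l p → τ j ≤ l p - (l q + ε q)
      τ≤diff lt = subst (_≤ l p - (l q + ε q)) (lem (l q + ε q) (τ j)) (ℚₚ.+-monoˡ-≤ (- (l q + ε q)) (ℚₚ.<⇒≤ lt))
        where
        lem : ∀ a t → (a + t) + - a ≡ t
        lem = solve-∀ ℚring
      lq≤ : (l q + ε q) + τ j < l p → l q + ε q ≤ l p
      lq≤ lt = ℚₚ.≤-trans (≤-by (τ j) (0≤τ j) refl) (ℚₚ.<⇒≤ lt)
      τ≤ : (l q + ε q) + τ j < l p → τ j ≤ (l p - (l q + ε q)) * E (l q + ε q) (suc q)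
      τ≤ lt = ℚₚ.≤-trans (τ≤diff lt) (subst (_≤ (l p - (l q + ε q)) * E (l q + ε q) (suc q)) (ℚₚ.*-identityʳ _)
        (ℚₚ.*-monoˡ-≤-nonNeg (l p - (l q + ε q)) {{ℚ.nonNegative (≤⇒0≤ (lq≤ lt))}} (1≤E q 0≤lq)))

    l-cauchy : Cauchy l
    l-cauchy δ 0<δ = (j ℕ.+ (B ℕ.+ B)) ℕ.⊔ proj₁ s , λ m n hm hn →
      ∣∣< (side m n (ℕₚ.m⊔n≤o⇒m≤o _ _ hm) (ℕₚ.m⊔n≤o⇒m≤o _ _ hn) (ℕₚ.m⊔n≤o⇒n≤o (j ℕ.+ (B ℕ.+ B)) _ hn))
          (subst (_< δ) (lem (l m) (l n)) (side n m (ℕₚ.m⊔n≤o⇒m≤o _ _ hn) (ℕₚ.m⊔n≤o⇒m≤o _ _ hm) (ℕₚ.m⊔n≤o⇒n≤o (j ℕ.+ (B ℕ.+ B)) _ hm)))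
      where
      t = τ-small (0<½ 0<δ)
      j : ℕ
      j = proj₁ t
      s = ε-small (0<½ 0<δ)
      lem : ∀ a b → b - a ≡ - (a - b)
      lem = solve-∀ ℚring
      side : ∀ m n → j ℕ.+ (B ℕ.+ B) ℕ.≤ m → j ℕ.+ (B ℕ.+ B) ℕ.≤ n → proj₁ s ℕ.≤ n → l m - l n < δ
      side m n hm hn sn = ℚₚ.≤-<-trans (ℚₚ.+-monoˡ-≤ (- l n) (close j m n hm hn))
        (subst₂ _<_ (lem₁ (l n) (ε n) (τ j)) (½+½ δ) (ℚₚ.+-mono-< (proj₂ s n sn) (proj₂ t j ℕₚ.≤-refl)))
        where
        lem₁ : ∀ a e h → e + h ≡ (a + e + h) - a
        lem₁ = solve-∀ ℚring

    log : ℝ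
    log = mkℝ l l-cauchy

    isLog : Log (fromℕ n) log
    isLog δ 0<δ = j ℕ.+ (B ℕ.+ B) , λ M hM →
      (½ * δ , 0<½ 0<δ , M , λ i hi → subst₂ (λ a b → a - b + ½ * δ < δ) (sym (seq-expSum log M i)) (sym (/1≡ι (ℤ.+ n)))
        (ℚₚ.≤-<-trans (ℚₚ.+-monoˡ-≤ (½ * δ) (ℚₚ.≤-trans (ℚₚ.+-monoˡ-≤ (- ν n) (ℚₚ.≤-trans (E-≤ (ℕₚ.m≤n⇒m≤o+n 2 hi) (0≤l i)) (El≤ i)))
            (ℚₚ.≤-reflexive (ℚₚ.+-inverseʳ (ν n)))))
          (subst (_< δ) (sym (ℚₚ.+-identityˡ (½ * δ))) (½< 0<δ)))) ,
      (½ * δ , 0<½ 0<δ , M ℕ.⊔ proj₁ s , λ i hi → subst₂ (λ a b → b - a + ½ * δ < δ) (sym (seq-expSum log M i)) (sym (/1≡ι (ℤ.+ n)))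
        (subst (ν n - E (l i) M + ½ * δ <_) (½+½ δ) (ℚₚ.+-monoˡ-< (½ * δ) (lower M hM i (ℕₚ.m⊔n≤o⇒m≤o M _ hi) (ℕₚ.m⊔n≤o⇒n≤o M _ hi)))))
      where
      t = τ-small (0<½ (0<½ 0<δ))
      j : ℕ
      j = proj₁ t
      ev = Ev-small Lip (0<½ (0<½ 0<δ))
      s = ε-small (proj₁ (proj₂ ev))
      εLip : ∀ i → proj₁ s ℕ.≤ i → ε i * Lip < ½ * (½ * δ)
      εLip i h = ℚₚ.≤-<-trans (ℚₚ.*-monoˡ-≤-nonNeg (ε i) {{ℚ.nonNegative (ℚₚ.<⇒≤ (0<ε i))}} (ℚₚ.≤-trans (≤∣∣ Lip) (≤-by 1ℚ (ℚₚ.<⇒≤ 0<1) (ℚₚ.+-comm ∣ Lip ∣ 1ℚ))))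
        (proj₂ (proj₂ ev) (ε i) (0<ε i) (proj₂ s i h))
      lower : ∀ M → j ℕ.+ (B ℕ.+ B) ℕ.≤ M → ∀ i → M ℕ.≤ i → proj₁ s ℕ.≤ i → ν n - E (l i) M < ½ * δ
      lower M hM i hi si = ℚₚ.<-trans (ℚₚ.+-monoˡ-< (- E (l i) M) (ℚₚ.<-≤-trans (<El i) (ℚₚ.≤-trans (E-Lip (2 ℕ.+ i) (0≤l i) (≤-by (ε i) (ℚₚ.<⇒≤ (0<ε i)) refl) (l+ε≤B i))
          (ℚₚ.+-monoˡ-≤ ((l i + ε i - l i) * Lip) (ℚₚ.≤-trans (E-upper j (2 ℕ.+ i) (0≤l i) (l≤B i) (ℕₚ.m≤n⇒m≤o+n 2 (ℕₚ.≤-trans hM hi)))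
            (ℚₚ.+-monoˡ-≤ (τ j) (E-≤ hM (0≤l i))))))))
        (subst₂ _<_ (lem (E (l i) M) (τ j) (l i) (ε i) Lip) (½+½ (½ * δ)) (ℚₚ.+-mono-< (proj₂ t j ℕₚ.≤-refl) (εLip i si)))
        where
        lem : ∀ a t l e L → t + e * L ≡ (a + t + (l + e - l) * L) + - a
        lem = solve-∀ ℚring

    -- By the mean value inequality a unit step of the argument at least doubles the sum, at the
    -- price of one more term. This bounds the logarithm of `n` by `X` when `n` is at most `2 ^ X`.
    2^≤E : ∀ X → ν (2 ℕ.^ X) ≤ E (ν X) (suc X)
    2^≤E zero    = 1≤E 0 ℚₚ.≤-refl
    2^≤E (suc X) = ℚₚ.≤-trans (ℚₚ.≤-reflexive (trans (cong ν (cong (2 ℕ.^ X ℕ.+_) (ℕₚ.+-identityʳ (2 ℕ.^ X)))) (ι-+ (ℤ.+ (2 ℕ.^ X)) (ℤ.+ (2 ℕ.^ X)))))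
      (ℚₚ.≤-trans (ℚₚ.+-mono-≤ (ℚₚ.≤-trans (2^≤E X) (E-≤ (ℕₚ.n≤1+n (suc X)) (0≤ν X))) (ℚₚ.≤-trans (2^≤E X) (ℚₚ.≤-reflexive (sym one))))
        (proj₁ (E-diff {ν X} {ν (suc X)} (suc X) (0≤ν X) (ν-≤ (ℕₚ.n≤1+n X)))))
      where
      one : (ν (suc X) - ν X) * E (ν X) (suc X) ≡ E (ν X) (suc X)
      one = trans (cong (λ a → (a - ν X) * E (ν X) (suc X)) (ν-suc X)) (lem (ν X) (E (ν X) (suc X)))
        where
        lem : ∀ x e → (1ℚ + x - x) * e ≡ e
        lem = solve-∀ ℚring

    log≤ : ∀ X → n ℕ.≤ 2 ℕ.^ X → ∀ i → X ℕ.≤ i → l i ≤ ν X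
    log≤ X h i hi = by-contra λ lt → ℚₚ.<-irrefl refl (begin-strict
      ν n                                                                ≤⟨ ν-≤ h ⟩
      ν (2 ℕ.^ X)                                                        ≤⟨ 2^≤E X ⟩
      E (ν X) (suc X)                                                    ≤⟨ E-≤ (s≤s (ℕₚ.m≤n⇒m≤1+n hi)) (0≤ν X) ⟩
      E (ν X) (2 ℕ.+ i)                                                  <⟨ <-by ((l i - ν X) * E (ν X) (suc i)) (0<* (<⇒0< lt) (ℚₚ.<-≤-trans 0<1 (1≤E i (0≤ν X)))) refl ⟩
      E (ν X) (2 ℕ.+ i) + (l i - ν X) * E (ν X) (suc i)                  ≤⟨ proj₁ (E-diff (suc i) (0≤ν X) (ℚₚ.<⇒≤ lt)) ⟩
      E (l i) (2 ℕ.+ i)                                                  ≤⟨ El≤ i ⟩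
      ν n                                                                ∎)
      where open ℚₚ.≤-Reasoning

  -- e^x ≤ 1 / (1 − x) in the form e^(j/5) ≤ (5/4)^j.

  ⅕ 5/4 : ℚ
  ⅕ = ε 4
  5/4 = ℤ.+ 5 ℚ./ 4

  E-5/4 : ∀ {x} M → 0ℚ ≤ x → E (⅕ + x) M ≤ 5/4 * E x M
  E-5/4 zero h = ℚₚ.≤-reflexive refl
  E-5/4 {x} (suc M) h = ℚₚ.≤-trans (≤-by (5/4 * ((E x (suc M) + ((⅕ + x) - x) * E (⅕ + x) M) - E (⅕ + x) (suc M)) + ¼′ * term (⅕ + x) M)
      (0≤+ (0≤* (ℚₚ.<⇒≤ (ℚₚ.positive⁻¹ 5/4)) (≤⇒0≤ (proj₂ (E-diff M h (≤-by ⅕ (ℚₚ.<⇒≤ (0<ε 4)) (ℚₚ.+-comm x ⅕))))))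
           (0≤* (ℚₚ.<⇒≤ (ℚₚ.positive⁻¹ ¼′)) (0≤term M (0≤+ (ℚₚ.<⇒≤ (0<ε 4)) h))))
      (lem (E x (suc M)) x (E (⅕ + x) M) (term (⅕ + x) M))) ℚₚ.≤-refl
    where
    ¼′ : ℚ
    ¼′ = ε 3
    lem : ∀ e x f t → (f + t) + (5/4 * ((e + ((⅕ + x) - x) * f) - (f + t)) + ¼′ * t) ≡ 5/4 * e
    lem = Sol.solve 4 (λ e x f t → (f Sol.:+ t) Sol.:+ (Sol.con 5/4 Sol.:* ((e Sol.:+ ((Sol.con ⅕ Sol.:+ x) Sol.:- x) Sol.:* f) Sol.:- (f Sol.:+ t)) Sol.:+ Sol.con ¼′ Sol.:* t) Sol.:= Sol.con 5/4 Sol.:* e) refl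

  E-power : ∀ J M → E (ν J * ⅕) M ≤ pow 5/4 J
  E-power zero    M = ℚₚ.≤-trans (ℚₚ.≤-reflexive (cong (λ a → E a M) (ℚₚ.*-zeroˡ ⅕))) (E0 M)
  E-power (suc J) M = ℚₚ.≤-trans (ℚₚ.≤-reflexive (cong (λ a → E a M) (trans (cong (_* ⅕) (ν-suc J)) (lem (ν J) ⅕))))
    (ℚₚ.≤-trans (E-5/4 M (0≤* (0≤ν J) (ℚₚ.<⇒≤ (0<ε 4)))) (ℚₚ.*-monoˡ-≤-nonNeg 5/4 (E-power J M)))
    where
    lem : ∀ j f → (1ℚ + j) * f ≡ f + j * f
    lem = solve-∀ ℚring

  -- The constant in the exponent is c = 1/(5 (k + 1)). If log n is at most ((k + 1) J)², then c
  -- sqrt(log n) is at most J/5, and its exponential at most (5/4)^J.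
  module ExpSqrtLog (k : ℕ) (n : ℕ) (1≤n : 1 ℕ.≤ n) where
    open LogOf n 1≤n public using (log; isLog; l; 0≤l; l≤n; log≤)
    module R = RootOf 2 (s≤s z≤n) log 0≤l

    0<c : 0ℚ < (⅕ * ε k)
    0<c = 0<* (0<ε 4) (0<ε k)

    isSqrt : Sqrt log R.root
    isSqrt = R.isRoot n l≤n

    0≤arg : ∀ i → 0ℚ ≤ seq (fromℚ (⅕ * ε k) *ℝ R.root) i
    0≤arg i = 0≤* (ℚₚ.<⇒≤ 0<c) (R.0≤u i)

    arg≤ : ∀ i → seq (fromℚ (⅕ * ε k) *ℝ R.root) i ≤ ν (suc n)
    arg≤ i = ℚₚ.≤-trans (subst ((⅕ * ε k) * R.u i ≤_) (ℚₚ.*-identityˡ (R.u i)) (ℚₚ.*-monoʳ-≤-nonNeg (R.u i) {{ℚ.nonNegative (R.0≤u i)}}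
      (subst ((⅕ * ε k) ≤_) (ℚₚ.*-identityˡ 1ℚ) (*-mono-≤ (ℚₚ.<⇒≤ (0<ε 4)) (ℚₚ.<⇒≤ 0<1) (ε≤1 4) (ε≤1 k))))) (R.u≤ n l≤n i)

    module X = ExpOf (suc n) (fromℚ (⅕ * ε k) *ℝ R.root) 0≤arg arg≤

    bound : ∀ J → n ℕ.≤ 2 ℕ.^ ((suc k ℕ.* J) ℕ.* (suc k ℕ.* J)) → ∃[ N ] (∀ i → N ℕ.≤ i → seq X.expo i ≤ pow 5/4 J)
    bound J h = Y ℕ.* Y , λ i hi → ℚₚ.≤-trans (E-mono i (0≤arg i) (argJ i hi)) (E-power J i)
      where
      Y : ℕ
      Y = suc k ℕ.* J
      sqrt≤ : ∀ i → Y ℕ.* Y ℕ.≤ i → R.u i ≤ ν Y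
      sqrt≤ i hi = by-contra λ lt → ℚₚ.<-irrefl refl (begin-strict
        ν Y * ν Y                  ≤⟨ ℚₚ.*-monoʳ-≤-nonNeg (ν Y) {{ℚ.nonNegative (0≤ν Y)}} (ℚₚ.<⇒≤ lt) ⟩
        R.u i * ν Y                <⟨ ℚₚ.*-monoʳ-<-pos (R.u i) {{ℚ.positive (ℚₚ.≤-<-trans (0≤ν Y) lt)}} lt ⟩
        R.u i * R.u i              ≡⟨ cong (R.u i *_) (ℚₚ.*-identityʳ (R.u i)) ⟨
        pow (R.u i) 2              ≤⟨ R.u^k≤ i ⟩
        l i                        ≤⟨ log≤ (Y ℕ.* Y) h i hi ⟩
        ν (Y ℕ.* Y)                ≡⟨ ν-* Y Y ⟩
        ν Y * ν Y                  ∎)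
        where open ℚₚ.≤-Reasoning
      argJ : ∀ i → Y ℕ.* Y ℕ.≤ i → seq (fromℚ (⅕ * ε k) *ℝ R.root) i ≤ ν J * ⅕
      argJ i hi = ℚₚ.≤-trans (ℚₚ.*-monoˡ-≤-nonNeg (⅕ * ε k) {{ℚ.nonNegative (ℚₚ.<⇒≤ 0<c)}} (sqrt≤ i hi))
        (ℚₚ.≤-reflexive (trans (cong ((⅕ * ε k) *_) (ν-* (suc k) J)) (trans (lem ⅕ (ε k) (ν (suc k)) (ν J)) (trans (cong (λ a → ν J * ⅕ * a) (ε-ν k)) (ℚₚ.*-identityʳ _)))))
        where
        lem : ∀ a e k j → (a * e) * (k * j) ≡ j * a * (e * k)
        lem = solve-∀ ℚring

  exp-sqrt-log : ∀ k n → 1 ℕ.≤ n → ∃[ ℓ ] ∃[ s ] ∃[ e ] (Log (fromℕ n) ℓ × Sqrt ℓ s × Exp (fromℚ (⅕ * ε k) *ℝ s) e ×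
    (∀ J → n ℕ.≤ 2 ℕ.^ ((suc k ℕ.* J) ℕ.* (suc k ℕ.* J)) → ∃[ N ] (∀ i → N ℕ.≤ i → seq e i ≤ pow 5/4 J)))
  exp-sqrt-log k n 1≤n = T.log , T.R.root , T.X.expo , T.isLog , T.isSqrt , T.X.isExp , T.bound
    where
    module T = ExpSqrtLog k n 1≤n

-- From rational cells to halving hyperplanes over the reals

module HalvingPlanes where

  open import Defs
  open FiniteTypes using (∑F; ∑F-cong; ∑F-+; ∑F-const; ∑F-single; ∑ᵀ-zero; fin)
  open RationalVectors
  open Perturbation hiding (module Cell)
  open Perturbation using (module Cell)
  open Interpolation
  open import Tactic.RingSolver using (solve-∀)
  open import Algebra.Bundles using (CommutativeRing)
  open import Data.Bool using (Bool; true; false)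
  open import Data.Nat as ℕ using (ℕ; zero; suc)
  import Data.Nat.Properties as ℕₚ
  open import Data.Integer as ℤ using (ℤ; 0ℤ; 1ℤ; -1ℤ)
  import Data.Integer.Properties as ℤₚ
  import Data.Integer.Tactic.RingSolver as ℤR
  open import Data.Rational using (ℚ; 0ℚ; 1ℚ; ½; _+_; _*_; _-_; -_; _<_; _≤_; ∣_∣)
  import Data.Rational as ℚ
  import Data.Rational.Properties as ℚₚ
  open import Data.Fin as Fin using (Fin; zero; suc)
  import Data.Fin.Properties as Finₚ
  open import Data.Fin.Subset using (Subset; _∈_) renaming (∣_∣ to card)
  import Data.Vec as Vec
  import Data.Vec.Properties as Vecₚ
  open import Data.Product using (∃-syntax; _×_; _,_; proj₁; proj₂)
  open import Data.Sum using (_⊎_; inj₁; inj₂)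
  open import Data.Vec.Functional using (Vector; tail) renaming (_∷_ to _∷ᵥ_)
  open import Function using (_∘_; Injective; _⇔_; mk⇔; Equivalence)
  open import Relation.Nullary using (¬_; Dec; yes; no; does; contradiction)
  open import Relation.Binary using (tri<; tri≈; tri>)
  open import Relation.Binary.PropositionalEquality hiding (J)

  open import Algebra.Properties.Semiring.Sum (CommutativeRing.semiring ℚₚ.+-*-commutativeRing)
    using (sum; sum-cong-≗)

  -- A competing hyperplane is real, that is, a sequence of rational functionals. Being equal to 0,
  -- bounded, or apart from 0 is expressed for such sequences.
  Null Bnd Away : (ℕ → ℚ) → Set
  Null u = ∀ ε → 0ℚ < ε → ∃[ N ] (∀ n → N ℕ.≤ n → ∣ u n ∣ < ε)
  Bnd u  = ∃[ B ] ∃[ N ] (∀ n → N ℕ.≤ n → ∣ u n ∣ ≤ B)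
  Away u = ∃[ c ] (0ℚ < c × ∃[ N ] (∀ n → N ℕ.≤ n → c ≤ ∣ u n ∣))

  Null-≗ : ∀ {u v} → (∀ n → u n ≡ v n) → Null u → Null v
  Null-≗ e nu ε 0<ε = let N , h = nu ε 0<ε in N , λ n k → subst (λ x → ∣ x ∣ < ε) (e n) (h n k)

  Null-0 : Null (λ _ → 0ℚ)
  Null-0 ε 0<ε = 0 , λ _ _ → 0<ε

  Null-+ : ∀ {u v} → Null u → Null v → Null (λ n → u n + v n)
  Null-+ {u} {v} nu nv ε 0<ε = let M , h = nu _ (0<½ 0<ε) ; N , k = nv _ (0<½ 0<ε) in M ℕ.⊔ N , λ n l →
    ℚₚ.≤-<-trans (ℚₚ.∣p+q∣≤∣p∣+∣q∣ (u n) (v n)) (subst (∣ u n ∣ + ∣ v n ∣ <_) (½+½ ε)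
      (ℚₚ.+-mono-< (h n (ℕₚ.m⊔n≤o⇒m≤o M N l)) (k n (ℕₚ.m⊔n≤o⇒n≤o M N l))))

  Null-* : ∀ {u v} → Null u → Bnd v → Null (λ n → u n * v n)
  Null-* {u} {v} nu (B , M , hB) ε 0<ε = M ℕ.⊔ N , λ n l → subst (_< ε) (sym (ℚₚ.∣p*q∣≡∣p∣*∣q∣ (u n) (v n)))
      (ℚₚ.≤-<-trans (*-mono-≤ (ℚₚ.0≤∣p∣ (u n)) (ℚₚ.<⇒≤ (0<1+∣∣ B)) (ℚₚ.<⇒≤ (h n (ℕₚ.m⊔n≤o⇒n≤o M N l)))
          (ℚₚ.≤-trans (hB n (ℕₚ.m⊔n≤o⇒m≤o M N l)) (ℚₚ.≤-trans (≤∣∣ B) (≤-by 1ℚ (ℚₚ.<⇒≤ 0<1) (ℚₚ.+-comm ∣ B ∣ 1ℚ)))))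
        (proj₂ (proj₂ w)))
    where
    w = Ev-witness (Ev-small B 0<ε)
    N : ℕ
    N = proj₁ (nu (proj₁ w) (proj₁ (proj₂ w)))
    h = proj₂ (nu (proj₁ w) (proj₁ (proj₂ w)))

  Bnd-const : ∀ c → Bnd (λ _ → c)
  Bnd-const c = ∣ c ∣ , 0 , λ _ _ → ℚₚ.≤-refl

  Null-scale : ∀ {u} c → Null u → Null (λ n → c * u n)
  Null-scale {u} c nu = Null-≗ (λ n → ℚₚ.*-comm (u n) c) (Null-* nu (Bnd-const c))

  Bnd-≗ : ∀ {u v} → (∀ n → u n ≡ v n) → Bnd u → Bnd v
  Bnd-≗ e (B , N , h) = B , N , λ n l → subst (λ x → ∣ x ∣ ≤ B) (e n) (h n l)

  Bnd-+ : ∀ {u v} → Bnd u → Bnd v → Bnd (λ n → u n + v n)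
  Bnd-+ {u} {v} (B , M , h) (C , N , k) = B + C , M ℕ.⊔ N , λ n l → ℚₚ.≤-trans (ℚₚ.∣p+q∣≤∣p∣+∣q∣ (u n) (v n))
    (ℚₚ.+-mono-≤ (h n (ℕₚ.m⊔n≤o⇒m≤o M N l)) (k n (ℕₚ.m⊔n≤o⇒n≤o M N l)))

  Bnd-scale : ∀ {u} c → Bnd u → Bnd (λ n → u n * c)
  Bnd-scale {u} c (B , N , h) = B * ∣ c ∣ , N , λ n l → subst (_≤ B * ∣ c ∣) (sym (ℚₚ.∣p*q∣≡∣p∣*∣q∣ (u n) c))
    (ℚₚ.*-monoʳ-≤-nonNeg ∣ c ∣ {{ℚ.nonNegative (ℚₚ.0≤∣p∣ c)}} (h n l))

  Cauchy⇒Bnd : ∀ {u} → Cauchy u → Bnd u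
  Cauchy⇒Bnd {u} cu = let N , h = cu 1ℚ 0<1 in 1ℚ + ∣ u N ∣ , N , λ n l →
    subst (λ x → ∣ x ∣ ≤ 1ℚ + ∣ u N ∣) (lem (u n) (u N)) (ℚₚ.≤-trans (ℚₚ.∣p+q∣≤∣p∣+∣q∣ (u n - u N) (u N))
      (ℚₚ.+-monoˡ-≤ ∣ u N ∣ (ℚₚ.<⇒≤ (h n N l ℕₚ.≤-refl))))
    where
    lem : ∀ a b → (a - b) + b ≡ a
    lem = solve-∀ ℚring

  Null-sum : ∀ {k} (u : ℕ → Vector ℚ k) → (∀ i → Null (λ n → u n i)) → Null (λ n → sum (u n))
  Null-sum {zero}  u h = Null-0
  Null-sum {suc k} u h = Null-+ (h zero) (Null-sum (λ n → tail (u n)) (h ∘ suc))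

  Bnd-sum : ∀ {k} (u : ℕ → Vector ℚ k) → (∀ i → Bnd (λ n → u n i)) → Bnd (λ n → sum (u n))
  Bnd-sum {zero}  u h = Bnd-const 0ℚ
  Bnd-sum {suc k} u h = Bnd-+ (h zero) (Bnd-sum (λ n → tail (u n)) (h ∘ suc))

  Null-· : ∀ {k} (u v : ℕ → Vector ℚ k) → (∀ i → Null (λ n → u n i)) → (∀ i → Bnd (λ n → v n i)) → Null (λ n → u n · v n)
  Null-· u v h k = Null-≗ (λ n → sym (·-sum-def (u n) (v n))) (Null-sum (λ n i → u n i * v n i) λ i → Null-* (h i) (k i))

  Bnd-· : ∀ {k} (u : ℕ → Vector ℚ k) v → (∀ i → Bnd (λ n → u n i)) → Bnd (λ n → u n · v)
  Bnd-· u v h = Bnd-≗ (λ n → sym (·-sum-def (u n) v)) (Bnd-sum (λ n i → u n i * v i) λ i → Bnd-scale (v i) (h i))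

  Null-cancel : ∀ {u v} → Away u → Null (λ n → u n * v n) → Null v
  Null-cancel {u} {v} (c , 0<c , M , hc) nuv ε 0<ε = let N , h = nuv (c * ε) (0<* 0<c 0<ε) in M ℕ.⊔ N , λ n l →
    ℚₚ.*-cancelˡ-<-nonNeg c {{ℚ.nonNegative (ℚₚ.<⇒≤ 0<c)}} (ℚₚ.≤-<-trans
      (ℚₚ.*-monoʳ-≤-nonNeg ∣ v n ∣ {{ℚ.nonNegative (ℚₚ.0≤∣p∣ (v n))}} (hc n (ℕₚ.m⊔n≤o⇒m≤o M N l)))
      (subst (_< c * ε) (ℚₚ.∣p*q∣≡∣p∣*∣q∣ (u n) (v n)) (h n (ℕₚ.m⊔n≤o⇒n≤o M N l))))

  0<∣∣ : ∀ {c} → c ≢ 0ℚ → 0ℚ < ∣ c ∣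
  0<∣∣ {c} h with ℚₚ.<-cmp 0ℚ ∣ c ∣
  ... | tri< p _ _ = p
  ... | tri≈ _ e _ = contradiction (ℚₚ.∣p∣≡0⇒p≡0 c (sym e)) h
  ... | tri> _ _ p = contradiction (ℚₚ.<-≤-trans p (ℚₚ.0≤∣p∣ c)) (ℚₚ.<-irrefl refl)

  Away-const : ∀ {c} → c ≢ 0ℚ → Away (λ _ → c)
  Away-const {c} h = ∣ c ∣ , 0<∣∣ h , 0 , λ _ _ → ℚₚ.≤-refl

  Away-factor : ∀ {u} h → Away (λ n → h * u n) → Away u
  Away-factor {u} h (c , 0<c , N , k) = proj₁ w , proj₁ (proj₂ w) , N , λ n l → ℚₚ.≮⇒≥ λ lt → ℚₚ.<-irrefl refl
      (ℚₚ.<-≤-trans (ℚₚ.≤-<-trans (ℚₚ.≤-trans (ℚₚ.≤-reflexive (trans (ℚₚ.∣p*q∣≡∣p∣*∣q∣ h (u n)) (ℚₚ.*-comm ∣ h ∣ ∣ u n ∣)))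
        (*-mono-≤ (ℚₚ.0≤∣p∣ (u n)) (ℚₚ.<⇒≤ (0<1+∣∣ h)) (ℚₚ.<⇒≤ lt) (≤-by 1ℚ (ℚₚ.<⇒≤ 0<1) (ℚₚ.+-comm ∣ h ∣ 1ℚ)))) (proj₂ (proj₂ w)))
        (k n l))
    where
    w = Ev-witness (Ev-small h 0<c)

  Away-perturb : ∀ {u v} → Away u → Null v → Away (λ n → u n + v n)
  Away-perturb {u} {v} (c , 0<c , M , h) nv = let N , k = nv _ (0<½ 0<c) in ½ * c , 0<½ 0<c , M ℕ.⊔ N , λ n l →
    ℚₚ.≮⇒≥ λ lt → ℚₚ.<-irrefl refl (ℚₚ.≤-<-trans (h n (ℕₚ.m⊔n≤o⇒m≤o M N l)) (ℚₚ.≤-<-trans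
      (subst (λ x → ∣ x ∣ ≤ ∣ u n + v n ∣ + ∣ v n ∣) (lem (u n) (v n)) (ℚₚ.∣p-q∣≤∣p∣+∣q∣ (u n + v n) (v n)))
      (subst (∣ u n + v n ∣ + ∣ v n ∣ <_) (½+½ c) (ℚₚ.+-mono-< lt (k n (ℕₚ.m⊔n≤o⇒n≤o M N l))))))
    where
    lem : ∀ a b → (a + b) - b ≡ a
    lem = solve-∀ ℚring

  Away⇒¬Null : ∀ {u} → Away u → ¬ Null u
  Away⇒¬Null (c , 0<c , M , h) nu = let N , k = nu c 0<c in
    ℚₚ.<-irrefl refl (ℚₚ.≤-<-trans (h (M ℕ.⊔ N) (ℕₚ.m≤m⊔n M N)) (k (M ℕ.⊔ N) (ℕₚ.m≤n⊔m M N)))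

  #0⇒Away : ∀ x → x # 0ℝ → Away (seq x)
  #0⇒Away x (inj₁ (c , 0<c , N , h)) = c , 0<c , N , λ n l → ℚₚ.≤-trans (ℚₚ.<⇒≤ (subst₂ _<_ (lem₁ (seq x n) c) (lem₂ (seq x n))
      (ℚₚ.+-monoʳ-< (- seq x n) (h n l)))) (-≤∣∣ (seq x n))
    where
    lem₁ : ∀ x c → - x + (x + c) ≡ c
    lem₁ = solve-∀ ℚring
    lem₂ : ∀ x → - x + 0ℚ ≡ - x
    lem₂ = solve-∀ ℚring
  #0⇒Away x (inj₂ (c , 0<c , N , h)) = c , 0<c , N , λ n l → ℚₚ.≤-trans (ℚₚ.<⇒≤ (subst (_< seq x n) (ℚₚ.+-identityˡ c) (h n l))) (≤∣∣ (seq x n))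

  fromℚ-#0 : ∀ {q} → q ≢ 0ℚ → fromℚ q # 0ℝ
  fromℚ-#0 {q} h = go (ℚₚ.<-cmp q 0ℚ)
    where
    go : _ → fromℚ q # 0ℝ
    go (tri< p _ _) = inj₁ (½ * - q , 0<½ (neg⇒pos p) , 0 , λ _ _ → subst (q + ½ * - q <_) (ℚₚ.+-inverseʳ q) (ℚₚ.+-monoʳ-< q (½< (neg⇒pos p))))
    go (tri≈ _ e _) = contradiction e h
    go (tri> _ _ p) = inj₂ (½ * q , 0<½ p , 0 , λ _ _ → subst (_< q) (sym (ℚₚ.+-identityˡ (½ * q))) (½< p))

  indicator : Bool → ℤ
  indicator true  = 1ℤ
  indicator false = 0ℤ

  card-∑ : ∀ {n} (f : Fin n → Bool) → ℤ.+ card (Vec.tabulate f) ≡ ∑F (indicator ∘ f)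
  card-∑ {zero}  f = refl
  card-∑ {suc n} f with f zero
  ... | true  = cong (λ a → 1ℤ ℤ.+ a) (card-∑ (f ∘ suc))
  ... | false = trans (card-∑ (f ∘ suc)) (sym (ℤₚ.+-identityˡ (∑F (indicator ∘ f ∘ suc))))

  ∑F-comm : ∀ {m n} (f : Fin m → Fin n → ℤ) → ∑F (λ i → ∑F λ j → f i j) ≡ ∑F (λ j → ∑F λ i → f i j)
  ∑F-comm {zero}  {n} f = sym (∑ᵀ-zero (fin n) λ _ → refl)
  ∑F-comm {suc m} {n} f = trans (cong (λ a → ∑F (f zero) ℤ.+ a) (∑F-comm (f ∘ suc))) (sym (∑F-+ (f zero) (λ j → ∑F λ i → f (suc i) j)))

  -- Every index has sign 1, has sign `-1`, or belongs to the tuple, and exactly one of these.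
  -- Summing this over all indices, together with the vanishing sum of signs, gives two linear
  -- equations for the two cardinalities.
  module Balanced {n d : ℕ} (s : Fin d → Fin n) (s-inj : Injective _≡_ _≡_ s) (σ : Fin n → ℤ) (∑σ : ∑F σ ≡ 0ℤ)
    (on : ∀ k → σ (s k) ≡ 0ℤ) (off : ∀ i → (∀ k → s k ≢ i) → σ i ≡ 1ℤ ⊎ σ i ≡ -1ℤ) where

    is : ℤ → Fin n → Bool
    is τ i = does (σ i ℤ.≟ τ)

    pos neg : Subset n
    pos = Vec.tabulate (is 1ℤ)
    neg = Vec.tabulate (is -1ℤ)

    ∈⇔ : ∀ τ i → i ∈ Vec.tabulate (is τ) ⇔ σ i ≡ τ
    ∈⇔ τ i = mk⇔ (λ i∈ → to (σ i ℤ.≟ τ) (trans (sym (Vecₚ.lookup∘tabulate (is τ) i)) (Vecₚ.[]=⇒lookup i∈)))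
      (λ e → Vecₚ.lookup⇒[]= i (Vec.tabulate (is τ)) (trans (Vecₚ.lookup∘tabulate (is τ) i) (from (σ i ℤ.≟ τ) e)))
      where
      to : (dec : Dec (σ i ≡ τ)) → does dec ≡ true → σ i ≡ τ
      to (yes p) _ = p
      from : (dec : Dec (σ i ≡ τ)) → σ i ≡ τ → does dec ≡ true
      from (yes p) _ = refl
      from (no np) e = contradiction e np

    hits : Fin n → ℤ
    hits i = ∑F λ k → indicator (does (s k Fin.≟ i))

    ∑hits : ∑F hits ≡ ℤ.+ d
    ∑hits = trans (∑F-comm λ i k → indicator (does (s k Fin.≟ i))) (trans (∑F-cong λ k → trans (∑F-single (s k) (λ w ne → miss (s k Fin.≟ w) (ne ∘ sym))) (hit (s k Fin.≟ s k)))
      (trans (∑F-const d 1ℤ) (ℤₚ.*-identityʳ (ℤ.+ d))))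
      where
      miss : ∀ {a b : Fin n} (dec : Dec (a ≡ b)) → a ≢ b → indicator (does dec) ≡ 0ℤ
      miss (yes p) ne = contradiction p ne
      miss (no _)  ne = refl
      hit : ∀ {a : Fin n} (dec : Dec (a ≡ a)) → indicator (does dec) ≡ 1ℤ
      hit (yes _) = refl
      hit (no ne) = contradiction refl ne

    hits-on : ∀ k → hits (s k) ≡ 1ℤ
    hits-on k = trans (∑F-single k λ j ne → miss (s j Fin.≟ s k) λ e → ne (s-inj e)) (hit (s k Fin.≟ s k))
      where
      miss : ∀ {a b : Fin n} (dec : Dec (a ≡ b)) → a ≢ b → indicator (does dec) ≡ 0ℤ
      miss (yes p) ne = contradiction p ne
      miss (no _)  ne = refl
      hit : ∀ {a : Fin n} (dec : Dec (a ≡ a)) → indicator (does dec) ≡ 1ℤ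
      hit (yes _) = refl
      hit (no ne) = contradiction refl ne

    hits-off : ∀ i → (∀ k → s k ≢ i) → hits i ≡ 0ℤ
    hits-off i none = ∑ᵀ-zero (fin d) λ k → miss (s k Fin.≟ i) (none k)
      where
      miss : ∀ {a b : Fin n} (dec : Dec (a ≡ b)) → a ≢ b → indicator (does dec) ≡ 0ℤ
      miss (yes p) ne = contradiction p ne
      miss (no _)  ne = refl

    both : ∀ i → σ i ≡ indicator (is 1ℤ i) ℤ.- indicator (is -1ℤ i) × 1ℤ ≡ indicator (is 1ℤ i) ℤ.+ indicator (is -1ℤ i) ℤ.+ hits i
    both i = go (Finₚ.any? λ k → s k Fin.≟ i)
      where
      known : ∀ {τ} → σ i ≡ τ → indicator (is 1ℤ i) ≡ indicator (does (τ ℤ.≟ 1ℤ)) × indicator (is -1ℤ i) ≡ indicator (does (τ ℤ.≟ -1ℤ))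
      known refl = refl , refl
      Goal : Set
      Goal = σ i ≡ indicator (is 1ℤ i) ℤ.- indicator (is -1ℤ i) × 1ℤ ≡ indicator (is 1ℤ i) ℤ.+ indicator (is -1ℤ i) ℤ.+ hits i
      mk : ∀ {τ a b h} → σ i ≡ τ → indicator (is 1ℤ i) ≡ a → indicator (is -1ℤ i) ≡ b → hits i ≡ h → τ ≡ a ℤ.- b → 1ℤ ≡ a ℤ.+ b ℤ.+ h → Goal
      mk refl refl refl refl e f = e , f
      go : Dec (∃[ k ] s k ≡ i) → Goal
      go (yes (k , refl)) = mk (on k) (proj₁ (known (on k))) (proj₂ (known (on k))) (hits-on k) refl refl
      go (no none) = go₂ (off i λ k e → none (k , e))
        where
        h0 : hits i ≡ 0ℤ
        h0 = hits-off i λ k e → none (k , e)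
        go₂ : σ i ≡ 1ℤ ⊎ σ i ≡ -1ℤ → Goal
        go₂ (inj₁ e) = mk e (proj₁ (known e)) (proj₂ (known e)) h0 refl refl
        go₂ (inj₂ e) = mk e (proj₁ (known e)) (proj₂ (known e)) h0 refl refl

    ∑F-- : ∀ {n} (f g : Fin n → ℤ) → ∑F (λ i → f i ℤ.- g i) ≡ ∑F f ℤ.- ∑F g
    ∑F-- {zero}  f g = refl
    ∑F-- {suc n} f g = trans (cong (λ a → (f zero ℤ.- g zero) ℤ.+ a) (∑F-- (f ∘ suc) (g ∘ suc))) (lem (f zero) (g zero) (∑F (f ∘ suc)) (∑F (g ∘ suc)))
      where
      lem : ∀ a b c d → (a ℤ.- b) ℤ.+ (c ℤ.- d) ≡ (a ℤ.+ c) ℤ.- (b ℤ.+ d)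
      lem = ℤR.solve-∀

    card-eq : card pos ≡ card neg
    card-eq = ℤₚ.+-injective (ℤₚ.i-j≡0⇒i≡j (ℤ.+ card pos) (ℤ.+ card neg) (trans (cong₂ ℤ._-_ (card-∑ (is 1ℤ)) (card-∑ (is -1ℤ)))
      (trans (sym (∑F-- (indicator ∘ is 1ℤ) (indicator ∘ is -1ℤ))) (trans (sym (∑F-cong λ i → proj₁ (both i))) ∑σ))))

    total : 2 ℕ.* card pos ℕ.+ d ≡ n
    total = ℤₚ.+-injective (begin
      ℤ.+ (2 ℕ.* card pos ℕ.+ d)                       ≡⟨ cong (λ k → ℤ.+ (k ℕ.+ d)) (cong (card pos ℕ.+_) (trans (ℕₚ.+-identityʳ (card pos)) card-eq)) ⟩
      ℤ.+ card pos ℤ.+ ℤ.+ card neg ℤ.+ ℤ.+ d          ≡⟨ cong₂ ℤ._+_ (cong₂ ℤ._+_ (card-∑ (is 1ℤ)) (card-∑ (is -1ℤ))) (sym ∑hits) ⟩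
      ∑F (indicator ∘ is 1ℤ) ℤ.+ ∑F (indicator ∘ is -1ℤ) ℤ.+ ∑F hits ≡⟨ cong (λ a → a ℤ.+ ∑F hits) (∑F-+ (indicator ∘ is 1ℤ) (indicator ∘ is -1ℤ)) ⟨
      ∑F (λ i → indicator (is 1ℤ i) ℤ.+ indicator (is -1ℤ i)) ℤ.+ ∑F hits ≡⟨ ∑F-+ _ hits ⟨
      ∑F (λ i → indicator (is 1ℤ i) ℤ.+ indicator (is -1ℤ i) ℤ.+ hits i) ≡⟨ ∑F-cong (λ i → proj₂ (both i)) ⟨
      ∑F {n} (λ _ → 1ℤ)                                ≡⟨ trans (∑F-const n 1ℤ) (ℤₚ.*-identityʳ (ℤ.+ n)) ⟩
      ℤ.+ n ∎)
      where open ≡-Reasoning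

  seq-∑ : ∀ {k} (f : Vector ℝ k) n → seq (∑ f) n ≡ sum (λ i → seq (f i) n)
  seq-∑ {zero}  f n = refl
  seq-∑ {suc k} f n = cong (seq (f zero) n +_) (seq-∑ (f ∘ suc) n)

  module _ {d n : ℕ} where
    abstract
      -- The last component tells hyperplanes apart: a hyperplane contains no points of `P` outside
      -- its own tuple.
      HalvingPlane : PointSet d n → (Fin d → Fin n) → Hyperplane d → Set
      HalvingPlane P s H = IsHalving P H × (∀ k → On H (point P (s k))) × (∀ i → On H (point P i) → ∃[ k ] s k ≡ i)

      halvingPlane : ∀ P s (H : Hyperplane d) → IsHalving P H → (∀ k → On H (point P (s k))) → (∀ i → On H (point P i) → ∃[ k ] s k ≡ i) →
        HalvingPlane P s H
      halvingPlane P s H halving on only = halving , on , only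

      plane-halving : ∀ P s H → HalvingPlane P s H → IsHalving P H
      plane-halving P s H h = proj₁ h

      plane-on : ∀ P s H → HalvingPlane P s H → ∀ k → On H (point P (s k))
      plane-on P s H h = proj₁ (proj₂ h)

      plane-only : ∀ P s H → HalvingPlane P s H → ∀ i → On H (point P i) → ∃[ k ] s k ≡ i
      plane-only P s H h = proj₂ (proj₂ h)

  module _ {d : ℕ} where

    at : Point d → ℕ → Vector ℚ d
    at p n l = seq (p l) n

    -- The equation of the hyperplane as a linear functional on `hat p`, at the stage `n` of the
    -- approximation.
    functionals : Hyperplane d → ℕ → Vector ℚ (suc d)
    functionals H n = (- seq (offset H) n) ∷ᵥ λ l → seq (normal H l) n

    functionals-· : ∀ H p n → functionals H n · hat (at p n) ≡ seq ⟨ normal H , p ⟩ n - seq (offset H) n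
    functionals-· H p n = trans (·-hat (functionals H n) (at p n)) (trans (cong (- seq (offset H) n +_)
        (trans (·-sum-def (λ l → seq (normal H l) n) (at p n)) (sym (seq-∑ (λ i → normal H i *ℝ p i) n))))
      (ℚₚ.+-comm (- seq (offset H) n) (seq ⟨ normal H , p ⟩ n)))

    On⇒Null : ∀ H p → On H p → Null (λ n → functionals H n · hat (at p n))
    On⇒Null H p on = Null-≗ (λ n → sym (functionals-· H p n)) on

    Null⇒On : ∀ H p → Null (λ n → functionals H n · hat (at p n)) → On H p
    Null⇒On H p nu = Null-≗ (functionals-· H p) nu

    Bnd-functionals : ∀ H l → Bnd (λ n → functionals H n l)
    Bnd-functionals H zero    = Bnd-≗ (λ n → lem (seq (offset H) n)) (Bnd-scale {seq (offset H)} (- 1ℚ) (Cauchy⇒Bnd {seq (offset H)} (cauchy (offset H))))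
      where
      lem : ∀ a → a * - 1ℚ ≡ - a
      lem = solve-∀ ℚring
    Bnd-functionals H (suc l) = Cauchy⇒Bnd (cauchy (normal H l))

    Bnd-hat : ∀ (p : Point d) l → Bnd (λ n → hat (at p n) l)
    Bnd-hat p zero    = Bnd-const 1ℚ
    Bnd-hat p (suc l) = Cauchy⇒Bnd (cauchy (p l))

    rational : Vector ℚ d → Point d
    rational x l = fromℚ (x l)

    -- Every coordinate of a functional is a fixed combination of its values at the `d + 1` points.
    -- If these values tend to 0, so does every coordinate, but one coordinate of the normal is
    -- bounded away from 0.
    Dual⇒¬On : ∀ {v : Fin (suc d) → Vector ℚ d} → Dual (hat ∘ v) → ∀ H → ¬ (∀ k → On H (rational (v k)))
    Dual⇒¬On {v} (φ , diag , off) H on = let i , ne = nonzero H in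
      Away⇒¬Null (#0⇒Away (normal H i) ne) (component (suc i))
      where
      component : ∀ l → Null (λ n → functionals H n l)
      component l = let γ , formula = coordinates (hat ∘ v) φ diag off l in
        Null-≗ (λ n → sym (formula (functionals H n))) (Null-sum (λ n k → γ k * (functionals H n · hat (v k)))
          λ k → Null-scale (γ k) (On⇒Null H (rational (v k)) (on k)))

    in-general-position : ∀ {N} {X : Config {N} {d}} (P : PointSet d N) → point P ≡ (λ i → rational (X i)) → GenPos X → InGeneralPosition P
    in-general-position {X = X} P point≡ gp s inj (H , on) =
      Dual⇒¬On {v = λ k → X (s k)} (tuple-dual X gp s inj) H (subst (λ p → ∀ k → On H (p (s k))) {point P} {λ i → rational (X i)} point≡ on)

    module FromCell {N : ℕ} {X : Config {N} {d}} {s : Fin d → Fin N} {ê : Vector ℚ (suc d)} {σ : Fin N → ℤ}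
      (cell : Cell s ê σ X) (ê₀ : ê zero ≡ 0ℚ) where
      open Cell cell

      -- A functional with zero tail would vanish on `ê`, whose first coordinate is 0.
      nonzero-tail : NonZeroV (tail h)
      nonzero-tail = go (zero? (tail h))
        where
        go : NonZeroV (tail h) ⊎ (∀ i → tail h i ≡ 0ℚ) → NonZeroV (tail h)
        go (inj₁ z) = z
        go (inj₂ z) = contradiction (trans (·-suc h ê) (trans (cong₂ _+_ (trans (cong (h zero *_) ê₀) (ℚₚ.*-zeroʳ (h zero))) (·-zeroˡ (tail ê) z)) refl)) h-ê

      plane : Hyperplane d
      plane = record { normal = rational (tail h) ; offset = fromℚ (- h zero) ; nonzero = proj₁ nonzero-tail , fromℚ-#0 (proj₂ nonzero-tail) }

      plane-functional : ∀ n i → functionals plane n i ≡ h i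
      plane-functional n zero    = lem (h zero)
        where
        lem : ∀ a → - (- a) ≡ a
        lem = solve-∀ ℚring
      plane-functional n (suc i) = refl

      plane-· : ∀ n w → functionals plane n · w ≡ h · w
      plane-· n w = ·-cong (plane-functional n) λ _ → refl

      plane-value : ∀ (x : Vector ℚ d) n → seq ⟨ normal plane , rational x ⟩ n ≡ h · hat x + - h zero
      plane-value x n = trans (lem (seq ⟨ normal plane , rational x ⟩ n) (h zero))
        (cong (_+ - h zero) (trans (sym (functionals-· plane (rational x) n)) (plane-· n (hat x))))
        where
        lem : ∀ a b → a ≡ a - (- b) + - b
        lem = solve-∀ ℚring

      on-points : ∀ k → On plane (rational (X (s k)))
      on-points k = Null⇒On plane (rational (X (s k))) (Null-≗ (λ n → sym (trans (plane-· n (hat (X (s k)))) (h-on k))) Null-0)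

      basis φ′ : Fin (suc d) → Vector ℚ (suc d)
      basis zero    = ê
      basis (suc k) = hat (X (s k))
      φ′ zero    = h
      φ′ (suc k) = φ k

      diag′ : ∀ i → φ′ i · basis i ≢ 0ℚ
      diag′ zero    = h-ê
      diag′ (suc k) = pos≢0 (φ-diag k)

      off′ : ∀ i j → i ≢ j → φ′ i · basis j ≡ 0ℚ
      off′ zero    zero    ne = contradiction refl ne
      off′ zero    (suc j) ne = h-on j
      off′ (suc i) zero    ne = φ-ê i
      off′ (suc i) (suc j) ne = φ-off i j (ne ∘ cong suc)

      s-injective : Injective _≡_ _≡_ s
      s-injective {i} {j} e = go (i Fin.≟ j)
        where
        go : Dec (i ≡ j) → i ≡ j
        go (yes p) = p
        go (no ne) = contradiction (trans (cong (λ a → φ i · hat (X a)) e) (φ-off i j ne)) (pos≢0 (φ-diag i))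

      -- Up to a null sequence `e n`, the approximating functionals `g n` are multiples of `h` with
      -- factor `(g n · ê) / (h · ê)`. The factor stays away from 0 because a coordinate of the
      -- normal of `H′` does. So vanishing at a point passes from either hyperplane to the other.
      module Unique (H′ : Hyperplane d) (on : ∀ k → On H′ (rational (X (s k)))) where

        g : ℕ → Vector ℚ (suc d)
        g = functionals H′

        γ : Fin (suc d) → Fin (suc d) → ℚ
        γ l = proj₁ (coordinates basis φ′ diag′ off′ l)

        formula : ∀ l (f : Vector ℚ (suc d)) → f l ≡ γ l zero * (f · ê) + sum (λ k → γ l (suc k) * (f · hat (X (s k))))
        formula l f = proj₂ (coordinates basis φ′ diag′ off′ l) f

        e : ℕ → Vector ℚ (suc d)
        e n l = sum λ k → γ l (suc k) * (g n · hat (X (s k)))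

        Null-e : ∀ l → Null (λ n → e n l)
        Null-e l = Null-sum (λ n k → γ l (suc k) * (g n · hat (X (s k)))) λ k → Null-scale (γ l (suc k)) (On⇒Null H′ (rational (X (s k))) (on k))

        hê : ℚ
        hê = h · ê

        h-formula : ∀ l → h l ≡ γ l zero * hê
        h-formula l = trans (formula l h) (trans (cong (γ l zero * hê +_) (sum-zero λ k → trans (cong (γ l (suc k) *_) (h-on k)) (ℚₚ.*-zeroʳ (γ l (suc k)))))
          (ℚₚ.+-identityʳ (γ l zero * hê)))

        pointwise : ∀ n l → hê * g n l ≡ (g n · ê) * h l + hê * e n l
        pointwise n l = trans (cong (hê *_) (formula l (g n))) (trans (lem hê (γ l zero) (g n · ê) (e n l))
          (cong (λ x → (g n · ê) * x + hê * e n l) (sym (h-formula l))))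
          where
          lem : ∀ a c b e → a * (c * b + e) ≡ b * (c * a) + a * e
          lem = solve-∀ ℚring

        applied : ∀ n w → hê * (g n · w) ≡ (g n · ê) * (h · w) + hê * (e n · w)
        applied n w = trans (lem (hê * (g n · w)) (g n · w)) (trans (sym (·-combo hê 0ℚ (g n) (g n) w))
          (trans (·-cong {v = w} {w = w} (λ l → trans (lem′ (hê * g n l) (g n l)) (pointwise n l)) (λ _ → refl)) (·-combo (g n · ê) hê h (e n) w)))
          where
          lem : ∀ a b → a ≡ a + 0ℚ * b
          lem = solve-∀ ℚring
          lem′ : ∀ a b → a + 0ℚ * b ≡ a
          lem′ = solve-∀ ℚring

        Away-gê : Away (λ n → g n · ê)
        Away-gê = let i , ne = nonzero H′ in Away-factor (h (suc i)) (Away-≗ (λ n → trans (cong (_+ - (hê * e n (suc i))) (pointwise n (suc i))) (lem (g n · ê) (h (suc i)) (hê * e n (suc i))))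
          (Away-perturb (Away-scale (#0⇒Away (normal H′ i) ne)) (Null-≗ (λ n → lem₂ hê (e n (suc i))) (Null-scale (- hê) (Null-e (suc i))))))
          where
          lem : ∀ a h e → (a * h + e) + - e ≡ h * a
          lem = solve-∀ ℚring
          lem₂ : ∀ a e → - a * e ≡ - (a * e)
          lem₂ = solve-∀ ℚring
          Away-≗ : ∀ {u v} → (∀ n → u n ≡ v n) → Away u → Away v
          Away-≗ eq (c , 0<c , N , k) = c , 0<c , N , λ n l → subst (λ x → c ≤ ∣ x ∣) (eq n) (k n l)
          Away-scale : ∀ {u} → Away u → Away (λ n → hê * u n)
          Away-scale {u} (c , 0<c , N , k) = ∣ hê ∣ * c , 0<* (0<∣∣ h-ê) 0<c , N , λ n l →
            subst (∣ hê ∣ * c ≤_) (sym (ℚₚ.∣p*q∣≡∣p∣*∣q∣ hê (u n))) (ℚₚ.*-monoˡ-≤-nonNeg ∣ hê ∣ {{ℚ.nonNegative (ℚₚ.0≤∣p∣ hê)}} (k n l))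

        same : H′ ≐ plane
        same p = mk⇔ to from
          where
          w : ℕ → Vector ℚ (suc d)
          w n = hat (at p n)
          Null-ew : Null (λ n → e n · w n)
          Null-ew = Null-· e w Null-e (Bnd-hat p)
          to : On H′ p → On plane p
          to on′ = Null⇒On plane p (Null-≗ (λ n → sym (plane-· n (w n))) (Null-cancel Away-gê
            (Null-≗ (λ n → trans (cong (_+ - hê * (e n · w n)) (applied n (w n))) (lem ((g n · ê) * (h · w n)) hê (e n · w n)))
              (Null-+ (Null-scale hê (On⇒Null H′ p on′)) (Null-scale (- hê) Null-ew)))))
            where
            lem : ∀ a h e → (a + h * e) + - h * e ≡ a
            lem = solve-∀ ℚring
          from : On plane p → On H′ p
          from onp = Null⇒On H′ p (Null-cancel (Away-const h-ê) (Null-≗ (λ n → sym (applied n (w n)))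
            (Null-+ (Null-≗ (λ n → ℚₚ.*-comm (h · w n) (g n · ê)) (Null-* (Null-≗ (λ n → plane-· n (w n)) (On⇒Null plane p onp)) (Bnd-· g ê (Bnd-functionals H′))))
              (Null-scale hê Null-ew))))

      above⇔ : ∀ i → (∀ k → s k ≢ i) → Above plane (rational (X i)) ⇔ σ i ≡ 1ℤ
      above⇔ i off = mk⇔ (λ ab → to (h-side i off) ab) (λ eq → from (h-side i off) eq)
        where
        q : ℚ
        q = h · hat (X i)
        to : ∀ {τ} → Side τ q → Above plane (rational (X i)) → τ ≡ 1ℤ
        to (above _) _ = refl
        to (below p) (c , 0<c , N , k) = contradiction (ℚₚ.<-trans (subst₂ _<_ (lem (h zero) c) (lem₂ q (h zero)) (ℚₚ.+-monoʳ-< (h zero)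
            (subst (- h zero + c <_) (plane-value (X i) N) (k N ℕₚ.≤-refl)))) p) λ lt → ℚₚ.<-irrefl refl (ℚₚ.<-trans 0<c lt)
          where
          lem : ∀ a c → a + (- a + c) ≡ c
          lem = solve-∀ ℚring
          lem₂ : ∀ q a → a + (q + - a) ≡ q
          lem₂ = solve-∀ ℚring
        from : ∀ {τ} → Side τ q → τ ≡ 1ℤ → Above plane (rational (X i))
        from (above p) _ = ½ * q , 0<½ p , 0 , λ n _ → subst (- h zero + ½ * q <_) (sym (trans (plane-value (X i) n) (ℚₚ.+-comm q (- h zero))))
          (ℚₚ.+-monoʳ-< (- h zero) (½< p))
        from (below p) ()

      below⇔ : ∀ i → (∀ k → s k ≢ i) → Below plane (rational (X i)) ⇔ σ i ≡ -1ℤ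
      below⇔ i off = mk⇔ (λ be → to (h-side i off) be) (λ eq → from (h-side i off) eq)
        where
        q : ℚ
        q = h · hat (X i)
        to : ∀ {τ} → Side τ q → Below plane (rational (X i)) → τ ≡ -1ℤ
        to (below _) _ = refl
        to (above p) (c , 0<c , N , k) = contradiction (ℚₚ.<-trans (0<+ p 0<c) (subst₂ _<_ (lem q (h zero) c) (ℚₚ.+-inverseʳ (h zero)) (ℚₚ.+-monoʳ-< (h zero)
            (subst (λ x → x + c < - h zero) (plane-value (X i) N) (k N ℕₚ.≤-refl))))) (ℚₚ.<-irrefl refl)
          where
          lem : ∀ q a c → a + (q + - a + c) ≡ q + c
          lem = solve-∀ ℚring
        from : ∀ {τ} → Side τ q → τ ≡ -1ℤ → Below plane (rational (X i))
        from (below p) _ = ½ * - q , 0<½ (neg⇒pos p) , 0 , λ n _ → subst₂ (λ a b → a + ½ * - q < b) (sym (plane-value (X i) n)) (lem₂ (h zero) q)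
          (subst (q + - h zero + ½ * - q <_) (lem₃ q (h zero)) (ℚₚ.+-monoʳ-< (q + - h zero) (½< (neg⇒pos p))))
          where
          lem₂ : ∀ a q → - a ≡ - a
          lem₂ _ _ = refl
          lem₃ : ∀ q a → q + - a + - q ≡ - a
          lem₃ = solve-∀ ℚring
        from (above p) ()

      ¬above-on : ∀ k → ¬ Above plane (rational (X (s k)))
      ¬above-on k (c , 0<c , N , lt) = ℚₚ.<-irrefl refl (ℚₚ.<-trans (subst₂ _<_ (lem (h zero) c) (trans (lem₂ (h · hat (X (s k))) (h zero)) (h-on k))
          (ℚₚ.+-monoʳ-< (h zero) (subst (- h zero + c <_) (plane-value (X (s k)) N) (lt N ℕₚ.≤-refl)))) 0<c)
        where
        lem : ∀ a c → a + (- a + c) ≡ c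
        lem = solve-∀ ℚring
        lem₂ : ∀ q a → a + (q + - a) ≡ q
        lem₂ = solve-∀ ℚring

      ¬below-on : ∀ k → ¬ Below plane (rational (X (s k)))
      ¬below-on k (c , 0<c , N , lt) = ℚₚ.<-irrefl refl (ℚₚ.<-trans (subst₂ _<_ (trans (lem (h · hat (X (s k))) (h zero) c) (trans (cong (_+ c) (h-on k)) (ℚₚ.+-identityˡ c)))
          (ℚₚ.+-inverseʳ (h zero)) (ℚₚ.+-monoʳ-< (h zero) (subst (λ x → x + c < - h zero) (plane-value (X (s k)) N) (lt N ℕₚ.≤-refl)))) 0<c)
        where
        lem : ∀ q a c → a + (q + - a + c) ≡ q + c
        lem = solve-∀ ℚring

      on⇒selected : ∀ i → On plane (rational (X i)) → ∃[ k ] s k ≡ i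
      on⇒selected i on = go (Finₚ.any? λ k → s k Fin.≟ i)
        where
        nonzero-side : ∀ {τ q} → Side τ q → q ≢ 0ℚ
        nonzero-side (above p) = pos≢0 p
        nonzero-side (below p) = neg≢0 p
        go : Dec (∃[ k ] s k ≡ i) → ∃[ k ] s k ≡ i
        go (yes p) = p
        go (no np) = contradiction (Null-≗ (λ n → plane-· n (hat (X i))) (On⇒Null plane (rational (X i)) on))
          (Away⇒¬Null (Away-const (nonzero-side (h-side i λ k e → np (k , e)))))

      -- Transport along point≡ is cheaper than conversion, which would unfold On down to the Cauchy proofs.
      module _ (P : PointSet d N) (point≡ : point P ≡ λ i → rational (X i))
        (∑σ : ∑F σ ≡ 0ℤ) (σ-on : ∀ k → σ (s k) ≡ 0ℤ) where

        transfer : (Q : (Fin N → Point d) → Set) → Q (λ i → rational (X i)) → Q (point P)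
        transfer Q = subst Q {λ i → rational (X i)} {point P} (sym point≡)

        halving-plane : ∃[ H ] HalvingPlane P s H
        halving-plane = plane , halvingPlane P s plane (determined , card B.pos , B.total , aboves , belows) on
            (transfer (λ p → ∀ i → On plane (p i) → ∃[ k ] s k ≡ i) on⇒selected)
          where
          pm : ∀ {τ q} → Side τ q → τ ≡ 1ℤ ⊎ τ ≡ -1ℤ
          pm (above _) = inj₁ refl
          pm (below _) = inj₂ refl
          module B = Balanced s s-injective σ ∑σ σ-on (λ i off → pm (h-side i off))
          on : ∀ k → On plane (point P (s k))
          on = transfer (λ p → ∀ k → On plane (p (s k))) on-points
          determined : IsDetermined P plane
          determined = s , s-injective , on , λ H′ on′ → Unique.same H′ (subst (λ p → ∀ k → On H′ (p (s k))) {point P} {λ i → rational (X i)} point≡ on′)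
          side-of : ∀ (Q : Fin N → Set) τ → 0ℤ ≢ τ → (∀ i → (∀ k → s k ≢ i) → Q i ⇔ σ i ≡ τ) → (∀ k → ¬ Q (s k)) →
            ∀ i → i ∈ Vec.tabulate (B.is τ) ⇔ Q i
          side-of Q τ τ≢0 off on i = go (Finₚ.any? λ k → s k Fin.≟ i)
            where
            go : Dec (∃[ k ] s k ≡ i) → i ∈ Vec.tabulate (B.is τ) ⇔ Q i
            go (yes (k , refl)) = mk⇔ (λ i∈ → contradiction (trans (sym (σ-on k)) (Equivalence.to (B.∈⇔ τ i) i∈)) τ≢0) (λ q → contradiction q (on k))
            go (no none) = mk⇔ (λ i∈ → Equivalence.from (off i λ k e → none (k , e)) (Equivalence.to (B.∈⇔ τ i) i∈))
              (λ q → Equivalence.from (B.∈⇔ τ i) (Equivalence.to (off i λ k e → none (k , e)) q))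
          aboves : Card (λ i → Above plane (point P i)) (card B.pos)
          aboves = B.pos , transfer (λ p → ∀ i → i ∈ B.pos ⇔ Above plane (p i))
            (side-of (λ i → Above plane (rational (X i))) 1ℤ (λ ()) above⇔ ¬above-on) , refl
          belows : Card (λ i → Below plane (point P i)) (card B.pos)
          belows = B.neg , transfer (λ p → ∀ i → i ∈ B.neg ⇔ Below plane (p i))
            (side-of (λ i → Below plane (rational (X i))) -1ℤ (λ ()) below⇔ ¬below-on) , sym B.card-eq

-- Distances and density

module Density where

  open import Defs
  open RationalVectors
  open Interpolation using (/1≡ι)
  open ExponentialSeries
  open RealFunctions
  open HalvingPlanes using (seq-∑; rational)
  open import Tactic.RingSolver using (solve-∀)
  open import Algebra.Bundles using (CommutativeRing)
  open import Data.Nat as ℕ using (ℕ; zero; suc; s≤s; z≤n)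
  import Data.Nat.Properties as ℕₚ
  open import Data.Integer as ℤ using (ℤ)
  import Data.Integer.Properties as ℤₚ
  open import Data.Rational using (ℚ; 0ℚ; 1ℚ; ½; _+_; _*_; _-_; -_; _<_; _≤_; ∣_∣; *≤*)
  import Data.Rational as ℚ
  import Data.Rational.Properties as ℚₚ
  open import Data.Fin as Fin using (Fin; zero; suc; punchIn; punchOut)
  import Data.Fin.Properties as Finₚ
  open import Data.Product using (∃-syntax; _×_; _,_; proj₁; proj₂)
  open import Data.Sum using (_⊎_; inj₁; inj₂)
  open import Data.Vec.Functional using (Vector)
  open import Function using (_∘_)
  open import Relation.Nullary using (¬_)
  open import Relation.Binary.PropositionalEquality hiding (J)

  open import Algebra.Properties.Semiring.Sum (CommutativeRing.semiring ℚₚ.+-*-commutativeRing)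
    using (sum; sum-cong-≗)

  sum-≤ : ∀ {k} {f g : Vector ℚ k} → (∀ i → f i ≤ g i) → sum f ≤ sum g
  sum-≤ {zero}  h = ℚₚ.≤-refl
  sum-≤ {suc k} h = ℚₚ.+-mono-≤ (h zero) (sum-≤ (h ∘ suc))

  0≤sum : ∀ {k} {f : Vector ℚ k} → (∀ i → 0ℚ ≤ f i) → 0ℚ ≤ sum f
  0≤sum {zero}  h = ℚₚ.≤-refl
  0≤sum {suc k} h = 0≤+ (h zero) (0≤sum (h ∘ suc))

  term≤sum : ∀ {k} {f : Vector ℚ k} → (∀ i → 0ℚ ≤ f i) → ∀ i → f i ≤ sum f
  term≤sum {suc k} {f} h i = ≤-by (sum (f ∘ punchIn i)) (0≤sum (h ∘ punchIn i)) (sym (sum-punch i f))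

  sum-const : ∀ k c → sum {k} (λ _ → c) ≡ ν k * c
  sum-const zero    c = sym (ℚₚ.*-zeroˡ c)
  sum-const (suc k) c = trans (cong (c +_) (sum-const k c)) (trans (lem c (ν k)) (cong (_* c) (sym (ν-suc k))))
    where
    lem : ∀ c k → c + k * c ≡ (1ℚ + k) * c
    lem = solve-∀ ℚring

  square-∣∣ : ∀ a → pow a 2 ≡ ∣ a ∣ * ∣ a ∣
  square-∣∣ a = trans (cong (a *_) (ℚₚ.*-identityʳ a)) (sym (sq-case ∣ a ∣ (ℚₚ.∣p∣≡p∨∣p∣≡-p a)))
    where
    sq-case : ∀ b → (b ≡ a ⊎ b ≡ - a) → b * b ≡ a * a
    sq-case b (inj₁ refl) = refl
    sq-case b (inj₂ refl) = lem a
      where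
      lem : ∀ a → - a * - a ≡ a * a
      lem = solve-∀ ℚring

  0≤square : ∀ a → 0ℚ ≤ pow a 2
  0≤square a = subst (0ℚ ≤_) (sym (square-∣∣ a)) (0≤* (ℚₚ.0≤∣p∣ a) (ℚₚ.0≤∣p∣ a))

  -- A nonnegative real may have slightly negative approximations.
  eventually≥ : ∀ p → 0ℝ ≤ℝ p → ∀ {δ} → 0ℚ < δ → ∃[ N ] (∀ m → N ℕ.≤ m → - δ ≤ seq p m)
  eventually≥ p 0≤p {δ} 0<δ = N , λ m hm → by-contra λ lt → 0≤p (½ * δ , 0<½ 0<δ , N , λ k hk →
      <-by ((½ * δ - (seq p k - seq p m)) + (- δ - seq p m)) (0<+ (<⇒0< (ℚₚ.≤-<-trans (≤∣∣ (seq p k - seq p m)) (h k m hk hm))) (<⇒0< lt))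
        (trans (lem (seq p k) (seq p m) (½ * δ) δ) (trans (cong (_- δ) (½+½ δ)) (ℚₚ.+-inverseʳ δ))))
    where
    N : ℕ
    N = proj₁ (cauchy p (½ * δ) (0<½ 0<δ))
    h = proj₂ (cauchy p (½ * δ) (0<½ 0<δ))
    lem : ∀ a b c d → (a + c) + ((c - (a - b)) + (- d - b)) ≡ (c + c) - d
    lem = solve-∀ ℚring

  -- If `q` exceeded `p` by `c`, late approximations would satisfy `q + p ≥ c/2`, so the difference
  -- of the squares would be at least `c * (c/2)`; but it tends to `y - x`, which is not positive.
  -- This covers every real that is a distance by its defining property, not only the constructed
  -- root.
  sqrt-mono : ∀ p q x y → 0ℝ ≤ℝ p → p ^ℝ 2 ≈ x → q ^ℝ 2 ≈ y → (∀ m → seq y m ≤ seq x m) → q ≤ℝ p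
  sqrt-mono p q x y 0≤p px qy y≤x (c , 0<c , N , h) = ℚₚ.<-irrefl refl (begin-strict
      c * (½ * c)                                                ≤⟨ *-mono-≤ (ℚₚ.<⇒≤ 0<c) (ℚₚ.≤-trans (ℚₚ.<⇒≤ (0<½ 0<c)) ½c≤) (ℚₚ.<⇒≤ c<) ½c≤ ⟩
      (seq q m - seq p m) * (seq q m + seq p m)                  ≡⟨ lem (seq q m) (seq p m) ⟩
      pow (seq q m) 2 - pow (seq p m) 2                          ≡⟨ lem₂ (pow (seq q m) 2) (pow (seq p m) 2) (seq x m) (seq y m) ⟩
      (pow (seq q m) 2 - seq y m) + - (pow (seq p m) 2 - seq x m) + (seq y m - seq x m)
        <⟨ ℚₚ.+-mono-<-≤ (ℚₚ.+-mono-< (ℚₚ.≤-<-trans (≤∣∣ _) (qy′ m (le₄))) (ℚₚ.≤-<-trans (-≤∣∣ _) (px′ m (le₃))))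
             (ℚₚ.≤-trans (ℚₚ.+-monoˡ-≤ (- seq x m) (y≤x m)) (ℚₚ.≤-reflexive (ℚₚ.+-inverseʳ (seq x m)))) ⟩
      κ + κ + 0ℚ                                                 ≡⟨ trans (ℚₚ.+-identityʳ (κ + κ)) (½+½ (c * (½ * c))) ⟩
      c * (½ * c) ∎)
    where
    open ℚₚ.≤-Reasoning
    κ : ℚ
    κ = ½ * (c * (½ * c))
    0<κ : 0ℚ < κ
    0<κ = 0<½ (0<* 0<c (0<½ 0<c))
    px₀ = px κ 0<κ
    qy₀ = qy κ 0<κ
    ev = eventually≥ p 0≤p (0<½ (0<½ 0<c))
    m : ℕ
    m = N ℕ.⊔ (proj₁ ev ℕ.⊔ (proj₁ px₀ ℕ.⊔ proj₁ qy₀))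
    le₁ : N ℕ.≤ m
    le₁ = ℕₚ.m≤m⊔n N _
    le₂ : proj₁ ev ℕ.≤ m
    le₂ = ℕₚ.≤-trans (ℕₚ.m≤m⊔n (proj₁ ev) _) (ℕₚ.m≤n⊔m N _)
    le₃ : proj₁ px₀ ℕ.≤ m
    le₃ = ℕₚ.≤-trans (ℕₚ.m≤m⊔n (proj₁ px₀) _) (ℕₚ.≤-trans (ℕₚ.m≤n⊔m (proj₁ ev) _) (ℕₚ.m≤n⊔m N _))
    le₄ : proj₁ qy₀ ℕ.≤ m
    le₄ = ℕₚ.≤-trans (ℕₚ.m≤n⊔m (proj₁ px₀) _) (ℕₚ.≤-trans (ℕₚ.m≤n⊔m (proj₁ ev) _) (ℕₚ.m≤n⊔m N _))
    px′ : ∀ m → proj₁ px₀ ℕ.≤ m → ∣ pow (seq p m) 2 - seq x m ∣ < κ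
    px′ m l = subst (λ a → ∣ a - seq x m ∣ < κ) (seq-^ p 2 m) (proj₂ px₀ m l)
    qy′ : ∀ m → proj₁ qy₀ ℕ.≤ m → ∣ pow (seq q m) 2 - seq y m ∣ < κ
    qy′ m l = subst (λ a → ∣ a - seq y m ∣ < κ) (seq-^ q 2 m) (proj₂ qy₀ m l)
    c< : c < seq q m - seq p m
    c< = subst (_< seq q m - seq p m) (lem₀ (seq p m) c) (ℚₚ.+-monoˡ-< (- seq p m) (h m le₁))
      where
      lem₀ : ∀ a c → (a + c) + - a ≡ c
      lem₀ = solve-∀ ℚring
    ½c≤ : ½ * c ≤ seq q m + seq p m
    ½c≤ = ≤-by ((seq q m - seq p m - c) + ((seq p m - - (½ * (½ * c))) + (seq p m - - (½ * (½ * c)))))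
      (0≤+ (≤⇒0≤ (ℚₚ.<⇒≤ c<)) (0≤+ (≤⇒0≤ (proj₂ ev m le₂)) (≤⇒0≤ (proj₂ ev m le₂))))
      (trans (lem₀ (seq q m) (seq p m) c (½ * c) (½ * (½ * c))) (trans (cong (λ a → (½ * c + a - c) + (seq q m + seq p m)) (½+½ (½ * c)))
        (trans (cong (λ a → (a - c) + (seq q m + seq p m)) (½+½ c)) (trans (cong (_+ (seq q m + seq p m)) (ℚₚ.+-inverseʳ c)) (ℚₚ.+-identityˡ _)))))
      where
      lem₀ : ∀ q p c a b → a + ((q - p - c) + ((p - - b) + (p - - b))) ≡ (a + (b + b) - c) + (q + p)
      lem₀ = solve-∀ ℚring
    lem : ∀ a b → (a - b) * (a + b) ≡ a * (a * 1ℚ) - b * (b * 1ℚ)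
    lem = solve-∀ ℚring
    lem₂ : ∀ a b x y → a - b ≡ (a - y) + - (b - x) + (y - x)
    lem₂ = solve-∀ ℚring

  argmax : ∀ {k} (f : Fin (suc k) → ℚ) → ∃[ i ] (∀ j → f j ≤ f i)
  argmax {zero}  f = zero , λ { zero → ℚₚ.≤-refl }
  argmax {suc k} f = go (argmax (f ∘ suc))
    where
    go : ∃[ i ] (∀ j → f (suc j) ≤ f (suc i)) → ∃[ i ] (∀ j → f j ≤ f i)
    go (i , h) = go₂ (ℚₚ.≤-total (f zero) (f (suc i)))
      where
      go₂ : f zero ≤ f (suc i) ⊎ f (suc i) ≤ f zero → ∃[ i ] (∀ j → f j ≤ f i)
      go₂ (inj₁ l) = suc i , λ { zero → l ; (suc j) → h j }
      go₂ (inj₂ l) = zero , λ { zero → ℚₚ.≤-refl ; (suc j) → ℚₚ.≤-trans (h j) l }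

  argmax-pairs : ∀ {k} (f : Fin (suc (suc k)) → Fin (suc (suc k)) → ℚ) → ∃[ i ] ∃[ j ] (i ≢ j × (∀ a b → a ≢ b → f a b ≤ f i j))
  argmax-pairs f = i , punchIn i (proj₁ (inner i)) , (λ e → Finₚ.punchInᵢ≢i i _ (sym e)) , λ a b a≢b →
      ℚₚ.≤-trans (subst (λ c → f a c ≤ f a (punchIn a (proj₁ (inner a)))) (Finₚ.punchIn-punchOut a≢b) (proj₂ (inner a) (punchOut a≢b))) (proj₂ outer a)
    where
    inner : ∀ a → ∃[ j ] (∀ b → f a (punchIn a b) ≤ f a (punchIn a j))
    inner a = argmax λ b → f a (punchIn a b)
    outer = argmax λ a → f a (punchIn a (proj₁ (inner a)))
    i = proj₁ outer

  argmin-pairs : ∀ {k} (f : Fin (suc (suc k)) → Fin (suc (suc k)) → ℚ) → ∃[ i ] ∃[ j ] (i ≢ j × (∀ a b → a ≢ b → f i j ≤ f a b))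
  argmin-pairs f = let i , j , ne , h = argmax-pairs (λ a b → - f a b) in i , j , ne , λ a b a≢b →
      subst₂ _≤_ (lem (f i j)) (lem (f a b)) (ℚₚ.neg-antimono-≤ (h a b a≢b))
    where
    lem : ∀ a → - - a ≡ a
    lem = solve-∀ ℚring

  ε≤¼ : ∀ {m} → 3 ℕ.≤ m → ε m ≤ ε 3
  ε≤¼ {m} h = *≤* (subst₂ ℤ._≤_ (sym (ℤₚ.*-identityˡ (ℤ.+ 4))) (sym (ℤₚ.*-identityˡ (ℤ.+ suc m))) (ℤ.+≤+ (s≤s h)))

  -- Kept abstract, so that comparing statements about it does not unfold the Cauchy proofs.
  abstract
    pointSet : ∀ {n d} (X : Fin n → Vector ℚ d) → (∀ i j → i ≢ j → ∃[ l ] ½ ≤ ∣ X i l - X j l ∣) → PointSet d n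
    pointSet X sep = record { point = λ i → rational (X i) ; distinct = dist }
      where
      dist : ∀ i j → i ≢ j → ¬ (rational (X i) ≋ rational (X j))
      dist i j i≢j eq = go (sep i j i≢j)
        where
        go : ¬ (∃[ l ] ½ ≤ ∣ X i l - X j l ∣)
        go (l , h) = ℚₚ.<-irrefl refl (ℚₚ.≤-<-trans h (proj₂ (eq l ½ (ℚₚ.positive⁻¹ ½)) (proj₁ (eq l ½ (ℚₚ.positive⁻¹ ½))) ℕₚ.≤-refl))

    point-pointSet : ∀ {n d} (X : Fin n → Vector ℚ d) sep → point (pointSet X sep) ≡ λ i → rational (X i)
    point-pointSet X sep = refl

  dense-by : ∀ {n d} (P : PointSet d n) (γ D δ r : ℝ) → IsLargestDistance P D → IsSmallestDistance P δ → Root d (fromℕ n) r →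
    D ≤ℝ γ *ℝ r *ℝ δ → IsDense P γ
  dense-by P γ D δ r largest smallest root ratio = inj₂ (D , δ , r , largest , smallest , root , ratio)

  -- Coordinate differences at most `C * s` give distances at most `d * C * s`. The approximations
  -- of the smallest distance and of the root of `n` are at least 1/4 and `s/4`: half of the bounds
  -- 1/2 and `s/2`, the other half being spent on rounding.
  γ : ℕ → ℕ → ℚ
  γ d C = ν 16 * ν (d ℕ.* C)

  module Dense {n′ d : ℕ} (1≤d : 1 ℕ.≤ d) (X : Fin (suc (suc n′)) → Vector ℚ d)
    (sep : ∀ i j → i ≢ j → ∃[ l ] ½ ≤ ∣ X i l - X j l ∣)
    (C s : ℕ) (bd : ∀ i j l → ∣ X i l - X j l ∣ ≤ ν (C ℕ.* s))
    (1≤s : 1 ℕ.≤ s) (s≤ : pow (½ * ν s) d ≤ ν (suc (suc n′))) where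

    n W : ℕ
    n = suc (suc n′)
    W = C ℕ.* s

    sq : Fin n → Fin n → ℚ
    sq i j = sum λ l → pow (X i l - X j l) 2

    ¼≤sq : ∀ i j → i ≢ j → ε 3 ≤ sq i j
    ¼≤sq i j i≢j = go (sep i j i≢j)
      where
      go : ∃[ l ] ½ ≤ ∣ X i l - X j l ∣ → ε 3 ≤ sq i j
      go (l , h) = ℚₚ.≤-trans (ℚₚ.≤-trans (ℚₚ.≤-reflexive {ε 3} {½ * ½} refl) (ℚₚ.≤-trans (*-mono-≤ (ℚₚ.<⇒≤ (ℚₚ.positive⁻¹ ½)) (ℚₚ.0≤∣p∣ (X i l - X j l)) h h)
        (ℚₚ.≤-reflexive (sym (square-∣∣ (X i l - X j l)))))) (term≤sum (λ l → 0≤square (X i l - X j l)) l)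

    0≤sq : ∀ i j → 0ℚ ≤ sq i j
    0≤sq i j = 0≤sum λ l → 0≤square (X i l - X j l)

    sq≤ : ∀ i j → sq i j ≤ pow (ν (d ℕ.* W)) 2
    sq≤ i j = ℚₚ.≤-trans (sum-≤ {f = λ l → pow (X i l - X j l) 2} {λ _ → ν W * ν W} λ l → ℚₚ.≤-trans (ℚₚ.≤-reflexive (square-∣∣ (X i l - X j l)))
        (*-mono-≤ (ℚₚ.0≤∣p∣ (X i l - X j l)) (0≤ν W) (bd i j l) (bd i j l)))
      (ℚₚ.≤-trans (ℚₚ.≤-reflexive (sum-const d (ν W * ν W))) (ℚₚ.≤-trans (≤-by ((ν d - 1ℚ) * (ν d * (ν W * ν W)))
        (0≤* (≤⇒0≤ (ν-≤ {1} 1≤d)) (0≤* (0≤ν d) (0≤* (0≤ν W) (0≤ν W)))) (lem (ν d) (ν W)))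
        (ℚₚ.≤-reflexive (cong (λ a → pow a 2) (sym (ν-* d W))))))
      where
      lem : ∀ d w → d * (w * w) + (d - 1ℚ) * (d * (w * w)) ≡ (d * w) * ((d * w) * 1ℚ)
      lem = solve-∀ ℚring

    dist² : Fin n → Fin n → ℝ
    dist² i j = ∑ λ l → (point (pointSet X sep) i l -ℝ point (pointSet X sep) j l) ^ℝ 2

    seq-dist² : ∀ i j m → seq (dist² i j) m ≡ sq i j
    seq-dist² i j m = trans (seq-∑ (λ l → (point (pointSet X sep) i l -ℝ point (pointSet X sep) j l) ^ℝ 2) m)
      (cong (λ p → sum λ l → pow (seq (p i l) m - seq (p j l) m) 2) {point (pointSet X sep)} {λ i → rational (X i)} (point-pointSet X sep))

    module Root² (i j : Fin n) = RootOf 2 (s≤s z≤n) (dist² i j) (λ m → subst (0ℚ ≤_) (sym (seq-dist² i j m)) (0≤sq i j))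

    isRoot² : ∀ i j → Sqrt (dist² i j) (Root².root i j)
    isRoot² i j = Root².isRoot i j (ceil (sq i j)) λ m → subst (_≤ ν (ceil (sq i j))) (sym (seq-dist² i j m)) (ℚₚ.<⇒≤ (<ceil (sq i j)))

    abstract
      imax jmax imin jmin : Fin n
      imax = proj₁ (argmax-pairs sq)
      jmax = proj₁ (proj₂ (argmax-pairs sq))
      imin = proj₁ (argmin-pairs sq)
      jmin = proj₁ (proj₂ (argmin-pairs sq))

      max-≤ : ∀ a b → a ≢ b → sq a b ≤ sq imax jmax
      max-≤ = proj₂ (proj₂ (proj₂ (argmax-pairs sq)))
      min-≤ : ∀ a b → a ≢ b → sq imin jmin ≤ sq a b
      min-≤ = proj₂ (proj₂ (proj₂ (argmin-pairs sq)))
      imax≢jmax : imax ≢ jmax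
      imax≢jmax = proj₁ (proj₂ (proj₂ (argmax-pairs sq)))
      imin≢jmin : imin ≢ jmin
      imin≢jmin = proj₁ (proj₂ (proj₂ (argmin-pairs sq)))

    Dmax Dmin : ℝ
    Dmax = Root².root imax jmax
    Dmin = Root².root imin jmin

    ¬longer : ∀ δ i j → i ≢ j → δ ^ℝ 2 ≈ dist² i j → δ ≤ℝ Dmax
    ¬longer δ i j i≢j δ² = sqrt-mono Dmax δ (dist² imax jmax) (dist² i j) (proj₁ (isRoot² imax jmax)) (proj₂ (isRoot² imax jmax)) δ²
      λ m → subst₂ _≤_ (sym (seq-dist² i j m)) (sym (seq-dist² imax jmax m)) (max-≤ i j i≢j)

    ¬shorter : ∀ δ i j → i ≢ j → 0ℝ ≤ℝ δ → δ ^ℝ 2 ≈ dist² i j → Dmin ≤ℝ δ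
    ¬shorter δ i j i≢j 0≤δ δ² = sqrt-mono δ Dmin (dist² i j) (dist² imin jmin) 0≤δ δ² (proj₂ (isRoot² imin jmin))
      λ m → subst₂ _≤_ (sym (seq-dist² imin jmin m)) (sym (seq-dist² i j m)) (min-≤ i j i≢j)

    largest : IsLargestDistance (pointSet X sep) Dmax
    largest = (imax , jmax , imax≢jmax , isRoot² imax jmax) , λ δ (i , j , i≢j , _ , δ²) → ¬longer δ i j i≢j δ²

    smallest : IsSmallestDistance (pointSet X sep) Dmin
    smallest = (imin , jmin , imin≢jmin , isRoot² imin jmin) , λ δ (i , j , i≢j , 0≤δ , δ²) → ¬shorter δ i j i≢j 0≤δ δ²

    0≤n : ∀ m → 0ℚ ≤ seq (fromℕ n) m
    0≤n m = subst (0ℚ ≤_) (sym (/1≡ι (ℤ.+ n))) (0≤ν n)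

    module Rn = RootOf d 1≤d (fromℕ n) 0≤n

    isRootn : Root d (fromℕ n) Rn.root
    isRootn = Rn.isRoot n λ m → ℚₚ.≤-reflexive (/1≡ι (ℤ.+ n))

    Dmax≤ : ∀ m → seq Dmax m ≤ ν (d ℕ.* W)
    Dmax≤ m = by-contra λ lt → ℚₚ.<-irrefl refl (begin-strict
      ν (d ℕ.* W) * (ν (d ℕ.* W) * 1ℚ)   ≡⟨ cong (λ a → ν (d ℕ.* W) * a) (ℚₚ.*-identityʳ (ν (d ℕ.* W))) ⟩
      ν (d ℕ.* W) * ν (d ℕ.* W)          ≤⟨ ℚₚ.*-monoʳ-≤-nonNeg (ν (d ℕ.* W)) {{ℚ.nonNegative (0≤ν (d ℕ.* W))}} (ℚₚ.<⇒≤ lt) ⟩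
      seq Dmax m * ν (d ℕ.* W)           <⟨ ℚₚ.*-monoʳ-<-pos (seq Dmax m) {{ℚ.positive (ℚₚ.≤-<-trans (0≤ν (d ℕ.* W)) lt)}} lt ⟩
      seq Dmax m * seq Dmax m            ≡⟨ cong (seq Dmax m *_) (ℚₚ.*-identityʳ _) ⟨
      pow (seq Dmax m) 2                 ≤⟨ Root².u^k≤ imax jmax m ⟩
      seq (dist² imax jmax) m            ≡⟨ seq-dist² imax jmax m ⟩
      sq imax jmax                       ≤⟨ sq≤ imax jmax ⟩
      ν (d ℕ.* W) * (ν (d ℕ.* W) * 1ℚ)   ∎)
      where open ℚₚ.≤-Reasoning

    Dmin≥ : ∀ m → 3 ℕ.≤ m → ε 3 ≤ seq Dmin m
    Dmin≥ m h = by-contra λ lt → ℚₚ.<-irrefl refl (begin-strict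
      ε 3                               ≤⟨ ¼≤sq imin jmin imin≢jmin ⟩
      sq imin jmin                      ≡⟨ seq-dist² imin jmin m ⟨
      seq (dist² imin jmin) m           <⟨ Root².<u+ε imin jmin m ⟩
      pow (seq Dmin m + ε m) 2          ≤⟨ pow-mono 2 (0≤+ (Root².0≤u imin jmin m) (ℚₚ.<⇒≤ (0<ε m))) (ℚₚ.+-mono-≤ (ℚₚ.<⇒≤ lt) (ε≤¼ h)) ⟩
      pow (ε 3 + ε 3) 2                 ≡⟨ refl ⟩
      ε 3                               ∎)
      where open ℚₚ.≤-Reasoning

    r≥ : ∀ m → 3 ℕ.≤ m → ε 3 * ν s ≤ seq Rn.root m
    r≥ m h = by-contra λ lt → ℚₚ.<-irrefl refl (begin-strict
      pow (½ * ν s) d                   ≤⟨ s≤ ⟩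
      ν n                               ≡⟨ /1≡ι (ℤ.+ n) ⟨
      seq (fromℕ n) m                   <⟨ Rn.<u+ε m ⟩
      pow (seq Rn.root m + ε m) d       ≤⟨ pow-mono d (0≤+ (Rn.0≤u m) (ℚₚ.<⇒≤ (0<ε m))) (ℚₚ.+-mono-≤ (ℚₚ.<⇒≤ lt) (ℚₚ.≤-trans (ε≤¼ h)
                                             (ℚₚ.≤-trans (ℚₚ.≤-reflexive (sym (ℚₚ.*-identityʳ (ε 3)))) (ℚₚ.*-monoˡ-≤-nonNeg (ε 3) (ν-≤ {1} 1≤s))))) ⟩
      pow (ε 3 * ν s + ε 3 * ν s) d     ≡⟨ cong (λ a → pow a d) (sym (ℚₚ.*-distribʳ-+ (ν s) (ε 3) (ε 3))) ⟩
      pow (½ * ν s) d                   ∎)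
      where open ℚₚ.≤-Reasoning

    ratio : Dmax ≤ℝ fromℚ (γ d C) *ℝ Rn.root *ℝ Dmin
    ratio (c , 0<c , N , h) = ℚₚ.<-irrefl refl (begin-strict
      seq Dmax m                               ≤⟨ Dmax≤ m ⟩
      ν (d ℕ.* W)                              ≡⟨ trans (cong ν (sym (ℕₚ.*-assoc d C s))) (trans (ν-* (d ℕ.* C) s) (sym unit)) ⟩
      γ d C * (ε 3 * ν s) * ε 3                    ≤⟨ *-mono-≤ (0≤* 0≤γ (0≤* (ℚₚ.<⇒≤ (0<ε 3)) (0≤ν s))) (Root².0≤u imin jmin m)
                                                    (ℚₚ.*-monoˡ-≤-nonNeg (γ d C) {{ℚ.nonNegative 0≤γ}} (r≥ m 3≤m)) (Dmin≥ m 3≤m) ⟩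
      γ d C * seq Rn.root m * seq Dmin m           <⟨ <-by c 0<c refl ⟩
      γ d C * seq Rn.root m * seq Dmin m + c       <⟨ h m (ℕₚ.m≤m⊔n N 3) ⟩
      seq Dmax m                               ∎)
      where
      open ℚₚ.≤-Reasoning
      m : ℕ
      m = N ℕ.⊔ 3
      3≤m : 3 ℕ.≤ m
      3≤m = ℕₚ.m≤n⊔m N 3
      0≤γ : 0ℚ ≤ γ d C
      0≤γ = 0≤* (0≤ν 16) (0≤ν (d ℕ.* C))
      unit : γ d C * (ε 3 * ν s) * ε 3 ≡ ν (d ℕ.* C) * ν s
      unit = trans (lem (ν 16) (ν (d ℕ.* C)) (ν s) (ε 3)) (trans (cong (λ a → a * (ν (d ℕ.* C) * ν s)) {ν 16 * ε 3 * ε 3} {1ℚ} refl) (ℚₚ.*-identityˡ _))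
        where
        lem : ∀ a b s e → (a * b) * (e * s) * e ≡ (a * e * e) * (b * s)
        lem = solve-∀ ℚring

    isDense : IsDense (pointSet X sep) (fromℚ (γ d C))
    isDense = dense-by (pointSet X sep) (fromℚ (γ d C)) Dmax Dmin Rn.root largest smallest isRootn ratio

  dense : ∀ {n d} → 1 ℕ.≤ n → 1 ℕ.≤ d → (X : Fin n → Vector ℚ d) (sep : ∀ i j → i ≢ j → ∃[ l ] ½ ≤ ∣ X i l - X j l ∣)
    (C s : ℕ) → (∀ i j l → ∣ X i l - X j l ∣ ≤ ν (C ℕ.* s)) → 1 ℕ.≤ s → pow (½ * ν s) d ≤ ν n →
    IsDense (pointSet X sep) (fromℚ (γ d C))
  dense {suc zero}    _ 1≤d X sep C s bd 1≤s s≤ = inj₁ refl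
  dense {suc (suc n)} _ 1≤d X sep C s bd 1≤s s≤ = Dense.isDense 1≤d X sep C s bd 1≤s s≤

-- Distinct hyperplanes and the lattice positions of the points

module Arrangements where

  open import Defs using (PointSet; IsDense; fromℚ; InGeneralPosition; HasAtLeastHalving; _≤ℝ_; fromℕ; Hyperplane; point)
  open FiniteTypes
  open PlanarSets using (Planar)
  open RationalVectors
  open Perturbation
  open Interpolation
  open Lifting
  open Assembly
  open ExponentialSeries using (ν; 0≤ν; ν-≤; ν-*; ε; 0<ε; ε-ν; pow; pow-ν; pow-mono)
  open HalvingPlanes
  open Density using (pointSet; point-pointSet; γ; dense)
  open import Tactic.RingSolver using (solve-∀)
  open import Data.Nat as ℕ using (ℕ; zero; suc; s≤s; z≤n)
  import Data.Nat.Properties as ℕₚ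
  open import Data.Integer as ℤ using (ℤ; 0ℤ)
  import Data.Integer.Properties as ℤₚ
  open import Data.Rational using (ℚ; 0ℚ; 1ℚ; ½; _+_; _*_; _-_; -_; _<_; _≤_; ∣_∣)
  import Data.Rational as ℚ
  import Data.Rational.Properties as ℚₚ
  open import Data.Fin as Fin using (Fin; zero; suc; toℕ; finToFun; funToFin; inject≤)
  open import Data.Fin.Patterns using (0F; 1F)
  import Data.Fin.Properties as Finₚ
  import Data.Fin.Subset
  import Data.Vec as Vec
  open import Data.Product using (Σ; ∃-syntax; _×_; _,_; proj₁; proj₂)
  open import Data.Sum using (inj₁; inj₂)
  open import Data.Vec.Functional using (Vector)
  open import Function using (_∘_; Equivalence)
  open import Relation.Nullary using (Dec; yes; no; contradiction; ¬?; decidable-stable)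
  open import Relation.Binary.PropositionalEquality hiding (J)

  funToFin-cong : ∀ {m n} {f g : Fin m → Fin n} → f ≗ g → funToFin f ≡ funToFin g
  funToFin-cong {zero}  e = refl
  funToFin-cong {suc m} e = cong₂ Fin.combine (e zero) (funToFin-cong (e ∘ suc))

  finToFun-injective : ∀ {m n} {i j : Fin (n ℕ.^ m)} → finToFun {n} {m} i ≗ finToFun j → i ≡ j
  finToFun-injective {m} {n} {i} {j} e = trans (sym (Finₚ.funToFin-finToFin {m} {n} i)) (trans (funToFin-cong e) (Finₚ.funToFin-finToFin {m} {n} j))

  finToFun-apart : ∀ {m n} {i j : Fin (n ℕ.^ m)} → i ≢ j → ∃[ k ] finToFun {n} {m} i k ≢ finToFun j k
  finToFun-apart {m} {n} {i} {j} i≢j = go (Finₚ.any? λ k → ¬? (finToFun {n} {m} i k Fin.≟ finToFun j k))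
    where
    go : Dec (∃[ k ] finToFun {n} {m} i k ≢ finToFun j k) → ∃[ k ] finToFun {n} {m} i k ≢ finToFun j k
    go (yes p) = p
    go (no np) = contradiction (finToFun-injective {m} {n} λ k → decidable-stable (finToFun {n} {m} i k Fin.≟ finToFun j k) λ ne → np (k , ne)) i≢j

  parity≤1 : ∀ k → parity k ℕ.≤ 1
  parity≤1 zero          = z≤n
  parity≤1 (suc zero)    = s≤s z≤n
  parity≤1 (suc (suc k)) = parity≤1 k

  1≤∣ι∣ : ∀ i → i ≢ 0ℤ → 1ℚ ≤ ∣ ι i ∣
  1≤∣ι∣ (ℤ.+ zero)    h = contradiction refl h
  1≤∣ι∣ (ℤ.+ (suc n)) h = ℚₚ.≤-trans (ι-≤ (ℤ.+≤+ (s≤s z≤n))) (≤∣∣ (ι (ℤ.+ suc n)))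
  1≤∣ι∣ ℤ.-[1+ n ]    h = ℚₚ.≤-trans (ι-≤ (ℤ.+≤+ (s≤s z≤n))) (-≤∣∣ (ι ℤ.-[1+ n ]))

  ι-apart : ∀ {i j} → i ≢ j → 1ℚ ≤ ∣ ι i - ι j ∣
  ι-apart {i} {j} h = subst (λ q → 1ℚ ≤ ∣ q ∣) (ι-- i j) (1≤∣ι∣ (i ℤ.- j) λ e → h (ℤₚ.i-j≡0⇒i≡j i j e))

  half-side : ∀ {s t n d} → s ℕ.≤ 2 ℕ.* t → t ℕ.^ d ℕ.≤ n → pow (½ * ν s) d ≤ ν n
  half-side {s} {t} {n} {d} s≤ t≤ = begin
    pow (½ * ν s) d      ≤⟨ pow-mono d (0≤* (ℚₚ.<⇒≤ (ℚₚ.positive⁻¹ ½)) (0≤ν s)) (begin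
        ½ * ν s              ≤⟨ ℚₚ.*-monoˡ-≤-nonNeg ½ (ν-≤ s≤) ⟩
        ½ * ν (2 ℕ.* t)      ≡⟨ cong (½ *_) (ν-* 2 t) ⟩
        ½ * (ν 2 * ν t)      ≡⟨ ℚₚ.*-assoc ½ (ν 2) (ν t) ⟨
        ½ * ν 2 * ν t        ≡⟨ ℚₚ.*-identityˡ (ν t) ⟩
        ν t                  ∎) ⟩
    pow (ν t) d          ≡⟨ pow-ν t d ⟩
    ν (t ℕ.^ d)          ≤⟨ ν-≤ t≤ ⟩
    ν n                  ∎
    where open ℚₚ.≤-Reasoning

  abstract
    Arrangement : ℕ → ℕ → ℕ → Set
    Arrangement d F n = Σ (PointSet d n) λ P → IsDense P (fromℚ (γ d 9)) × InGeneralPosition P × (∀ x → x ≤ℝ fromℕ F → HasAtLeastHalving P x)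

    Arrangement⁺ : ∀ d F n (P : PointSet d n) → IsDense P (fromℚ (γ d 9)) → InGeneralPosition P → (∀ x → x ≤ℝ fromℕ F → HasAtLeastHalving P x) → Arrangement d F n
    Arrangement⁺ d F n P isDense general many = P , isDense , general , many

    Arrangement⁻ : ∀ d F n → Arrangement d F n → Σ (PointSet d n) λ P → IsDense P (fromℚ (γ d 9)) × InGeneralPosition P × (∀ x → x ≤ℝ fromℕ F → HasAtLeastHalving P x)
    Arrangement⁻ d F n A = A

  arrange : ∀ {n d} F (X : Config {n} {d}) (sep : ∀ i j → i ≢ j → ∃[ l ] ½ ≤ ∣ X i l - X j l ∣) → GenPos X →
    (tuple : Fin F → Fin d → Fin n) → (∀ i → ∃[ H ] HalvingPlane (pointSet X sep) (tuple i) H) →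
    (∀ i j → (∀ k → ∃[ k′ ] tuple j k′ ≡ tuple i k) → i ≡ j) →
    ∀ s t → 1 ℕ.≤ n → 1 ℕ.≤ d → 1 ℕ.≤ s → (∀ i j l → ∣ X i l - X j l ∣ ≤ ν (9 ℕ.* s)) → s ℕ.≤ 2 ℕ.* t → t ℕ.^ d ℕ.≤ n → Arrangement d F n
  arrange {n} {d} F X sep gp tuple halving distinct s t 1≤n 1≤d 1≤s bd s≤ t≤ = Arrangement⁺ d F n (pointSet X sep)
      (dense {n} {d} 1≤n 1≤d X sep 9 s bd 1≤s (half-side {s} {t} {n} {d} s≤ t≤)) (in-general-position (pointSet X sep) (point-pointSet X sep) gp)
      λ x x≤ → F , x≤ , plane , (λ i → plane-halving (pointSet X sep) (tuple i) (plane i) (proj₂ (halving i))) ,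
        λ i j i≢j same → i≢j (distinct i j λ k → plane-only (pointSet X sep) (tuple j) (plane j) (proj₂ (halving j)) (tuple i k)
          (Equivalence.to (same (point (pointSet X sep) (tuple i k))) (plane-on (pointSet X sep) (tuple i) (plane i) (proj₂ (halving i)) k)))
    where
    plane : Fin F → Hyperplane d
    plane i = proj₁ (halving i)

  module FromHalves {Λ : ℕ} (κ : ℕ) (Pl : Planar Λ) (Row : Ty) (β rest : ℕ) (offset : El Row → ℕ)
    (x₀ : El (Build.At κ Pl Row β rest offset) → Vector ℚ (suc (suc κ)))
    (R : ℕ) (coef≤ : ∀ j → Build.coef κ Pl Row β rest offset j ≤ ι (ℤ.+ R)) where
    open Planar Pl using (E; bold; plain; edge-inj; b≢p)
    open Build κ Pl Row β rest offset
    open Assemble κ Pl Row β rest offset x₀ R coef≤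

    module _ (X : Config {size Pt} {d}) (sep : ∀ i j → i ≢ j → ∃[ l ] ½ ≤ ∣ X i l - X j l ∣)
      (gp : GenPos X) (halves : ∀ f → Halves f X) where

      halving : ∀ f → ∃[ H ] HalvingPlane (pointSet X sep) (tuple f) H
      halving f = FromCell.halving-plane cell dir₀ (pointSet X sep) (point-pointSet X sep) ∑σ σ-on
        where open Halves (halves f)

      same-row : ∀ {r r′ e e′ k} → _≡_ {A = El Pt} (inj₁ (inj₁ (r , e) , 0F)) (inj₁ (inj₁ (r′ , e′) , k)) → r ≡ r′ × e ≡ e′
      same-row refl = refl , refl

      -- A choice can be recovered from its set of points: no bold point is plain, so the ends of
      -- the edge cannot be exchanged, and a B-point carries its class.
      distinct : ∀ f f′ → (∀ k → ∃[ k′ ] tuple f′ k′ ≡ tuple f k) → f ≡ f′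
      distinct f@(ρ , e , b) f′@(ρ′ , e′ , b′) meets′ = cong₂ _,_ ρ≡ (cong₂ _,_ e≡ b≡)
        where
        meets : ∀ k → ∃[ k′ ] selected (choice f′) k′ ≡ selected (choice f) k
        meets k = let k′ , e = meets′ k in k′ , encode-injective Pt e
        m₀ : ρ′ ≡ ρ × bold e′ ≡ bold e
        m₀ = go (meets zero)
          where
          go : ∃[ k′ ] selected (choice f′) k′ ≡ selected (choice f) zero → ρ′ ≡ ρ × bold e′ ≡ bold e
          go (zero , eq) = same-row eq
          go (suc zero , eq) = contradiction (sym (proj₂ (same-row eq))) (b≢p e e′)
          go (suc (suc k) , ())
        m₁ : plain e′ ≡ plain e
        m₁ = go (meets (suc zero))
          where
          go : ∃[ k′ ] selected (choice f′) k′ ≡ selected (choice f) (suc zero) → plain e′ ≡ plain e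
          go (zero , eq) = contradiction (proj₂ (same-row eq)) (b≢p e′ e)
          go (suc zero , eq) = proj₂ (same-row eq)
          go (suc (suc k) , ())
        ρ≡ : ρ ≡ ρ′
        ρ≡ = sym (proj₁ m₀)
        e≡ : e ≡ e′
        e≡ = edge-inj e e′ (sym (proj₂ m₀)) (sym m₁)
        b≡ : b ≡ b′
        b≡ = finToFun-injective {κ} {β} λ k → go k (meets (suc (suc k)))
          where
          classes : ∀ {k k′ : Fin κ} {i i′ : Fin β} → _≡_ {A = El Pt} (inj₁ (inj₂ (inj₁ (k′ , i′)) , 0F)) (inj₁ (inj₂ (inj₁ (k , i)) , 0F)) → k′ ≡ k × i′ ≡ i
          classes refl = refl , refl
          go : ∀ k → ∃[ k′ ] selected (choice f′) k′ ≡ selected (choice f) (suc (suc k)) → finToFun b k ≡ finToFun b′ k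
          go k (zero , ())
          go k (suc zero , ())
          go k (suc (suc k′) , eq) = let k≡ , i≡ = classes eq in trans (sym i≡) (cong (finToFun b′) k≡)

      arrangement : ∀ s t → 1 ℕ.≤ size Pt → 1 ℕ.≤ s → (∀ i j l → ∣ X i l - X j l ∣ ≤ ν (9 ℕ.* s)) → s ℕ.≤ 2 ℕ.* t → t ℕ.^ d ℕ.≤ size Pt →
        Arrangement d (size Hx) (size Pt)
      arrangement s t 1≤n 1≤s bd s≤ t≤ = arrange (size Hx) X sep gp (λ i → tuple (decode Hx i)) (λ i → halving (decode Hx i))
        (λ i j h → trans (sym (encode-decode Hx i)) (trans (cong (encode Hx) (distinct (decode Hx i) (decode Hx j) h)) (encode-decode Hx j)))
        s t 1≤n (s≤s z≤n) 1≤s bd s≤ t≤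

  -- Rows run in the directions (1, g/s) with `g` in a cube of side `w`. Each direction carries `L`
  -- shifted copies of the planar set with first coordinates beyond `s`, each copy with an atom of
  -- its own. B-points are integer points with first coordinate from 1 to `s`. So the first
  -- coordinate separates rows, B-points, antipodes and centre.
  module Lattice {Λ : ℕ} (κ : ℕ) (Pl : Planar Λ) (w L t β rest : ℕ) where
    open Planar Pl using (W; p; p<Λ; p-inj; m; 1≤m)

    s : ℕ
    s = suc t

    Row : Ty
    Row = fin (w ℕ.^ suc κ) ⊗ fin L

    -- The summand `s` keeps different directions at distance at least 1, and multiples of `m` keep
    -- the copies along one direction disjoint.
    offset : El Row → ℕ
    offset (g , l) = s ℕ.+ m ℕ.* toℕ l

    open Build κ Pl Row β rest offset

    module _ (w≤s : w ℕ.≤ s) (fitA : Fin L → Λ ℕ.≤ s × m ℕ.* L ℕ.≤ s) (fitB : κ ℕ.* β ℕ.+ rest ℕ.≤ s ℕ.^ d) where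

      gcoord : El Row → Fin (suc κ) → ℕ
      gcoord (g , l) j = toℕ (finToFun {w} {suc κ} g j)

      bfun : El Bt → Fin d → Fin s
      bfun b = finToFun {s} {d} (inject≤ (encode Bt b) fitB)

      bcoord : El Bt → Fin d → ℕ
      bcoord b zero    = suc (toℕ (bfun b zero))
      bcoord b (suc j) = toℕ (bfun b (suc j))

      x₀ : El At → Vector ℚ d
      -- Both the origin and the transversal atom start at 0; only the perturbation of the atoms
      -- makes them different.
      x₀ (inj₁ _) l              = 0ℚ
      x₀ (inj₂ (inj₁ ρ)) zero    = 1ℚ
      x₀ (inj₂ (inj₁ ρ)) (suc j) = ν (gcoord ρ j) * ε t
      x₀ (inj₂ (inj₂ b)) l       = ν (bcoord b l)

      R : ℕ
      R = 4 ℕ.* s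

      1≤s : 1 ℕ.≤ s
      1≤s = s≤s z≤n

      pos≤R : ∀ ρ w → pos ρ w ℕ.≤ R
      pos≤R (g , l) w = begin
        suc (s ℕ.+ m ℕ.* toℕ l ℕ.+ p w)   ≡⟨ ℕₚ.+-suc (s ℕ.+ m ℕ.* toℕ l) (p w) ⟨
        s ℕ.+ m ℕ.* toℕ l ℕ.+ suc (p w)   ≤⟨ ℕₚ.+-mono-≤ (ℕₚ.+-monoʳ-≤ s (ℕₚ.≤-trans (ℕₚ.*-monoʳ-≤ m (ℕₚ.<⇒≤ (Finₚ.toℕ<n l))) (proj₂ (fitA l)))) (ℕₚ.≤-trans (p<Λ w) (proj₁ (fitA l))) ⟩
        s ℕ.+ s ℕ.+ s                     ≤⟨ ℕₚ.m≤m+n (s ℕ.+ s ℕ.+ s) s ⟩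
        s ℕ.+ s ℕ.+ s ℕ.+ s               ≡⟨ lem s ⟩
        4 ℕ.* s                           ∎
        where
        open ℕₚ.≤-Reasoning
        import Data.Nat.Tactic.RingSolver as ℕR
        lem : ∀ s → s ℕ.+ s ℕ.+ s ℕ.+ s ≡ 4 ℕ.* s
        lem = ℕR.solve-∀

      coef≤ : ∀ j → coef j ≤ ι (ℤ.+ R)
      coef≤ (inj₁ (ρ , w)) = ι-≤ (ℤ.+≤+ (pos≤R ρ w))
      coef≤ (inj₂ b)       = ι-≤ (ℤ.+≤+ (ℕₚ.≤-trans 1≤s (ℕₚ.m≤n*m s 4)))

      open Assemble κ Pl Row β rest offset x₀ R coef≤ using (ideal; Hx; configuration; Halves)

      base : El Ix → Vector ℚ d
      base j l = coef j * x₀ (atom j) l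

      affine-0 : ∀ c a k → 0ℚ + (c * (a + - 1ℚ * 0ℚ) + k * (0ℚ + - 1ℚ * 0ℚ)) ≡ c * a
      affine-0 = solve-∀ ℚring

      ideal⁺ : ∀ j l → ideal (inj₁ (j , 0F)) l ≡ base j l
      ideal⁺ j l = affine-0 (coef j) (x₀ (atom j) l) (0ℚ * 0ℚ * height j)

      ideal⁻ : ∀ j l → ideal (inj₁ (j , 1F)) l ≡ - base j l
      ideal⁻ j l = trans (affine-0 (- coef j) (x₀ (atom j) l) (0ℚ * ι (tilt j))) (lem (coef j) (x₀ (atom j) l))
        where
        lem : ∀ c a → - c * a ≡ - (c * a)
        lem = solve-∀ ℚring

      ideal⁰ : ∀ i l → ideal (inj₂ i) l ≡ 0ℚ
      ideal⁰ i l = affine-0 0ℚ 0ℚ 0ℚ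

      lead : El Ix → ℕ
      lead (inj₁ (ρ , w)) = pos ρ w
      lead (inj₂ b)       = bcoord b zero

      1≤lead : ∀ j → 1 ℕ.≤ lead j
      1≤lead (inj₁ _) = s≤s z≤n
      1≤lead (inj₂ b) = s≤s z≤n

      base-lead : ∀ j → base j zero ≡ ι (ℤ.+ lead j)
      base-lead (inj₁ (ρ , w)) = ℚₚ.*-identityʳ (coef (inj₁ (ρ , w)))
      base-lead (inj₂ b)       = ℚₚ.*-identityˡ (ν (bcoord b zero))

      s<pos : ∀ ρ w → s ℕ.< pos ρ w
      s<pos (g , l) w = s≤s (ℕₚ.≤-trans (ℕₚ.m≤m+n s (m ℕ.* toℕ l)) (ℕₚ.m≤m+n _ (p w)))

      -- Two rows with different directions, compared at the same first coordinate `c > s`, differ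
      -- by `c * (a - b) / s`, at least 1. With equal directions, `p-inj` makes the points equal.
      -- B-points are integral, and no row point has the first coordinate of a B-point.
      base-apart : ∀ j k → j ≢ k → lead j ≡ lead k → ∃[ l ] 1ℚ ≤ ∣ base j l - base k l ∣
      base-apart (inj₁ (ρ@(g , l) , v)) (inj₁ (ρ′@(g′ , l′) , v′)) ne eq = go (g Fin.≟ g′)
        where
        same-offset : m ℕ.* toℕ l ℕ.+ p v ≡ m ℕ.* toℕ l′ ℕ.+ p v′
        same-offset = ℕₚ.+-cancelˡ-≡ s _ _ (trans (sym (ℕₚ.+-assoc s (m ℕ.* toℕ l) (p v))) (trans (ℕₚ.suc-injective eq) (ℕₚ.+-assoc s (m ℕ.* toℕ l′) (p v′))))
        v≡ : v ≡ v′
        v≡ = p-inj v v′ (toℕ l) (toℕ l′) (trans (ℕₚ.+-comm (p v) _) (trans same-offset (ℕₚ.+-comm _ (p v′))))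
        l≡ : l ≡ l′
        l≡ = Finₚ.toℕ-injective (ℕₚ.*-cancelˡ-≡ (toℕ l) (toℕ l′) m {{ℕ.>-nonZero 1≤m}}
          (ℕₚ.+-cancelʳ-≡ (p v) _ _ (trans same-offset (cong (λ v → m ℕ.* toℕ l′ ℕ.+ p v) (sym v≡)))))
        go : Dec (g ≡ g′) → ∃[ i ] 1ℚ ≤ ∣ base (inj₁ (ρ , v)) i - base (inj₁ (ρ′ , v′)) i ∣
        go (yes g≡) = contradiction (cong₂ (λ r v → inj₁ (r , v)) (cong₂ _,_ g≡ l≡) v≡) ne
        go (no g≢)  = far (finToFun-apart {suc κ} {w} g≢)
          where
          far : ∃[ i ] finToFun {w} {suc κ} g i ≢ finToFun g′ i → ∃[ i ] 1ℚ ≤ ∣ base (inj₁ (ρ , v)) i - base (inj₁ (ρ′ , v′)) i ∣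
          far (i , ne) = suc i , subst (λ q → 1ℚ ≤ ∣ q ∣) (trans (lem c (ν a) (ν b) (ε t)) (cong (λ n → c * (ν a * ε t) - ν n * (ν b * ε t)) eq)) big
            where
            a b : ℕ
            a = gcoord ρ i
            b = gcoord ρ′ i
            c : ℚ
            c = ν (pos ρ v)
            lem : ∀ c a b e → (c * e) * (a - b) ≡ c * (a * e) - c * (b * e)
            lem = solve-∀ ℚring
            1≤cε : 1ℚ ≤ c * ε t
            1≤cε = ℚₚ.≤-trans (ℚₚ.≤-reflexive (sym (trans (ℚₚ.*-comm (ν s) (ε t)) (ε-ν t))))
              (ℚₚ.*-monoʳ-≤-nonNeg (ε t) {{ℚ.nonNegative (ℚₚ.<⇒≤ (0<ε t))}} (ν-≤ (ℕₚ.<⇒≤ (s<pos ρ v))))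
            big : 1ℚ ≤ ∣ (c * ε t) * (ν a - ν b) ∣
            big = subst (1ℚ ≤_) (sym (ℚₚ.∣p*q∣≡∣p∣*∣q∣ (c * ε t) (ν a - ν b))) (ℚₚ.≤-trans (ℚₚ.≤-reflexive (sym (ℚₚ.*-identityˡ 1ℚ)))
              (*-mono-≤ (ℚₚ.<⇒≤ 0<1) (ℚₚ.0≤∣p∣ (ν a - ν b)) (ℚₚ.≤-trans 1≤cε (≤∣∣ (c * ε t))) (ι-apart {ℤ.+ a} {ℤ.+ b} λ e → ne (Finₚ.toℕ-injective (ℤₚ.+-injective e)))))
      base-apart (inj₁ (ρ , v)) (inj₂ b) _ eq = contradiction (subst (ℕ._≤ s) (sym eq) (Finₚ.toℕ<n (bfun b zero))) (ℕₚ.<⇒≱ (s<pos ρ v))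
      base-apart (inj₂ b) (inj₁ (ρ , v)) _ eq = contradiction (subst (ℕ._≤ s) eq (Finₚ.toℕ<n (bfun b zero))) (ℕₚ.<⇒≱ (s<pos ρ v))
      base-apart (inj₂ b) (inj₂ b′) ne eq = go (finToFun-apart {d} {s} λ e → ne (cong inj₂ (encode-injective Bt (Finₚ.inject≤-injective fitB fitB _ _ e))))
        where
        go : ∃[ i ] bfun b i ≢ bfun b′ i → ∃[ i ] 1ℚ ≤ ∣ base (inj₂ b) i - base (inj₂ b′) i ∣
        go (zero , ne) = contradiction (Finₚ.toℕ-injective (ℕₚ.suc-injective eq)) ne
        go (suc i , ne) = suc i , subst₂ (λ x y → 1ℚ ≤ ∣ x - y ∣) (sym (ℚₚ.*-identityˡ (ν (bcoord b (suc i))))) (sym (ℚₚ.*-identityˡ (ν (bcoord b′ (suc i)))))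
          (ι-apart {ℤ.+ bcoord b (suc i)} {ℤ.+ bcoord b′ (suc i)} λ e → ne (Finₚ.toℕ-injective (ℤₚ.+-injective e)))

      height₀ : El Pt → ℤ
      height₀ (inj₁ (j , 0F)) = ℤ.+ lead j
      height₀ (inj₁ (j , 1F)) = ℤ.- (ℤ.+ lead j)
      height₀ (inj₂ _)        = 0ℤ

      ideal-height : ∀ P → ideal P zero ≡ ι (height₀ P)
      ideal-height (inj₁ (j , 0F)) = trans (ideal⁺ j zero) (base-lead j)
      ideal-height (inj₁ (j , 1F)) = trans (ideal⁻ j zero) (trans (cong -_ (base-lead j)) (sym (ι-neg (ℤ.+ lead j))))
      ideal-height (inj₂ i)        = ideal⁰ i zero

      pos≢neg : ∀ {a b} → 1 ℕ.≤ a → ℤ.+ a ≢ ℤ.- (ℤ.+ b)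
      pos≢neg {suc a} {zero}  h ()
      pos≢neg {suc a} {suc b} h ()

      ideal-apart′ : ∀ P Q → P ≢ Q → height₀ P ≡ height₀ Q → ∃[ l ] 1ℚ ≤ ∣ ideal P l - ideal Q l ∣
      ideal-apart′ (inj₁ (j , 0F)) (inj₁ (k , 0F)) ne eq = let l , h = base-apart j k (λ { refl → ne refl }) (ℤₚ.+-injective eq) in
        l , subst₂ (λ x y → 1ℚ ≤ ∣ x - y ∣) (sym (ideal⁺ j l)) (sym (ideal⁺ k l)) h
      ideal-apart′ (inj₁ (j , 1F)) (inj₁ (k , 1F)) ne eq = let l , h = base-apart j k (λ { refl → ne refl }) (ℤₚ.+-injective (ℤₚ.neg-injective eq)) in
        l , subst₂ (λ x y → 1ℚ ≤ ∣ x - y ∣) (sym (ideal⁻ j l)) (sym (ideal⁻ k l))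
          (subst (1ℚ ≤_) (trans (sym (ℚₚ.∣-p∣≡∣p∣ (base j l - base k l))) (cong ∣_∣ (lem (base j l) (base k l)))) h)
        where
        lem : ∀ a b → - (a - b) ≡ - a - - b
        lem = solve-∀ ℚring
      ideal-apart′ (inj₁ (j , 0F)) (inj₁ (k , 1F)) _ eq = contradiction eq (pos≢neg {lead j} {lead k} (1≤lead j))
      ideal-apart′ (inj₁ (j , 1F)) (inj₁ (k , 0F)) _ eq = contradiction (sym eq) (pos≢neg {lead k} {lead j} (1≤lead k))
      ideal-apart′ (inj₁ (j , 0F)) (inj₂ _) _ eq = contradiction eq (pos≢neg {lead j} {0} (1≤lead j))
      ideal-apart′ (inj₁ (j , 1F)) (inj₂ _) _ eq = contradiction (ℤₚ.neg-injective eq) (pos≢neg {lead j} {0} (1≤lead j))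
      ideal-apart′ (inj₂ _) (inj₁ (k , 0F)) _ eq = contradiction (sym eq) (pos≢neg {lead k} {0} (1≤lead k))
      ideal-apart′ (inj₂ _) (inj₁ (k , 1F)) _ eq = contradiction (ℤₚ.neg-injective (sym eq)) (pos≢neg {lead k} {0} (1≤lead k))
      ideal-apart′ (inj₂ i) (inj₂ i′) ne _ = contradiction (cong inj₂ (one (parity≤1 κ) i i′)) ne
        where
        one : ∀ {n} → n ℕ.≤ 1 → (i j : Fin n) → i ≡ j
        one (s≤s z≤n) zero zero = refl

      ideal-apart : ∀ P Q → P ≢ Q → ∃[ l ] 1ℚ ≤ ∣ ideal P l - ideal Q l ∣
      ideal-apart P Q ne = go (height₀ P ℤ.≟ height₀ Q)
        where
        go : Dec (height₀ P ≡ height₀ Q) → ∃[ l ] 1ℚ ≤ ∣ ideal P l - ideal Q l ∣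
        go (yes e) = ideal-apart′ P Q ne e
        go (no ne) = zero , subst₂ (λ x y → 1ℚ ≤ ∣ x - y ∣) (sym (ideal-height P)) (sym (ideal-height Q)) (ι-apart ne)

      ∣x₀∣≤1 : ∀ ρ l → ∣ x₀ (inj₂ (inj₁ ρ)) l ∣ ≤ 1ℚ
      ∣x₀∣≤1 ρ zero    = ℚₚ.≤-reflexive refl
      ∣x₀∣≤1 ρ (suc j) = subst (_≤ 1ℚ) (sym (ℚₚ.0≤p⇒∣p∣≡p (0≤* (0≤ν (gcoord ρ j)) (ℚₚ.<⇒≤ (0<ε t)))))
        (ℚₚ.≤-trans (ℚₚ.*-monoʳ-≤-nonNeg (ε t) {{ℚ.nonNegative (ℚₚ.<⇒≤ (0<ε t))}} (ν-≤ (ℕₚ.≤-trans (ℕₚ.<⇒≤ (Finₚ.toℕ<n (finToFun {w} {suc κ} (proj₁ ρ) j))) w≤s)))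
          (ℚₚ.≤-reflexive (trans (ℚₚ.*-comm (ν s) (ε t)) (ε-ν t))))

      bcoord≤ : ∀ b l → bcoord b l ℕ.≤ s
      bcoord≤ b zero    = Finₚ.toℕ<n (bfun b zero)
      bcoord≤ b (suc j) = ℕₚ.<⇒≤ (Finₚ.toℕ<n (bfun b (suc j)))

      base≤ : ∀ j l → ∣ base j l ∣ ≤ ν R
      base≤ (inj₁ (ρ , v)) l = subst (_≤ ν R) (sym (ℚₚ.∣p*q∣≡∣p∣*∣q∣ c (x₀ (inj₂ (inj₁ ρ)) l))) (subst (∣ c ∣ * ∣ x₀ (inj₂ (inj₁ ρ)) l ∣ ≤_) (ℚₚ.*-identityʳ (ν R))
          (*-mono-≤ (ℚₚ.0≤∣p∣ c) (ℚₚ.<⇒≤ 0<1) (ℚₚ.≤-trans (ℚₚ.≤-reflexive (ℚₚ.0≤p⇒∣p∣≡p (0≤ν (pos ρ v)))) (coef≤ (inj₁ (ρ , v)))) (∣x₀∣≤1 ρ l)))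
        where
        c : ℚ
        c = ν (pos ρ v)
      base≤ (inj₂ b) l = ℚₚ.≤-trans (ℚₚ.≤-reflexive (trans (cong ∣_∣ (ℚₚ.*-identityˡ (ν (bcoord b l)))) (ℚₚ.0≤p⇒∣p∣≡p (0≤ν (bcoord b l)))))
        (ν-≤ (ℕₚ.≤-trans (bcoord≤ b l) (ℕₚ.m≤n*m s 4)))

      ideal≤ : ∀ P l → ∣ ideal P l ∣ ≤ ν R
      ideal≤ (inj₁ (j , 0F)) l = subst (λ q → ∣ q ∣ ≤ ν R) (sym (ideal⁺ j l)) (base≤ j l)
      ideal≤ (inj₁ (j , 1F)) l = subst (λ q → ∣ q ∣ ≤ ν R) (sym (ideal⁻ j l)) (subst (_≤ ν R) (sym (ℚₚ.∣-p∣≡∣p∣ (base j l))) (base≤ j l))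
      ideal≤ (inj₂ i) l = subst (λ q → ∣ q ∣ ≤ ν R) (sym (ideal⁰ i l)) (0≤ν R)

      module Near-ideal (X : Config {size Pt} {d}) (near : Near (ideal ∘ decode Pt) ¼ X) where

        -- Ideal positions differ by 1 in some coordinate, and the perturbation takes away at most a
        -- quarter at either point.
        sep : ∀ i j → i ≢ j → ∃[ l ] ½ ≤ ∣ X i l - X j l ∣
        sep i j i≢j = let l , h = ideal-apart (decode Pt i) (decode Pt j) (λ e → i≢j (trans (sym (encode-decode Pt i)) (trans (cong (encode Pt) e) (encode-decode Pt j)))) in
          l , ℚₚ.≮⇒≥ λ lt → ℚₚ.<-irrefl refl (ℚₚ.≤-<-trans h (ℚₚ.≤-<-trans (triangle (X i l) (X j l) (ideal (decode Pt i) l) (ideal (decode Pt j) l))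
            (subst (∣ X i l - X j l ∣ + (∣ X i l - ideal (decode Pt i) l ∣ + ∣ X j l - ideal (decode Pt j) l ∣) <_) quarter
              (ℚₚ.+-mono-< lt (ℚₚ.+-mono-< (near i l) (near j l))))))
          where
          quarter : ½ + (¼ + ¼) ≡ 1ℚ
          quarter = refl
          triangle : ∀ x y a b → ∣ a - b ∣ ≤ ∣ x - y ∣ + (∣ x - a ∣ + ∣ y - b ∣)
          triangle x y a b = subst (λ q → ∣ q ∣ ≤ ∣ x - y ∣ + (∣ x - a ∣ + ∣ y - b ∣)) (lem x y a b) (ℚₚ.≤-trans (ℚₚ.∣p-q∣≤∣p∣+∣q∣ (x - y) ((x - a) - (y - b)))
            (ℚₚ.+-monoʳ-≤ ∣ x - y ∣ (ℚₚ.∣p-q∣≤∣p∣+∣q∣ (x - a) (y - b))))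
            where
            lem : ∀ x y a b → (x - y) - ((x - a) - (y - b)) ≡ a - b
            lem = solve-∀ ℚring

        within : ∀ i l → ∣ X i l ∣ ≤ ν R + ¼
        within i l = subst (λ q → ∣ q ∣ ≤ ν R + ¼) (lem (X i l) (ideal (decode Pt i) l)) (ℚₚ.≤-trans (ℚₚ.∣p+q∣≤∣p∣+∣q∣ (ideal (decode Pt i) l) (X i l - ideal (decode Pt i) l))
          (ℚₚ.+-mono-≤ (ideal≤ (decode Pt i) l) (ℚₚ.<⇒≤ (near i l))))
          where
          lem : ∀ x a → a + (x - a) ≡ x
          lem = solve-∀ ℚring

        diameter : ∀ i j l → ∣ X i l - X j l ∣ ≤ ν (9 ℕ.* s)
        diameter i j l = ℚₚ.≤-trans (ℚₚ.∣p-q∣≤∣p∣+∣q∣ (X i l) (X j l)) (ℚₚ.≤-trans (ℚₚ.+-mono-≤ (within i l) (within j l))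
          (ℚₚ.≤-trans (ℚₚ.≤-reflexive (lem (ν R) ¼)) (ℚₚ.≤-trans (ℚₚ.+-monoʳ-≤ (ν R + ν R) half≤s) (ℚₚ.≤-reflexive sum≡))))
          where
          import Data.Nat.Tactic.RingSolver as ℕR
          lem : ∀ a b → (a + b) + (a + b) ≡ (a + a) + (b + b)
          lem = solve-∀ ℚring
          half≤s : ¼ + ¼ ≤ ν s
          half≤s = ℚₚ.≤-trans (ℚₚ.<⇒≤ (½< 0<1)) (ν-≤ {1} 1≤s)
          nine : ∀ s → 4 ℕ.* s ℕ.+ 4 ℕ.* s ℕ.+ s ≡ 9 ℕ.* s
          nine = ℕR.solve-∀
          sum≡ : (ν R + ν R) + ν s ≡ ν (9 ℕ.* s)
          sum≡ = trans (cong (_+ ν s) (sym (ι-+ (ℤ.+ R) (ℤ.+ R)))) (trans (sym (ι-+ (ℤ.+ (R ℕ.+ R)) (ℤ.+ s))) (cong ν (nine s)))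

-- Choice of the parameters and growth of the number of hyperplanes

module ParameterChoice where

  open PlanarSets
  open Lifting using (parity)
  open ExponentialSeries using (crossing)
  open import Data.Nat hiding (parity)
  open import Data.Nat.Properties
  open import Data.Nat.DivMod using (_/_; _%_; m≡m%n+[m/n]*n; m%n<n; m/n*n≤m)
  open import Data.Nat.Divisibility using (_∣_; divides)
  open import Data.Nat.Tactic.RingSolver using (solve-∀)
  open import Data.Fin using (Fin)
  open import Data.Product using (∃-syntax; _×_; _,_)
  open import Relation.Nullary using (¬_; Dec; yes; no; contradiction)
  open import Relation.Binary.PropositionalEquality hiding (J)

  parity-double : ∀ q → parity (q * 2) ≡ 0
  parity-double zero    = refl
  parity-double (suc q) = parity-double q

  parity-suc : ∀ k → parity (suc k) ≡ 0 → 1 ≡ parity k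
  parity-suc (suc zero)    h = refl
  parity-suc (suc (suc k)) h = parity-suc k h

  parity-cancel : ∀ n k → parity (n + k) ≡ 0 → parity n ≡ parity k
  parity-cancel zero          k h = sym h
  parity-cancel (suc zero)    k h = parity-suc k h
  parity-cancel (suc (suc n)) k h = parity-cancel n k h

  halve : ∀ n → ∃[ q ] q * 2 + parity n ≡ n
  halve zero          = 0 , refl
  halve (suc zero)    = 0 , refl
  halve (suc (suc n)) = let q , e = halve n in suc q , cong (λ i → suc (suc i)) e

  halve-even : ∀ κ n → 2 ∣ n + suc (suc κ) → ∃[ q ] q * 2 + parity κ ≡ n
  halve-even κ n (divides k e) = let q , e′ = halve n in q , trans (cong (q * 2 +_) (sym (parity-cancel n κ even))) e′
    where
    even : parity (n + κ) ≡ 0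
    even = trans (cong parity (sym (trans (+-suc n (suc κ)) (cong suc (+-suc n κ))))) (trans (cong parity e) (parity-double k))

  parity≤ : ∀ k → parity k ≤ 1
  parity≤ zero          = z≤n
  parity≤ (suc zero)    = s≤s z≤n
  parity≤ (suc (suc k)) = parity≤ k

  ≤^suc : ∀ n k → 1 ≤ n → n ≤ n ^ suc k
  ≤^suc n k 1≤n = m≤m*n n (n ^ k) {{m^n≢0 n k {{>-nonZero 1≤n}}}}

  n<2^n : ∀ n → n < 2 ^ n
  n<2^n zero    = s≤s z≤n
  n<2^n (suc n) = begin-strict
    suc n            <⟨ s<s (n<2^n n) ⟩
    1 + 2 ^ n        ≤⟨ +-monoˡ-≤ (2 ^ n) (m^n>0 2 n) ⟩
    2 ^ n + 2 ^ n    ≡⟨ cong (2 ^ n +_) (+-identityʳ (2 ^ n)) ⟨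
    2 ^ suc n        ∎
    where open ≤-Reasoning

  -- The root of `n` lies between `t` and `suc t`, and `t′ = t` will do except for `t = 0`, where 1
  -- takes its place.
  root-bracket : ∀ n k → 1 ≤ n → ∃[ t ] ∃[ t′ ] (n ≤ suc t ^ suc k × suc t ≤ 2 * t′ × t′ ^ suc k ≤ n)
  root-bracket n k 1≤n = go (crossing (λ j → j ^ suc k < n) (λ j → j ^ suc k <? n) 1≤n n (≤⇒≯ (≤^suc n k 1≤n)))
    where
    go : ∃[ t ] (t ^ suc k < n × ¬ suc t ^ suc k < n) → ∃[ t ] ∃[ t′ ] (n ≤ suc t ^ suc k × suc t ≤ 2 * t′ × t′ ^ suc k ≤ n)
    go (zero  , _ , ge)  = 0 , 1 , ≮⇒≥ ge , s≤s z≤n , subst (_≤ n) (sym (^-zeroˡ (suc k))) 1≤n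
    go (suc t , lt , ge) = suc t , suc t , ≮⇒≥ ge , subst (_≤ 2 * suc t) (+-comm (suc t) 1) (+-monoʳ-≤ (suc t) (s≤s z≤n)) , <⇒≤ lt

  halves-≤ : ∀ {a b} → 2 * a ≤ 2 * b + 1 → a ≤ b
  halves-≤ {a} {b} h = s≤s⁻¹ (*-cancelˡ-< 2 a (suc b) (subst (2 * a <_) (lem b) (s≤s h)))
    where
    lem : ∀ b → suc (2 * b + 1) ≡ 2 * suc b
    lem = solve-∀

  abstract
    -- A power of two above the width of level `r`, which is cubic in `2 ^ expo r` with a factor at
    -- most 128.
    threshold : ℕ → ℕ
    threshold r = 2 ^ (7 + 3 * expo r)

    threshold≡ : ∀ r → threshold r ≡ 2 ^ (7 + 3 * expo r)
    threshold≡ r = refl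

  expo-mono : ∀ {i j} → i ≤ j → expo i ≤ expo j
  expo-mono h = *-monoʳ-≤ 7 (*-mono-≤ h (s≤s h))

  threshold-mono : ∀ {i j} → i ≤ j → threshold i ≤ threshold j
  threshold-mono {i} {j} h = subst₂ _≤_ (sym (threshold≡ i)) (sym (threshold≡ j)) (^-monoʳ-≤ 2 (+-monoʳ-≤ 7 (*-monoʳ-≤ 3 (expo-mono h))))

  <threshold : ∀ w → w < threshold w
  <threshold w = <-≤-trans (n<2^n w) (subst (2 ^ w ≤_) (sym (threshold≡ w)) (^-monoʳ-≤ 2 (begin
    w                        ≤⟨ m≤m*n w (suc w) ⟩
    w * suc w                ≤⟨ m≤n*m (w * suc w) 7 ⟩
    expo w                   ≤⟨ m≤n*m (expo w) 3 ⟩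
    3 * expo w               ≤⟨ m≤n+m (3 * expo w) 7 ⟩
    7 + 3 * expo w           ∎)))
    where open ≤-Reasoning

  points≤ : ∀ r → points r ≤ 2 * 2 ^ expo r
  points≤ r = begin
    points r                         ≡⟨ points-even r ⟩
    halfPoints r + halfPoints r      ≤⟨ +-mono-≤ (halfPoints≤ r) (halfPoints≤ r) ⟩
    2 ^ expo r + 2 ^ expo r          ≡⟨ cong (2 ^ expo r +_) (+-identityʳ (2 ^ expo r)) ⟨
    2 * 2 ^ expo r                   ∎
    where open ≤-Reasoning

  1≤points : ∀ r → 1 ≤ points r
  1≤points r = subst (1 ≤_) (sym (points-even r)) (≤-trans (1≤halfPoints r) (m≤m+n (halfPoints r) (halfPoints r)))

  width≤threshold : ∀ r → Thicken.Λ r ≤ threshold r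
  width≤threshold r = begin
    points r * ((8 * Bs r + 1) * (Bs r + Bs r)) + points r
      ≤⟨ +-mono-≤ (*-mono-≤ (points≤ r) (*-mono-≤ (+-monoˡ-≤ 1 (*-monoʳ-≤ 8 (Bs≤ r))) (+-mono-≤ (Bs≤ r) (Bs≤ r)))) (points≤ r) ⟩
    2 * Q * ((8 * Q + 1) * (Q + Q)) + 2 * Q
      ≤⟨ bound Q (m^n>0 2 (expo r)) ⟩
    128 * (Q * (Q * Q))
      ≡⟨ cong (128 *_) (trans (cong (Q *_) (sym (^-distribˡ-+-* 2 e e))) (sym (^-distribˡ-+-* 2 e (e + e)))) ⟩
    2 ^ 7 * 2 ^ (e + (e + e))
      ≡⟨ ^-distribˡ-+-* 2 7 (e + (e + e)) ⟨
    2 ^ (7 + (e + (e + e)))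
      ≡⟨ trans (cong (λ i → 2 ^ (7 + (e + (e + i)))) (sym (+-identityʳ e))) (sym (threshold≡ r)) ⟩
    threshold r ∎
    where
    open ≤-Reasoning
    e Q : ℕ
    e = expo r
    Q = 2 ^ e
    bound : ∀ q → 1 ≤ q → 2 * q * ((8 * q + 1) * (q + q)) + 2 * q ≤ 128 * (q * (q * q))
    bound (suc q) _ = subst (2 * suc q * ((8 * suc q + 1) * (suc q + suc q)) + 2 * suc q ≤_) (lem q)
      (m≤m+n (2 * suc q * ((8 * suc q + 1) * (suc q + suc q)) + 2 * suc q) (suc q * (96 * (q * q) + 188 * q + 90)))
      where
      lem : ∀ q → 2 * (1 + q) * ((8 * (1 + q) + 1) * ((1 + q) + (1 + q))) + 2 * (1 + q) + (1 + q) * (96 * (q * q) + 188 * q + 90) ≡ 128 * ((1 + q) * ((1 + q) * (1 + q)))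
      lem = solve-∀

  -- The last level that fits into the width `w` is taken, with as many copies as there is room for.
  -- If not even level 0 fits, there are no copies; requirements that concern only copies are
  -- therefore stated under `Fin L`.
  stage : ∀ w → ∃[ r ] ∃[ L ] ((Fin L → Thicken.Λ r ≤ w) × points r * L ≤ w ×
    (∀ r₀ → threshold r₀ ≤ w → r₀ ≤ r × w ≤ 2 * (points r * L) × w < threshold (suc r)))
  stage w = go (threshold 0 ≤? w)
    where
    go : Dec (threshold 0 ≤ w) → ∃[ r ] ∃[ L ] ((Fin L → Thicken.Λ r ≤ w) × points r * L ≤ w ×
      (∀ r₀ → threshold r₀ ≤ w → r₀ ≤ r × w ≤ 2 * (points r * L) × w < threshold (suc r)))
    go (no h)  = 0 , 0 , (λ ()) , z≤n , λ r₀ h₀ → contradiction (≤-trans (threshold-mono {0} {r₀} z≤n) h₀) h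
    go (yes h) = from (crossing (λ j → threshold j ≤ w) (λ j → threshold j ≤? w) h w (<⇒≱ (<threshold w)))
      where
      from : ∃[ r ] (threshold r ≤ w × ¬ threshold (suc r) ≤ w) → ∃[ r ] ∃[ L ] ((Fin L → Thicken.Λ r ≤ w) × points r * L ≤ w ×
        (∀ r₀ → threshold r₀ ≤ w → r₀ ≤ r × w ≤ 2 * (points r * L) × w < threshold (suc r)))
      from (r , lo , hi) = r , L , (λ _ → Λ≤w) , subst (_≤ w) (*-comm L m) (m/n*n≤m w m) , λ r₀ h₀ →
          ≮⇒≥ (λ r<r₀ → hi (≤-trans (threshold-mono r<r₀) h₀)) , w≤ , ≰⇒> hi
        where
        m : ℕ
        m = points r
        instance
          m≢0 : NonZero m
          m≢0 = >-nonZero (1≤points r)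
        L : ℕ
        L = w / m
        Λ≤w : Thicken.Λ r ≤ w
        Λ≤w = ≤-trans (width≤threshold r) lo
        1≤L : 1 ≤ L
        1≤L = nonzero (L ≟ 0)
          where
          nonzero : Dec (L ≡ 0) → 1 ≤ L
          nonzero (no h)  = n≢0⇒n>0 h
          nonzero (yes e) = contradiction (≤-trans (m≤n+m m (m * (Thicken.C r * (Bs r + Bs r)))) Λ≤w) (<⇒≱ (subst (_< m) (sym (trans (m≡m%n+[m/n]*n w m)
            (trans (cong (λ l → w % m + l * m) e) (+-identityʳ (w % m))))) (m%n<n w m)))
        w≤ : w ≤ 2 * (m * L)
        w≤ = begin
          w                    ≡⟨ m≡m%n+[m/n]*n w m ⟩
          w % m + L * m        ≤⟨ +-mono-≤ (≤-trans (<⇒≤ (m%n<n w m)) (m≤m*n m L {{>-nonZero 1≤L}})) (≤-reflexive (*-comm L m)) ⟩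
          m * L + m * L        ≡⟨ cong (m * L +_) (+-identityʳ (m * L)) ⟨
          2 * (m * L)          ∎
          where open ≤-Reasoning

  ^-distribʳ-* : ∀ k a b → (a * b) ^ k ≡ a ^ k * b ^ k
  ^-distribʳ-* zero    a b = refl
  ^-distribʳ-* (suc k) a b = trans (cong (a * b *_) (^-distribʳ-* k a b)) (lem a b (a ^ k) (b ^ k))
    where
    lem : ∀ a b p q → a * b * (p * q) ≡ a * p * (b * q)
    lem = solve-∀

  -- Bernoulli's inequality for (1 + 1/5)^r, multiplied out.
  bernoulli : ∀ r → (5 + r) * 5 ^ r ≤ 5 * 6 ^ r
  bernoulli zero    = s≤s (s≤s (s≤s (s≤s (s≤s z≤n))))
  bernoulli (suc r) = begin
    (5 + suc r) * (5 * 5 ^ r)      ≤⟨ subst ((5 + suc r) * (5 * 5 ^ r) ≤_) (lem r (5 ^ r)) (m≤m+n ((5 + suc r) * (5 * 5 ^ r)) (r * 5 ^ r)) ⟩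
    6 * ((5 + r) * 5 ^ r)          ≤⟨ *-monoʳ-≤ 6 (bernoulli r) ⟩
    6 * (5 * 6 ^ r)                ≡⟨ lem2 (6 ^ r) ⟩
    5 * (6 * 6 ^ r)                ∎
    where
    open ≤-Reasoning
    lem : ∀ r p → (5 + (1 + r)) * (5 * p) + r * p ≡ 6 * ((5 + r) * p)
    lem = solve-∀
    lem2 : ∀ p → 6 * (5 * p) ≡ 5 * (6 * p)
    lem2 = solve-∀

  geometric : ∀ K r → 10 * K ≤ r → K * (25 * 5 ^ r) ≤ 16 * 6 ^ r
  geometric K r h = *-cancelˡ-≤ 5 (begin
    5 * (K * (25 * 5 ^ r))         ≤⟨ subst (5 * (K * (25 * 5 ^ r)) ≤_) (lem K (5 ^ r)) (m≤m+n (5 * (K * (25 * 5 ^ r))) (35 * (K * 5 ^ r))) ⟩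
    16 * (10 * K * 5 ^ r)          ≤⟨ *-monoʳ-≤ 16 (*-monoˡ-≤ (5 ^ r) (≤-trans h (m≤n+m r 5))) ⟩
    16 * ((5 + r) * 5 ^ r)         ≤⟨ *-monoʳ-≤ 16 (bernoulli r) ⟩
    16 * (5 * 6 ^ r)               ≡⟨ lem2 (6 ^ r) ⟩
    5 * (16 * 6 ^ r)               ∎)
    where
    open ≤-Reasoning
    lem : ∀ k p → 5 * (k * (25 * p)) + 35 * (k * p) ≡ 16 * (10 * k * p)
    lem = solve-∀
    lem2 : ∀ p → 16 * (5 * p) ≡ 5 * (16 * p)
    lem2 = solve-∀

  -- Since 3/2 is the product of 6/5 and 5/4, the part (6/5)^r of the gain absorbs the constant `K`
  -- and two more factors 5/4; there remains (5/4)^(r + 2).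
  superlinear : ∀ X F K r → 10 * K ≤ r → X * 3 ^ r ≤ K * (2 ^ r * F) → X * 5 ^ suc (suc r) ≤ F * 4 ^ suc (suc r)
  superlinear X F K r K≤r h = *-cancelʳ-≤ (X * 5 ^ suc (suc r)) (F * 4 ^ suc (suc r)) (3 ^ r) {{m^n≢0 3 r}} (begin
    X * (5 * (5 * 5 ^ r)) * 3 ^ r               ≡⟨ lem X (5 ^ r) (3 ^ r) ⟩
    X * 3 ^ r * (25 * 5 ^ r)                    ≤⟨ *-monoˡ-≤ (25 * 5 ^ r) h ⟩
    K * (2 ^ r * F) * (25 * 5 ^ r)              ≡⟨ lem1 K (2 ^ r) F (25 * 5 ^ r) ⟩
    K * (25 * 5 ^ r) * (2 ^ r * F)              ≤⟨ *-monoˡ-≤ (2 ^ r * F) (geometric K r K≤r) ⟩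
    16 * 6 ^ r * (2 ^ r * F)                    ≡⟨ cong (λ i → 16 * i * (2 ^ r * F)) (^-distribʳ-* r 2 3) ⟩
    16 * (2 ^ r * 3 ^ r) * (2 ^ r * F)          ≡⟨ lem2 (2 ^ r) (3 ^ r) F ⟩
    F * (4 * (4 * (2 ^ r * 2 ^ r))) * 3 ^ r     ≡⟨ cong (λ i → F * (4 * (4 * i)) * 3 ^ r) (^-distribʳ-* r 2 2) ⟨
    F * (4 * (4 * 4 ^ r)) * 3 ^ r               ∎)
    where
    open ≤-Reasoning
    lem : ∀ x a b → x * (5 * (5 * a)) * b ≡ x * b * (25 * a)
    lem = solve-∀
    lem1 : ∀ k p f a → k * (p * f) * a ≡ k * a * (p * f)
    lem1 = solve-∀
    lem2 : ∀ p t f → 16 * (p * t) * (p * f) ≡ f * (4 * (4 * (p * p))) * t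
    lem2 = solve-∀

  -- The width is below `threshold (suc r)`, and the 5 stands for the factor 32 between width and
  -- side. The exponent is quadratic in `J = r + 2`; this is the origin of the factor 24 times the
  -- dimension.
  exponent≤ : ∀ r d → (5 + (7 + 3 * expo (suc r))) * suc d ≤ (24 * suc d * suc (suc r)) * (24 * suc d * suc (suc r))
  exponent≤ r d = begin
    (12 + 3 * (7 * (suc r * J))) * suc d            ≤⟨ *-monoˡ-≤ (suc d) (+-mono-≤ (*-monoʳ-≤ 3 (*-mono-≤ {2} {J} {2} {J} (s≤s (s≤s z≤n)) (s≤s (s≤s z≤n)))) (*-monoʳ-≤ 3 (*-monoʳ-≤ 7 (*-monoˡ-≤ J (n≤1+n (suc r)))))) ⟩
    (3 * (J * J) + 3 * (7 * (J * J))) * suc d       ≡⟨ lem1 J (suc d) ⟩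
    24 * suc d * (J * J)                            ≤⟨ m≤n*m (24 * suc d * (J * J)) (24 * suc d) ⟩
    24 * suc d * (24 * suc d * (J * J))             ≡⟨ lem2 (24 * suc d) J ⟩
    (24 * suc d * J) * (24 * suc d * J)             ∎
    where
    open ≤-Reasoning
    J : ℕ
    J = suc (suc r)
    lem1 : ∀ j d → (3 * (j * j) + 3 * (7 * (j * j))) * d ≡ 24 * d * (j * j)
    lem1 = solve-∀
    lem2 : ∀ a j → a * (a * (j * j)) ≡ (a * j) * (a * j)
    lem2 = solve-∀

  ≤2^ : ∀ n w f d Y → n ≤ (32 * w) ^ d → w ≤ 2 ^ f → (5 + f) * d ≤ Y → n ≤ 2 ^ Y
  ≤2^ n w f d Y n≤ w≤ f≤ = begin
    n                      ≤⟨ n≤ ⟩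
    (32 * w) ^ d           ≤⟨ ^-monoˡ-≤ d (*-monoʳ-≤ 32 w≤) ⟩
    (32 * 2 ^ f) ^ d       ≡⟨ cong (_^ d) (^-distribˡ-+-* 2 5 f) ⟨
    (2 ^ (5 + f)) ^ d      ≡⟨ ^-*-assoc 2 (5 + f) d ⟩
    2 ^ ((5 + f) * d)      ≤⟨ ^-monoʳ-≤ 2 f≤ ⟩
    2 ^ Y                  ∎
    where open ≤-Reasoning

  -- One factor `n` is replaced by a power of `w`, in which one `w` is exchanged for the `m * L`
  -- positions along a direction. The other `κ` factors are replaced by the B-points of the classes.
  -- The ratio of edges to points then turns `m * 3 ^ r` into edges.
  many-edges : ∀ d κ n w m L β e r → n ≤ (32 * w) ^ suc d → n ≤ 8 * (κ * β) → w ≤ 2 * (m * L) → e * 2 * 2 ^ r ≡ m * 3 ^ r →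
    n * n ^ κ * 3 ^ r ≤ 4 * (32 ^ suc d * (8 * κ) ^ κ) * (2 ^ r * (w ^ d * L * (e * β ^ κ)))
  many-edges d κ n w m L β e r n≤ n≤′ w≤ edges≡ = begin
    n * n ^ κ * 3 ^ r
      ≤⟨ *-monoˡ-≤ (3 ^ r) (*-mono-≤ n≤ (^-monoˡ-≤ κ n≤′)) ⟩
    (32 * w) ^ suc d * (8 * (κ * β)) ^ κ * 3 ^ r
      ≡⟨ cong₂ (λ a b → a * b * 3 ^ r) (^-distribʳ-* (suc d) 32 w) (trans (cong (_^ κ) (sym (*-assoc 8 κ β))) (^-distribʳ-* κ (8 * κ) β)) ⟩
    32 ^ suc d * w ^ suc d * ((8 * κ) ^ κ * β ^ κ) * 3 ^ r
      ≤⟨ *-monoˡ-≤ (3 ^ r) (*-monoˡ-≤ ((8 * κ) ^ κ * β ^ κ) (*-monoʳ-≤ (32 ^ suc d) (*-monoˡ-≤ (w ^ d) w≤))) ⟩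
    32 ^ suc d * (2 * (m * L) * w ^ d) * ((8 * κ) ^ κ * β ^ κ) * 3 ^ r
      ≡⟨ lem (32 ^ suc d) m L (w ^ d) ((8 * κ) ^ κ) (β ^ κ) (3 ^ r) ⟩
    2 * (32 ^ suc d * (8 * κ) ^ κ) * (w ^ d * L * β ^ κ) * (m * 3 ^ r)
      ≡⟨ cong (2 * (32 ^ suc d * (8 * κ) ^ κ) * (w ^ d * L * β ^ κ) *_) edges≡ ⟨
    2 * (32 ^ suc d * (8 * κ) ^ κ) * (w ^ d * L * β ^ κ) * (e * 2 * 2 ^ r)
      ≡⟨ lem2 (32 ^ suc d * (8 * κ) ^ κ) (w ^ d * L) (β ^ κ) e (2 ^ r) ⟩
    4 * (32 ^ suc d * (8 * κ) ^ κ) * (2 ^ r * (w ^ d * L * (e * β ^ κ))) ∎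
    where
    open ≤-Reasoning
    lem : ∀ a m l w k b c → a * (2 * (m * l) * w) * (k * b) * c ≡ 2 * (a * k) * (w * l * b) * (m * c)
    lem = solve-∀
    lem2 : ∀ a w b e c → 2 * a * (w * b) * (e * 2 * c) ≡ 4 * a * (c * (w * (e * b)))
    lem2 = solve-∀

  abstract
    -- `constant` is the loss in `many-edges`, `start₀` the level from which the growth outweighs
    -- it, and `floor` a size from which that level fits and the rounding in the class sizes is
    -- harmless.
    constant start₀ floor : ℕ → ℕ
    constant κ = 4 * (32 ^ suc (suc κ) * (8 * κ) ^ κ)
    start₀ κ    = 10 * constant κ
    floor κ    = (16 * threshold (start₀ κ)) ^ suc (suc κ) + (8 * κ + 1)

    constant≡ : ∀ κ → 4 * (32 ^ suc (suc κ) * (8 * κ) ^ κ) ≡ constant κ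
    constant≡ κ = refl

    start₀≡ : ∀ κ → start₀ κ ≡ 10 * constant κ
    start₀≡ κ = refl

    floor≡ : ∀ κ → (16 * threshold (start₀ κ)) ^ suc (suc κ) + (8 * κ + 1) ≡ floor κ
    floor≡ κ = refl

    -- Here `J` stands for a constant multiple of sqrt(log n): the first inequality bounds log n in
    -- terms of `J` squared, the second exhibits the gain (5/4)^J.
    Growth : ℕ → ℕ → ℕ → Set
    Growth d n F = ∃[ J ] (n ≤ 2 ^ ((24 * suc d * J) * (24 * suc d * J)) × n ^ d * 5 ^ J ≤ F * 4 ^ J)

    Growth⁺ : ∀ d n F J → n ≤ 2 ^ ((24 * suc d * J) * (24 * suc d * J)) → n ^ d * 5 ^ J ≤ F * 4 ^ J → Growth d n F
    Growth⁺ d n F J h k = J , h , k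

    Growth⁻ : ∀ d n F → Growth d n F → ∃[ J ] (n ≤ 2 ^ ((24 * suc d * J) * (24 * suc d * J)) × n ^ d * 5 ^ J ≤ F * 4 ^ J)
    Growth⁻ d n F g = g

  record Parameters (κ n : ℕ) : Set where
    d : ℕ
    d = suc (suc κ)
    field
      r L w t t′ β rest : ℕ
    s : ℕ
    s = suc t
    rows : ℕ
    rows = w ^ suc κ * L
    planes : ℕ
    planes = rows * (edges r * β ^ κ)
    field
      s≤2t′  : s ≤ 2 * t′
      t′≤n   : t′ ^ d ≤ n
      w≤s    : w ≤ s
      fitA   : Fin L → Thicken.Λ r ≤ s × points r * L ≤ s
      fitB   : κ * β + rest ≤ s ^ d
      total  : (rows * points r + (κ * β + rest)) * 2 + parity κ ≡ n
      growth : floor κ ≤ n → Growth (suc κ) n planes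

  -- `q` is the number of antipodal pairs. With `w` a sixteenth of the side, the rows use at most a
  -- 32nd of the pairs. Up to half of the pairs form `κ` classes of equal size, and what is left
  -- over fills the lattice.
  module Choose (κ n : ℕ) (1≤κ : 1 ≤ κ) (t t′ r L q : ℕ)
    (n≤ : n ≤ suc t ^ suc (suc κ)) (s≤2t′ : suc t ≤ 2 * t′) (t′≤n : t′ ^ suc (suc κ) ≤ n) (q≡ : q * 2 + parity κ ≡ n)
    (Λ≤w : Fin L → Thicken.Λ r ≤ suc t / 16) (mL≤w : points r * L ≤ suc t / 16)
    (late : ∀ r₀ → threshold r₀ ≤ suc t / 16 → r₀ ≤ r × suc t / 16 ≤ 2 * (points r * L) × suc t / 16 < threshold (suc r)) where

    instance
      κ≢0 : NonZero κ
      κ≢0 = >-nonZero 1≤κ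

    d s w m u β ρ rest : ℕ
    d = suc (suc κ)
    s = suc t
    w = s / 16
    m = points r
    u = q / 2
    β = u / κ
    ρ = w ^ suc κ * L
    rest = q ∸ (ρ * m + κ * β)

    w*16≤s : w * 16 ≤ s
    w*16≤s = m/n*n≤m s 16

    8w≤t′ : 8 * w ≤ t′
    8w≤t′ = *-cancelˡ-≤ 2 (≤-trans (≤-reflexive (lem w)) (≤-trans w*16≤s s≤2t′))
      where
      lem : ∀ w → 2 * (8 * w) ≡ w * 16
      lem = solve-∀

    n≤2q+1 : n ≤ 2 * q + 1
    n≤2q+1 = ≤-trans (≤-reflexive (sym q≡)) (+-mono-≤ (≤-reflexive (*-comm q 2)) (parity≤ κ))

    q≤n : q ≤ n
    q≤n = ≤-trans (m≤m*n q 2) (≤-trans (m≤m+n (q * 2) (parity κ)) (≤-reflexive q≡))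

    32w^d≤q : 32 * w ^ d ≤ q
    32w^d≤q = halves-≤ (begin
      2 * (32 * w ^ d)       ≡⟨ *-assoc 2 32 (w ^ d) ⟨
      64 * w ^ d             ≤⟨ *-monoˡ-≤ (w ^ d) 64≤8^d ⟩
      8 ^ d * w ^ d          ≡⟨ ^-distribʳ-* d 8 w ⟨
      (8 * w) ^ d            ≤⟨ ^-monoˡ-≤ d 8w≤t′ ⟩
      t′ ^ d                 ≤⟨ t′≤n ⟩
      n                      ≤⟨ n≤2q+1 ⟩
      2 * q + 1              ∎)
      where
      open ≤-Reasoning
      64≤8^d : 64 ≤ 8 ^ d
      64≤8^d = ^-monoʳ-≤ 8 {2} {d} (s≤s (s≤s z≤n))

    ρm≤w^d : ρ * m ≤ w ^ d
    ρm≤w^d = begin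
      w ^ suc κ * L * m      ≡⟨ *-assoc (w ^ suc κ) L m ⟩
      w ^ suc κ * (L * m)    ≤⟨ *-monoʳ-≤ (w ^ suc κ) (≤-trans (≤-reflexive (*-comm L m)) mL≤w) ⟩
      w ^ suc κ * w          ≡⟨ *-comm (w ^ suc κ) w ⟩
      w ^ d                  ∎
      where open ≤-Reasoning

    κβ≤u : κ * β ≤ u
    κβ≤u = ≤-trans (≤-reflexive (*-comm κ β)) (m/n*n≤m u κ)

    fits : ρ * m + κ * β ≤ q
    fits = *-cancelˡ-≤ 2 (begin
      2 * (ρ * m + κ * β)                 ≡⟨ *-distribˡ-+ 2 (ρ * m) (κ * β) ⟩
      2 * (ρ * m) + 2 * (κ * β)           ≤⟨ +-mono-≤ (≤-trans (*-mono-≤ {2} {32} (s≤s (s≤s z≤n)) ρm≤w^d) 32w^d≤q)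
                                                      (≤-trans (*-monoʳ-≤ 2 κβ≤u) (≤-trans (≤-reflexive (*-comm 2 u)) (m/n*n≤m q 2))) ⟩
      q + q                               ≡⟨ cong (q +_) (+-identityʳ q) ⟨
      2 * q                               ∎)
      where open ≤-Reasoning

    split : ρ * m + (κ * β + rest) ≡ q
    split = trans (sym (+-assoc (ρ * m) (κ * β) rest)) (m+[n∸m]≡n fits)

    n≤8κβ : 8 * κ + 1 ≤ n → n ≤ 8 * (κ * β)
    n≤8κβ h = +-cancelʳ-≤ n n (8 * (κ * β)) (begin
      n + n                                  ≤⟨ +-mono-≤ n≤4u+3 n≤4u+3 ⟩
      (4 * u + 3) + (4 * u + 3)              ≤⟨ m≤m+n ((4 * u + 3) + (4 * u + 3)) 2 ⟩
      (4 * u + 3) + (4 * u + 3) + 2          ≡⟨ lem u ⟩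
      8 * suc u                              ≤⟨ *-monoʳ-≤ 8 u<κβ+κ ⟩
      8 * (κ * β + κ)                        ≡⟨ *-distribˡ-+ 8 (κ * β) κ ⟩
      8 * (κ * β) + 8 * κ                    ≤⟨ +-monoʳ-≤ (8 * (κ * β)) (≤-trans (m≤m+n (8 * κ) 1) h) ⟩
      8 * (κ * β) + n                        ∎)
      where
      open ≤-Reasoning
      lem : ∀ u → (4 * u + 3) + (4 * u + 3) + 2 ≡ 8 * (1 + u)
      lem = solve-∀
      q≤2u+1 : q ≤ 1 + u * 2
      q≤2u+1 = ≤-trans (≤-reflexive (m≡m%n+[m/n]*n q 2)) (+-monoˡ-≤ (u * 2) (s≤s⁻¹ (m%n<n q 2)))
      n≤4u+3 : n ≤ 4 * u + 3
      n≤4u+3 = ≤-trans n≤2q+1 (≤-trans (+-monoˡ-≤ 1 (*-monoʳ-≤ 2 q≤2u+1)) (≤-reflexive (lem2 u)))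
        where
        lem2 : ∀ u → 2 * (1 + u * 2) + 1 ≡ 4 * u + 3
        lem2 = solve-∀
      u<κβ+κ : u < κ * β + κ
      u<κβ+κ = begin-strict
        u                     ≡⟨ m≡m%n+[m/n]*n u κ ⟩
        u % κ + β * κ         <⟨ +-monoˡ-< (β * κ) (m%n<n u κ) ⟩
        κ + β * κ             ≡⟨ trans (+-comm κ (β * κ)) (cong (_+ κ) (*-comm β κ)) ⟩
        κ * β + κ             ∎

    s<16w+16 : s < 16 * suc w
    s<16w+16 = begin-strict
      s                     ≡⟨ m≡m%n+[m/n]*n s 16 ⟩
      s % 16 + w * 16       <⟨ +-monoˡ-< (w * 16) (m%n<n s 16) ⟩
      16 + w * 16           ≡⟨ *-comm (suc w) 16 ⟩
      16 * suc w            ∎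
      where open ≤-Reasoning

    floor<n : floor κ ≤ n → (16 * threshold (start₀ κ)) ^ d + (8 * κ + 1) ≤ n
    floor<n h = ≤-trans (≤-reflexive (floor≡ κ)) h

    -- Otherwise the side `s` would be at most 16 times the threshold, and `s ^ d` could not reach
    -- `n`.
    large : floor κ ≤ n → threshold (start₀ κ) ≤ w
    large h = ≮⇒≥ λ lt → <-irrefl refl (begin-strict
      n                                             ≤⟨ n≤ ⟩
      s ^ d                                         ≤⟨ ^-monoˡ-≤ d (≤-trans (<⇒≤ s<16w+16) (*-monoʳ-≤ 16 lt)) ⟩
      (16 * threshold (start₀ κ)) ^ d                <⟨ m<m+n ((16 * threshold (start₀ κ)) ^ d) (m≤n+m 1 (8 * κ)) ⟩
      (16 * threshold (start₀ κ)) ^ d + (8 * κ + 1)  ≤⟨ floor<n h ⟩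
      n                                             ∎)
      where open ≤-Reasoning

    n≤32w^d : 1 ≤ w → n ≤ (32 * w) ^ d
    n≤32w^d 1≤w = ≤-trans n≤ (^-monoˡ-≤ d (begin
      s                ≤⟨ <⇒≤ s<16w+16 ⟩
      16 * (1 + w)     ≤⟨ *-monoʳ-≤ 16 (+-monoˡ-≤ w 1≤w) ⟩
      16 * (w + w)     ≡⟨ lem w ⟩
      32 * w           ∎))
      where
      open ≤-Reasoning
      lem : ∀ w → 16 * (w + w) ≡ 32 * w
      lem = solve-∀

    growth : floor κ ≤ n → Growth (suc κ) n (ρ * (edges r * β ^ κ))
    growth h = from (late (start₀ κ) (large h))
      where
      n≤w : n ≤ (32 * w) ^ d
      n≤w = n≤32w^d (≤-trans (≤-<-trans z≤n (<threshold (start₀ κ))) (large h))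
      from : start₀ κ ≤ r × w ≤ 2 * (m * L) × w < threshold (suc r) → Growth (suc κ) n (ρ * (edges r * β ^ κ))
      from (start₀≤r , w≤ , w<) = Growth⁺ (suc κ) n (ρ * (edges r * β ^ κ)) (suc (suc r)) (≤2^ n w (7 + 3 * expo (suc r)) d ((24 * d * suc (suc r)) * (24 * d * suc (suc r)))
          n≤w (≤-trans (<⇒≤ w<) (≤-reflexive (threshold≡ (suc r)))) (exponent≤ r (suc κ)))
        (superlinear (n ^ suc κ) (ρ * (edges r * β ^ κ)) (constant κ) r (≤-trans (≤-reflexive (sym (start₀≡ κ))) start₀≤r)
          (≤-trans (many-edges (suc κ) κ n w m L β (edges r) r n≤w (n≤8κβ (≤-trans (m≤n+m (8 * κ + 1) ((16 * threshold (start₀ κ)) ^ d)) (floor<n h))) w≤ (edges-points r))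
            (≤-reflexive (cong (_* (2 ^ r * (ρ * (edges r * β ^ κ)))) (constant≡ κ)))))

    parameters : Parameters κ n
    parameters = record
      { r = r ; L = L ; w = w ; t = t ; t′ = t′ ; β = β ; rest = rest
      ; s≤2t′ = s≤2t′ ; t′≤n = t′≤n ; w≤s = w≤s
      ; fitA = λ l → ≤-trans (Λ≤w l) w≤s , ≤-trans mL≤w w≤s
      ; fitB = ≤-trans (m≤n+m (κ * β + rest) (ρ * m)) (≤-trans (≤-reflexive split) (≤-trans q≤n n≤))
      ; total = trans (cong (λ i → i * 2 + parity κ) split) q≡
      ; growth = growth }
      where
      w≤s : w ≤ s
      w≤s = ≤-trans (m≤m*n w 16) w*16≤s

  abstract
    parameters : ∀ κ n → 1 ≤ κ → 1 ≤ n → 2 ∣ n + suc (suc κ) → Parameters κ n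
    parameters κ n 1≤κ 1≤n even =
      let t , t′ , n≤ , s≤ , t′≤ = root-bracket n (suc κ) 1≤n
          r , L , Λ≤ , mL≤ , late = stage (suc t / 16)
          q , q≡ = halve-even κ n even
      in Choose.parameters κ n 1≤κ t t′ r L q n≤ s≤ t′≤ q≡ Λ≤ mL≤ late

-- From the integer growth estimate to the exponential lower bound

module Conclusion where

  open import Defs hiding (offset)
  open FiniteTypes using (size; decode)
  open PlanarSets using (module Thicken)
  open RationalVectors
  open Perturbation using (Config; GenPos; Near)
  open Interpolation using (/1≡ι)
  open Lifting
  open Assembly
  open ExponentialSeries using (ν; 0<ν; 0≤ν; ν-≤; ν-*; ε; pow; pow-ν; pow-distrib)
  open RealFunctions
  open Density
  open Arrangements
  open ParameterChoice hiding (parity≤)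
  open import Data.Nat as ℕ using (ℕ; suc; s≤s; z≤n)
  import Data.Nat.Properties as ℕₚ
  open import Data.Integer as ℤ using (ℤ)
  open import Data.Rational using (ℚ; 0ℚ; ½; _+_; _*_; _<_; _≤_)
  import Data.Rational as ℚ
  import Data.Rational.Properties as ℚₚ
  open import Data.Product using (Σ; ∃-syntax; _×_; _,_)
  open import Function using (_∘_)
  open import Relation.Binary.PropositionalEquality hiding (J)

  0<fromℚ : ∀ {q} → 0ℚ < q → 0ℝ <ℝ fromℚ q
  0<fromℚ {q} h = ½ * q , 0<½ h , 0 , λ _ _ → subst (_< q) (sym (ℚₚ.+-identityˡ (½ * q))) (½< h)

  -- Multiplication by `4 ^ J` clears the denominators of the bound (5/4)^J and leaves the integer
  -- inequality.
  product≤ : ∀ X F J e → X ℕ.* 5 ℕ.^ J ℕ.≤ F ℕ.* 4 ℕ.^ J → (∃[ N ] (∀ i → N ℕ.≤ i → seq e i ≤ pow 5/4 J)) →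
    fromℕ X *ℝ e ≤ℝ fromℕ F
  product≤ X F J e h (N , e≤) (δ , 0<δ , M , lt) = ℚₚ.<-irrefl refl (begin-strict
    ν F                                ≡⟨ /1≡ι (ℤ.+ F) ⟨
    seq (fromℕ F) i                    <⟨ <-by δ 0<δ refl ⟩
    seq (fromℕ F) i + δ                <⟨ lt i (ℕₚ.m≤m⊔n M N) ⟩
    (ℤ.+ X ℚ./ 1) * seq e i            ≡⟨ cong (_* seq e i) (/1≡ι (ℤ.+ X)) ⟩
    ν X * seq e i                      ≤⟨ ℚₚ.*-monoˡ-≤-nonNeg (ν X) {{ℚ.nonNegative (0≤ν X)}} (e≤ i (ℕₚ.m≤n⊔m M N)) ⟩
    ν X * pow 5/4 J                    ≤⟨ scaled ⟩
    ν F                                ∎)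
    where
    open ℚₚ.≤-Reasoning
    i : ℕ
    i = M ℕ.⊔ N
    4^J : ℚ
    4^J = ν (4 ℕ.^ J)
    pow-5/4 : pow 5/4 J * 4^J ≡ ν (5 ℕ.^ J)
    pow-5/4 = trans (cong (pow 5/4 J *_) (sym (pow-ν 4 J))) (trans (sym (pow-distrib 5/4 (ν 4) J)) (trans (cong (λ q → pow q J) {5/4 * ν 4} {ν 5} refl) (pow-ν 5 J)))
    scaled : ν X * pow 5/4 J ≤ ν F
    scaled = ℚₚ.*-cancelʳ-≤-pos 4^J {{ℚ.positive (0<ν (ℕₚ.m^n>0 4 J))}} (begin
      ν X * pow 5/4 J * 4^J            ≡⟨ ℚₚ.*-assoc (ν X) (pow 5/4 J) 4^J ⟩
      ν X * (pow 5/4 J * 4^J)          ≡⟨ cong (ν X *_) pow-5/4 ⟩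
      ν X * ν (5 ℕ.^ J)                ≡⟨ ν-* X (5 ℕ.^ J) ⟨
      ν (X ℕ.* 5 ℕ.^ J)                ≤⟨ ν-≤ h ⟩
      ν (F ℕ.* 4 ℕ.^ J)                ≡⟨ ν-* F (4 ℕ.^ J) ⟩
      ν F * 4^J                        ∎)

  module Arrange (κ n : ℕ) (1≤n : 1 ℕ.≤ n) (A : Parameters κ n) where
    open Parameters A

    Pl = Thicken.planar r
    module L′ = Lattice κ Pl w L t β rest
    open L′ using (Row; offset; x₀; R; coef≤; module Near-ideal)
    open Build κ Pl Row β rest offset using (Pt)
    module As = Assemble κ Pl Row β rest offset (x₀ w≤s fitA fitB) (R w≤s fitA fitB) (coef≤ w≤s fitA fitB)
    module FH = FromHalves κ Pl Row β rest offset (x₀ w≤s fitA fitB) (R w≤s fitA fitB) (coef≤ w≤s fitA fitB)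

    build : Σ (Config {size Pt} {d}) (λ X → Near (As.ideal ∘ decode Pt) ¼ X × GenPos X × (∀ f → As.Halves f X)) →
      Arrangement d planes (size Pt)
    build (X , near , gp , halves) = FH.arrangement X NI.sep gp halves s t′ (subst (1 ℕ.≤_) (sym total) 1≤n) (s≤s z≤n) NI.diameter
        s≤2t′ (subst (t′ ℕ.^ d ℕ.≤_) (sym total) t′≤n)
      where
      module NI = Near-ideal w≤s fitA fitB X near

    abstract
      arrangement : Arrangement d planes n
      arrangement = subst (Arrangement d planes) total (build As.configuration)

  finish : ∀ (d n F n₀ k : ℕ) → 24 ℕ.* d ≡ suc k →
    (Σ (PointSet d n) λ P → IsDense P (fromℚ (γ d 9)) × InGeneralPosition P × (∀ x → x ≤ℝ fromℕ F → HasAtLeastHalving P x)) →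
    (∃[ ℓ ] ∃[ s ] ∃[ e ] (Log (fromℕ n) ℓ × Sqrt ℓ s × Exp (fromℚ (⅕ * ε k) *ℝ s) e ×
      (∀ J → n ℕ.≤ 2 ℕ.^ ((suc k ℕ.* J) ℕ.* (suc k ℕ.* J)) → ∃[ N ] (∀ i → N ℕ.≤ i → seq e i ≤ pow 5/4 J)))) →
    (n₀ ℕ.≤ n → ∃[ J ] (n ℕ.≤ 2 ℕ.^ ((24 ℕ.* d ℕ.* J) ℕ.* (24 ℕ.* d ℕ.* J)) × n ℕ.^ (d ℕ.∸ 1) ℕ.* 5 ℕ.^ J ℕ.≤ F ℕ.* 4 ℕ.^ J)) →
    Σ (PointSet d n) λ P → IsDense P (fromℚ (γ d 9)) × InGeneralPosition P × (n₀ ℕ.≤ n →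
      ∃[ ℓ ] ∃[ s ] ∃[ e ] (Log (fromℕ n) ℓ × Sqrt ℓ s × Exp (fromℚ (⅕ * ε k) *ℝ s) e ×
        HasAtLeastHalving P (fromℕ (n ℕ.^ (d ℕ.∸ 1)) *ℝ e)))
  finish d n F n₀ k 24d≡ (P , isDense , general , many) (ℓ , s , e , isLog , isSqrt , isExp , bound) growth =
    P , isDense , general , λ n₀≤n → ℓ , s , e , isLog , isSqrt , isExp , many (fromℕ (n ℕ.^ (d ℕ.∸ 1)) *ℝ e) (below (growth n₀≤n))
    where
    below : ∃[ J ] (n ℕ.≤ 2 ℕ.^ ((24 ℕ.* d ℕ.* J) ℕ.* (24 ℕ.* d ℕ.* J)) × n ℕ.^ (d ℕ.∸ 1) ℕ.* 5 ℕ.^ J ℕ.≤ F ℕ.* 4 ℕ.^ J) →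
      fromℕ (n ℕ.^ (d ℕ.∸ 1)) *ℝ e ≤ℝ fromℕ F
    below (J , n≤ , big) = product≤ (n ℕ.^ (d ℕ.∸ 1)) F J e big (bound J (subst (λ K → n ℕ.≤ 2 ℕ.^ ((K ℕ.* J) ℕ.* (K ℕ.* J))) 24d≡ n≤))

open import Defs
open import Data.Nat using (ℕ; _+_; _∸_; _^_; _≤_)
open import Data.Nat.Divisibility using (_∣_)
open import Data.Product using (Σ; ∃-syntax; _×_)
open import Data.Nat using (suc; s≤s; z≤n; _*_)
open import Data.Product using (_,_)
open import Data.Rational using () renaming (_*_ to _*ℚ_)
open import Relation.Binary.PropositionalEquality using (refl)
open Conclusion using (0<fromℚ; finish; module Arrange)
open Density using (γ)
open ExponentialSeries using (ε; 0<ε; 0<ν)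
open RationalVectors using (0<*)
open RealFunctions using (⅕; exp-sqrt-log)
open Arrangements using (Arrangement⁻)
open ParameterChoice using (floor; parameters; Growth⁻; module Parameters)

theorem2 : ∀ (d : ℕ) → 3 ≤ d →
    ∃[ γ ] ∃[ c ] ∃[ n₀ ] (0ℝ <ℝ γ × 0ℝ <ℝ c ×
    (∀ (n : ℕ) → 1 ≤ n → 2 ∣ (n + d) →
    Σ (PointSet d n) λ P →
    IsDense P γ × InGeneralPosition P ×
    (n₀ ≤ n →
    ∃[ ℓ ] ∃[ s ] ∃[ e ]
    (Log (fromℕ n) ℓ × Sqrt ℓ s × Exp (c *ℝ s) e ×
    HasAtLeastHalving P (fromℕ (n ^ (d ∸ 1)) *ℝ e)))))
-- `suc κ + 23 * suc (suc κ)` is the predecessor of 24 times the dimension d, so that c = 1/(120 d);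
-- the density constant is 16 · 9 · d.
theorem2 (suc (suc κ)) (s≤s (s≤s 1≤κ)) = fromℚ (γ (suc (suc κ)) 9) , fromℚ (⅕ *ℚ ε (suc κ + 23 * suc (suc κ))) , floor κ ,
    0<fromℚ (0<* (0<ν {16} (s≤s z≤n)) (0<ν {suc (suc κ) * 9} (s≤s z≤n))) , 0<fromℚ (0<* (0<ε 4) (0<ε (suc κ + 23 * suc (suc κ)))) ,
    λ n 1≤n even → let par = parameters κ n 1≤κ 1≤n even in
      finish (suc (suc κ)) n (Parameters.planes par) (floor κ) (suc κ + 23 * suc (suc κ)) refl
        (Arrangement⁻ (suc (suc κ)) (Parameters.planes par) n (Arrange.arrangement κ n 1≤n par)) (exp-sqrt-log (suc κ + 23 * suc (suc κ)) n 1≤n)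
        λ late → Growth⁻ (suc κ) n (Parameters.planes par) (Parameters.growth par late)
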